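{- Fix an integer $r\geq 1$, let $\mathbf v=(v_1,\dots,v_r)$, and let $a_1(\mathbf v),\dots,a_{r+1}(\mathbf v)$ be the polynomials in $\mathbf v$ uniquely determined by the identity in the variable $x$ $$\sum_{k=1}^{r+1} k\,a_k(\mathbf v)\prod_{j=0}^{k-2}(x-j)=\prod_{i=1}^r(x+v_i).$$ Then, with $t_n=p_n/n$, $$Z_{(r)}(s;v_1,\dots,v_r;\mathbf p)=\exp\Big(s\sum_{k=1}^{r+1}a_k(\mathbf v)P^{(k)}_{ -1}\Big)(1).$$
   Context: For $d\geq 0$, a partition $\mu$ of $d$ and integers $k_1,\dots,k_r$, let $N^\bullet_{k_1,\dots,k_r}(\mu)=\frac{1}{d!}\#\{(\alpha_1,\dots,\alpha_r,\alpha)\in (S_d)^{r+1}:\alpha_1\cdots\alpha_r\alpha=e,\ \alpha_i \text{ has exactly } k_i \text{ cycles},\ \alpha \text{ has cycle type }\mu\}$ (the weighted count of possibly disconnected branched covers of $\mathbb{CP}^1$ over $r+1$ points with $k_i$ preimages over the $i$-th point and profile $\mu$ over the last). The generalized dessin partition function is $Z_{(r)}(s;\mathbf v;\mathbf p)=\sum_{k_1,\dots,k_r\ge 0}\sum_{\mu\in\mathcal P}\big(\prod_i v_i^{k_i}\big)s^{|\mu|}N^\bullet_{k_1,\dots,k_r}(\mu)p_\mu$ over all partitions $\mu$ (the empty partition contributes the constant term $1$), with $p_\mu=p_{\mu_1}\cdots p_{\mu_l}$. The operators $P^{(k)}_{ -1}$ act on formal power series in $\mathbf t=(t_1,t_2,\dots)$: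 let $J(z)=\sum_{n\geq1}nt_nz^{n-1}+\sum_{n\geq1}\frac{\partial}{\partial t_n}z^{ -n-1}$, let $P^{(k)}(z)={:}\big(\partial_z+J(z)\big)^{k-1}J(z){:}$, where $\partial_z$ differentiates everything to its right (including the $z$-dependence of $J(z)$) and the normal ordering ${:}\ {:}$ places all operators $\partial/\partial t_n$ to the right of all multiplication operators $t_m$; write $P^{(k)}(z)=\sum_{m\in\mathbb Z}P^{(k)}_m z^{ -m-k}$. For example $P^{(1)}_{ -1}=t_1$ and $P^{(2)}_{ -1}=\sum_{n\ge1}2(n+1)t_{n+1}\frac{\partial}{\partial t_n}$. The exponential is a formal power series in $s$ applied to the constant function $1$. -}

module Defs where

-- Generalized dessin partition function vs. cut-and-join type operators P^{(k)}_{-1}.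
-- Everything is an identity of formal power series; we compare coefficients
-- of every monomial  s^d x^? v^k t^e  (all coefficients are finite sums).

open import Data.Nat as ℕ using (ℕ; zero; suc; _∸_; _!)
open import Data.Nat.Properties using (_!≢0)
open import Data.Integer as ℤ using (ℤ; +_; -[1+_])
open import Data.Rational as ℚ using (ℚ; 0ℚ; 1ℚ)
open import Data.Bool using (Bool; true; false; _∧_; _∨_; not; if_then_else_)
open import Data.Fin as Fin using (Fin; toℕ)
open import Data.Vec as Vec using (Vec; []; _∷_)
open import Data.List as List using (List; []; _∷_; _++_; map; concatMap; foldr; allFin; filterᵇ; length)
open import Data.Product using (_×_; _,_; proj₁; proj₂)
open import Relation.Nullary.Decidable using (⌊_⌋)
open import Relation.Binary.PropositionalEquality using (_≡_)

ℤtoℚ : ℤ → ℚ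
ℤtoℚ z = z ℚ./ 1

ℕtoℚ : ℕ → ℚ
ℕtoℚ n = ℤtoℚ (+ n)

sumℚ : List ℚ → ℚ
sumℚ = foldr ℚ._+_ 0ℚ

invFact : ℕ → ℚ
invFact d = (+ 1) ℚ./ (d !) where instance _ = d !≢0

-- A monomial x^xe * ∏ v_i^(ve i) * ∏_{n≥1} t_n^(te !! (n-1)).
-- Entries of te beyond its length are exponent 0 (trailing zeros irrelevant).
record Mono (r : ℕ) : Set where
  constructor mono
  field
    xe : ℕ
    ve : Vec ℕ r
    te : List ℕ
open Mono public

Poly : ℕ → Set
Poly r = List (ℚ × Mono r)

addL : List ℕ → List ℕ → List ℕ
addL [] ys = ys
addL (x ∷ xs) [] = x ∷ xs
addL (x ∷ xs) (y ∷ ys) = (x ℕ.+ y) ∷ addL xs ys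

allZero : List ℕ → Bool
allZero [] = true
allZero (x ∷ xs) = (x ℕ.≡ᵇ 0) ∧ allZero xs

eqL : List ℕ → List ℕ → Bool
eqL [] ys = allZero ys
eqL (x ∷ xs) [] = allZero (x ∷ xs)
eqL (x ∷ xs) (y ∷ ys) = (x ℕ.≡ᵇ y) ∧ eqL xs ys

eqV : ∀ {n} → Vec ℕ n → Vec ℕ n → Bool
eqV [] [] = true
eqV (x ∷ xs) (y ∷ ys) = (x ℕ.≡ᵇ y) ∧ eqV xs ys

eqMono : ∀ {r} → Mono r → Mono r → Bool
eqMono m n = (xe m ℕ.≡ᵇ xe n) ∧ eqV (ve m) (ve n) ∧ eqL (te m) (te n)

mulMono : ∀ {r} → Mono r → Mono r → Mono r
mulMono m n = mono (xe m ℕ.+ xe n) (Vec.zipWith ℕ._+_ (ve m) (ve n)) (addL (te m) (te n))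

oneMono : ∀ {r} → Mono r
oneMono = mono 0 (Vec.replicate _ 0) []

coeff : ∀ {r} → Poly r → Mono r → ℚ
coeff p m = sumℚ (map proj₁ (filterᵇ (λ u → eqMono (proj₂ u) m) p))

_≋_ : ∀ {r} → Poly r → Poly r → Set
p ≋ q = ∀ m → coeff p m ≡ coeff q m

zeroP : ∀ {r} → Poly r
zeroP = []

constP : ∀ {r} → ℚ → Poly r
constP c = (c , oneMono) ∷ []

oneP : ∀ {r} → Poly r
oneP = constP 1ℚ

_⊕_ : ∀ {r} → Poly r → Poly r → Poly r
p ⊕ q = p ++ q

scaleP : ∀ {r} → ℚ → Poly r → Poly r
scaleP c = map (λ u → (c ℚ.* proj₁ u , proj₂ u))

_⊗_ : ∀ {r} → Poly r → Poly r → Poly r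
p ⊗ q = concatMap (λ u → map (λ w → (proj₁ u ℚ.* proj₁ w , mulMono (proj₂ u) (proj₂ w))) q) p

sumP : ∀ {r} → List (Poly r) → Poly r
sumP = foldr _⊕_ zeroP

prodP : ∀ {r} → List (Poly r) → Poly r
prodP = foldr _⊗_ oneP

xP : ∀ {r} → Poly r
xP = (1ℚ , mono 1 (Vec.replicate _ 0) []) ∷ []

vP : ∀ {r} → Fin r → Poly r
vP i = (1ℚ , mono 0 (Vec.updateAt (Vec.replicate _ 0) i (λ _ → 1)) []) ∷ []

-- exponent list of t_(suc n)
tExp : ℕ → List ℕ
tExp n = List.replicate n 0 ++ (1 ∷ [])

-- the variable t_(suc n)
tP : ∀ {r} → ℕ → Poly r
tP n = (1ℚ , mono 0 (Vec.replicate _ 0) (tExp n)) ∷ []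

PolyV : ℕ → Set
PolyV r = List (ℚ × Vec ℕ r)

ιV : ∀ {r} → PolyV r → Poly r
ιV = map (λ u → (proj₁ u , mono 0 (proj₂ u) []))

lookupD : List ℕ → ℕ → ℕ
lookupD [] _ = 0
lookupD (x ∷ xs) zero = x
lookupD (x ∷ xs) (suc n) = lookupD xs n

decAt : List ℕ → ℕ → List ℕ
decAt [] _ = []
decAt (x ∷ xs) zero = (x ∸ 1) ∷ xs
decAt (x ∷ xs) (suc n) = x ∷ decAt xs n

-- ∂/∂t_(suc n)
dT : ∀ {r} → ℕ → Poly r → Poly r
dT n = map (λ u → ( proj₁ u ℚ.* ℕtoℚ (lookupD (te (proj₂ u)) n)
                   , mono (xe (proj₂ u)) (ve (proj₂ u)) (decAt (te (proj₂ u)) n)))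

maxT : ∀ {r} → Poly r → ℕ
maxT = foldr (λ u k → length (te (proj₂ u)) ℕ.⊔ k) 0

-- Modes of the current:  J(z) = Σ_a J_a z^{-a-1},
--   J_{-n} = n t_n (n ≥ 1),  J_0 = 0,  J_n = ∂/∂t_n (n ≥ 1).
-- Normal-ordered product :J_{a_1} ... J_{a_j}: : all ∂'s act first.

applyD : ∀ {r} → List ℤ → Poly r → Poly r
applyD [] f = f
applyD (+ zero ∷ as) f = zeroP
applyD (+ suc n ∷ as) f = dT n (applyD as f)
applyD (-[1+ n ] ∷ as) f = applyD as f

applyM : ∀ {r} → List ℤ → Poly r → Poly r
applyM [] f = f
applyM (+ n ∷ as) f = applyM as f
applyM (-[1+ n ] ∷ as) f = scaleP (ℕtoℚ (suc n)) (tP n) ⊗ applyM as f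

nord : ∀ {r} → List ℤ → Poly r → Poly r
nord as f = applyM as (applyD as f)

-- P^{(k)}(z) = :(∂_z + J(z))^{k-1} J(z): as a differential polynomial in J:
-- a list of terms (c , (e_1,...,e_j)) meaning  c · J^{(e_1)}(z) ⋯ J^{(e_j)}(z).

DPoly : Set
DPoly = List (ℕ × List ℕ)

-- product rule: differentiate each factor in turn
incrEach : List ℕ → List (List ℕ)
incrEach [] = []
incrEach (e ∷ es) = (suc e ∷ es) ∷ map (e ∷_) (incrEach es)

∂z : DPoly → DPoly
∂z = concatMap (λ u → map (λ es → (proj₁ u , es)) (incrEach (proj₂ u)))

Jtimes : DPoly → DPoly
Jtimes = map (λ u → (proj₁ u , 0 ∷ proj₂ u))

-- PD k = (∂_z + J)^{k-1} J  for k ≥ 1  (PD 0 is unused)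
PD : ℕ → DPoly
PD zero = []
PD (suc zero) = (1 , 0 ∷ []) ∷ []
PD (suc (suc k)) = ∂z (PD (suc k)) ++ Jtimes (PD (suc k))

-- J^{(e)}(z) = Σ_a J_a · ff a e · z^{-a-1-e},   ff a e = ∏_{i=1}^{e} (-a-i)
ff : ℤ → ℕ → ℤ
ff a zero = + 1
ff a (suc e) = (ℤ.- a ℤ.- + suc e) ℤ.* ff a e

tuples : ℕ → List ℤ → List (List ℤ)
tuples zero xs = [] ∷ []
tuples (suc j) xs = concatMap (λ a → map (a ∷_) (tuples j xs)) xs

rangeZ : ℤ → ℕ → List ℤ
rangeZ lo zero = []
rangeZ lo (suc c) = lo ∷ rangeZ (lo ℤ.+ + 1) c

sumZ : List ℤ → ℤ
sumZ = foldr ℤ._+_ (+ 0)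

prodZ : List ℤ → ℤ
prodZ = foldr ℤ._*_ (+ 1)

-- z-exponent of the term J_{a_1}^{(e_1)} ⋯ J_{a_j}^{(e_j)}: Σ_i (-a_i - 1 - e_i)
zExp : List ℤ → List ℕ → ℤ
zExp [] _ = + 0
zExp (a ∷ as) [] = + 0
zExp (a ∷ as) (e ∷ es) = (ℤ.- a ℤ.- + 1 ℤ.- + e) ℤ.+ zExp as es

ffs : List ℤ → List ℕ → ℤ
ffs [] _ = + 1
ffs (a ∷ as) [] = + 1
ffs (a ∷ as) (e ∷ es) = ff a e ℤ.* ffs as es

-- The mode P^{(k)}_m (coefficient of z^{-m-k}) applied to f.
-- The formally infinite sum over (a_1,...,a_j) has only finitely many terms
-- that are nonzero on f: a positive a_i must satisfy a_i ≤ maxT f (otherwise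
-- ∂/∂t_{a_i} kills it), a_i = 0 gives 0, and then Σ a_i is fixed by the
-- z-exponent, which bounds the negative a_i below by -(|T| + j·maxT f)
-- where T = Σ a_i.  We sum over exactly this (sufficient) range.
Pmode : ∀ {r} → ℕ → ℤ → Poly r → Poly r
Pmode {r} k m f = sumP (concatMap term (PD k))
  where
  N = maxT f
  term : ℕ × List ℕ → List (Poly r)
  term (c , es) = map contrib (filterᵇ ok (tuples j range))
    where
    j = length es
    target = ℤ.- m ℤ.- + k
    T = ℤ.- target ℤ.- + j ℤ.- sumZ (map +_ es)
    B = ℤ.∣ T ∣ ℕ.+ j ℕ.* N
    range = rangeZ (ℤ.- (+ B)) (B ℕ.+ suc N)
    ok : List ℤ → Bool
    ok as = ⌊ zExp as es ℤ.≟ target ⌋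
    contrib : List ℤ → Poly r
    contrib as = scaleP (ℤtoℚ (+ c ℤ.* ffs as es)) (nord as f)

-- Right-hand side:  coefficient of s^d in exp(s Σ_k a_k P^{(k)}_{-1})(1),
-- i.e.  (1/d!) A^d (1)  with  A = Σ_{k=1}^{r+1} a_k P^{(k)}_{-1}.

Aop : ∀ {r} → (Fin (suc r) → PolyV r) → Poly r → Poly r
Aop {r} a f = sumP (map (λ i → ιV (a i) ⊗ Pmode (suc (toℕ i)) (ℤ.- (+ 1)) f) (allFin (suc r)))

iter : ∀ {A : Set} → ℕ → (A → A) → A → A
iter zero g x = x
iter (suc n) g x = g (iter n g x)

expCoeff : ∀ {r} → (Fin (suc r) → PolyV r) → ℕ → Poly r
expCoeff a d = scaleP (invFact d) (iter d (Aop a) oneP)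

fallingX : ∀ {r} → ℕ → Poly r
fallingX n = prodP (List.applyUpTo (λ j → xP ⊕ constP (ℚ.- ℕtoℚ j)) n)

aIdentity : ∀ {r} → (Fin (suc r) → PolyV r) → Set
aIdentity {r} a =
  sumP (map (λ i → constP (ℕtoℚ (suc (toℕ i))) ⊗ (ιV (a i) ⊗ fallingX (toℕ i))) (allFin (suc r)))
  ≋ prodP (map (λ i → xP ⊕ vP i) (allFin r))

-- Permutations of {0..d-1} as vectors of images (σ i = lookup σ i).

Perm : ℕ → Set
Perm d = Vec (Fin d) d

eqFin : ∀ {d} → Fin d → Fin d → Bool
eqFin i j = toℕ i ℕ.≡ᵇ toℕ j

allL : ∀ {A : Set} → (A → Bool) → List A → Bool
allL p = foldr (λ x b → p x ∧ b) true

anyL : ∀ {A : Set} → (A → Bool) → List A → Bool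
anyL p = foldr (λ x b → p x ∨ b) false

allVecs : ∀ {A : Set} → List A → (n : ℕ) → List (Vec A n)
allVecs xs zero = [] ∷ []
allVecs xs (suc n) = concatMap (λ x → map (x ∷_) (allVecs xs n)) xs

isInjective : ∀ {d} → Vec (Fin d) d → Bool
isInjective {d} σ = allL (λ i → allL (λ j → not (eqFin (Vec.lookup σ i) (Vec.lookup σ j)) ∨ eqFin i j) (allFin d)) (allFin d)

-- the symmetric group S_d (each element listed exactly once)
Sym : (d : ℕ) → List (Perm d)
Sym d = filterᵇ isInjective (allVecs (allFin d) d)

idPerm : ∀ {d} → Perm d
idPerm = Vec.tabulate (λ i → i)

-- (σ ∘ τ)(i) = σ (τ i); product α_1 α_2 ⋯ means α_1 ∘ α_2 ∘ ⋯
compose : ∀ {d} → Perm d → Perm d → Perm d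
compose σ τ = Vec.map (Vec.lookup σ) τ

isId : ∀ {d} → Perm d → Bool
isId {d} σ = allL (λ i → eqFin (Vec.lookup σ i) i) (allFin d)

iterP : ∀ {d} → Perm d → ℕ → Fin d → Fin d
iterP σ n i = iter n (Vec.lookup σ) i

isCycleMin : ∀ {d} → Perm d → Fin d → Bool
isCycleMin {d} σ i = allL (λ n → toℕ i ℕ.≤ᵇ toℕ (iterP σ n i)) (List.upTo (suc d))

cycleLen : ∀ {d} → Perm d → Fin d → ℕ
cycleLen {d} σ i = go d 1
  where
  go : ℕ → ℕ → ℕ
  go zero n = n
  go (suc f) n = if eqFin (iterP σ n i) i then n else go f (suc n)

cycleMins : ∀ {d} → Perm d → List (Fin d)
cycleMins {d} σ = filterᵇ (isCycleMin σ) (allFin d)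

numCycles : ∀ {d} → Perm d → ℕ
numCycles σ = length (cycleMins σ)

insertDesc : ℕ → List ℕ → List ℕ
insertDesc x [] = x ∷ []
insertDesc x (y ∷ ys) = if y ℕ.≤ᵇ x then x ∷ y ∷ ys else y ∷ insertDesc x ys

sortDesc : List ℕ → List ℕ
sortDesc = foldr insertDesc []

cycleType : ∀ {d} → Perm d → List ℕ
cycleType σ = sortDesc (map (cycleLen σ) (cycleMins σ))

eqListℕ : List ℕ → List ℕ → Bool
eqListℕ [] [] = true
eqListℕ [] (_ ∷ _) = false
eqListℕ (_ ∷ _) [] = false
eqListℕ (x ∷ xs) (y ∷ ys) = (x ℕ.≡ᵇ y) ∧ eqListℕ xs ys

-- Partitions of n with all parts ≤ m, as weakly decreasing lists (fuel f ≥ n).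
partsF : ℕ → ℕ → ℕ → List (List ℕ)
partsF _ zero _ = [] ∷ []
partsF zero (suc n) _ = []
partsF (suc f) (suc n) m =
  concatMap (λ p → map (suc p ∷_) (partsF f (suc n ∸ suc p) (suc p)))
            (List.upTo (m ℕ.⊓ suc n))

partitions : ℕ → List (List ℕ)
partitions d = partsF d d d

Nbullet : ∀ {r} (d : ℕ) → Vec ℕ r → List ℕ → ℚ
Nbullet {r} d k μ = invFact d ℚ.* ℕtoℚ (length (filterᵇ good tuplesP))
  where
  tuplesP : List (Vec (Perm d) r × Perm d)
  tuplesP = concatMap (λ αs → map (αs ,_) (Sym d)) (allVecs (Sym d) r)
  good : Vec (Perm d) r × Perm d → Bool
  good (αs , α) =
    isId (Vec.foldr _ compose α αs)
    ∧ eqV (Vec.map numCycles αs) k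
    ∧ eqListℕ (cycleType α) μ

-- p_μ written in the t-variables:  p_n = n t_n
pμ : ∀ {r} → List ℕ → Poly r
pμ μ = prodP (map (λ n → scaleP (ℕtoℚ n) (tP (n ∸ 1))) μ)

vMonoP : ∀ {r} → Vec ℕ r → Poly r
vMonoP k = (1ℚ , mono 0 k []) ∷ []

-- Coefficient of  s^d · (monomial m)  in Z_(r)(s; v; p) with t_n = p_n / n.
-- Z = Σ_k Σ_μ v^k s^{|μ|} N^•_k(μ) p_μ; for a fixed monomial m only the
-- summand with k = (v-exponents of m) can contribute, and |μ| = d.
Zcoeff : ∀ {r} → ℕ → Mono r → ℚ
Zcoeff d m = sumℚ (map (λ μ → Nbullet d (ve m) μ ℚ.* coeff (vMonoP (ve m) ⊗ pμ μ) m) (partitions d))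

{-# OPTIONS --safe #-}
-- Let p_n = n t_n and let C be the cut-and-join operator, so that C p_type(σ) = p_type(σ T) with T the sum of all
-- transpositions of S_d.  Every element of S_{d+1} is σ or σ (0 j) with σ in S_d, the second form having one cycle
-- less; hence the generating series of tuples is obtained from the one for S_d by inserting ∏_i (v_i + 𝒳) with the
-- Jucys-Murphy element 𝒳 = Σ_j (0 j).  Since 𝒳 is the difference of the elements T for d + 1 and d, inserting 𝒳^n is
-- the operator (ad C)^n p_1.  So the theorem reduces to [C, P_k/k] = P_{k+1}/(k+1) + (k-1) P_k/k for
-- P_k = P^{(k)}_{-1}, which says that P_k/k is the (k-1)-st falling factorial of ad C applied to p_1.
-- The P^{(k)} are the coefficients in u of the vertex operator V = :exp(φ(qz) - φ(z)):, where φ' = J and q = 1 + u, and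
-- [J_b, V] = (q^b - 1) z^b V.  A family of operators with commutators of this shape vanishes as soon as its vacuum
-- expectations do; this gives [L_b, V] and then [C, V] from [J_c, L_b] = c J_{b+c} and [J_b, C] = b L_b.

module Submission where

open import Defs
open import Data.Bool as Bool using (Bool; true; false; _∧_; _∨_; not)
open import Data.Empty using (⊥-elim)
open import Data.Fin as Fin using (Fin; zero; suc; toℕ)
import Data.Fin.Properties as Fin
open import Data.Integer as ℤ using (ℤ; +_; -[1+_])
import Data.Integer.Properties as ℤ
import Data.Integer.Tactic.RingSolver as ℤSolver
open import Data.List using (List; []; _∷_; map; _++_; concatMap; length; filterᵇ; foldr; allFin; applyUpTo; reverse; upTo)
import Data.List.Properties as List
open import Data.List.Membership.Propositional using (_∈_)
import Data.List.Membership.Propositional.Properties as ∈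
open import Data.List.Relation.Binary.Permutation.Propositional as ↭ using (_↭_)
import Data.List.Relation.Binary.Permutation.Propositional.Properties as ↭
open import Data.List.Relation.Unary.All as All using (All; []; _∷_)
import Data.List.Relation.Unary.All.Properties as All
open import Data.List.Relation.Unary.AllPairs using ([]; _∷_)
open import Data.List.Relation.Unary.Any using (here; there)
open import Data.List.Relation.Unary.Unique.Propositional using (Unique)
import Data.List.Relation.Unary.Unique.Propositional.Properties as Unique
open import Data.Maybe using (Maybe; just; nothing)
open import Data.Nat as ℕ using (ℕ; zero; suc; _≤_; _<_; z≤n; s≤s)
open import Data.Nat.ListAction using (sum)
import Data.Nat.ListAction.Properties as Sum
import Data.Nat.Properties as ℕ
open import Data.Product using (_×_; _,_; proj₁; proj₂; Σ)
open import Data.Rational as ℚ using (ℚ; 0ℚ; 1ℚ; _+_; _*_; -_; _-_)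
import Data.Rational.Properties as ℚ
import Data.Rational.Unnormalised as ℚᵘ
import Data.Rational.Unnormalised.Properties as ℚᵘ
open import Data.Sum using (_⊎_; inj₁; inj₂)
open import Data.Vec as Vec using (Vec; []; _∷_; lookup)
import Data.Vec.Properties as Vec
open import Function using (_∘_; case_of_)
open import Relation.Binary.PropositionalEquality hiding (J; resp)
open import Relation.Nullary using (¬_; Dec; yes; no)
open import Relation.Nullary.Decidable using (⌊_⌋)
open import Tactic.RingSolver using (solve-∀)
open import Tactic.RingSolver.Core.AlmostCommutativeRing using (AlmostCommutativeRing; fromCommutativeRing)

-- Products of normally ordered series are infinite sums of modes. Everything is therefore done on
-- coefficient functions `Fn`, where each coefficient is a finite sum, and identities are proved for
-- sums cut off at one large common bound. The formulas for [L_b, V] and [C, V] are not derived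
-- inside this setting; they are only checked. Their compatibility with the commutators of J_c is an
-- identity between operators in q (`BΛ-Δ`, `DT-Δ`), and their vacuum expectations are finite
-- geometric sums. Doubling L and C into `Λ` and `T` avoids halves until `C-P`. The other obstacle
-- is to put ad C in place of x in the identity that defines the a_k, since equality of `Poly` means
-- equality of coefficients. The identity is paired with a linear functional on monomials that sends
-- x^j to (ad C)^j p_1 and v^α to a shift of the exponents of v. This is done on polynomials in t
-- (`Pol`), where the formula for [C, P_k] is known, so `T` has to preserve them.

ℚR : AlmostCommutativeRing _ _
ℚR = fromCommutativeRing ℚ.+-*-commutativeRing isZero
  where
  isZero : ∀ x → Maybe (0ℚ ≡ x)
  isZero x with 0ℚ ℚ.≟ x
  ... | yes p = just p
  ... | no _  = nothing

opaque
  -- Kept `opaque` so that conversion checking never normalises a fraction: afterwards integers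
  -- enter the rationals only through the homomorphism laws, and the ring solver treats `ι z` as an
  -- atom.
  ι : ℤ → ℚ
  ι = ℤtoℚ

  ι-def : ∀ z → ℤtoℚ z ≡ ι z
  ι-def z = refl

  ι0 : ι (+ 0) ≡ 0ℚ
  ι0 = refl

  ι1 : ι (+ 1) ≡ 1ℚ
  ι1 = refl

  ι-+ : ∀ a b → ι (a ℤ.+ b) ≡ ι a + ι b
  ι-+ a b = ℚ.toℚᵘ-injective (ℚᵘ.≃-trans (ℚ.toℚᵘ-fromℚᵘ (ℚᵘ.mkℚᵘ (a ℤ.+ b) 0))
    (ℚᵘ.≃-trans (ℚᵘ.*≡* (cong (λ z → (z ℤ.* (+ 1))) (sym (cong₂ ℤ._+_ (ℤ.*-identityʳ a) (ℤ.*-identityʳ b)))))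
    (ℚᵘ.≃-trans (ℚᵘ.+-cong (ℚᵘ.≃-sym (ℚ.toℚᵘ-fromℚᵘ (ℚᵘ.mkℚᵘ a 0))) (ℚᵘ.≃-sym (ℚ.toℚᵘ-fromℚᵘ (ℚᵘ.mkℚᵘ b 0))))
     (ℚᵘ.≃-sym (ℚ.toℚᵘ-homo-+ (ι a) (ι b))))))

  ι-* : ∀ a b → ι (a ℤ.* b) ≡ ι a * ι b
  ι-* a b = ℚ.toℚᵘ-injective (ℚᵘ.≃-trans (ℚ.toℚᵘ-fromℚᵘ (ℚᵘ.mkℚᵘ (a ℤ.* b) 0))
    (ℚᵘ.≃-trans (ℚᵘ.*-cong (ℚᵘ.≃-sym (ℚ.toℚᵘ-fromℚᵘ (ℚᵘ.mkℚᵘ a 0))) (ℚᵘ.≃-sym (ℚ.toℚᵘ-fromℚᵘ (ℚᵘ.mkℚᵘ b 0))))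
     (ℚᵘ.≃-sym (ℚ.toℚᵘ-homo-* (ι a) (ι b)))))

  recip : ℕ → ℚ
  recip n = (+ 1) ℚ./ suc n

  recip-ι : ∀ n → recip n * ι (+ suc n) ≡ 1ℚ
  recip-ι n = ℚ.toℚᵘ-injective (ℚᵘ.≃-trans (ℚ.toℚᵘ-homo-* (recip n) (ι (+ suc n)))
    (ℚᵘ.≃-trans (ℚᵘ.*-cong (ℚ.toℚᵘ-fromℚᵘ (ℚᵘ.mkℚᵘ (+ 1) n)) (ℚ.toℚᵘ-fromℚᵘ (ℚᵘ.mkℚᵘ (+ suc n) 0)))
      (ℚᵘ.*≡* (ℤ.*-assoc (+ 1) (+ suc n) (+ 1)))))

ι-neg : ∀ a → ι (ℤ.- a) ≡ - ι a
ι-neg a = inverseˡ-unique _ _ (trans (sym (ι-+ (ℤ.- a) a)) (trans (cong ι (ℤ.+-inverseˡ a)) ι0))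
  where open import Algebra.Properties.Group ℚ.+-0-group using (inverseˡ-unique)

ι-suc : ∀ n → ι (+ suc n) ≡ 1ℚ + ι (+ n)
ι-suc n = trans (ι-+ (+ 1) (+ n)) (cong (_+ ι (+ n)) ι1)

ι-suc-cancel : ∀ n {x y} → ι (+ suc n) * x ≡ ι (+ suc n) * y → x ≡ y
ι-suc-cancel n {x} {y} e = begin
  x                               ≡⟨ undo x ⟩
  recip n * (ι (+ suc n) * x)     ≡⟨ cong (recip n *_) e ⟩
  recip n * (ι (+ suc n) * y)     ≡⟨ sym (undo y) ⟩
  y                               ∎
  where
  open ≡-Reasoning
  undo : ∀ z → z ≡ recip n * (ι (+ suc n) * z)
  undo z = trans (sym (ℚ.*-identityˡ z)) (trans (cong (_* z) (sym (recip-ι n))) (ℚ.*-assoc (recip n) (ι (+ suc n)) z))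

ι-suc-cancel₀ : ∀ n {x} → ι (+ suc n) * x ≡ 0ℚ → x ≡ 0ℚ
ι-suc-cancel₀ n e = ι-suc-cancel n (trans e (sym (ℚ.*-zeroʳ (ι (+ suc n)))))

-- Linear maps between spaces of functions

-- The combination may be any `h` that agrees with it pointwise. Thus linearity includes
-- compatibility with pointwise equality and stands in for function extensionality throughout.
Lin : {A B : Set} → ((A → ℚ) → (B → ℚ)) → Set
Lin T = ∀ c {s t h} → (∀ a → h a ≡ c * s a + t a) → ∀ b → T h b ≡ c * T s b + T t b

module _ {A B : Set} {T : (A → ℚ) → (B → ℚ)} (lin : Lin T) where

  -- Pointwise equality is a combination in which `s` has the coefficient 0.
  lin-cong : ∀ {s t} → s ≗ t → T s ≗ T t
  lin-cong {s} {t} e b = trans (lin 0ℚ {s} {t} (λ a → trans (e a) (l (s a) (t a))) b) (sym (l (T s b) (T t b)))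
    where
    l : ∀ x y → y ≡ 0ℚ * x + y
    l = solve-∀ ℚR

  -- A zero function is -1 times itself plus itself, so its image has the same form.
  lin-zero : ∀ {s} → (∀ a → s a ≡ 0ℚ) → ∀ b → T s b ≡ 0ℚ
  lin-zero {s} z b = trans (lin (- 1ℚ) {s} {s} (λ a → trans (z a) (sym (l (s a)))) b) (l (T s b))
    where
    l : ∀ x → (- 1ℚ) * x + x ≡ 0ℚ
    l = solve-∀ ℚR

  lin-+ : ∀ {s t h} → (∀ a → h a ≡ s a + t a) → ∀ b → T h b ≡ T s b + T t b
  lin-+ {s} {t} e b = trans (lin 1ℚ (λ a → trans (e a) (l (s a) (t a))) b) (sym (l (T s b) (T t b)))
    where
    l : ∀ x y → x + y ≡ 1ℚ * x + y
    l = solve-∀ ℚR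

  lin-- : ∀ {s t h} → (∀ a → h a ≡ s a - t a) → ∀ b → T h b ≡ T s b - T t b
  lin-- {s} {t} e b = trans (lin (- 1ℚ) (λ a → trans (e a) (l (s a) (t a))) b) (sym (l (T s b) (T t b)))
    where
    l : ∀ x y → x - y ≡ (- 1ℚ) * y + x
    l = solve-∀ ℚR

  lin-* : ∀ c {s h} → (∀ a → h a ≡ c * s a) → ∀ b → T h b ≡ c * T s b
  lin-* c {s} {h} e b = trans (lin c {s} {λ _ → 0ℚ} (λ a → trans (e a) (l (c * s a))) b)
      (trans (cong (λ z → c * T s b + z) (lin-zero (λ _ → refl) b)) (sym (l _)))
    where
    l : ∀ x → x ≡ x + 0ℚ
    l = solve-∀ ℚR

-- Power series in u as sequences

-- Sequences s : ℕ → ℚ stand for exponential generating series Σ s_k u^k / k!.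
-- Then U is multiplication by u, S multiplication by q = 1 + u, S⁻ by q⁻¹, θ is q d/dq.

Seq : Set
Seq = ℕ → ℚ

U S S⁻ θ : Seq → Seq
U s zero = 0ℚ
U s (suc k) = ι (+ suc k) * s k
S s k = s k + U s k
S⁻ s zero = s zero
S⁻ s (suc k) = s (suc k) - ι (+ suc k) * S⁻ s k
θ s k = s (suc k) + ι (+ k) * s k

Sᶻ : ℤ → Seq → Seq
Sᶻ (+ n) s = iter n S s
Sᶻ -[1+ n ] s = iter (suc n) S⁻ s

U-lin : Lin U
U-lin c e zero = sym (trans (ℚ.+-identityʳ _) (ℚ.*-zeroʳ c))
U-lin c {s} {t} e (suc k) = trans (cong (ι (+ suc k) *_) (e k)) (l (ι (+ suc k)) c (s k) (t k))
  where
  l : ∀ i c x y → i * (c * x + y) ≡ c * (i * x) + i * y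
  l = solve-∀ ℚR

S-lin : Lin S
S-lin c {s} {t} e k = trans (cong₂ _+_ (e k) (U-lin c {s} {t} e k)) (l c (s k) (t k) (U s k) (U t k))
  where
  l : ∀ c x y x' y' → c * x + y + (c * x' + y') ≡ c * (x + x') + (y + y')
  l = solve-∀ ℚR

S⁻-lin : Lin S⁻
S⁻-lin c e zero = e zero
S⁻-lin c {s} {t} e (suc k) = trans (cong₂ (λ a b → a - ι (+ suc k) * b) (e (suc k)) (S⁻-lin c {s} {t} e k))
    (l (ι (+ suc k)) c (s (suc k)) (t (suc k)) (S⁻ s k) (S⁻ t k))
  where
  l : ∀ i c x y x' y' → c * x + y - i * (c * x' + y') ≡ c * (x - i * x') + (y - i * y')
  l = solve-∀ ℚR

θ-lin : Lin θ
θ-lin c {s} {t} e k = trans (cong₂ (λ a b → a + ι (+ k) * b) (e (suc k)) (e k)) (l (ι (+ k)) c (s (suc k)) (t (suc k)) (s k) (t k))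
  where
  l : ∀ i c x y x' y' → c * x + y + i * (c * x' + y') ≡ c * (x + i * x') + (y + i * y')
  l = solve-∀ ℚR

iter-lin : {T : Seq → Seq} → Lin T → ∀ n → Lin (iter n T)
iter-lin L zero c e = e
iter-lin L (suc n) c e = L c (iter-lin L n c e)

Sᶻ-lin : ∀ b → Lin (Sᶻ b)
Sᶻ-lin (+ n) = iter-lin S-lin n
Sᶻ-lin -[1+ n ] = iter-lin S⁻-lin (suc n)

-- T acts on the index of a sequence of functions, P on the functions themselves.
Natural : (Seq → Seq) → Set₁
Natural T = ∀ {A B : Set} {P : (A → ℚ) → (B → ℚ)} → Lin P → ∀ (g : ℕ → A → ℚ) b k →
  P (λ a → T (λ j → g j a) k) b ≡ T (λ j → P (g j) b) k

U-nat : Natural U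
U-nat L g b zero = lin-zero L (λ _ → refl) b
U-nat L g b (suc k) = lin-* L (ι (+ suc k)) (λ _ → refl) b

S-nat : Natural S
S-nat {P = P} L g b k = trans (lin-+ L (λ _ → refl) b) (cong (λ z → P (g k) b + z) (U-nat L g b k))

S⁻-nat : Natural S⁻
S⁻-nat L g b zero = refl
S⁻-nat {P = P} L g b (suc k) = trans (lin-- L (λ _ → refl) b)
  (cong (λ z → P (g (suc k)) b - z) (trans (lin-* L (ι (+ suc k)) (λ _ → refl) b) (cong (ι (+ suc k) *_) (S⁻-nat L g b k))))

θ-nat : Natural θ
θ-nat {P = P} L g b k = trans (lin-+ L (λ _ → refl) b) (cong (λ z → P (g (suc k)) b + z) (lin-* L (ι (+ k)) (λ _ → refl) b))

iter-nat : {T : Seq → Seq} → Lin T → Natural T → ∀ n → Natural (iter n T)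
iter-nat L N zero LP g b k = refl
iter-nat {T} L N (suc n) LP g b k = trans (N LP (λ j a → iter n T (λ i → g i a) j) b k)
  (lin-cong L (λ j → iter-nat L N n LP g b j) k)

Sᶻ-nat : ∀ b → Natural (Sᶻ b)
Sᶻ-nat (+ n) = iter-nat S-lin S-nat n
Sᶻ-nat -[1+ n ] = iter-nat S⁻-lin S⁻-nat (suc n)

S-S⁻ : ∀ s → S (S⁻ s) ≗ s
S-S⁻ s zero = ℚ.+-identityʳ _
S-S⁻ s (suc k) = l (s (suc k)) (ι (+ suc k) * S⁻ s k)
  where
  l : ∀ x y → x - y + y ≡ x
  l = solve-∀ ℚR

S⁻-S : ∀ s → S⁻ (S s) ≗ s
S⁻-S s zero = ℚ.+-identityʳ _
S⁻-S s (suc k) = trans (cong (λ z → s (suc k) + ι (+ suc k) * s k - ι (+ suc k) * z) (S⁻-S s k)) (l (s (suc k)) (ι (+ suc k) * s k))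
  where
  l : ∀ x y → x + y - y ≡ x
  l = solve-∀ ℚR

Sᶻ-suc : ∀ b s → Sᶻ (ℤ.suc b) s ≗ S (Sᶻ b s)
Sᶻ-suc (+ n) s k = refl
Sᶻ-suc -[1+ zero ] s k = sym (S-S⁻ s k)
Sᶻ-suc -[1+ suc n ] s k = sym (S-S⁻ (Sᶻ -[1+ n ] s) k)

Sᶻ-pred : ∀ b s → Sᶻ (ℤ.pred b) s ≗ S⁻ (Sᶻ b s)
Sᶻ-pred (+ zero) s k = refl
Sᶻ-pred (+ suc n) s k = sym (S⁻-S (Sᶻ (+ n) s) k)
Sᶻ-pred -[1+ n ] s k = refl

Sᶻ-+ : ∀ b c s → Sᶻ (b ℤ.+ c) s ≗ Sᶻ b (Sᶻ c s)
Sᶻ-+ (+ zero) c s k = cong (λ z → Sᶻ z s k) (ℤ.+-identityˡ c)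
Sᶻ-+ (+ suc n) c s k = trans (cong (λ z → Sᶻ z s k) (ℤ.+-assoc (+ 1) (+ n) c))
  (trans (Sᶻ-suc (+ n ℤ.+ c) s k) (lin-cong S-lin (Sᶻ-+ (+ n) c s) k))
Sᶻ-+ -[1+ zero ] c s k = Sᶻ-pred c s k
Sᶻ-+ -[1+ suc n ] c s k = trans (cong (λ z → Sᶻ z s k) (ℤ.+-assoc -[1+ 0 ] -[1+ n ] c))
  (trans (Sᶻ-pred (-[1+ n ] ℤ.+ c) s k) (lin-cong S⁻-lin (Sᶻ-+ -[1+ n ] c s) k))

Sᶻ-comm : ∀ b c s → Sᶻ b (Sᶻ c s) ≗ Sᶻ c (Sᶻ b s)
Sᶻ-comm b c s k = trans (sym (Sᶻ-+ b c s k)) (trans (cong (λ z → Sᶻ z s k) (ℤ.+-comm b c)) (Sᶻ-+ c b s k))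

Sᶻ-ind : (P : ℤ → Set) → P (+ 0) → (∀ b → P b → P (ℤ.suc b)) → (∀ b → P b → P (ℤ.pred b)) → ∀ b → P b
Sᶻ-ind P p0 ps pp (+ zero) = p0
Sᶻ-ind P p0 ps pp (+ suc n) = ps (+ n) (Sᶻ-ind P p0 ps pp (+ n))
Sᶻ-ind P p0 ps pp -[1+ zero ] = pp (+ 0) p0
Sᶻ-ind P p0 ps pp -[1+ suc n ] = pp -[1+ n ] (Sᶻ-ind P p0 ps pp -[1+ n ])

U-S : ∀ s → U (S s) ≗ S (U s)
U-S s zero = refl
U-S s (suc k) = ℚ.*-distribˡ-+ (ι (+ suc k)) (s k) (U s k)

U-S⁻ : ∀ s → U (S⁻ s) ≗ S⁻ (U s)
U-S⁻ s k = trans (sym (S⁻-S (U (S⁻ s)) k)) (lin-cong S⁻-lin (λ j → trans (sym (U-S (S⁻ s) j)) (lin-cong U-lin (S-S⁻ s) j)) k)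

U-Sᶻ : ∀ b s → U (Sᶻ b s) ≗ Sᶻ b (U s)
U-Sᶻ b s = Sᶻ-ind (λ b → U (Sᶻ b s) ≗ Sᶻ b (U s)) (λ _ → refl)
  (λ b e k → trans (lin-cong U-lin (Sᶻ-suc b s) k) (trans (U-S (Sᶻ b s) k) (trans (lin-cong S-lin e k) (sym (Sᶻ-suc b (U s) k)))))
  (λ b e k → trans (lin-cong U-lin (Sᶻ-pred b s) k) (trans (U-S⁻ (Sᶻ b s) k) (trans (lin-cong S⁻-lin e k) (sym (Sᶻ-pred b (U s) k)))))
  b

-- θ is a derivation with θ u = q, which is where the term `S s` comes from.
θ-U : ∀ s k → θ (U s) k ≡ U (θ s) k + S s k
θ-U s zero = l (s 0) (ι (+ 0)) 
  where
  l : ∀ x z → ι (+ 1) * x + z * 0ℚ ≡ 0ℚ + (x + 0ℚ)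
  l x z = trans (cong (λ i → i * x + z * 0ℚ) ι1) (l' x z)
    where
    l' : ∀ x z → 1ℚ * x + z * 0ℚ ≡ 0ℚ + (x + 0ℚ)
    l' = solve-∀ ℚR
θ-U s (suc k) = trans (cong (λ i → i * s (suc k) + ι (+ suc k) * (ι (+ suc k) * s k)) (ι-suc (suc k)))
    (trans (l (ι (+ suc k)) (s (suc k)) (s k)) (trans (cong (λ i → ι (+ suc k) * s (suc k) + ι (+ suc k) * (i * s k) + s (suc k)) (ι-suc k)) (l2 (ι (+ k)) (ι (+ suc k)) (s (suc k)) (s k))))
  where
  l : ∀ i x y → (1ℚ + i) * x + i * (i * y) ≡ i * x + i * (i * y) + x
  l = solve-∀ ℚR
  l2 : ∀ j i x y → i * x + i * ((1ℚ + j) * y) + x ≡ i * (x + j * y) + (x + i * y)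
  l2 = solve-∀ ℚR

θ-S : ∀ s k → θ (S s) k ≡ S (θ s) k + S s k
θ-S s k = trans (l (s (suc k)) (U s (suc k)) (s k) (U s k) (ι (+ k))) (trans (cong (λ z → θ s k + z) (θ-U s k)) (sym (ℚ.+-assoc (θ s k) (U (θ s) k) (S s k))))
  where
  l : ∀ x x' y y' i → x + x' + i * (y + y') ≡ x + i * y + (x' + i * y')
  l = solve-∀ ℚR

θ-S⁻ : ∀ s k → θ (S⁻ s) k ≡ S⁻ (θ s) k - S⁻ s k
θ-S⁻ s k = trans (sym (S⁻-S (θ (S⁻ s)) k)) (lin-- S⁻-lin (λ j → trans (l (S (θ (S⁻ s)) j) (S (S⁻ s) j))
    (cong₂ _-_ (trans (sym (θ-S (S⁻ s) j)) (lin-cong θ-lin (S-S⁻ s) j)) (S-S⁻ s j))) k)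
  where
  l : ∀ x y → x ≡ x + y - y
  l = solve-∀ ℚR

-- The rule θ ∘ q^b = q^b ∘ (θ + b), extended from `S` and `S⁻` to all powers by induction in both
-- directions.
θ-Sᶻ : ∀ b s k → θ (Sᶻ b s) k ≡ Sᶻ b (θ s) k + ι b * Sᶻ b s k
θ-Sᶻ b s = Sᶻ-ind (λ b → ∀ k → θ (Sᶻ b s) k ≡ Sᶻ b (θ s) k + ι b * Sᶻ b s k)
  (λ k → trans (l0 (θ s k) (s k)) (cong (λ i → θ s k + i * s k) (sym ι0)))
  (λ b e k → begin
    θ (Sᶻ (ℤ.suc b) s) k                                 ≡⟨ lin-cong θ-lin (Sᶻ-suc b s) k ⟩
    θ (S (Sᶻ b s)) k                                     ≡⟨ θ-S (Sᶻ b s) k ⟩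
    S (θ (Sᶻ b s)) k + S (Sᶻ b s) k                      ≡⟨ cong (_+ S (Sᶻ b s) k) (S-lin (ι b) (λ j → trans (e j) (ℚ.+-comm (Sᶻ b (θ s) j) (ι b * Sᶻ b s j))) k) ⟩
    ι b * S (Sᶻ b s) k + S (Sᶻ b (θ s)) k + S (Sᶻ b s) k ≡⟨ l1 (ι b) (S (Sᶻ b s) k) (S (Sᶻ b (θ s)) k) ⟩
    S (Sᶻ b (θ s)) k + (1ℚ + ι b) * S (Sᶻ b s) k         ≡⟨ cong₂ _+_ (sym (Sᶻ-suc b (θ s) k)) (cong₂ _*_ (sym (trans (ι-+ (+ 1) b) (cong (_+ ι b) ι1))) (sym (Sᶻ-suc b s k))) ⟩
    Sᶻ (ℤ.suc b) (θ s) k + ι (ℤ.suc b) * Sᶻ (ℤ.suc b) s k ∎)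
  (λ b e k → begin
    θ (Sᶻ (ℤ.pred b) s) k                                ≡⟨ lin-cong θ-lin (Sᶻ-pred b s) k ⟩
    θ (S⁻ (Sᶻ b s)) k                                    ≡⟨ θ-S⁻ (Sᶻ b s) k ⟩
    S⁻ (θ (Sᶻ b s)) k - S⁻ (Sᶻ b s) k                    ≡⟨ cong (_- S⁻ (Sᶻ b s) k) (S⁻-lin (ι b) (λ j → trans (e j) (ℚ.+-comm (Sᶻ b (θ s) j) (ι b * Sᶻ b s j))) k) ⟩
    ι b * S⁻ (Sᶻ b s) k + S⁻ (Sᶻ b (θ s)) k - S⁻ (Sᶻ b s) k ≡⟨ l2 (ι b) (S⁻ (Sᶻ b s) k) (S⁻ (Sᶻ b (θ s)) k) ⟩
    S⁻ (Sᶻ b (θ s)) k + (- 1ℚ + ι b) * S⁻ (Sᶻ b s) k     ≡⟨ cong₂ _+_ (sym (Sᶻ-pred b (θ s) k)) (cong₂ _*_ (sym (trans (ι-+ -[1+ 0 ] b) (cong (_+ ι b) (trans (ι-neg (+ 1)) (cong -_ ι1))))) (sym (Sᶻ-pred b s k))) ⟩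
    Sᶻ (ℤ.pred b) (θ s) k + ι (ℤ.pred b) * Sᶻ (ℤ.pred b) s k ∎)
  b
  where
  open ≡-Reasoning
  l0 : ∀ x y → x ≡ x + 0ℚ * y
  l0 = solve-∀ ℚR
  l1 : ∀ i x y → i * x + y + x ≡ y + (1ℚ + i) * x
  l1 = solve-∀ ℚR
  l2 : ∀ i x y → i * x + y - x ≡ y + (- 1ℚ + i) * x
  l2 = solve-∀ ℚR

-- Coefficient functions of power series in the t_n

Fn : Set
Fn = List ℕ → ℚ

infix 4 _~_
-- Exponent lists are read with trailing zeros ignored, so this relation is equality of monomials.
-- As a record it lets both lists be inferred from a proof.
record _~_ (xs ys : List ℕ) : Set where
  constructor ~i
  field ~e : ∀ n → lookupD xs n ≡ lookupD ys n
open _~_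

Resp : Fn → Set
Resp f = ∀ {xs ys} → xs ~ ys → f xs ≡ f ys

incAt : List ℕ → ℕ → List ℕ
incAt [] zero = 1 ∷ []
incAt [] (suc n) = 0 ∷ incAt [] n
incAt (x ∷ xs) zero = suc x ∷ xs
incAt (x ∷ xs) (suc n) = x ∷ incAt xs n

lk-inc-≡ : ∀ m n → lookupD (incAt m n) n ≡ suc (lookupD m n)
lk-inc-≡ [] zero = refl
lk-inc-≡ [] (suc n) = lk-inc-≡ [] n
lk-inc-≡ (x ∷ m) zero = refl
lk-inc-≡ (x ∷ m) (suc n) = lk-inc-≡ m n

lk-inc-≢ : ∀ m n k → n ≢ k → lookupD (incAt m n) k ≡ lookupD m k
lk-inc-≢ m zero zero ne = ⊥-elim (ne refl)
lk-inc-≢ [] zero (suc k) ne = refl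
lk-inc-≢ (x ∷ m) zero (suc k) ne = refl
lk-inc-≢ [] (suc n) zero ne = refl
lk-inc-≢ (x ∷ m) (suc n) zero ne = refl
lk-inc-≢ [] (suc n) (suc k) ne = lk-inc-≢ [] n k (ne ∘ cong suc)
lk-inc-≢ (x ∷ m) (suc n) (suc k) ne = lk-inc-≢ m n k (ne ∘ cong suc)

lk-dec-≡ : ∀ m n → lookupD (decAt m n) n ≡ lookupD m n ℕ.∸ 1
lk-dec-≡ [] n = refl
lk-dec-≡ (x ∷ m) zero = refl
lk-dec-≡ (x ∷ m) (suc n) = lk-dec-≡ m n

lk-dec-≢ : ∀ m n k → n ≢ k → lookupD (decAt m n) k ≡ lookupD m k
lk-dec-≢ [] n k ne = refl
lk-dec-≢ (x ∷ m) zero zero ne = ⊥-elim (ne refl)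
lk-dec-≢ (x ∷ m) zero (suc k) ne = refl
lk-dec-≢ (x ∷ m) (suc n) zero ne = refl
lk-dec-≢ (x ∷ m) (suc n) (suc k) ne = lk-dec-≢ m n k (ne ∘ cong suc)

inc-resp : ∀ {xs ys} n → xs ~ ys → incAt xs n ~ incAt ys n
inc-resp {xs} {ys} n e .~e k with n ℕ.≟ k
... | yes refl = trans (lk-inc-≡ xs n) (trans (cong suc (~e e n)) (sym (lk-inc-≡ ys n)))
... | no ne = trans (lk-inc-≢ xs n k ne) (trans (~e e k) (sym (lk-inc-≢ ys n k ne)))

dec-resp : ∀ {xs ys} n → xs ~ ys → decAt xs n ~ decAt ys n
dec-resp {xs} {ys} n e .~e k with n ℕ.≟ k
... | yes refl = trans (lk-dec-≡ xs n) (trans (cong (ℕ._∸ 1) (~e e n)) (sym (lk-dec-≡ ys n)))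
... | no ne = trans (lk-dec-≢ xs n k ne) (trans (~e e k) (sym (lk-dec-≢ ys n k ne)))

dec-inc : ∀ m n → decAt (incAt m n) n ~ m
dec-inc m n .~e k with n ℕ.≟ k
... | yes refl = trans (lk-dec-≡ (incAt m n) n) (cong (ℕ._∸ 1) (lk-inc-≡ m n))
... | no ne = trans (lk-dec-≢ (incAt m n) n k ne) (lk-inc-≢ m n k ne)

inc-dec : ∀ m n {e} → lookupD m n ≡ suc e → incAt (decAt m n) n ~ m
inc-dec m n p .~e k with n ℕ.≟ k
... | yes refl = trans (lk-inc-≡ (decAt m n) n) (trans (cong suc (trans (lk-dec-≡ m n) (cong (ℕ._∸ 1) p))) (sym p))
... | no ne = trans (lk-inc-≢ (decAt m n) n k ne) (lk-dec-≢ m n k ne)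

-- Each map changes only its own entry, and the new value there depends only on the old value there;
-- at every index at most one of the two acts.
swap : ∀ (F G : List ℕ → List ℕ) n k →
  (∀ m j → n ≢ j → lookupD (F m) j ≡ lookupD m j) → (∀ m j → k ≢ j → lookupD (G m) j ≡ lookupD m j) →
  (∀ {m m'} → lookupD m n ≡ lookupD m' n → lookupD (F m) n ≡ lookupD (F m') n) →
  (∀ {m m'} → lookupD m k ≡ lookupD m' k → lookupD (G m) k ≡ lookupD (G m') k) →
  n ≢ k → ∀ m → F (G m) ~ G (F m)
swap F G n k f≢ g≢ f≡ g≡ ne m .~e j with n ℕ.≟ j | k ℕ.≟ j
... | yes refl | yes refl = ⊥-elim (ne refl)
... | yes refl | no kj = trans (f≡ (g≢ m n kj)) (sym (g≢ (F m) n kj))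
... | no nj | yes refl = trans (f≢ (G m) k nj) (sym (g≡ (f≢ m k nj)))
... | no nj | no kj = trans (f≢ (G m) j nj) (trans (g≢ m j kj) (sym (trans (g≢ (F m) j kj) (f≢ m j nj))))

-- Multiplication by a variable contributes to the coefficient of a monomial only if the variable
-- occurs in it; `decAt` truncates at 0 and cannot detect this by itself.
nz : ℕ → ℚ
nz zero = 0ℚ
nz (suc _) = 1ℚ

-- J_{-n} is multiplication by p_n = n t_n, J_n is ∂/∂t_n and J_0 = 0, on coefficient functions:
-- (J b f)(m) = jc b m · f (js b m).
jc : ℤ → List ℕ → ℚ
jc (+ zero) m = 0ℚ
jc (+ suc n) m = ι (+ suc (lookupD m n))
jc -[1+ n ] m = nz (lookupD m n) * ι (+ suc n)

js : ℤ → List ℕ → List ℕ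
js (+ zero) m = m
js (+ suc n) m = incAt m n
js -[1+ n ] m = decAt m n

J : ℤ → Fn → Fn
J b f m = jc b m * f (js b m)

jc-resp : ∀ b {xs ys} → xs ~ ys → jc b xs ≡ jc b ys
jc-resp (+ zero) e = refl
jc-resp (+ suc n) e = cong (λ z → ι (+ suc z)) (~e e n)
jc-resp -[1+ n ] e = cong (λ z → nz z * ι (+ suc n)) (~e e n)

js-resp : ∀ b {xs ys} → xs ~ ys → js b xs ~ js b ys
js-resp (+ zero) e = e
js-resp (+ suc n) e = inc-resp n e
js-resp -[1+ n ] e = dec-resp n e

J-resp : ∀ b {f} → Resp f → Resp (J b f)
J-resp b r e = cong₂ _*_ (jc-resp b e) (r (js-resp b e))

J-lin : ∀ b → Lin (J b)
J-lin b c {s} {t} e m = trans (cong (jc b m *_) (e (js b m))) (l (jc b m) c (s (js b m)) (t (js b m)))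
  where
  l : ∀ j c x y → j * (c * x + y) ≡ c * (j * x) + j * y
  l = solve-∀ ℚR

-- The Heisenberg relation

δ : ℤ → ℚ
δ (+ zero) = 1ℚ
δ (+ suc _) = 0ℚ
δ -[1+ _ ] = 0ℚ

δ-yes : ∀ {z} → z ≡ + 0 → δ z ≡ 1ℚ
δ-yes refl = refl

δ-no : ∀ {z} → z ≢ + 0 → δ z ≡ 0ℚ
δ-no {+ zero} ne = ⊥-elim (ne refl)
δ-no {+ suc _} ne = refl
δ-no { -[1+ _ ]} ne = refl

⊖≢0 : ∀ {n k} → n ≢ k → + suc n ℤ.+ -[1+ k ] ≢ + 0
⊖≢0 {n} {k} ne e = ne (ℕ.suc-injective (ℤ.+-injective (ℤ.i-j≡0⇒i≡j (+ suc n) (+ suc k) e)))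

Comm : ℤ → ℤ → Fn → List ℕ → Set
Comm b c f m = J b (J c f) m - J c (J b f) m ≡ ι b * (δ (b ℤ.+ c) * f m)

indep : ∀ b c f m → Resp f → jc c (js b m) ≡ jc c m → jc b (js c m) ≡ jc b m → js c (js b m) ~ js b (js c m) →
  J b (J c f) m - J c (J b f) m ≡ 0ℚ
indep b c f m r p q s = trans (cong₂ (λ x y → jc b m * (x * f (js c (js b m))) - jc c m * (y * f (js b (js c m)))) p q)
  (trans (cong (λ z → jc b m * (jc c m * z) - jc c m * (jc b m * f (js b (js c m)))) (r s)) (l (jc b m) (jc c m) (f (js b (js c m)))))
  where
  l : ∀ x y z → x * (y * z) - y * (x * z) ≡ 0ℚ
  l = solve-∀ ℚR

zero-rhs : ∀ i x {d} → d ≡ 0ℚ → 0ℚ ≡ i * (d * x)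
zero-rhs i x refl = l i x
  where
  l : ∀ i x → 0ℚ ≡ i * (0ℚ * x)
  l = solve-∀ ℚR

js-swap : ∀ b c m n k → n ≢ k →
  (b ≡ + suc n) ⊎ (b ≡ -[1+ n ]) → (c ≡ + suc k) ⊎ (c ≡ -[1+ k ]) → js c (js b m) ~ js b (js c m)
js-swap b c m n k ne pb pc = swap (js c) (js b) k n (≢' c k pc) (≢' b n pb) (≡' c k pc) (≡' b n pb) (ne ∘ sym) m
  where
  ≢' : ∀ b n → (b ≡ + suc n) ⊎ (b ≡ -[1+ n ]) → ∀ m j → n ≢ j → lookupD (js b m) j ≡ lookupD m j
  ≢' _ n (inj₁ refl) m j = lk-inc-≢ m n j
  ≢' _ n (inj₂ refl) m j = lk-dec-≢ m n j
  ≡' : ∀ b n → (b ≡ + suc n) ⊎ (b ≡ -[1+ n ]) → ∀ {m m'} → lookupD m n ≡ lookupD m' n → lookupD (js b m) n ≡ lookupD (js b m') n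
  ≡' _ n (inj₁ refl) {m} {m'} e = trans (lk-inc-≡ m n) (trans (cong suc e) (sym (lk-inc-≡ m' n)))
  ≡' _ n (inj₂ refl) {m} {m'} e = trans (lk-dec-≡ m n) (trans (cong (ℕ._∸ 1) e) (sym (lk-dec-≡ m' n)))

-- For different variables the modes act independently. For the same variable with exponent e, the
-- two orders give e + 1 and e times n + 1; for e = 0 the second product is killed by `nz` instead
-- of by an exponent, so this case is separate.
JJ-mixed : ∀ n k f m → Resp f → Comm (+ suc n) -[1+ k ] f m
JJ-mixed n k f m r with n ℕ.≟ k
... | no ne = trans (indep (+ suc n) -[1+ k ] f m r
        (cong (λ z → nz z * ι (+ suc k)) (lk-inc-≢ m n k ne)) (cong (λ z → ι (+ suc z)) (lk-dec-≢ m k n (ne ∘ sym)))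
        (js-swap (+ suc n) -[1+ k ] m n k ne (inj₁ refl) (inj₂ refl)))
      (zero-rhs (ι (+ suc n)) (f m) (δ-no (⊖≢0 ne)))
... | yes refl = trans (cong₂ (λ x y → ι (+ suc (lookupD m n)) * (nz x * ι (+ suc n) * y) - J -[1+ n ] (J (+ suc n) f) m)
        (lk-inc-≡ m n) (r (dec-inc m n)))
      (trans (aux (lookupD m n) refl)
      (cong (λ d → ι (+ suc n) * (d * f m)) (sym (δ-yes (ℤ.n⊖n≡0 (suc n))))))
  where
  aux : ∀ e → lookupD m n ≡ e → ι (+ suc (lookupD m n)) * (nz (suc e) * ι (+ suc n) * f m) - J -[1+ n ] (J (+ suc n) f) m ≡ ι (+ suc n) * (1ℚ * f m)
  aux zero p = trans (cong (λ z → ι (+ suc z) * (1ℚ * ι (+ suc n) * f m) - nz z * ι (+ suc n) * J (+ suc n) f (decAt m n)) p)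
     (trans (cong (λ i → i * (1ℚ * ι (+ suc n) * f m) - 0ℚ * ι (+ suc n) * J (+ suc n) f (decAt m n)) ι1) (l (ι (+ suc n)) (f m) (J (+ suc n) f (decAt m n))))
    where
    l : ∀ i x y → 1ℚ * (1ℚ * i * x) - 0ℚ * i * y ≡ i * (1ℚ * x)
    l = solve-∀ ℚR
  aux (suc e) p = trans (cong₂ (λ z y → ι (+ suc z) * (1ℚ * ι (+ suc n) * f m) - nz z * ι (+ suc n) * y) p
       (cong₂ (λ a b → ι (+ suc a) * b) (trans (lk-dec-≡ m n) (cong (ℕ._∸ 1) p)) (r (inc-dec m n p))))
     (trans (cong (λ i → i * (1ℚ * ι (+ suc n) * f m) - 1ℚ * ι (+ suc n) * (ι (+ suc e) * f m)) (ι-suc (suc e))) (l (ι (+ suc n)) (ι (+ suc e)) (f m)))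
    where
    l : ∀ i j x → (1ℚ + j) * (1ℚ * i * x) - 1ℚ * i * (j * x) ≡ i * (1ℚ * x)
    l = solve-∀ ℚR

JJ : ∀ b c f m → Resp f → Comm b c f m
JJ (+ zero) c f m r = trans (l (J c f m) (jc c m) (f (js c m))) (cong (_* (δ (+ 0 ℤ.+ c) * f m)) (sym ι0)) 
  where
  l' : ∀ x j y d → 0ℚ * x - j * (0ℚ * y) ≡ 0ℚ * d
  l' = solve-∀ ℚR
  l : ∀ x j y → 0ℚ * x - j * (0ℚ * y) ≡ 0ℚ * (δ (+ 0 ℤ.+ c) * f m)
  l x j y = l' x j y (δ (+ 0 ℤ.+ c) * f m)
JJ (+ suc n) (+ zero) f m r = trans (l' (jc (+ suc n) m) (f (incAt m n)) (J (+ suc n) f m)) (zero-rhs (ι (+ suc n)) (f m) (δ-no {+ suc n ℤ.+ + 0} (λ ())))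
  where
  l' : ∀ j x y → j * (0ℚ * x) - 0ℚ * y ≡ 0ℚ
  l' = solve-∀ ℚR
JJ -[1+ n ] (+ zero) f m r = trans (l' (jc -[1+ n ] m) (f (decAt m n)) (J -[1+ n ] f m)) (zero-rhs (ι -[1+ n ]) (f m) (δ-no { -[1+ n ] ℤ.+ + 0} (λ ())))
  where
  l' : ∀ j x y → j * (0ℚ * x) - 0ℚ * y ≡ 0ℚ
  l' = solve-∀ ℚR
JJ (+ suc n) (+ suc k) f m r with n ℕ.≟ k
... | yes refl = trans (ℚ.+-inverseʳ (J (+ suc n) (J (+ suc n) f) m)) (zero-rhs (ι (+ suc n)) (f m) refl)
... | no ne = trans (indep (+ suc n) (+ suc k) f m r (cong (λ z → ι (+ suc z)) (lk-inc-≢ m n k ne)) (cong (λ z → ι (+ suc z)) (lk-inc-≢ m k n (ne ∘ sym)))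
        (js-swap (+ suc n) (+ suc k) m n k ne (inj₁ refl) (inj₁ refl))) (zero-rhs (ι (+ suc n)) (f m) refl)
JJ (+ suc n) -[1+ k ] f m r = JJ-mixed n k f m r
JJ -[1+ n ] (+ suc k) f m r = trans (anti (J -[1+ n ] (J (+ suc k) f) m) (J (+ suc k) (J -[1+ n ] f) m))
  (trans (cong -_ (JJ-mixed k n f m r)) aux)
  where
  anti : ∀ x y → x - y ≡ - (y - x)
  anti = solve-∀ ℚR
  neg1 : ∀ i d x → - (i * (d * x)) ≡ (- i) * (d * x)
  neg1 = solve-∀ ℚR
  aux : - (ι (+ suc k) * (δ (+ suc k ℤ.+ -[1+ n ]) * f m)) ≡ ι -[1+ n ] * (δ (-[1+ n ] ℤ.+ + suc k) * f m)
  aux with n ℕ.≟ k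
  ... | yes refl = trans (neg1 (ι (+ suc n)) (δ (+ suc n ℤ.+ -[1+ n ])) (f m)) (cong (_* (δ (+ suc n ℤ.+ -[1+ n ]) * f m)) (sym (ι-neg (+ suc n))))
  ... | no ne = trans (trans (neg1 (ι (+ suc k)) (δ (+ suc k ℤ.+ -[1+ n ])) (f m)) (sym (zero-rhs (- ι (+ suc k)) (f m) (δ-no (⊖≢0 (ne ∘ sym)))))) (zero-rhs (ι -[1+ n ]) (f m) (δ-no (⊖≢0 (ne ∘ sym))))
JJ -[1+ n ] -[1+ k ] f m r with n ℕ.≟ k
... | yes refl = trans (ℚ.+-inverseʳ (J -[1+ n ] (J -[1+ n ] f) m)) (zero-rhs (ι -[1+ n ]) (f m) refl)
... | no ne = trans (indep -[1+ n ] -[1+ k ] f m r (cong (λ z → nz z * ι (+ suc k)) (lk-dec-≢ m n k ne)) (cong (λ z → nz z * ι (+ suc n)) (lk-dec-≢ m k n (ne ∘ sym)))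
        (js-swap -[1+ n ] -[1+ k ] m n k ne (inj₂ refl) (inj₂ refl))) (zero-rhs (ι -[1+ n ]) (f m) refl)

-- Finite sums

Σ< : ℕ → (ℕ → ℚ) → ℚ
Σ< zero g = 0ℚ
Σ< (suc K) g = Σ< K g + g K

Σ<-cong : ∀ K {g h} → (∀ i → g i ≡ h i) → Σ< K g ≡ Σ< K h
Σ<-cong zero e = refl
Σ<-cong (suc K) e = cong₂ _+_ (Σ<-cong K e) (e K)

Σ<-lin : ∀ K c {g h f} → (∀ i → f i ≡ c * g i + h i) → Σ< K f ≡ c * Σ< K g + Σ< K h
Σ<-lin zero c e = sym (trans (ℚ.+-identityʳ (c * 0ℚ)) (ℚ.*-zeroʳ c))
Σ<-lin (suc K) c {g} {h} e = trans (cong₂ _+_ (Σ<-lin K c e) (e K)) (l c (Σ< K g) (Σ< K h) (g K) (h K))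
  where
  l : ∀ c x y x' y' → c * x + y + (c * x' + y') ≡ c * (x + x') + (y + y')
  l = solve-∀ ℚR

Σ<-Lin : ∀ K → Lin {ℕ} {ℕ} (λ g _ → Σ< K g)
Σ<-Lin K c e _ = Σ<-lin K c e

Σ<-zero : ∀ K {g} → (∀ i → g i ≡ 0ℚ) → Σ< K g ≡ 0ℚ
Σ<-zero K e = lin-zero (Σ<-Lin K) e 0

Σ<-stable : ∀ {B K g} → (∀ i → B ≤ i → g i ≡ 0ℚ) → B ≤ K → Σ< K g ≡ Σ< B g
Σ<-stable {B} {g = g} z b≤K = go (ℕ.≤⇒≤′ b≤K)
  where
  go : ∀ {K} → B ℕ.≤′ K → Σ< K g ≡ Σ< B g
  go (ℕ.≤′-reflexive refl) = refl
  go (ℕ.≤′-step p) = trans (cong₂ _+_ (go p) (z _ (ℕ.≤′⇒≤ p))) (ℚ.+-identityʳ _)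

Σ<-single : ∀ K j {g} → j < K → (∀ i → i ≢ j → g i ≡ 0ℚ) → Σ< K g ≡ g j
Σ<-single (suc K) j {g} j<K z with j ℕ.≟ K
... | yes refl = trans (cong (_+ g j) (below K ℕ.≤-refl)) (ℚ.+-identityˡ _)
  where
  below : ∀ L → L ≤ j → Σ< L g ≡ 0ℚ
  below zero _ = refl
  below (suc L) p = trans (cong₂ _+_ (below L (ℕ.<⇒≤ p)) (z L (ℕ.<⇒≢ p))) (ℚ.+-identityˡ _)
... | no ne = trans (cong₂ _+_ (Σ<-single K j (ℕ.≤∧≢⇒< (ℕ.≤-pred j<K) ne) z) (z K (ne ∘ sym))) (ℚ.+-identityʳ _)

-- Normal-ordered multiplication by the current

-- The weighted degree in which t_n has degree n; the offset `k` keeps track of the position in the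
-- list.
wt : ℕ → List ℕ → ℕ
wt k [] = 0
wt k (x ∷ xs) = x ℕ.* suc k ℕ.+ wt (suc k) xs

w : List ℕ → ℕ
w = wt 0

wt-dec : ∀ k m n {e} → lookupD m n ≡ suc e → wt k m ≡ suc (k ℕ.+ n) ℕ.+ wt k (decAt m n)
wt-dec k (suc x ∷ m) zero p = trans (ℕ.+-assoc (suc k) (x ℕ.* suc k) (wt (suc k) m)) (cong (λ z → suc z ℕ.+ (x ℕ.* suc k ℕ.+ wt (suc k) m)) (sym (ℕ.+-identityʳ k)))
wt-dec k (x ∷ m) (suc n) p = trans (cong (x ℕ.* suc k ℕ.+_) (wt-dec (suc k) m n p))
  (trans (l (x ℕ.* suc k) (suc (suc k ℕ.+ n)) (wt (suc k) (decAt m n))) (cong (λ z → suc z ℕ.+ (x ℕ.* suc k ℕ.+ wt (suc k) (decAt m n))) (sym (ℕ.+-suc k n))))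
  where
  l : ∀ a b c → a ℕ.+ (b ℕ.+ c) ≡ b ℕ.+ (a ℕ.+ c)
  l a b c = trans (sym (ℕ.+-assoc a b c)) (trans (cong (ℕ._+ c) (ℕ.+-comm a b)) (ℕ.+-assoc b a c))

w-dec : ∀ m n {e} → lookupD m n ≡ suc e → w m ≡ suc n ℕ.+ w (decAt m n)
w-dec = wt-dec 0

lk-bound : ∀ m n → w m ≤ n → lookupD m n ≡ 0
lk-bound m n p with lookupD m n in eq
... | zero = refl
... | suc e = ⊥-elim (ℕ.<⇒≱ (ℕ.≤-trans (s≤s (ℕ.m≤m+n n _)) (ℕ.≤-reflexive (sym (w-dec m n eq)))) p)

-- The index is the amount by which an operator raises the weighted degree, so `φ n` plays the role
-- of the mode of index -n.
Fam : Set
Fam = ℤ → Fn → Fn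

-- The part of degree `n` of :J φ:, cut off at `K`: creation modes stand to the left of `φ`,
-- annihilation modes to its right.
N : ℕ → Fam → Fam
N K φ n f m = Σ< K (λ i → J -[1+ i ] (φ (n ℤ.+ -[1+ i ]) f) m + φ (n ℤ.+ + suc i) (J (+ suc i) f) m)

bnd : ℤ → List ℕ → ℕ
bnd n m = w m ℕ.+ ℤ.∣ n ∣

-- For local families the sum defining N is locally finite, and 𝒩 is its value.
𝒩 : Fam → Fam
𝒩 φ n f m = N (bnd n m) φ n f m

-- An operator that raises the degree by `p` reaches no monomial of weight below `p`. This is what
-- makes the normally ordered sum finite at every coefficient.
Local : Fam → Set
Local φ = ∀ p f m → w m < p → φ (+ p) f m ≡ 0ℚ

record IsFam (φ : Fam) : Set where
  field
    lin  : ∀ n → Lin (φ n)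
    resp : ∀ n {f} → Resp f → Resp (φ n f)
open IsFam

N-congᴿ : ∀ K {φ ψ} n {f} m → Resp f → (∀ n {f} m → Resp f → φ n f m ≡ ψ n f m) → N K φ n f m ≡ N K ψ n f m
N-congᴿ K n {f} m r e = Σ<-cong K (λ i → cong₂ _+_ (cong (λ z → jc -[1+ i ] m * z) (e (n ℤ.+ -[1+ i ]) (js -[1+ i ] m) r)) (e (n ℤ.+ + suc i) m (J-resp (+ suc i) r)))

-- Families are uncurried so that `Lin`, which speaks of maps between function spaces, applies to
-- `N` as a map of families.
Idx : Set
Idx = ℤ × Fn × List ℕ

N-Lin : ∀ K → Lin {Idx} {Idx} (λ φ a → N K (λ n f m → φ (n , f , m)) (proj₁ a) (proj₁ (proj₂ a)) (proj₂ (proj₂ a)))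
N-Lin K c {s} {t} e (n , f , m) = Σ<-lin K c (λ i →
    trans (cong₂ _+_ (cong (λ z → jc -[1+ i ] m * z) (e (n ℤ.+ -[1+ i ] , f , js -[1+ i ] m))) (e (n ℤ.+ + suc i , J (+ suc i) f , m)))
      (l c (jc -[1+ i ] m) (s (n ℤ.+ -[1+ i ] , f , js -[1+ i ] m)) (t (n ℤ.+ -[1+ i ] , f , js -[1+ i ] m)) (s (n ℤ.+ + suc i , J (+ suc i) f , m)) (t (n ℤ.+ + suc i , J (+ suc i) f , m))))
  where
  l : ∀ c j x y x' y' → j * (c * x + y) + (c * x' + y') ≡ c * (j * x + x') + (j * y + y')
  l = solve-∀ ℚR

N-lin : ∀ K {φ} → (∀ n → Lin (φ n)) → ∀ n → Lin (N K φ n)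
N-lin K {φ} L n c {s} {t} e m = Σ<-lin K c (λ i →
    trans (cong₂ _+_ (J-lin -[1+ i ] c (L (n ℤ.+ -[1+ i ]) c e) m) (L (n ℤ.+ + suc i) c (J-lin (+ suc i) c e) m))
      (l c (J -[1+ i ] (φ (n ℤ.+ -[1+ i ]) s) m) (J -[1+ i ] (φ (n ℤ.+ -[1+ i ]) t) m) (φ (n ℤ.+ + suc i) (J (+ suc i) s) m) (φ (n ℤ.+ + suc i) (J (+ suc i) t) m)))
  where
  l : ∀ c x y x' y' → (c * x + y) + (c * x' + y') ≡ c * (x + x') + (y + y')
  l = solve-∀ ℚR

N-resp : ∀ K {φ} → IsFam φ → ∀ n {f} → Resp f → Resp (N K φ n f)
N-resp K I n r e = Σ<-cong K (λ i → cong₂ _+_ (J-resp -[1+ i ] (resp I (n ℤ.+ -[1+ i ]) r) e) (resp I (n ℤ.+ + suc i) (J-resp (+ suc i) r) e))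

shift⁺ : ∀ n i v → v ℕ.+ ℤ.∣ n ∣ ≤ i → Σ ℕ λ p → (n ℤ.+ + suc i ≡ + p) × v < p
shift⁺ (+ a) i v h = a ℕ.+ suc i , refl , ℕ.≤-trans (s≤s (ℕ.≤-trans (ℕ.m≤m+n v a) h)) (ℕ.m≤n+m (suc i) a)
shift⁺ -[1+ a ] i v h = suc i ℕ.∸ suc a , ℤ.⊖-≥ (ℕ.≤-trans (ℕ.m≤n+m (suc a) v) (ℕ.m≤n⇒m≤1+n h)) ,
  ℕ.m+n≤o⇒m≤o∸n (suc v) (subst (_≤ i) (ℕ.+-suc v a) h)

shift⁻ : ∀ p i → suc i ≤ p → + p ℤ.+ -[1+ i ] ≡ + (p ℕ.∸ suc i)
shift⁻ p i h = ℤ.⊖-≥ h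

J⁻-zero : ∀ i m f → lookupD m i ≡ 0 → J -[1+ i ] f m ≡ 0ℚ
J⁻-zero i m f e = trans (cong (λ z → nz z * ι (+ suc i) * f (decAt m i)) e) (l (ι (+ suc i)) (f (decAt m i)))
  where
  l : ∀ i x → 0ℚ * i * x ≡ 0ℚ
  l = solve-∀ ℚR

-- For `i` at least `bnd n m`, the monomial is too light to contain the variable supplied by the
-- creation mode, and in the other term `φ` raises the degree by more than the weight of `m`.
N-stable : ∀ φ → Local φ → ∀ n f m K → bnd n m ≤ K → N K φ n f m ≡ 𝒩 φ n f m
N-stable φ loc n f m K h = Σ<-stable term h
  where
  term : ∀ i → bnd n m ≤ i → J -[1+ i ] (φ (n ℤ.+ -[1+ i ]) f) m + φ (n ℤ.+ + suc i) (J (+ suc i) f) m ≡ 0ℚ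
  term i b with shift⁺ n i (w m) b
  ... | p , e , lt = trans (cong₂ _+_ (J⁻-zero i m (φ (n ℤ.+ -[1+ i ]) f) (lk-bound m i (ℕ.≤-trans (ℕ.m≤m+n (w m) _) b)))
      (trans (cong (λ z → φ z (J (+ suc i) f) m) e) (loc p (J (+ suc i) f) m lt))) (ℚ.+-identityʳ 0ℚ)

J⁻-φ-zero : ∀ {φ} → Local φ → ∀ p f m i → w m < p → J -[1+ i ] (φ (+ p ℤ.+ -[1+ i ]) f) m ≡ 0ℚ
J⁻-φ-zero {φ} loc p f m i lt with lookupD m i in eq
... | zero = trans (cong (_* φ (+ p ℤ.+ -[1+ i ]) f (decAt m i)) (ℚ.*-zeroˡ (ι (+ suc i)))) (ℚ.*-zeroˡ (φ (+ p ℤ.+ -[1+ i ]) f (decAt m i)))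
... | suc e = trans (cong (λ z → 1ℚ * ι (+ suc i) * z) (trans (cong (λ z → φ z f (decAt m i)) (shift⁻ p i i<p)) (loc (p ℕ.∸ suc i) f (decAt m i) lt'))) (ℚ.*-zeroʳ (1ℚ * ι (+ suc i)))
  where
  wm = w-dec m i eq
  i<p : suc i ≤ p
  i<p = ℕ.<⇒≤ (ℕ.≤-<-trans (ℕ.≤-trans (ℕ.m≤m+n (suc i) _) (ℕ.≤-reflexive (sym wm))) lt)
  lt' : w (decAt m i) < p ℕ.∸ suc i
  lt' = ℕ.m+n≤o⇒m≤o∸n (suc (w (decAt m i))) (subst (_≤ p) (cong suc (trans wm (ℕ.+-comm (suc i) (w (decAt m i))))) lt)

𝒩-local : ∀ {φ} → Local φ → Local (𝒩 φ)
𝒩-local {φ} loc p f m lt = Σ<-zero (bnd (+ p) m) (λ i → trans (cong₂ _+_ (J⁻-φ-zero {φ} loc p f m i lt)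
   (loc (p ℕ.+ suc i) (J (+ suc i) f) m (ℕ.≤-trans lt (ℕ.m≤m+n p (suc i))))) (ℚ.+-identityʳ 0ℚ))

𝒩-isFam : ∀ {φ} → Local φ → IsFam φ → IsFam (𝒩 φ)
𝒩-isFam {φ} loc I .lin n c e m = N-lin (bnd n m) (lin I) n c e m
𝒩-isFam {φ} loc I .resp n {f} r {xs} {ys} e =
  trans (sym (N-stable φ loc n f xs K (ℕ.m≤m+n (bnd n xs) (bnd n ys)))) (trans (N-resp K I n r e) (N-stable φ loc n f ys K (ℕ.m≤n+m (bnd n ys) (bnd n xs))))
  where
  K = bnd n xs ℕ.+ bnd n ys

N-shift : ∀ K φ b n f m → N K (λ n → φ (n ℤ.- b)) n f m ≡ N K φ (n ℤ.- b) f m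
N-shift K φ b n f m = Σ<-cong K (λ i → cong₂ _+_ (cong (λ z → jc -[1+ i ] m * φ z f (js -[1+ i ] m)) (l n -[1+ i ] (ℤ.- b))) (cong (λ z → φ z (J (+ suc i) f) m) (l n (+ suc i) (ℤ.- b))))
  where
  l : ∀ a b c → a ℤ.+ b ℤ.+ c ≡ a ℤ.+ c ℤ.+ b
  l a b c = trans (ℤ.+-assoc a b c) (trans (cong (λ z → a ℤ.+ z) (ℤ.+-comm b c)) (sym (ℤ.+-assoc a c b)))

comm : ℤ → Fam → Fam
comm b φ n f m = J b (φ n f) m - φ n (J b f) m

-- Leibniz rule: `J b` passes either a mode of the current, where `JJ` leaves a scalar, or `φ`. For
-- `b` different from 0 the scalars form a sum with one nonzero term, at position `∣ b ∣` minus one;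
-- hence the lower bound on `K`.
N-comm : ∀ K {φ} → IsFam φ → ∀ b n {f} m → Resp f → ℤ.∣ b ∣ ≤ K →
  J b (N K φ n f) m - N K φ n (J b f) m ≡ ι b * φ (n ℤ.- b) f m + N K (comm b φ) n f m
N-comm K {φ} I b n {f} m r b≤K = begin
  J b (N K φ n f) m - N K φ n (J b f) m ≡⟨ cong (_- N K φ n (J b f) m) jsum ⟩
  Σ< K (λ i → J b (t i) m) - Σ< K t' ≡⟨ sym (lin-- (Σ<-Lin K) (λ _ → refl) 0) ⟩
  Σ< K (λ i → J b (t i) m - t' i) ≡⟨ Σ<-cong K step ⟩
  Σ< K (λ i → s i + (J -[1+ i ] (comm b φ (n ℤ.+ -[1+ i ]) f) m + comm b φ (n ℤ.+ + suc i) (J (+ suc i) f) m)) ≡⟨ lin-+ (Σ<-Lin K) (λ _ → refl) 0 ⟩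
  Σ< K s + N K (comm b φ) n f m ≡⟨ cong (_+ N K (comm b φ) n f m) (sel b b≤K) ⟩
  ι b * φ (n ℤ.- b) f m + N K (comm b φ) n f m ∎
  where
  open ≡-Reasoning
  t : ℕ → Fn
  t i m = J -[1+ i ] (φ (n ℤ.+ -[1+ i ]) f) m + φ (n ℤ.+ + suc i) (J (+ suc i) f) m
  t' : ℕ → ℚ
  t' i = J -[1+ i ] (φ (n ℤ.+ -[1+ i ]) (J b f)) m + φ (n ℤ.+ + suc i) (J (+ suc i) (J b f)) m
  s : ℕ → ℚ
  s i = ι b * (δ (b ℤ.+ -[1+ i ]) * φ (n ℤ.+ -[1+ i ]) f m) + ι b * (δ (b ℤ.+ + suc i) * φ (n ℤ.+ + suc i) f m)
  jsum : J b (N K φ n f) m ≡ Σ< K (λ i → J b (t i) m)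
  jsum = sym (lin-* (Σ<-Lin K) (jc b m) (λ _ → refl) 0)
  step : ∀ i → J b (t i) m - t' i ≡ s i + (J -[1+ i ] (comm b φ (n ℤ.+ -[1+ i ]) f) m + comm b φ (n ℤ.+ + suc i) (J (+ suc i) f) m)
  step i = begin
    J b (t i) m - t' i
      ≡⟨ cong (_- t' i) (lin-+ (J-lin b) {J -[1+ i ] (φ (n ℤ.+ -[1+ i ]) f)} {φ (n ℤ.+ + suc i) (J (+ suc i) f)} (λ _ → refl) m) ⟩
    a + d - (e + g)
      ≡⟨ l a a' d e g y ⟩
    (a - a') + (y - g) + (a' - e + (d - y))
      ≡⟨ cong₂ _+_ (cong₂ _+_ (JJ b -[1+ i ] (φ (n ℤ.+ -[1+ i ]) f) m (resp I _ r)) yg) (cong (_+ (d - y)) (sym (lin-- (J-lin -[1+ i ]) {J b (φ (n ℤ.+ -[1+ i ]) f)} {φ (n ℤ.+ -[1+ i ]) (J b f)} (λ _ → refl) m))) ⟩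
    s i + (J -[1+ i ] (comm b φ (n ℤ.+ -[1+ i ]) f) m + comm b φ (n ℤ.+ + suc i) (J (+ suc i) f) m) ∎
    where
    a = J b (J -[1+ i ] (φ (n ℤ.+ -[1+ i ]) f)) m
    a' = J -[1+ i ] (J b (φ (n ℤ.+ -[1+ i ]) f)) m
    d = J b (φ (n ℤ.+ + suc i) (J (+ suc i) f)) m
    e = J -[1+ i ] (φ (n ℤ.+ -[1+ i ]) (J b f)) m
    g = φ (n ℤ.+ + suc i) (J (+ suc i) (J b f)) m
    y = φ (n ℤ.+ + suc i) (J b (J (+ suc i) f)) m
    yg : y - g ≡ ι b * (δ (b ℤ.+ + suc i) * φ (n ℤ.+ + suc i) f m)
    yg = trans (sym (lin-- (lin I (n ℤ.+ + suc i)) (λ _ → refl) m))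
      (trans (lin-* (lin I (n ℤ.+ + suc i)) (ι b * δ (b ℤ.+ + suc i)) (λ m → trans (JJ b (+ suc i) f m r) (sym (ℚ.*-assoc (ι b) (δ (b ℤ.+ + suc i)) (f m)))) m) (ℚ.*-assoc (ι b) (δ (b ℤ.+ + suc i)) _))
    l : ∀ a a' d e g y → a + d - (e + g) ≡ (a - a') + (y - g) + (a' - e + (d - y))
    l = solve-∀ ℚR
  φ⁻ φ⁺ : ℕ → ℚ
  φ⁻ i = φ (n ℤ.+ -[1+ i ]) f m
  φ⁺ i = φ (n ℤ.+ + suc i) f m
  z0 : ∀ i x y {p q} → p ≡ 0ℚ → q ≡ 0ℚ → i * (p * x) + i * (q * y) ≡ 0ℚ
  z0 i x y refl refl = l i x y
    where
    l : ∀ i x y → i * (0ℚ * x) + i * (0ℚ * y) ≡ 0ℚ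
    l = solve-∀ ℚR
  z1 : ∀ i x y {p q} → p ≡ 1ℚ → q ≡ 0ℚ → i * (p * x) + i * (q * y) ≡ i * x
  z1 i x y refl refl = l i x y
    where
    l : ∀ i x y → i * (1ℚ * x) + i * (0ℚ * y) ≡ i * x
    l = solve-∀ ℚR
  z2 : ∀ i x y {p q} → p ≡ 0ℚ → q ≡ 1ℚ → i * (p * x) + i * (q * y) ≡ i * y
  z2 i x y refl refl = l i x y
    where
    l : ∀ i x y → i * (0ℚ * x) + i * (1ℚ * y) ≡ i * y
    l = solve-∀ ℚR
  sel : ∀ b → ℤ.∣ b ∣ ≤ K → Σ< K (λ i → ι b * (δ (b ℤ.+ -[1+ i ]) * φ (n ℤ.+ -[1+ i ]) f m) + ι b * (δ (b ℤ.+ + suc i) * φ (n ℤ.+ + suc i) f m)) ≡ ι b * φ (n ℤ.- b) f m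
  sel (+ zero) _ = trans (Σ<-zero K (λ i → z0 (ι (+ 0)) (φ⁻ i) (φ⁺ i) refl refl)) (sym (trans (cong (_* φ (n ℤ.- + 0) f m) ι0) (ℚ.*-zeroˡ (φ (n ℤ.- + 0) f m))))
  sel (+ suc j) lt = trans (Σ<-single K j lt (λ i ne → z0 (ι (+ suc j)) (φ⁻ i) (φ⁺ i) (δ-no (⊖≢0 (ne ∘ sym))) refl))
    (z1 (ι (+ suc j)) (φ⁻ j) (φ⁺ j) (δ-yes (ℤ.n⊖n≡0 (suc j))) refl)
  sel -[1+ j ] lt = trans (Σ<-single K j lt (λ i ne → z0 (ι -[1+ j ]) (φ⁻ i) (φ⁺ i) refl (δ-no (λ e → ⊖≢0 ne (trans (ℤ.+-comm (+ suc i) -[1+ j ]) e)))))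
    (z2 (ι -[1+ j ]) (φ⁻ j) (φ⁺ j) refl (δ-yes (ℤ.n⊖n≡0 (suc j))))

-- X k n = P^{(k)}_{-n}, from P^{(k+1)} = ∂_z P^{(k)} + :J P^{(k)}: with P^{(0)} = 1.
X : ℕ → Fam
X zero n f m = δ n * f m
X (suc k) n f m = ι (n ℤ.- + k) * X k n f m + 𝒩 (X k) n f m

X-local : ∀ k → Local (X k)
X-local zero (suc p) f m lt = ℚ.*-zeroˡ (f m)
X-local (suc k) p f m lt = trans (cong₂ (λ a b → ι (+ p ℤ.- + k) * a + b) (X-local k p f m lt) (𝒩-local {X k} (X-local k) p f m lt)) (l (ι (+ p ℤ.- + k)))
  where
  l : ∀ i → i * 0ℚ + 0ℚ ≡ 0ℚ
  l = solve-∀ ℚR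

X-isFam : ∀ k → IsFam (X k)
X-isFam zero .lin n c {s} {t} e m = trans (cong (δ n *_) (e m)) (l c (δ n) (s m) (t m))
  where
  l : ∀ c d x y → d * (c * x + y) ≡ c * (d * x) + d * y
  l = solve-∀ ℚR
X-isFam zero .resp n r e = cong (δ n *_) (r e)
X-isFam (suc k) .lin n c {s} {t} e m = trans (cong₂ (λ a b → ι (n ℤ.- + k) * a + b) (lin (X-isFam k) n c e m) (lin (𝒩-isFam {X k} (X-local k) (X-isFam k)) n c e m))
    (l c (ι (n ℤ.- + k)) (X k n s m) (X k n t m) (𝒩 (X k) n s m) (𝒩 (X k) n t m))
  where
  l : ∀ c i x y x' y' → i * (c * x + y) + (c * x' + y') ≡ c * (i * x + x') + (i * y + y')
  l = solve-∀ ℚR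
X-isFam (suc k) .resp n r e = cong₂ (λ a b → ι (n ℤ.- + k) * a + b) (resp (X-isFam k) n r e) (resp (𝒩-isFam {X k} (X-local k) (X-isFam k)) n r e)

ι-- : ∀ a b → ι (a ℤ.- b) ≡ ι a - ι b
ι-- a b = trans (ι-+ a (ℤ.- b)) (cong (λ z → ι a + z) (ι-neg b))

-- For the vertex operator V this is q ∂V/∂q = z ∂V/∂z + :z J(z) V:, where both sides equal :qz
-- J(qz) V:.
X-θ : ∀ n f m k → θ (λ j → X j n f m) k ≡ ι n * X k n f m + 𝒩 (X k) n f m
X-θ n f m k = trans (cong (λ i → i * X k n f m + 𝒩 (X k) n f m + ι (+ k) * X k n f m) (ι-- n (+ k))) (l (ι n) (ι (+ k)) (X k n f m) (𝒩 (X k) n f m))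
  where
  l : ∀ n k x y → (n - k) * x + y + k * x ≡ n * x + y
  l = solve-∀ ℚR

Sᶻ-0 : ∀ b s → Sᶻ b s 0 ≡ s 0
Sᶻ-0 b s = Sᶻ-ind (λ b → Sᶻ b s 0 ≡ s 0) refl (λ b e → trans (Sᶻ-suc b s 0) (trans (ℚ.+-identityʳ _) e)) (λ b e → trans (Sᶻ-pred b s 0) e) b

-- By induction on `k`. In the recursion for `X`, the Leibniz rule contributes `ι b` from the outer
-- current, and this is exactly the failure of θ to commute with q^b, by `θ-Sᶻ`.
X-comm : ∀ k b n {f} m → Resp f → J b (X k n f) m - X k n (J b f) m ≡ Sᶻ b (λ j → X j (n ℤ.- b) f m) k - X k (n ℤ.- b) f m
X-comm zero b n {f} m r = trans (l (jc b m) (δ n) (f (js b m)) ) (trans (sym (ℚ.+-inverseʳ (X 0 (n ℤ.- b) f m))) (cong (_- X 0 (n ℤ.- b) f m) (sym (Sᶻ-0 b (λ j → X j (n ℤ.- b) f m)))))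
  where
  l : ∀ j d x → j * (d * x) - d * (j * x) ≡ 0ℚ
  l = solve-∀ ℚR
X-comm (suc k) b n {f} m r = begin
  J b (X (suc k) n f) m - X (suc k) n (J b f) m
    ≡⟨ cong₂ (λ p q → jc b m * (i * X k n f (js b m) + p) - (i * X k n (J b f) m + q)) (sym (N-stable (X k) (X-local k) n f (js b m) K K≥1)) (sym (N-stable (X k) (X-local k) n (J b f) m K K≥2)) ⟩
  jc b m * (i * X k n f (js b m) + N K (X k) n f (js b m)) - (i * X k n (J b f) m + N K (X k) n (J b f) m)
    ≡⟨ l1 (jc b m) i (X k n f (js b m)) (N K (X k) n f (js b m)) (X k n (J b f) m) (N K (X k) n (J b f) m) ⟩
  i * comm b (X k) n f m + (J b (N K (X k) n f) m - N K (X k) n (J b f) m)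
    ≡⟨ cong₂ (λ p q → i * p + q) (X-comm k b n m r) (trans (N-comm K (X-isFam k) b n m r K≥3) (cong (λ z → ι b * x k + z) nk)) ⟩
  i * (y k - x k) + (ι b * x k + ((Sᶻ b (θ x) k - ι (n ℤ.- b) * y k) - (θ x k - ι (n ℤ.- b) * x k)))
    ≡⟨ cong₂ (λ p q → p * (y k - x k) + (ι b * x k + ((Sᶻ b (θ x) k - q * y k) - (θ x k - q * x k)))) (ι-- n (+ k)) (ι-- n b) ⟩
  (ι n - ι (+ k)) * (y k - x k) + (ι b * x k + ((Sᶻ b (θ x) k - (ι n - ι b) * y k) - (x (suc k) + ι (+ k) * x k - (ι n - ι b) * x k)))
    ≡⟨ l2 (ι n) (ι (+ k)) (ι b) (x k) (y k) (x (suc k)) (Sᶻ b (θ x) k) ⟩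
  Sᶻ b (θ x) k + ι b * y k - ι (+ k) * y k - x (suc k)
    ≡⟨ cong (λ z → z - ι (+ k) * y k - x (suc k)) (sym (θ-Sᶻ b x k)) ⟩
  y (suc k) + ι (+ k) * y k - ι (+ k) * y k - x (suc k)
    ≡⟨ l3 (y (suc k)) (ι (+ k) * y k) (x (suc k)) ⟩
  y (suc k) - x (suc k) ∎
  where
  open ≡-Reasoning
  i = ι (n ℤ.- + k)
  x : Seq
  x j = X j (n ℤ.- b) f m
  y = Sᶻ b x
  -- One cut-off above the bounds of the three sums involved and above `∣ b ∣`, as `N-comm` demands.
  K = bnd n (js b m) ℕ.+ (bnd n m ℕ.+ (ℤ.∣ b ∣ ℕ.+ bnd (n ℤ.- b) m))
  K≥1 : bnd n (js b m) ≤ K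
  K≥1 = ℕ.m≤m+n (bnd n (js b m)) _
  K≥2 : bnd n m ≤ K
  K≥2 = ℕ.≤-trans (ℕ.m≤m+n (bnd n m) (ℤ.∣ b ∣ ℕ.+ bnd (n ℤ.- b) m)) (ℕ.m≤n+m _ (bnd n (js b m)))
  K≥34 : ℤ.∣ b ∣ ℕ.+ bnd (n ℤ.- b) m ≤ K
  K≥34 = ℕ.≤-trans (ℕ.m≤n+m (ℤ.∣ b ∣ ℕ.+ bnd (n ℤ.- b) m) (bnd n m)) (ℕ.m≤n+m _ (bnd n (js b m)))
  K≥3 : ℤ.∣ b ∣ ≤ K
  K≥3 = ℕ.≤-trans (ℕ.m≤m+n ℤ.∣ b ∣ (bnd (n ℤ.- b) m)) K≥34
  K≥4 : bnd (n ℤ.- b) m ≤ K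
  K≥4 = ℕ.≤-trans (ℕ.m≤n+m (bnd (n ℤ.- b) m) ℤ.∣ b ∣) K≥34
  nj : ∀ j → N K (λ n → X j (n ℤ.- b)) n f m ≡ θ x j - ι (n ℤ.- b) * x j
  nj j = trans (N-shift K (X j) b n f m) (trans (N-stable (X j) (X-local j) (n ℤ.- b) f m K K≥4)
    (trans (l (ι (n ℤ.- b) * x j) (𝒩 (X j) (n ℤ.- b) f m)) (cong (_- ι (n ℤ.- b) * x j) (sym (X-θ (n ℤ.- b) f m j)))))
    where
    l : ∀ a b → b ≡ a + b - a
    l = solve-∀ ℚR
  nk : N K (comm b (X k)) n f m ≡ (Sᶻ b (θ x) k - ι (n ℤ.- b) * y k) - (θ x k - ι (n ℤ.- b) * x k)
  nk = trans (N-congᴿ K {comm b (X k)} {λ n f m → Sᶻ b (λ j → X j (n ℤ.- b) f m) k - X k (n ℤ.- b) f m} n m r (λ n m r → X-comm k b n m r))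
    (trans (lin-- (N-Lin K) {s = λ { (n , f , m) → Sᶻ b (λ j → X j (n ℤ.- b) f m) k }} {t = λ { (n , f , m) → X k (n ℤ.- b) f m }} (λ _ → refl) (n , f , m))
    (cong₂ _-_ (trans (Sᶻ-nat b (N-Lin K) (λ { j (n , f , m) → X j (n ℤ.- b) f m }) (n , f , m) k)
       (trans (lin-cong (Sᶻ-lin b) nj k) (trans (lin-- (Sᶻ-lin b) (λ _ → refl) k) (cong (λ z → Sᶻ b (θ x) k - z) (lin-* (Sᶻ-lin b) (ι (n ℤ.- b)) (λ _ → refl) k)))))
      (nj k)))
  l1 : ∀ c i a b d e → c * (i * a + b) - (i * d + e) ≡ i * (c * a - d) + (c * b - e)
  l1 = solve-∀ ℚR
  l2 : ∀ n k b x y x' z → (n - k) * (y - x) + (b * x + ((z - (n - b) * y) - (x' + k * x - (n - b) * x))) ≡ z + b * y - k * y - x'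
  l2 = solve-∀ ℚR
  l3 : ∀ a b c → a + b - b - c ≡ a - c
  l3 = solve-∀ ℚR

-- Vacuum expectations

vac : Fn
vac [] = 1ℚ
vac (zero ∷ m) = vac m
vac (suc _ ∷ m) = 0ℚ

vac-zero : ∀ m → (∀ n → lookupD m n ≡ 0) → vac m ≡ 1ℚ
vac-zero [] z = refl
vac-zero (zero ∷ m) z = vac-zero m (z ∘ suc)
vac-zero (suc x ∷ m) z = case z 0 of λ ()

vac-pos : ∀ m n {e} → lookupD m n ≡ suc e → vac m ≡ 0ℚ
vac-pos (zero ∷ m) (suc n) p = vac-pos m n p
vac-pos (suc x ∷ m) n p = refl

support : ∀ m → (∀ n → lookupD m n ≡ 0) ⊎ (Σ ℕ λ n → Σ ℕ λ e → lookupD m n ≡ suc e)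
support [] = inj₁ (λ n → refl)
support (suc x ∷ m) = inj₂ (0 , x , refl)
support (zero ∷ m) with support m
... | inj₁ z = inj₁ (λ { zero → refl ; (suc n) → z n })
... | inj₂ (n , e , p) = inj₂ (suc n , e , p)

vac-resp : Resp vac
vac-resp {xs} {ys} e with support xs
... | inj₁ z = trans (vac-zero xs z) (sym (vac-zero ys (λ n → trans (sym (~e e n)) (z n))))
... | inj₂ (n , k , p) = trans (vac-pos xs n p) (sym (vac-pos ys n (trans (sym (~e e n)) p)))

J⁺-vac : ∀ p m → J (+ p) vac m ≡ 0ℚ
J⁺-vac zero m = ℚ.*-zeroˡ (vac m)
J⁺-vac (suc n) m = trans (cong (λ z → jc (+ suc n) m * z) (vac-pos (incAt m n) n (lk-inc-≡ m n))) (ℚ.*-zeroʳ (jc (+ suc n) m))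

J⁻-[] : ∀ i f → J -[1+ i ] f [] ≡ 0ℚ
J⁻-[] i f = J⁻-zero i [] f refl

-- Polynomials in t, presented as what the creation modes generate from the constant 1, because the
-- uniqueness argument removes these modes one at a time. The pointwise equation in `lin-pol` closes
-- the class under pointwise equality.
data Pol : Fn → Set where
  vac-pol : Pol vac
  J-pol   : ∀ a {f} → Pol f → Pol (J -[1+ a ] f)
  lin-pol : ∀ c {f g h} → Pol f → Pol g → (∀ m → h m ≡ c * f m + g m) → Pol h

Pol-resp : ∀ {f} → Pol f → Resp f
Pol-resp vac-pol = vac-resp
Pol-resp (J-pol a p) = J-resp -[1+ a ] (Pol-resp p)
Pol-resp (lin-pol c p q e) {xs} {ys} r = trans (e xs) (trans (cong₂ (λ x y → c * x + y) (Pol-resp p r) (Pol-resp q r)) (sym (e ys)))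

0-pol : ∀ {f h} → Pol f → (∀ m → h m ≡ 0ℚ) → Pol h
0-pol {f} p z = lin-pol (- 1ℚ) p p (λ m → trans (z m) (l (f m)))
  where
  l : ∀ x → 0ℚ ≡ (- 1ℚ) * x + x
  l = solve-∀ ℚR

-- Annihilation modes are pushed to the right through the creation modes by `JJ` until they reach
-- the vacuum, which they kill.
J-Pol : ∀ b {f} → Pol f → Pol (J b f)
J-Pol -[1+ a ] p = J-pol a p
J-Pol (+ n) vac-pol = 0-pol vac-pol (J⁺-vac n)
J-Pol (+ n) (lin-pol c p q e) = lin-pol c (J-Pol (+ n) p) (J-Pol (+ n) q) (J-lin (+ n) c e)
J-Pol (+ n) (J-pol a {f} p) = lin-pol (ι (+ n) * δ (+ n ℤ.+ -[1+ a ])) p (J-pol a (J-Pol (+ n) p))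
  (λ m → trans (l (J (+ n) (J -[1+ a ] f) m) (J -[1+ a ] (J (+ n) f) m)) (cong (_+ J -[1+ a ] (J (+ n) f) m)
    (trans (JJ (+ n) -[1+ a ] f m (Pol-resp p)) (sym (ℚ.*-assoc (ι (+ n)) (δ (+ n ℤ.+ -[1+ a ])) (f m))))))
  where
  l : ∀ x y → x ≡ x - y + y
  l = solve-∀ ℚR

Σ-pol : ∀ K {g : ℕ → Fn} → (∀ i → Pol (g i)) → Pol (λ m → Σ< K (λ i → g i m))
Σ-pol zero p = 0-pol vac-pol (λ _ → refl)
Σ-pol (suc K) {g} p = lin-pol 1ℚ (Σ-pol K p) (p K) (λ m → cong (_+ g K m) (sym (ℚ.*-identityˡ (Σ< K (λ i → g i m)))))

-- A family with the commutation relations of a vertex operator is determined by its vacuum expectations: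
-- positive modes strip variables off the coefficient, negative modes strip factors off the argument.
module _ (M : ℕ → Fam) (M-fam : ∀ k → IsFam (M k))
  (M-comm : ∀ k b n {f} m → b ≢ + 0 → Pol f → comm b (M k) n f m ≡ Sᶻ b (λ j → M j (n ℤ.- b) f m) k - M k (n ℤ.- b) f m)
  (M-vac : ∀ k n → M k n vac [] ≡ 0ℚ) where

  private
    vanish : ∀ b {s : Seq} → (∀ k → s k ≡ 0ℚ) → ∀ k → Sᶻ b s k - s k ≡ 0ℚ
    vanish b z k = trans (cong₂ _-_ (lin-zero (Sᶻ-lin b) z k) (z k)) (ℚ.+-inverseʳ 0ℚ)

    at-[] : ∀ {f} → Pol f → ∀ k n → M k n f [] ≡ 0ℚ
    at-[] vac-pol k n = M-vac k n
    at-[] (J-pol a {f} p) k n = begin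
      M k n (J -[1+ a ] f) []                                          ≡⟨ l (J -[1+ a ] (M k n f) []) _ ⟩
      J -[1+ a ] (M k n f) [] - comm -[1+ a ] (M k) n f []             ≡⟨ cong₂ _-_ (J⁻-[] a (M k n f)) (trans (M-comm k -[1+ a ] n [] (λ ()) p) (vanish -[1+ a ] (λ j → at-[] p j (n ℤ.- -[1+ a ])) k)) ⟩
      0ℚ - 0ℚ                                                          ≡⟨ ℚ.+-inverseʳ 0ℚ ⟩
      0ℚ ∎
      where
      open ≡-Reasoning
      l : ∀ x y → y ≡ x - (x - y)
      l = solve-∀ ℚR
    at-[] (lin-pol c {f} {g} p q e) k n = trans (lin (M-fam k) n c e []) (trans (cong₂ (λ x y → c * x + y) (at-[] p k n) (at-[] q k n)) (trans (ℚ.+-identityʳ (c * 0ℚ)) (ℚ.*-zeroʳ c)))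

    go : ∀ W m → w m ≤ W → ∀ {f} → Pol f → ∀ k n → M k n f m ≡ 0ℚ
    go W m h {f} p k n with support m
    ... | inj₁ z = trans (resp (M-fam k) n (Pol-resp p) (~i z)) (at-[] p k n)
    go zero m h p k n | inj₂ (i , e , q) = case ℕ.≤-trans (ℕ.≤-reflexive (sym (w-dec m i q))) h of λ ()
    -- The annihilation mode recovers the coefficient at `m` only up to the exponent of the
    -- variable, which is written as a successor so that it can be cancelled.
    go (suc W) m h {f} p k n | inj₂ (i , e , q) = ι-suc-cancel₀ (lookupD (decAt m i) i) (begin
      ι (+ suc (lookupD (decAt m i) i)) * M k n f m
        ≡⟨ cong (λ z → ι (+ suc (lookupD (decAt m i) i)) * z) (resp (M-fam k) n (Pol-resp p) (~i (λ j → sym (~e (inc-dec m i q) j)))) ⟩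
      J (+ suc i) (M k n f) (decAt m i)
        ≡⟨ l (J (+ suc i) (M k n f) (decAt m i)) (M k n (J (+ suc i) f) (decAt m i)) ⟩
      M k n (J (+ suc i) f) (decAt m i) + comm (+ suc i) (M k) n f (decAt m i)
        ≡⟨ cong₂ _+_ (go W (decAt m i) h' (J-Pol (+ suc i) p) k n) (trans (M-comm k (+ suc i) n (decAt m i) (λ ()) p) (vanish (+ suc i) (λ j → go W (decAt m i) h' p j (n ℤ.- + suc i)) k)) ⟩
      0ℚ + 0ℚ
        ≡⟨ ℚ.+-identityʳ 0ℚ ⟩
      0ℚ ∎)
      where
      open ≡-Reasoning
      h' : w (decAt m i) ≤ W
      h' = ℕ.≤-pred (ℕ.≤-trans (s≤s (ℕ.m≤n+m (w (decAt m i)) i)) (ℕ.≤-trans (ℕ.≤-reflexive (sym (w-dec m i q))) h))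
      l : ∀ x y → x ≡ y + (x - y)
      l = solve-∀ ℚR

  uniqueness : ∀ {f} → Pol f → ∀ k n m → M k n f m ≡ 0ℚ
  uniqueness p k n m = go (w m) m ℕ.≤-refl p k n

-- Virasoro and cut-and-join operators

Jm : Fam
Jm n = J (ℤ.- n)

Jm-local : Local Jm
Jm-local (suc p) f m lt = J⁻-zero p m f (lk-bound m p (ℕ.≤-pred lt))

Jm-isFam : IsFam Jm
Jm-isFam .lin n = J-lin (ℤ.- n)
Jm-isFam .resp n = J-resp (ℤ.- n)

-- Λ n = 2 L_{-n} (Virasoro) and T = 2 C, with C the cut-and-join operator.
Λ : Fam
Λ = 𝒩 Jm

Λ-local : Local Λ
Λ-local = 𝒩-local {Jm} Jm-local

Λ-isFam : IsFam Λ
Λ-isFam = 𝒩-isFam {Jm} Jm-local Jm-isFam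

⅓ : ℚ
⅓ = recip 2

T : Fn → Fn
T f m = ⅓ * 𝒩 Λ (+ 0) f m

T-lin : Lin T
T-lin c {s} {t} e m = trans (cong (⅓ *_) (lin (𝒩-isFam {Λ} Λ-local Λ-isFam) (+ 0) c e m)) (l ⅓ c (𝒩 Λ (+ 0) s m) (𝒩 Λ (+ 0) t m))
  where
  l : ∀ r c x y → r * (c * x + y) ≡ c * (r * x) + r * y
  l = solve-∀ ℚR

T-resp : ∀ {f} → Resp f → Resp (T f)
T-resp r e = cong (⅓ *_) (resp (𝒩-isFam {Λ} Λ-local Λ-isFam) (+ 0) r e)

-- The two deltas pick the single creation or annihilation mode of index `c`; for `c` = 0 they pick
-- nothing, in accordance with J_0 = 0.
Nδ : ∀ K c f m → ℤ.∣ c ∣ ≤ K → Σ< K (λ i → δ (c ℤ.+ + suc i) * J -[1+ i ] f m + δ (c ℤ.+ -[1+ i ]) * J (+ suc i) f m) ≡ J c f m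
Nδ K c f m h = sel c h
  where
  z0 : ∀ x y {p q} → p ≡ 0ℚ → q ≡ 0ℚ → p * x + q * y ≡ 0ℚ
  z0 x y refl refl = l x y
    where
    l : ∀ x y → 0ℚ * x + 0ℚ * y ≡ 0ℚ
    l = solve-∀ ℚR
  z1 : ∀ x y {p q} → p ≡ 1ℚ → q ≡ 0ℚ → p * x + q * y ≡ x
  z1 x y refl refl = l x y
    where
    l : ∀ x y → 1ℚ * x + 0ℚ * y ≡ x
    l = solve-∀ ℚR
  z2 : ∀ x y {p q} → p ≡ 0ℚ → q ≡ 1ℚ → p * x + q * y ≡ y
  z2 x y refl refl = l x y
    where
    l : ∀ x y → 0ℚ * x + 1ℚ * y ≡ y
    l = solve-∀ ℚR
  j⁻ j⁺ : ℕ → ℚ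
  j⁻ i = J -[1+ i ] f m
  j⁺ i = J (+ suc i) f m
  sel : ∀ c → ℤ.∣ c ∣ ≤ K → Σ< K (λ i → δ (c ℤ.+ + suc i) * J -[1+ i ] f m + δ (c ℤ.+ -[1+ i ]) * J (+ suc i) f m) ≡ J c f m
  sel (+ zero) _ = trans (Σ<-zero K (λ i → z0 (j⁻ i) (j⁺ i) refl refl)) (sym (ℚ.*-zeroˡ (f m)))
  sel (+ suc j) lt = trans (Σ<-single K j lt (λ i ne → z0 (j⁻ i) (j⁺ i) refl (δ-no (⊖≢0 (ne ∘ sym))))) (z2 (j⁻ j) (j⁺ j) refl (δ-yes (ℤ.n⊖n≡0 (suc j))))
  sel -[1+ j ] lt = trans (Σ<-single K j lt (λ i ne → z0 (j⁻ i) (j⁺ i) (δ-no (λ e → ⊖≢0 ne (trans (ℤ.+-comm (+ suc i) -[1+ j ]) e))) refl)) (z1 (j⁻ j) (j⁺ j) (δ-yes (ℤ.n⊖n≡0 (suc j))) refl)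

-‿shift : ∀ b n i → b ℤ.+ ℤ.- (n ℤ.+ i) ≡ (b ℤ.- n) ℤ.+ ℤ.- i
-‿shift b n i = trans (cong (λ z → b ℤ.+ z) (ℤ.neg-distrib-+ n i)) (sym (ℤ.+-assoc b (ℤ.- n) (ℤ.- i)))

module _ (b n : ℤ) (m : List ℕ) where
  -- A common cut-off for the sums in commutators with `J b`; the last summand serves `Nδ`.
  Kb : ℕ
  Kb = bnd n (js b m) ℕ.+ (bnd n m ℕ.+ (ℤ.∣ b ∣ ℕ.+ (bnd (n ℤ.- b) m ℕ.+ ℤ.∣ b ℤ.- n ∣)))
  Kb₁ : bnd n (js b m) ≤ Kb
  Kb₁ = ℕ.m≤m+n (bnd n (js b m)) _
  Kb₂' = ℕ.m≤n+m (bnd n m ℕ.+ (ℤ.∣ b ∣ ℕ.+ (bnd (n ℤ.- b) m ℕ.+ ℤ.∣ b ℤ.- n ∣))) (bnd n (js b m))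
  Kb₂ : bnd n m ≤ Kb
  Kb₂ = ℕ.≤-trans (ℕ.m≤m+n (bnd n m) _) Kb₂'
  Kb₃' = ℕ.≤-trans (ℕ.m≤n+m (ℤ.∣ b ∣ ℕ.+ (bnd (n ℤ.- b) m ℕ.+ ℤ.∣ b ℤ.- n ∣)) (bnd n m)) Kb₂'
  Kb₃ : ℤ.∣ b ∣ ≤ Kb
  Kb₃ = ℕ.≤-trans (ℕ.m≤m+n ℤ.∣ b ∣ _) Kb₃'
  Kb₄' = ℕ.≤-trans (ℕ.m≤n+m (bnd (n ℤ.- b) m ℕ.+ ℤ.∣ b ℤ.- n ∣) ℤ.∣ b ∣) Kb₃'
  Kb₄ : bnd (n ℤ.- b) m ≤ Kb
  Kb₄ = ℕ.≤-trans (ℕ.m≤m+n (bnd (n ℤ.- b) m) _) Kb₄'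
  Kb₅ : ℤ.∣ b ℤ.- n ∣ ≤ Kb
  Kb₅ = ℕ.≤-trans (ℕ.m≤n+m ℤ.∣ b ℤ.- n ∣ (bnd (n ℤ.- b) m)) Kb₄'

𝒩-comm : ∀ {φ} → Local φ → IsFam φ → ∀ b n {f} m → Resp f → J b (𝒩 φ n f) m - 𝒩 φ n (J b f) m ≡ ι b * φ (n ℤ.- b) f m + N (Kb b n m) (comm b φ) n f m
𝒩-comm {φ} loc I b n {f} m r = trans (cong₂ (λ x y → jc b m * x - y) (sym (N-stable φ loc n f (js b m) (Kb b n m) (Kb₁ b n m))) (sym (N-stable φ loc n (J b f) m (Kb b n m) (Kb₂ b n m))))
  (N-comm (Kb b n m) I b n m r (Kb₃ b n m))

-- Each of the two factors of :JJ: contributes b times the same mode: the outer one through the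
-- Leibniz rule, the inner one through `Nδ`.
Λ-comm : ∀ b n {f} m → Resp f → J b (Λ n f) m - Λ n (J b f) m ≡ (ι b + ι b) * J (b ℤ.- n) f m
Λ-comm b n {f} m r = trans (𝒩-comm {Jm} Jm-local Jm-isFam b n m r) (trans (cong₂ _+_ (cong (λ z → ι b * J z f m) (neg- n b)) nk) (l (ι b) (J (b ℤ.- n) f m)))
  where
  K = Kb b n m
  neg- : ∀ n b → ℤ.- (n ℤ.- b) ≡ b ℤ.- n
  neg- n b = trans (ℤ.neg-distrib-+ n (ℤ.- b)) (trans (cong (λ z → ℤ.- n ℤ.+ z) (ℤ.neg-involutive b)) (ℤ.+-comm (ℤ.- n) b))
  l : ∀ i x → i * x + i * x ≡ (i + i) * x
  l = solve-∀ ℚR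
  l2 : ∀ j i d x → j * (i * (d * x)) ≡ i * (d * (j * x))
  l2 = solve-∀ ℚR
  l3 : ∀ i a b → i * a + i * b ≡ i * (a + b)
  l3 = solve-∀ ℚR
  nk : N K (comm b Jm) n f m ≡ ι b * J (b ℤ.- n) f m
  nk = trans (Σ<-cong K (λ i → trans (cong₂ _+_
         (trans (cong (λ z → jc -[1+ i ] m * z) (trans (JJ b (ℤ.- (n ℤ.+ -[1+ i ])) f (js -[1+ i ] m) r) (cong (λ z → ι b * (δ z * f (js -[1+ i ] m))) (-‿shift b n -[1+ i ]))))
            (l2 (jc -[1+ i ] m) (ι b) (δ ((b ℤ.- n) ℤ.+ + suc i)) (f (js -[1+ i ] m))))
         (trans (JJ b (ℤ.- (n ℤ.+ + suc i)) (J (+ suc i) f) m (J-resp (+ suc i) r)) (cong (λ z → ι b * (δ z * J (+ suc i) f m)) (-‿shift b n (+ suc i)))))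
         (l3 (ι b) (δ ((b ℤ.- n) ℤ.+ + suc i) * J -[1+ i ] f m) (δ ((b ℤ.- n) ℤ.+ -[1+ i ]) * J (+ suc i) f m))))
       (trans (lin-* (Σ<-Lin K) (ι b) (λ _ → refl) 0) (cong (ι b *_) (Nδ K (b ℤ.- n) f m (Kb₅ b n m))))

-- The outer factor of :JJJ: contributes one copy of b `Λ` and the two factors inside `Λ` contribute
-- two more. The factor ⅓ in `T` compensates for these three equal contributions.
T-comm : ∀ b {f} m → Resp f → J b (T f) m - T (J b f) m ≡ ι b * Λ (ℤ.- b) f m
T-comm b {f} m r = begin
  jc b m * (⅓ * 𝒩 Λ (+ 0) f (js b m)) - ⅓ * 𝒩 Λ (+ 0) (J b f) m
    ≡⟨ l1 (jc b m) ⅓ (𝒩 Λ (+ 0) f (js b m)) (𝒩 Λ (+ 0) (J b f) m) ⟩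
  ⅓ * (J b (𝒩 Λ (+ 0) f) m - 𝒩 Λ (+ 0) (J b f) m)
    ≡⟨ cong (⅓ *_) (trans (𝒩-comm {Λ} Λ-local Λ-isFam b (+ 0) m r) (cong (λ z → ι b * Λ (+ 0 ℤ.- b) f m + z) nk)) ⟩
  ⅓ * (ι b * Λ (+ 0 ℤ.- b) f m + (ι b + ι b) * Λ (+ 0 ℤ.- b) f m)
    ≡⟨ l2 ⅓ (ι b) (Λ (+ 0 ℤ.- b) f m) ⟩
  ⅓ * (1ℚ + (1ℚ + 1ℚ)) * (ι b * Λ (+ 0 ℤ.- b) f m)
    ≡⟨ cong₂ (λ x y → x * (ι b * Λ y f m)) third (ℤ.+-identityˡ (ℤ.- b)) ⟩
  1ℚ * (ι b * Λ (ℤ.- b) f m)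
    ≡⟨ ℚ.*-identityˡ (ι b * Λ (ℤ.- b) f m) ⟩
  ι b * Λ (ℤ.- b) f m ∎
  where
  open ≡-Reasoning
  K = Kb b (+ 0) m
  third : ⅓ * (1ℚ + (1ℚ + 1ℚ)) ≡ 1ℚ
  third = trans (cong (⅓ *_) (sym (trans (ι-suc 2) (cong (λ z → 1ℚ + z) (trans (ι-suc 1) (cong (λ z → 1ℚ + z) ι1)))))) (recip-ι 2)
  l1 : ∀ j r x y → j * (r * x) - r * y ≡ r * (j * x - y)
  l1 = solve-∀ ℚR
  l2 : ∀ r i x → r * (i * x + (i + i) * x) ≡ r * (1ℚ + (1ℚ + 1ℚ)) * (i * x)
  l2 = solve-∀ ℚR
  neg- : ∀ n b → b ℤ.- n ≡ ℤ.- (n ℤ.- b)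
  neg- n b = sym (trans (ℤ.neg-distrib-+ n (ℤ.- b)) (trans (cong (λ z → ℤ.- n ℤ.+ z) (ℤ.neg-involutive b)) (ℤ.+-comm (ℤ.- n) b)))
  nk : N K (comm b Λ) (+ 0) f m ≡ (ι b + ι b) * Λ (+ 0 ℤ.- b) f m
  nk = trans (N-congᴿ K {comm b Λ} {λ n f m → (ι b + ι b) * Jm (n ℤ.- b) f m} (+ 0) m r
         (λ n {f} m r → trans (Λ-comm b n m r) (cong (λ z → (ι b + ι b) * J z f m) (neg- n b))))
       (trans (lin-* (N-Lin K) (ι b + ι b) {s = λ { (n , f , m) → Jm (n ℤ.- b) f m }} (λ _ → refl) (+ 0 , f , m))
       (cong (λ z → (ι b + ι b) * z) (trans (N-shift K Jm b (+ 0) f m) (N-stable Jm Jm-local (+ 0 ℤ.- b) f m K (Kb₄ b (+ 0) m)))))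

-- Operators on series in u

-- What lets an operator in q act on families of operators: it is linear, and it commutes with every
-- linear map of coefficient functions.
record SOp (P : Seq → Seq) : Set₁ where
  field
    slin : Lin P
    snat : Natural P
open SOp

S-op : SOp S
S-op = record { slin = S-lin ; snat = S-nat }
U-op : SOp U
U-op = record { slin = U-lin ; snat = U-nat }
θ-op : SOp θ
θ-op = record { slin = θ-lin ; snat = θ-nat }
Sᶻ-op : ∀ b → SOp (Sᶻ b)
Sᶻ-op b = record { slin = Sᶻ-lin b ; snat = Sᶻ-nat b }

∘-op : ∀ {P Q} → SOp P → SOp Q → SOp (λ s → P (Q s))
∘-op p q .slin c e = slin p c (slin q c e)
∘-op {P} {Q} p q .snat L g b k = trans (snat p L (λ j a → Q (λ i → g i a) j) b k) (lin-cong (slin p) (λ j → snat q L g b j) k)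

+-op : ∀ {P Q} → SOp P → SOp Q → SOp (λ s k → P s k + Q s k)
+-op {P} {Q} p q .slin c {s} {t} e k = trans (cong₂ _+_ (slin p c e k) (slin q c e k)) (l c (P s k) (P t k) (Q s k) (Q t k))
  where
  l : ∀ c x y x' y' → (c * x + y) + (c * x' + y') ≡ c * (x + x') + (y + y')
  l = solve-∀ ℚR
+-op p q .snat L g b k = trans (lin-+ L (λ _ → refl) b) (cong₂ _+_ (snat p L g b k) (snat q L g b k))

*-op : ∀ r {P} → SOp P → SOp (λ s k → r * P s k)
*-op r {P} p .slin c {s} {t} e k = trans (cong (r *_) (slin p c e k)) (l r c (P s k) (P t k))
  where
  l : ∀ r c x y → r * (c * x + y) ≡ c * (r * x) + r * y
  l = solve-∀ ℚR
*-op r p .snat L g b k = trans (lin-* L r (λ _ → refl) b) (cong (r *_) (snat p L g b k))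

2ℚ : ℚ
2ℚ = 1ℚ + 1ℚ

H : Seq → Seq
H s k = 2ℚ * U (θ s) k + (- 2ℚ) * S s k

H-op : SOp H
H-op = +-op (*-op 2ℚ (∘-op U-op θ-op)) (*-op (- 2ℚ) S-op)

-- Multiplication by q^c commutes with u and q, so the extra term comes from θ alone.
H-Sᶻ : ∀ c s k → H (Sᶻ c s) k ≡ Sᶻ c (H s) k + (ι c + ι c) * U (Sᶻ c s) k
H-Sᶻ c s k = begin
  2ℚ * U (θ (Sᶻ c s)) k + (- 2ℚ) * S (Sᶻ c s) k
    ≡⟨ cong₂ (λ x y → 2ℚ * x + (- 2ℚ) * y) (trans (U-lin (ι c) (λ j → trans (θ-Sᶻ c s j) (ℚ.+-comm (Sᶻ c (θ s) j) (ι c * Sᶻ c s j))) k) (cong (λ z → ι c * U (Sᶻ c s) k + z) (U-Sᶻ c (θ s) k)))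
          (Sᶻ-comm (+ 1) c s k) ⟩
  2ℚ * (ι c * U (Sᶻ c s) k + Sᶻ c (U (θ s)) k) + (- 2ℚ) * Sᶻ c (S s) k
    ≡⟨ l 2ℚ (ι c) (U (Sᶻ c s) k) (Sᶻ c (U (θ s)) k) (Sᶻ c (S s) k) ⟩
  (2ℚ * Sᶻ c (U (θ s)) k + (- 2ℚ) * Sᶻ c (S s) k) + 2ℚ * ι c * U (Sᶻ c s) k
    ≡⟨ cong₂ _+_ (sym (trans (Sᶻ-lin c 2ℚ (λ _ → refl) k) (cong (λ z → 2ℚ * Sᶻ c (U (θ s)) k + z) (lin-* (Sᶻ-lin c) (- 2ℚ) (λ _ → refl) k)))) (l2 (ι c) (U (Sᶻ c s) k)) ⟩
  Sᶻ c (H s) k + (ι c + ι c) * U (Sᶻ c s) k ∎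
  where
  open ≡-Reasoning
  l : ∀ t i a b d → t * (i * a + b) + (- t) * d ≡ (t * b + (- t) * d) + t * i * a
  l = solve-∀ ℚR
  l2 : ∀ i a → (1ℚ + 1ℚ) * i * a ≡ (i + i) * a
  l2 = solve-∀ ℚR

-- BΛ b n = (q^b - 1)(2uθ - 2q + (b+1)u) + 2nu and DT n = n(2uθ - 2q - (n-1)u) are the actions of 2u L_b and
-- 2u C on the vertex operator, found by residues; the factor u = q - 1 clears the denominator of (q^{b+1} - 1)/(q - 1).
BΛ : ℤ → ℤ → Seq → Seq
BΛ b n s k = Sᶻ b (G s) k + ((- 1ℚ) * G s k + (ι n + ι n) * U s k)
  where
  G : Seq → Seq
  G s k = H s k + (ι b + 1ℚ) * U s k

DT : ℤ → Seq → Seq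
DT n s k = ι n * (H s k + (1ℚ - ι n) * U s k)

BΛ-op : ∀ b n → SOp (BΛ b n)
BΛ-op b n = +-op (∘-op (Sᶻ-op b) G) (+-op (*-op (- 1ℚ) G) (*-op (ι n + ι n) U-op))
  where G = +-op H-op (*-op (ι b + 1ℚ) U-op)

DT-op : ∀ n → SOp (DT n)
DT-op n = *-op (ι n) (+-op H-op (*-op (1ℚ - ι n) U-op))

Δ : ℤ → Seq → Seq
Δ c s k = Sᶻ c s k - s k

Sᶻ-+₂ : ∀ b {s t h} → (∀ k → h k ≡ s k + t k) → ∀ k → Sᶻ b h k ≡ Sᶻ b s k + Sᶻ b t k
Sᶻ-+₂ b = lin-+ (Sᶻ-lin b)

BΛ-flat : ∀ b n s k → BΛ b n s k ≡ Sᶻ b (H s) k + (ι b + 1ℚ) * Sᶻ b (U s) k + ((- 1ℚ) * (H s k + (ι b + 1ℚ) * U s k) + (ι n + ι n) * U s k)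
BΛ-flat b n s k = cong (_+ ((- 1ℚ) * (H s k + (ι b + 1ℚ) * U s k) + (ι n + ι n) * U s k))
  (trans (lin-+ (Sᶻ-lin b) (λ _ → refl) k) (cong (λ z → Sᶻ b (H s) k + z) (lin-* (Sᶻ-lin b) (ι b + 1ℚ) (λ _ → refl) k)))

-- The Jacobi identity for J_c, L_b and V, read off in the variable q; the last term reflects that
-- [J_c, 2 L_b] = 2c J_(b+c).
BΛ-Δ : ∀ b n c s k → BΛ b n (Δ c s) k ≡ Δ c (BΛ b (n ℤ.- c) s) k + (ι c + ι c) * U (Δ (b ℤ.+ c) s) k
BΛ-Δ b n c s k = begin
  BΛ b n (Δ c s) k
    ≡⟨ lin-- (slin (BΛ-op b n)) (λ _ → refl) k ⟩
  BΛ b n (Sᶻ c s) k - BΛ b n s k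
    ≡⟨ cong₂ _-_ (BΛ-flat b n (Sᶻ c s) k) (BΛ-flat b n s k) ⟩
  (Sᶻ b (H y) k + i * Sᶻ b (U y) k + ((- 1ℚ) * (H y k + i * U y k) + n2 * U y k)) - (Sᶻ b (H s) k + i * Sᶻ b (U s) k + ((- 1ℚ) * (H s k + i * U s k) + n2 * U s k))
    ≡⟨ cong₂ (λ p q → (p + i * Sᶻ b (U y) k + ((- 1ℚ) * (q + i * U y k) + n2 * U y k)) - (Sᶻ b (H s) k + i * Sᶻ b (U s) k + ((- 1ℚ) * (H s k + i * U s k) + n2 * U s k)))
        (trans (lin-+ (Sᶻ-lin b) (H-Sᶻ c s) k) (cong₂ _+_ (Sᶻ-comm b c (H s) k) (lin-* (Sᶻ-lin b) (ι c + ι c) (λ _ → refl) k))) (H-Sᶻ c s k) ⟩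
  (Sᶻ c (Sᶻ b (H s)) k + (ι c + ι c) * Sᶻ b (U y) k + i * Sᶻ b (U y) k + ((- 1ℚ) * (Sᶻ c (H s) k + (ι c + ι c) * U y k + i * U y k) + n2 * U y k)) - (Sᶻ b (H s) k + i * Sᶻ b (U s) k + ((- 1ℚ) * (H s k + i * U s k) + n2 * U s k))
    ≡⟨ l (Sᶻ c (Sᶻ b (H s)) k) (ι c) (Sᶻ b (U y) k) i (Sᶻ c (H s) k) (U y k) (ι n) (Sᶻ b (H s) k) (Sᶻ b (U s) k) (H s k) (U s k) ⟩
  (Sᶻ c (Sᶻ b (H s)) k + i * Sᶻ b (U y) k + ((- 1ℚ) * (Sᶻ c (H s) k + i * U y k) + (ι n - ι c + (ι n - ι c)) * U y k)) - (Sᶻ b (H s) k + i * Sᶻ b (U s) k + ((- 1ℚ) * (H s k + i * U s k) + (ι n - ι c + (ι n - ι c)) * U s k)) + (ι c + ι c) * (Sᶻ b (U y) k - U s k)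
    ≡⟨ cong₂ _+_ (cong₂ _-_ big (trans (cong (λ z → Sᶻ b (H s) k + i * Sᶻ b (U s) k + ((- 1ℚ) * (H s k + i * U s k) + (z + z) * U s k)) (sym (ι-- n c))) (sym (BΛ-flat b (n ℤ.- c) s k))))
        (cong (λ z → (ι c + ι c) * z) (sym (trans (lin-- U-lin (λ _ → refl) k) (cong (_- U s k) (trans (lin-cong U-lin (Sᶻ-+ b c s) k) (U-Sᶻ b y k)))))) ⟩
  Δ c (BΛ b (n ℤ.- c) s) k + (ι c + ι c) * U (Δ (b ℤ.+ c) s) k ∎
  where
  open ≡-Reasoning
  y = Sᶻ c s
  i = ι b + 1ℚ
  n2 = ι n + ι n
  l : ∀ SSH c SU i SH Uy n bH bU h u → (SSH + (c + c) * SU + i * SU + ((- 1ℚ) * (SH + (c + c) * Uy + i * Uy) + (n + n) * Uy)) - (bH + i * bU + ((- 1ℚ) * (h + i * u) + (n + n) * u))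
     ≡ (SSH + i * SU + ((- 1ℚ) * (SH + i * Uy) + (n - c + (n - c)) * Uy)) - (bH + i * bU + ((- 1ℚ) * (h + i * u) + (n - c + (n - c)) * u)) + (c + c) * (SU - u)
  l = solve-∀ ℚR
  mm = ι n - ι c + (ι n - ι c)
  big : Sᶻ c (Sᶻ b (H s)) k + i * Sᶻ b (U y) k + ((- 1ℚ) * (Sᶻ c (H s) k + i * U y k) + mm * U y k) ≡ Sᶻ c (BΛ b (n ℤ.- c) s) k
  big = sym (trans (lin-cong (Sᶻ-lin c) (λ j → trans (BΛ-flat b (n ℤ.- c) s j) (cong (λ z → Sᶻ b (H s) j + i * Sᶻ b (U s) j + ((- 1ℚ) * (H s j + i * U s j) + (z + z) * U s j)) (ι-- n c))) k)
    (trans (Sᶻ-+₂ c (λ _ → refl) k) (cong₂ _+_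
      (trans (Sᶻ-+₂ c (λ _ → refl) k) (cong (λ z → Sᶻ c (Sᶻ b (H s)) k + z) (trans (lin-* (Sᶻ-lin c) i (λ _ → refl) k) (cong (i *_) (trans (Sᶻ-comm c b (U s) k) (lin-cong (Sᶻ-lin b) (λ j → sym (U-Sᶻ c s j)) k))))))
      (trans (Sᶻ-+₂ c (λ _ → refl) k) (cong₂ _+_ (trans (lin-* (Sᶻ-lin c) (- 1ℚ) (λ _ → refl) k) (cong (λ z → (- 1ℚ) * z) (trans (Sᶻ-+₂ c (λ _ → refl) k) (cong (λ z → Sᶻ c (H s) k + z) (trans (lin-* (Sᶻ-lin c) i (λ _ → refl) k) (cong (i *_) (sym (U-Sᶻ c s k))))))))
         (trans (lin-* (Sᶻ-lin c) mm (λ _ → refl) k) (cong (mm *_) (sym (U-Sᶻ c s k)))))))))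

-- Likewise for J_c, C and V, where [J_c, `T`] = c `Λ` produces the first term.
DT-Δ : ∀ n c s k → DT n (Δ c s) k ≡ ι c * BΛ c n s k + Δ c (DT (n ℤ.- c) s) k
DT-Δ n c s k = begin
  DT n (Δ c s) k
    ≡⟨ lin-- (slin (DT-op n)) (λ _ → refl) k ⟩
  ι n * (H y k + (1ℚ - ι n) * U y k) - ι n * (H s k + (1ℚ - ι n) * U s k)
    ≡⟨ cong (λ z → ι n * (z + (1ℚ - ι n) * U y k) - ι n * (H s k + (1ℚ - ι n) * U s k)) (H-Sᶻ c s k) ⟩
  ι n * (Sᶻ c (H s) k + (ι c + ι c) * U y k + (1ℚ - ι n) * U y k) - ι n * (H s k + (1ℚ - ι n) * U s k)
    ≡⟨ l (ι n) (ι c) (Sᶻ c (H s) k) (U y k) (H s k) (U s k) ⟩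
  ι c * (Sᶻ c (H s) k + (ι c + 1ℚ) * U y k + ((- 1ℚ) * (H s k + (ι c + 1ℚ) * U s k) + (ι n + ι n) * U s k)) + ((ι n - ι c) * (Sᶻ c (H s) k + (1ℚ - (ι n - ι c)) * U y k) - (ι n - ι c) * (H s k + (1ℚ - (ι n - ι c)) * U s k))
    ≡⟨ cong₂ (λ p q → ι c * p + q) (trans (cong (λ z → Sᶻ c (H s) k + (ι c + 1ℚ) * z + ((- 1ℚ) * (H s k + (ι c + 1ℚ) * U s k) + (ι n + ι n) * U s k)) (U-Sᶻ c s k)) (sym (BΛ-flat c n s k)))
       (trans (cong (λ z → z * (Sᶻ c (H s) k + (1ℚ - z) * U y k) - z * (H s k + (1ℚ - z) * U s k)) (sym (ι-- n c)))
         (cong (_- DT (n ℤ.- c) s k) (sym (trans (lin-* (Sᶻ-lin c) (ι (n ℤ.- c)) (λ _ → refl) k) (cong (λ z → ι (n ℤ.- c) * z) (trans (Sᶻ-+₂ c (λ _ → refl) k)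
            (cong (λ z → Sᶻ c (H s) k + z) (trans (lin-* (Sᶻ-lin c) (1ℚ - ι (n ℤ.- c)) (λ _ → refl) k) (cong (λ z → (1ℚ - ι (n ℤ.- c)) * z) (sym (U-Sᶻ c s k)))))))))) ) ⟩
  ι c * BΛ c n s k + Δ c (DT (n ℤ.- c) s) k ∎
  where
  open ≡-Reasoning
  y = Sᶻ c s
  l : ∀ n c SH Uy h u → n * (SH + (c + c) * Uy + (1ℚ - n) * Uy) - n * (h + (1ℚ - n) * u)
    ≡ c * (SH + (c + 1ℚ) * Uy + ((- 1ℚ) * (h + (c + 1ℚ) * u) + (n + n) * u)) + ((n - c) * (SH + (1ℚ - (n - c)) * Uy) - (n - c) * (h + (1ℚ - (n - c)) * u))
  l = solve-∀ ℚR

Δ-op : ∀ c → SOp (Δ c)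
Δ-op c .slin r {s} {t} {h} e k = trans (cong₂ _-_ (Sᶻ-lin c r e k) (e k)) (l r (Sᶻ c s k) (Sᶻ c t k) (s k) (t k))
  where
  l : ∀ r x y x' y' → r * x + y - (r * x' + y') ≡ r * (x - x') + (y - y')
  l = solve-∀ ℚR
Δ-op c .snat L g b k = trans (lin-- L (λ _ → refl) b) (cong (_- _) (Sᶻ-nat c L g b k))

X-comm′ : ∀ k b n {f} m → Resp f → J b (X k n f) m ≡ X k n (J b f) m + Δ b (λ j → X j (n ℤ.- b) f m) k
X-comm′ k b n {f} m r = trans (l (J b (X k n f) m) (X k n (J b f) m)) (cong (λ z → X k n (J b f) m + z) (X-comm k b n m r))
  where
  l : ∀ x y → x ≡ y + (x - y)
  l = solve-∀ ℚR

-- Brackets with the vertex operator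

bracket : (Fn → Fn) → ℕ → Fam
bracket A k n f m = A (X k n f) m - X k n (A f) m

module _ {A : Fn → Fn} (A-lin : Lin A) (A-resp : ∀ {f} → Resp f → Resp (A f)) where

  bracket-isFam : ∀ k → IsFam (bracket A k)
  bracket-isFam k .lin n c {s} {t} e m = trans (cong₂ _-_ (A-lin c (lin (X-isFam k) n c e) m) (lin (X-isFam k) n c (A-lin c e) m))
    (l c (A (X k n s) m) (A (X k n t) m) (X k n (A s) m) (X k n (A t) m))
    where
    l : ∀ r x y x' y' → r * x + y - (r * x' + y') ≡ r * (x - x') + (y - y')
    l = solve-∀ ℚR
  bracket-isFam k .resp n r e = cong₂ _-_ (A-resp (resp (X-isFam k) n r) e) (resp (X-isFam k) n (A-resp r) e)

  -- The Jacobi identity, with [J_c, A] = α E as hypothesis and `X-comm` for the commutator of J_c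
  -- with X.
  bracket-comm : ∀ c α (E : Fn → Fn) → (∀ {g} m → Resp g → J c (A g) m - A (J c g) m ≡ α * E g m) →
    ∀ k n {f} m → Resp f → comm c (bracket A k) n f m ≡ α * (E (X k n f) m - X k n (E f) m) + Δ c (λ j → bracket A j (n ℤ.- c) f m) k
  bracket-comm c α E hA k n {f} m r = begin
    J c (λ m → A (X k n f) m - X k n (A f) m) m - bracket A k n (J c f) m
      ≡⟨ cong (_- bracket A k n (J c f) m) (trans (lin-- (J-lin c) {s = A (X k n f)} {t = X k n (A f)} (λ _ → refl) m) (cong₂ _-_ (trans (hA′ m (resp (X-isFam k) n r)) (cong (_+ α * E (X k n f) m) t2)) (trans (X-comm′ k c n m (A-resp r)) (cong (_+ Δ c a₂ k) t4)))) ⟩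
    (A (X k n (J c f)) m + Δ c a₁ k + α * E (X k n f) m) - (X k n (A (J c f)) m + α * X k n (E f) m + Δ c a₂ k) - (A (X k n (J c f)) m - X k n (A (J c f)) m)
      ≡⟨ l (A (X k n (J c f)) m) (Δ c a₁ k) α (E (X k n f) m) (X k n (A (J c f)) m) (X k n (E f) m) (Δ c a₂ k) ⟩
    α * (E (X k n f) m - X k n (E f) m) + (Δ c a₁ k - Δ c a₂ k)
      ≡⟨ cong (λ z → α * (E (X k n f) m - X k n (E f) m) + z) (sym (lin-- (slin (Δ-op c)) (λ _ → refl) k)) ⟩
    α * (E (X k n f) m - X k n (E f) m) + Δ c (λ j → bracket A j (n ℤ.- c) f m) k ∎
    where
    open ≡-Reasoning
    a₁ a₂ : Seq
    a₁ j = A (X j (n ℤ.- c) f) m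
    a₂ j = X j (n ℤ.- c) (A f) m
    l0 : ∀ x y → x ≡ y + (x - y)
    l0 = solve-∀ ℚR
    hA′ : ∀ {g} m → Resp g → J c (A g) m ≡ A (J c g) m + α * E g m
    hA′ {g} m r = trans (l0 (J c (A g) m) (A (J c g) m)) (cong (λ z → A (J c g) m + z) (hA m r))
    t2 : A (J c (X k n f)) m ≡ A (X k n (J c f)) m + Δ c a₁ k
    t2 = trans (lin-+ A-lin {t = λ m → Δ c (λ j → X j (n ℤ.- c) f m) k} (λ m → X-comm′ k c n m r) m)
      (cong (λ z → A (X k n (J c f)) m + z) (snat (Δ-op c) A-lin (λ j → X j (n ℤ.- c) f) m k))
    t4 : X k n (J c (A f)) m ≡ X k n (A (J c f)) m + α * X k n (E f) m
    t4 = trans (lin-+ (lin (X-isFam k) n) {t = λ m → α * E f m} (λ m → hA′ m r) m) (cong (λ z → X k n (A (J c f)) m + z) (lin-* (lin (X-isFam k) n) α (λ _ → refl) m))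
    l : ∀ x d α e x' e' d' → (x + d + α * e) - (x' + α * e' + d') - (x - x') ≡ α * (e - e') + (d - d')
    l = solve-∀ ℚR

-- Vacuum expectations of the brackets

X-vac⁻ : ∀ k p m → X k -[1+ p ] vac m ≡ 0ℚ
X-vac⁻ zero p m = ℚ.*-zeroˡ (vac m)
X-vac⁻ (suc k) p m = trans (cong₂ (λ x y → ι (-[1+ p ] ℤ.- + k) * x + y) (X-vac⁻ k p m) (Σ<-zero (bnd -[1+ p ] m) (λ i → trans (cong₂ _+_
    (lin-zero (J-lin -[1+ i ]) (λ m → X-vac⁻ k (suc (p ℕ.+ i)) m) m)
    (lin-zero (lin (X-isFam k) (-[1+ p ] ℤ.+ + suc i)) (J⁺-vac (suc i)) m)) (ℚ.+-identityʳ 0ℚ))))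
   (l (ι (-[1+ p ] ℤ.- + k)))
  where
  l : ∀ i → i * 0ℚ + 0ℚ ≡ 0ℚ
  l = solve-∀ ℚR

vev : ℤ → Seq
vev n j = X j n vac []

-- For n > 0 the operator raises the degree and misses the constant monomial; for n < 0 it kills the
-- vacuum; for n = 0 the factor is zero.
vev-degree : ∀ n k → ι n * vev n k ≡ 0ℚ
vev-degree (+ zero) k = trans (cong (_* vev (+ 0) k) ι0) (ℚ.*-zeroˡ (vev (+ 0) k))
vev-degree (+ suc n) k = trans (cong (λ z → ι (+ suc n) * z) (X-local k (suc n) vac [] (s≤s z≤n))) (ℚ.*-zeroʳ (ι (+ suc n)))
vev-degree -[1+ n ] k = trans (cong (λ z → ι -[1+ n ] * z) (X-vac⁻ k n [])) (ℚ.*-zeroʳ (ι -[1+ n ]))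

-- In `X-θ` the normally ordered term has no vacuum expectation and the other one vanishes by
-- degree. So the expectation of V does not depend on q.
vev-θ : ∀ n k → θ (vev n) k ≡ 0ℚ
vev-θ n k = trans (X-θ n vac [] k) (trans (cong₂ _+_ (vev-degree n k) (Σ<-zero (bnd n []) (λ i → trans (cong₂ _+_ (J⁻-[] i (X k (n ℤ.+ -[1+ i ]) vac))
  (lin-zero (lin (X-isFam k) (n ℤ.+ + suc i)) (J⁺-vac (suc i)) [])) (ℚ.+-identityʳ 0ℚ)))) (ℚ.+-identityʳ 0ℚ))

U-tele : ∀ c x k → U (Sᶻ c x) k ≡ Sᶻ (ℤ.suc c) x k - Sᶻ c x k
U-tele c x k = trans (l (Sᶻ c x k) (U (Sᶻ c x) k)) (cong (_- Sᶻ c x k) (sym (Sᶻ-suc c x k)))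
  where
  l : ∀ a b → b ≡ a + b - a
  l = solve-∀ ℚR

tele⁺ : ∀ (g : ℕ → ℚ) K → Σ< K (λ i → g (suc i) - g i) ≡ g K - g 0
tele⁺ g zero = sym (ℚ.+-inverseʳ (g 0))
tele⁺ g (suc K) = trans (cong (_+ (g (suc K) - g K)) (tele⁺ g K)) (l (g K) (g 0) (g (suc K)))
  where
  l : ∀ a b c → a - b + (c - a) ≡ c - b
  l = solve-∀ ℚR

U-Σ< : ∀ K (g : ℕ → Seq) k → U (λ j → Σ< K (λ i → g i j)) k ≡ Σ< K (λ i → U (g i) k)
U-Σ< K g k = sym (U-nat (Σ<-Lin K) (λ j i → g i j) 0 k)

Σ<-const : ∀ K x → Σ< K (λ _ → x) ≡ ι (+ K) * x
Σ<-const zero x = sym (trans (cong (_* x) ι0) (ℚ.*-zeroˡ x))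
Σ<-const (suc K) x = trans (cong (_+ x) (Σ<-const K x)) (trans (l (ι (+ K)) x) (cong (_* x) (sym (ι-suc K))))
  where
  l : ∀ i x → i * x + x ≡ (1ℚ + i) * x
  l = solve-∀ ℚR

ΔΔ : ∀ c d x k → Δ c (Δ d x) k ≡ Sᶻ (c ℤ.+ d) x k + x k - (Sᶻ c x k + Sᶻ d x k)
ΔΔ c d x k = trans (cong (_- Δ d x k) (trans (lin-- (Sᶻ-lin c) (λ _ → refl) k) (cong (_- Sᶻ c x k) (sym (Sᶻ-+ c d x k))))) (l (Sᶻ (c ℤ.+ d) x k) (Sᶻ c x k) (Sᶻ d x k) (x k))
  where
  l : ∀ a b c d → a - b - (c - d) ≡ a + d - (b + c)
  l = solve-∀ ℚR

-- With θ x = 0 and n x = b x the operator reduces to a combination of powers of q. It is arranged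
-- in the shape b u (q^b + 1) - (q^(b+1) - q) - (q^b - 1), which is how the sums over modes arrive.
BΛ-vac : ∀ b n x → (∀ k → θ x k ≡ 0ℚ) → (∀ k → ι (n ℤ.- b) * x k ≡ 0ℚ) → ∀ k →
  BΛ b n x k ≡ ι b * (U (Sᶻ b x) k + U x k) - (Sᶻ (ℤ.suc b) x k - S x k) - (Sᶻ b x k - x k)
BΛ-vac b n x θ0 d0 k = begin
  BΛ b n x k ≡⟨ BΛ-flat b n x k ⟩
  Sᶻ b (H x) k + (ι b + 1ℚ) * Sᶻ b (U x) k + ((- 1ℚ) * (H x k + (ι b + 1ℚ) * U x k) + (ι n + ι n) * U x k)
    ≡⟨ cong₂ (λ p q → p + (ι b + 1ℚ) * Sᶻ b (U x) k + ((- 1ℚ) * (H x k + (ι b + 1ℚ) * U x k) + q)) sh nU ⟩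
  (- 2ℚ) * Sᶻ (ℤ.suc b) x k + (ι b + 1ℚ) * Sᶻ b (U x) k + ((- 1ℚ) * (H x k + (ι b + 1ℚ) * U x k) + (ι b + ι b) * U x k)
    ≡⟨ cong₂ (λ p q → (- 2ℚ) * Sᶻ (ℤ.suc b) x k + (ι b + 1ℚ) * p + ((- 1ℚ) * (q + (ι b + 1ℚ) * U x k) + (ι b + ι b) * U x k)) (trans (sym (U-Sᶻ b x k)) (U-tele b x k)) (H0 k) ⟩
  (- 2ℚ) * Sᶻ (ℤ.suc b) x k + (ι b + 1ℚ) * (Sᶻ (ℤ.suc b) x k - Sᶻ b x k) + ((- 1ℚ) * ((- 2ℚ) * (x k + U x k) + (ι b + 1ℚ) * U x k) + (ι b + ι b) * U x k)
    ≡⟨ l (ι b) (Sᶻ (ℤ.suc b) x k) (Sᶻ b x k) (x k) (U x k) ⟩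
  ι b * (Sᶻ (ℤ.suc b) x k - Sᶻ b x k + U x k) - (Sᶻ (ℤ.suc b) x k - (x k + U x k)) - (Sᶻ b x k - x k)
    ≡⟨ cong (λ z → ι b * (z + U x k) - (Sᶻ (ℤ.suc b) x k - S x k) - (Sᶻ b x k - x k)) (sym (U-tele b x k)) ⟩
  ι b * (U (Sᶻ b x) k + U x k) - (Sᶻ (ℤ.suc b) x k - S x k) - (Sᶻ b x k - x k) ∎
  where
  open ≡-Reasoning
  l : ∀ b p q x u → (- (1ℚ + 1ℚ)) * p + (b + 1ℚ) * (p - q) + ((- 1ℚ) * ((- (1ℚ + 1ℚ)) * (x + u) + (b + 1ℚ) * u) + (b + b) * u) ≡ b * (p - q + u) - (p - (x + u)) - (q - x)
  l = solve-∀ ℚR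
  H0 : ∀ k → H x k ≡ (- 2ℚ) * S x k
  H0 k = trans (cong (λ z → 2ℚ * z + (- 2ℚ) * S x k) (lin-zero U-lin θ0 k)) (l0 2ℚ ((- 2ℚ) * S x k))
    where
    l0 : ∀ a b → a * 0ℚ + b ≡ b
    l0 = solve-∀ ℚR
  sh : Sᶻ b (H x) k ≡ (- 2ℚ) * Sᶻ (ℤ.suc b) x k
  sh = trans (lin-* (Sᶻ-lin b) (- 2ℚ) H0 k) (cong (λ z → (- 2ℚ) * z) (trans (Sᶻ-comm b (+ 1) x k) (sym (Sᶻ-suc b x k))))
  nx : ∀ k → (ι n + ι n) * x k ≡ (ι b + ι b) * x k
  nx k = trans (l1 (ι n) (ι b) (x k)) (trans (cong (λ z → (ι b + ι b) * x k + (1ℚ + 1ℚ) * z) (trans (cong (_* x k) (sym (ι-- n b))) (d0 k))) (l2 ((ι b + ι b) * x k)))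
    where
    l1 : ∀ n b x → (n + n) * x ≡ (b + b) * x + (1ℚ + 1ℚ) * ((n - b) * x)
    l1 = solve-∀ ℚR
    l2 : ∀ x → x + (1ℚ + 1ℚ) * 0ℚ ≡ x
    l2 = solve-∀ ℚR
  nU : (ι n + ι n) * U x k ≡ (ι b + ι b) * U x k
  nU = trans (sym (lin-* U-lin (ι n + ι n) (λ _ → refl) k)) (trans (lin-cong U-lin nx k) (lin-* U-lin (ι b + ι b) (λ _ → refl) k))

Σ<-cong< : ∀ K {g h} → (∀ i → i < K → g i ≡ h i) → Σ< K g ≡ Σ< K h
Σ<-cong< zero e = refl
Σ<-cong< (suc K) e = cong₂ _+_ (Σ<-cong< K (λ i lt → e i (ℕ.m≤n⇒m≤1+n lt))) (e K ℕ.≤-refl)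

minus-minus : ∀ n a b {c} → a ℤ.+ b ≡ c → n ℤ.- a ℤ.- b ≡ n ℤ.- c
minus-minus n a b refl = trans (ℤ.+-assoc n (ℤ.- a) (ℤ.- b)) (cong (λ z → n ℤ.+ z) (sym (ℤ.neg-distrib-+ a b)))

split-+ : ∀ b i → i < suc b → + suc i ℤ.+ + (b ℕ.∸ i) ≡ + suc b
split-+ b i lt = cong (λ z → + suc z) (ℕ.m+[n∸m]≡n (ℕ.≤-pred lt))

neg-split : ∀ b i → i < suc b → ℤ.- (+ suc b ℤ.+ -[1+ i ]) ≡ ℤ.- + (b ℕ.∸ i)
neg-split b i lt = cong ℤ.-_ (ℤ.⊖-≥ lt)

-- u = q - 1 makes both geometric sums telescope.
vev-sum : ∀ b x k → Σ< (suc b) (λ i → U (λ j → Sᶻ (+ suc b) x j + x j - (Sᶻ (+ suc i) x j + Sᶻ (+ (b ℕ.∸ i)) x j)) k)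
  ≡ ι (+ suc b) * (U (Sᶻ (+ suc b) x) k + U x k) - (Sᶻ (+ suc (suc b)) x k - S x k) - (Sᶻ (+ suc b) x k - x k)
vev-sum b x k = begin
  Σ< (suc b) (λ i → U (λ j → y j + x j - (g i j + h i j)) k)
    ≡⟨ Σ<-cong< (suc b) (λ i lt → trans (lin-- U-lin (λ _ → refl) k) (cong₂ _-_ (lin-+ U-lin (λ _ → refl) k) (trans (lin-+ U-lin (λ _ → refl) k) (cong₂ _+_ (U-tele (+ suc i) x k)
        (trans (U-tele (+ (b ℕ.∸ i)) x k) (cong (λ z → Sᶻ (+ z) x k - Sᶻ (+ (b ℕ.∸ i)) x k) (sym (ℕ.+-∸-assoc 1 (ℕ.≤-pred lt))))))))) ⟩
  Σ< (suc b) (λ i → c - ((g (suc i) k - g i k) + (h′ i - h′ (suc i))))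
    ≡⟨ lin-- (Σ<-Lin (suc b)) (λ _ → refl) 0 ⟩
  Σ< (suc b) (λ _ → c) - Σ< (suc b) (λ i → (g (suc i) k - g i k) + (h′ i - h′ (suc i)))
    ≡⟨ cong₂ _-_ (Σ<-const (suc b) c) (trans (lin-+ (Σ<-Lin (suc b)) (λ _ → refl) 0) (cong₂ _+_ (tele⁺ (λ i → g i k) (suc b))
         (trans (lin-* (Σ<-Lin (suc b)) (- 1ℚ) (λ i → flip (h′ i) (h′ (suc i))) 0) (cong (λ z → (- 1ℚ) * z) (tele⁺ h′ (suc b)))))) ⟩
  ι (+ suc b) * c - ((g (suc b) k - g 0 k) + (- 1ℚ) * (h′ (suc b) - h′ 0))
    ≡⟨ cong (λ z → ι (+ suc b) * c - ((g (suc b) k - g 0 k) + (- 1ℚ) * (Sᶻ (+ z) x k - h′ 0))) (ℕ.n∸n≡0 (suc b)) ⟩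
  ι (+ suc b) * c - ((g (suc b) k - g 0 k) + (- 1ℚ) * (x k - h′ 0))
    ≡⟨ l (ι (+ suc b) * c) (g (suc b) k - g 0 k) (x k) (h′ 0) ⟩
  ι (+ suc b) * c - (g (suc b) k - g 0 k) - (h′ 0 - x k) ∎
  where
  open ≡-Reasoning
  y = Sᶻ (+ suc b) x
  g h : ℕ → Seq
  g i = Sᶻ (+ suc i) x
  h i = Sᶻ (+ (b ℕ.∸ i)) x
  h′ : ℕ → ℚ
  h′ i = Sᶻ (+ (suc b ℕ.∸ i)) x k
  c = U y k + U x k
  flip : ∀ a b → a - b ≡ (- 1ℚ) * (b - a)
  flip = solve-∀ ℚR
  l : ∀ a b c d → a - (b + (- 1ℚ) * (c - d)) ≡ a - b - (d - c)
  l = solve-∀ ℚR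

JX-vac : ∀ p k n m → J (+ p) (X k n vac) m ≡ Δ (+ p) (λ j → X j (n ℤ.- + p) vac m) k
JX-vac p k n m = trans (X-comm′ k (+ p) n m vac-resp) (trans (cong (_+ Δ (+ p) (λ j → X j (n ℤ.- + p) vac m) k) (lin-zero (lin (X-isFam k) n) (J⁺-vac p) m)) (ℚ.+-identityˡ _))

JJX-vac : ∀ p q k n m → J (+ q) (J (+ p) (X k n vac)) m ≡ Δ (+ p) (λ j → Δ (+ q) (λ i → X i (n ℤ.- + p ℤ.- + q) vac m) j) k
JJX-vac p q k n m = trans (lin-cong (J-lin (+ q)) (JX-vac p k n) m)
  (trans (snat (Δ-op (+ p)) (J-lin (+ q)) (λ j → X j (n ℤ.- + p) vac) m k) (lin-cong (slin (Δ-op (+ p))) (λ j → JX-vac q j (n ℤ.- + p) m) k))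

J≤0-[] : ∀ p f → J (ℤ.- + p) f [] ≡ 0ℚ
J≤0-[] zero f = ℚ.*-zeroˡ (f [])
J≤0-[] (suc p) f = J⁻-[] p f

XJ-[] : ∀ p k n {f} → Resp f → X k n (J (ℤ.- + p) f) [] ≡ - Δ (ℤ.- + p) (λ j → X j (n ℤ.- (ℤ.- + p)) f []) k
XJ-[] p k n {f} r = trans (l (J (ℤ.- + p) (X k n f) []) (X k n (J (ℤ.- + p) f) [])) (trans (cong₂ _-_ (J≤0-[] p (X k n f)) (X-comm k (ℤ.- + p) n [] r)) (ℚ.+-identityˡ _))
  where
  l : ∀ x y → y ≡ x - (x - y)
  l = solve-∀ ℚR

Λ⁻-vac : ∀ p m → Λ -[1+ p ] vac m ≡ 0ℚ
Λ⁻-vac p m = Σ<-zero (bnd -[1+ p ] m) (λ i → trans (cong₂ _+_ (lin-zero (J-lin -[1+ i ]) (J⁺-vac (suc (suc (p ℕ.+ i)))) m)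
    (lin-zero (J-lin (ℤ.- (-[1+ p ] ℤ.+ + suc i))) (J⁺-vac (suc i)) m)) (ℚ.+-identityʳ 0ℚ))

-- Here the Virasoro operator kills the vacuum, so only its product with X on its right counts. At
-- the constant monomial only pairs of modes of nonnegative index survive, and each of them passes X
-- with a factor q^c - 1.
vev-bracket⁺ : ∀ b n k → let x = vev (n ℤ.- + suc b) in U (λ j → bracket (Λ (ℤ.- + suc b)) j n vac []) k ≡
  ι (+ suc b) * (U (Sᶻ (+ suc b) x) k + U x k) - (Sᶻ (+ suc (suc b)) x k - S x k) - (Sᶻ (+ suc b) x k - x k)
vev-bracket⁺ b n k = trans (lin-cong U-lin br k) (trans (U-Σ< (suc b) _ k) (vev-sum b x k))
  where
  x = vev (n ℤ.- + suc b)
  br : ∀ j → bracket (Λ -[1+ b ]) j n vac [] ≡ Σ< (suc b) (λ i → Sᶻ (+ suc b) x j + x j - (Sᶻ (+ suc i) x j + Sᶻ (+ (b ℕ.∸ i)) x j))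
  br j = trans (cong₂ _-_ (Σ<-cong< (suc b) (λ i lt → trans (cong₂ _+_ (J⁻-[] i (J (ℤ.- (-[1+ b ] ℤ.+ -[1+ i ])) (X j n vac))) (term i lt)) (ℚ.+-identityˡ _)))
      (lin-zero (lin (X-isFam j) n) (Λ⁻-vac b) [])) (minus0 _)
    where
    minus0 : ∀ x → x - 0ℚ ≡ x
    minus0 = solve-∀ ℚR
    term : ∀ i → i < suc b → J (ℤ.- (-[1+ b ] ℤ.+ + suc i)) (J (+ suc i) (X j n vac)) [] ≡ Sᶻ (+ suc b) x j + x j - (Sᶻ (+ suc i) x j + Sᶻ (+ (b ℕ.∸ i)) x j)
    term i lt = begin
      J (ℤ.- (-[1+ b ] ℤ.+ + suc i)) (J (+ suc i) (X j n vac)) []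
        ≡⟨ cong (λ z → J z (J (+ suc i) (X j n vac)) []) (trans (cong ℤ.-_ (ℤ.⊖-≤ lt)) (ℤ.neg-involutive (+ (b ℕ.∸ i)))) ⟩
      J (+ (b ℕ.∸ i)) (J (+ suc i) (X j n vac)) []
        ≡⟨ JJX-vac (suc i) (b ℕ.∸ i) j n [] ⟩
      Δ (+ suc i) (Δ (+ (b ℕ.∸ i)) (vev (n ℤ.- + suc i ℤ.- + (b ℕ.∸ i)))) j
        ≡⟨ cong (λ z → Δ (+ suc i) (Δ (+ (b ℕ.∸ i)) (vev z)) j) (minus-minus n (+ suc i) (+ (b ℕ.∸ i)) (split-+ b i lt)) ⟩
      Δ (+ suc i) (Δ (+ (b ℕ.∸ i)) x) j
        ≡⟨ ΔΔ (+ suc i) (+ (b ℕ.∸ i)) x j ⟩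
      Sᶻ (+ suc i ℤ.+ + (b ℕ.∸ i)) x j + x j - (Sᶻ (+ suc i) x j + Sᶻ (+ (b ℕ.∸ i)) x j)
        ≡⟨ cong (λ z → Sᶻ z x j + x j - (Sᶻ (+ suc i) x j + Sᶻ (+ (b ℕ.∸ i)) x j)) (split-+ b i lt) ⟩
      Sᶻ (+ suc b) x j + x j - (Sᶻ (+ suc i) x j + Sᶻ (+ (b ℕ.∸ i)) x j) ∎
      where open ≡-Reasoning

suc-neg : ∀ m → ℤ.suc (ℤ.- + suc m) ≡ ℤ.- + m
suc-neg zero = refl
suc-neg (suc m) = refl

vev-sum⁻ : ∀ a x k → - Σ< (suc a) (λ i → U (λ j → Sᶻ -[1+ a ] x j + x j - (Sᶻ -[1+ i ] x j + Sᶻ (ℤ.- + (a ℕ.∸ i)) x j)) k)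
  ≡ ι -[1+ a ] * (U (Sᶻ -[1+ a ] x) k + U x k) - (Sᶻ (ℤ.suc -[1+ a ]) x k - S x k) - (Sᶻ -[1+ a ] x k - x k)
vev-sum⁻ a x k = begin
  - Σ< (suc a) (λ i → U (λ j → y j + x j - (Sᶻ -[1+ i ] x j + Sᶻ (ℤ.- + (a ℕ.∸ i)) x j)) k)
    ≡⟨ cong -_ (Σ<-cong< (suc a) (λ i lt → trans (lin-- U-lin (λ _ → refl) k) (cong₂ _-_ (lin-+ U-lin (λ _ → refl) k) (trans (lin-+ U-lin (λ _ → refl) k) (cong₂ _+_
        (trans (U-tele -[1+ i ] x k) (cong (λ z → Sᶻ z x k - g (suc i)) (suc-neg i)))
        (trans (U-tele (ℤ.- + (a ℕ.∸ i)) x k) (cong (λ z → h (suc i) - Sᶻ z x k) (trans (sym (suc-neg (a ℕ.∸ i))) (cong (λ z → ℤ.suc (ℤ.- + z)) (sym (ℕ.+-∸-assoc 1 (ℕ.≤-pred lt))))))))))) ) ⟩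
  - Σ< (suc a) (λ i → c - ((g i - g (suc i)) + (h (suc i) - h i)))
    ≡⟨ cong -_ (trans (lin-- (Σ<-Lin (suc a)) (λ _ → refl) 0) (cong₂ _-_ (Σ<-const (suc a) c) (trans (lin-+ (Σ<-Lin (suc a)) (λ _ → refl) 0) (cong₂ _+_
         (trans (lin-* (Σ<-Lin (suc a)) (- 1ℚ) (λ i → flip (g i) (g (suc i))) 0) (cong (λ z → (- 1ℚ) * z) (tele⁺ g (suc a)))) (tele⁺ h (suc a)))))) ⟩
  - (ι (+ suc a) * c - ((- 1ℚ) * (g (suc a) - x k) + (h (suc a) - h 0)))
    ≡⟨ cong (λ z → - (ι (+ suc a) * c - ((- 1ℚ) * (g (suc a) - x k) + (Sᶻ (ℤ.suc (ℤ.- + z)) x k - h 0)))) (ℕ.n∸n≡0 (suc a)) ⟩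
  - (ι (+ suc a) * c - ((- 1ℚ) * (g (suc a) - x k) + (S x k - h 0)))
    ≡⟨ l (ι (+ suc a)) c (g (suc a)) (x k) (S x k) (h 0) ⟩
  (- ι (+ suc a)) * c - (h 0 - S x k) - (g (suc a) - x k)
    ≡⟨ cong (λ z → z * c - (h 0 - S x k) - (g (suc a) - x k)) (sym (ι-neg (+ suc a))) ⟩
  ι -[1+ a ] * c - (h 0 - S x k) - (g (suc a) - x k) ∎
  where
  open ≡-Reasoning
  y = Sᶻ -[1+ a ] x
  c = U y k + U x k
  g h : ℕ → ℚ
  g i = Sᶻ (ℤ.- + i) x k
  h i = Sᶻ (ℤ.suc (ℤ.- + (suc a ℕ.∸ i))) x k
  flip : ∀ a b → a - b ≡ (- 1ℚ) * (b - a)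
  flip = solve-∀ ℚR
  l : ∀ i c g x s h → - (i * c - ((- 1ℚ) * (g - x) + (s - h))) ≡ (- i) * c - (h - s) - (g - x)
  l = solve-∀ ℚR

lin-Σ< : ∀ {A B : Set} {P : (A → ℚ) → (B → ℚ)} → Lin P → ∀ K (g : ℕ → A → ℚ) b → P (λ a → Σ< K (λ i → g i a)) b ≡ Σ< K (λ i → P (g i) b)
lin-Σ< L zero g b = lin-zero L (λ _ → refl) b
lin-Σ< {P = P} L (suc K) g b = trans (lin-+ L (λ _ → refl) b) (cong (_+ P (g K) b) (lin-Σ< L K g b))

-- Only pairs of creation modes survive on the vacuum. For `i` = `a` the inner mode is J_0 = 0;
-- keeping this term gives the sum the length `suc a`.
Λ⁺-vac : ∀ a m → Λ (+ suc a) vac m ≡ Σ< (suc a) (λ i → J -[1+ i ] (J (ℤ.- + (a ℕ.∸ i)) vac) m)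
Λ⁺-vac a m = trans (Σ<-stable {suc a} {bnd (+ suc a) m} big (ℕ.m≤n+m (suc a) (w m))) (Σ<-cong< (suc a) (λ i lt → trans (cong₂ _+_ (cong (λ z → J -[1+ i ] (J z vac) m) (neg-split a i lt)) (drop i)) (ℚ.+-identityʳ _)))
  where
  drop : ∀ i → J (ℤ.- (+ suc a ℤ.+ + suc i)) (J (+ suc i) vac) m ≡ 0ℚ
  drop i = lin-zero (J-lin (ℤ.- (+ suc a ℤ.+ + suc i))) (J⁺-vac (suc i)) m
  big : ∀ i → suc a ≤ i → J -[1+ i ] (J (ℤ.- (+ suc a ℤ.+ -[1+ i ])) vac) m + J (ℤ.- (+ suc a ℤ.+ + suc i)) (J (+ suc i) vac) m ≡ 0ℚ
  big i le = trans (cong₂ _+_ (lin-zero (J-lin -[1+ i ]) (λ m → trans (cong (λ z → J z vac m) (trans (cong ℤ.-_ (ℤ.⊖-≤ (ℕ.m≤n⇒m≤1+n le))) (ℤ.neg-involutive (+ (suc i ℕ.∸ suc a))))) (J⁺-vac (i ℕ.∸ a) m)) m) (drop i)) (ℚ.+-identityʳ 0ℚ)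

-- Now the Virasoro operator creates, so its product with X has no constant coefficient and only the
-- subtracted term remains. There each creation mode is moved to the left of X, where it contributes
-- nothing, and leaves a commutator.
vev-bracket⁻ : ∀ a n k → let x = vev (n ℤ.- -[1+ a ]) in U (λ j → bracket (Λ (+ suc a)) j n vac []) k ≡
  ι -[1+ a ] * (U (Sᶻ -[1+ a ] x) k + U x k) - (Sᶻ (ℤ.suc -[1+ a ]) x k - S x k) - (Sᶻ -[1+ a ] x k - x k)
vev-bracket⁻ a n k = trans (lin-* U-lin (- 1ℚ) br k) (trans (cong (λ z → (- 1ℚ) * z) (U-Σ< (suc a) _ k)) (trans (neg1 _) (vev-sum⁻ a x k)))
  where
  x = vev (n ℤ.- -[1+ a ])
  neg1 : ∀ x → (- 1ℚ) * x ≡ - x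
  neg1 = solve-∀ ℚR
  ΛX : ∀ j → Λ (+ suc a) (X j n vac) [] ≡ 0ℚ
  ΛX j = trans (Σ<-cong< (suc a) {h = λ _ → 0ℚ} (λ i lt → trans (cong₂ _+_ (J⁻-[] i (J (ℤ.- (+ suc a ℤ.+ -[1+ i ])) (X j n vac)))
     (J⁻-[] (a ℕ.+ suc i) (J (+ suc i) (X j n vac)))) (ℚ.+-identityʳ 0ℚ))) (Σ<-zero (suc a) (λ _ → refl))
  JJ-term : ℕ → Fn
  JJ-term i = J -[1+ i ] (J (ℤ.- + (a ℕ.∸ i)) vac)
  br : ∀ j → bracket (Λ (+ suc a)) j n vac [] ≡ (- 1ℚ) * Σ< (suc a) (λ i → Sᶻ -[1+ a ] x j + x j - (Sᶻ -[1+ i ] x j + Sᶻ (ℤ.- + (a ℕ.∸ i)) x j))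
  br j = trans (cong₂ _-_ (ΛX j) (trans (lin-cong (lin (X-isFam j) n) (Λ⁺-vac a) []) (trans (lin-Σ< (lin (X-isFam j) n) (suc a) JJ-term []) (Σ<-cong< (suc a) term)))) (zero-minus (Σ< (suc a) (λ i → Sᶻ -[1+ a ] x j + x j - (Sᶻ -[1+ i ] x j + Sᶻ (ℤ.- + (a ℕ.∸ i)) x j))))
    where
    zero-minus : ∀ x → 0ℚ - x ≡ (- 1ℚ) * x
    zero-minus = solve-∀ ℚR
    term : ∀ i → i < suc a → X j n (JJ-term i) [] ≡ Sᶻ -[1+ a ] x j + x j - (Sᶻ -[1+ i ] x j + Sᶻ (ℤ.- + (a ℕ.∸ i)) x j)
    term i lt = begin
      X j n (JJ-term i) []
        ≡⟨ XJ-[] (suc i) j n (J-resp c vac-resp) ⟩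
      - Δ d (λ j → X j (n ℤ.- d) (J c vac) []) j
        ≡⟨ cong -_ (lin-* (slin (Δ-op d)) (- 1ℚ) (λ j → trans (XJ-[] (a ℕ.∸ i) j (n ℤ.- d) vac-resp) (sym (neg1 _))) j) ⟩
      - ((- 1ℚ) * Δ d (Δ c (vev (n ℤ.- d ℤ.- c))) j)
        ≡⟨ neg2 (Δ d (Δ c (vev (n ℤ.- d ℤ.- c))) j) ⟩
      Δ d (Δ c (vev (n ℤ.- d ℤ.- c))) j
        ≡⟨ cong (λ z → Δ d (Δ c (vev z)) j) (minus-minus n d c dc) ⟩
      Δ d (Δ c x) j
        ≡⟨ ΔΔ d c x j ⟩
      Sᶻ (d ℤ.+ c) x j + x j - (Sᶻ d x j + Sᶻ c x j)
        ≡⟨ cong (λ z → Sᶻ z x j + x j - (Sᶻ d x j + Sᶻ c x j)) dc ⟩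
      Sᶻ -[1+ a ] x j + x j - (Sᶻ d x j + Sᶻ c x j) ∎
      where
      open ≡-Reasoning
      d = -[1+ i ]
      c = ℤ.- + (a ℕ.∸ i)
      dc : d ℤ.+ c ≡ -[1+ a ]
      dc = trans (sym (ℤ.neg-distrib-+ (+ suc i) (+ (a ℕ.∸ i)))) (cong ℤ.-_ (split-+ a i lt))
      neg2 : ∀ x → - ((- 1ℚ) * x) ≡ x
      neg2 = solve-∀ ℚR

-- Both sides have the same commutators with all J_c and the same vacuum expectations.
module _ {A : Fn → Fn} (A-lin : Lin A) (A-resp : ∀ {f} → Resp f → Resp (A f))
  (sh : ℤ → ℤ) (sh-minus : ∀ n c → sh n ℤ.- c ≡ sh (n ℤ.- c)) (O : ℤ → Seq → Seq) (O-op : ∀ n → SOp (O n))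
  (step : ∀ c n {f} m k → c ≢ + 0 → Pol f → U (λ j → comm c (bracket A j) n f m) k ≡
    O n (Δ c (λ j → X j (sh (n ℤ.- c)) f m)) k - Δ c (O (n ℤ.- c) (λ j → X j (sh (n ℤ.- c)) f m)) k + Δ c (U (λ j → bracket A j (n ℤ.- c) f m)) k)
  (base : ∀ n k → U (λ j → bracket A j n vac []) k ≡ O n (λ j → X j (sh n) vac []) k) where

  private
    -- The difference of the two sides. `uniqueness` applies because its commutator with J_c is
    -- again given by q^c - 1.
    gap : ℕ → Fam
    gap k n f m = U (λ j → bracket A j n f m) k - O n (λ j → X j (sh n) f m) k

    br-fam = bracket-isFam A-lin A-resp

    gap-fam : ∀ k → IsFam (gap k)
    gap-fam k .lin n c {s} {t} e m = trans (cong₂ _-_ (U-lin c (λ j → lin (br-fam j) n c e m) k) (slin (O-op n) c (λ j → lin (X-isFam j) (sh n) c e m) k))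
        (l c (U (λ j → bracket A j n s m) k) (U (λ j → bracket A j n t m) k) (O n (λ j → X j (sh n) s m) k) (O n (λ j → X j (sh n) t m) k))
      where
      l : ∀ r x y x' y' → r * x + y - (r * x' + y') ≡ r * (x - x') + (y - y')
      l = solve-∀ ℚR
    gap-fam k .resp n r e = cong₂ _-_ (lin-cong U-lin (λ j → resp (br-fam j) n r e) k) (lin-cong (slin (O-op n)) (λ j → resp (X-isFam j) (sh n) r e) k)

    gap-comm : ∀ k c n {f} m → c ≢ + 0 → Pol f → comm c (gap k) n f m ≡ Δ c (λ j → gap j (n ℤ.- c) f m) k
    gap-comm k c n {f} m ne p = begin
      J c (gap k n f) m - gap k n (J c f) m
        ≡⟨ cong (_- gap k n (J c f) m) (trans (lin-- (J-lin c) {s = λ m → U (λ j → bracket A j n f m) k} {t = λ m → O n (λ j → X j (sh n) f m) k} (λ _ → refl) m)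
             (cong₂ _-_ (U-nat (J-lin c) (λ j → bracket A j n f) m k) (snat (O-op n) (J-lin c) (λ j → X j (sh n) f) m k))) ⟩
      U (λ j → J c (bracket A j n f) m) k - O n (λ j → J c (X j (sh n) f) m) k - (U (λ j → bracket A j n (J c f) m) k - O n (λ j → X j (sh n) (J c f) m) k)
        ≡⟨ l (U (λ j → J c (bracket A j n f) m) k) (O n (λ j → J c (X j (sh n) f) m) k) (U (λ j → bracket A j n (J c f) m) k) (O n (λ j → X j (sh n) (J c f) m) k) ⟩
      (U (λ j → J c (bracket A j n f) m) k - U (λ j → bracket A j n (J c f) m) k) - (O n (λ j → J c (X j (sh n) f) m) k - O n (λ j → X j (sh n) (J c f) m) k)
        ≡⟨ cong₂ _-_ (sym (lin-- U-lin (λ _ → refl) k)) (sym (lin-- (slin (O-op n)) (λ _ → refl) k)) ⟩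
      U (λ j → comm c (bracket A j) n f m) k - O n (λ j → comm c (X j) (sh n) f m) k
        ≡⟨ cong₂ _-_ (step c n m k ne p) (lin-cong (slin (O-op n)) (λ j → trans (X-comm j c (sh n) m (Pol-resp p)) (cong (λ z → Δ c (λ j → X j z f m) j) (sh-minus n c))) k) ⟩
      (O n (Δ c z) k - Δ c (O (n ℤ.- c) z) k + Δ c (U q) k) - O n (Δ c z) k
        ≡⟨ l2 (O n (Δ c z) k) (Δ c (O (n ℤ.- c) z) k) (Δ c (U q) k) ⟩
      Δ c (U q) k - Δ c (O (n ℤ.- c) z) k
        ≡⟨ sym (lin-- (slin (Δ-op c)) (λ _ → refl) k) ⟩
      Δ c (λ j → gap j (n ℤ.- c) f m) k ∎
      where
      open ≡-Reasoning
      q z : Seq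
      q j = bracket A j (n ℤ.- c) f m
      z j = X j (sh (n ℤ.- c)) f m
      l : ∀ a b c d → a - b - (c - d) ≡ (a - c) - (b - d)
      l = solve-∀ ℚR
      l2 : ∀ a b c → (a - b + c) - a ≡ c - b
      l2 = solve-∀ ℚR

    gap-vac : ∀ k n → gap k n vac [] ≡ 0ℚ
    gap-vac k n = trans (cong (_- O n (λ j → X j (sh n) vac []) k) (base n k)) (ℚ.+-inverseʳ (O n (λ j → X j (sh n) vac []) k))

  bracket-X : ∀ k n {f} m → Pol f → U (λ j → bracket A j n f m) k ≡ O n (λ j → X j (sh n) f m) k
  bracket-X k n {f} m p = trans (l (U (λ j → bracket A j n f m) k) (O n (λ j → X j (sh n) f m) k)) (trans (cong (_+ O n (λ j → X j (sh n) f m) k) (uniqueness gap gap-fam gap-comm gap-vac p k n m)) (ℚ.+-identityˡ _))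
    where
    l : ∀ x y → x ≡ x - y + y
    l = solve-∀ ℚR

Δ-U : ∀ c q k → U (Δ c q) k ≡ Δ c (U q) k
Δ-U c q k = trans (lin-- U-lin (λ _ → refl) k) (cong (_- U q k) (U-Sᶻ c q k))

-- u [Λ_{-b}, X(n)] = BΛ_{b,n} X(n-b)
Λ-X : ∀ b → b ≢ + 0 → ∀ k n {f} m → Pol f → U (λ j → bracket (Λ (ℤ.- b)) j n f m) k ≡ BΛ b n (λ j → X j (n ℤ.- b) f m) k
Λ-X b b≢0 = bracket-X (lin Λ-isFam (ℤ.- b)) (resp Λ-isFam (ℤ.- b)) (ℤ._- b) (λ n c → minus-swap n b c) (BΛ b) (BΛ-op b) step
    (λ n k → trans (vacuum b b≢0 n k) (sym (BΛ-vac b n (vev (n ℤ.- b)) (vev-θ (n ℤ.- b)) (vev-degree (n ℤ.- b)) k)))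
  where
  A = Λ (ℤ.- b)
  minus-swap : ∀ n b c → n ℤ.- b ℤ.- c ≡ n ℤ.- c ℤ.- b
  minus-swap n b c = trans (minus-minus n b c refl) (trans (cong (λ z → n ℤ.- z) (ℤ.+-comm b c)) (sym (minus-minus n c b refl)))
  step : ∀ c n {f} m k → c ≢ + 0 → Pol f → U (λ j → comm c (bracket A j) n f m) k ≡
    BΛ b n (Δ c (λ j → X j (n ℤ.- c ℤ.- b) f m)) k - Δ c (BΛ b (n ℤ.- c) (λ j → X j (n ℤ.- c ℤ.- b) f m)) k + Δ c (U (λ j → bracket A j (n ℤ.- c) f m)) k
  step c n {f} m k _ p = trans (U-lin (ι c + ι c) bc k) (trans (cong (λ y → (ι c + ι c) * U (Δ (b ℤ.+ c) z) k + y) (Δ-U c q k))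
      (trans (l ((ι c + ι c) * U (Δ (b ℤ.+ c) z) k) (Δ c (U q) k) (Δ c (BΛ b (n ℤ.- c) z) k)) (cong (λ y → y - Δ c (BΛ b (n ℤ.- c) z) k + Δ c (U q) k) (sym (BΛ-Δ b n c z k)))))
    where
    q z : Seq
    q j = bracket A j (n ℤ.- c) f m
    z j = X j (n ℤ.- c ℤ.- b) f m
    cb : c ℤ.- (ℤ.- b) ≡ b ℤ.+ c
    cb = trans (cong (λ z → c ℤ.+ z) (ℤ.neg-involutive b)) (ℤ.+-comm c b)
    bc : ∀ j → comm c (bracket A j) n f m ≡ (ι c + ι c) * Δ (b ℤ.+ c) z j + Δ c q j
    bc j = trans (bracket-comm (lin Λ-isFam (ℤ.- b)) (resp Λ-isFam (ℤ.- b)) c (ι c + ι c) (J (c ℤ.- (ℤ.- b))) (λ m r → Λ-comm c (ℤ.- b) m r) j n m (Pol-resp p))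
      (cong (λ y → (ι c + ι c) * y + Δ c q j) (trans (cong (λ z → J z (X j n f) m - X j n (J z f) m) cb)
        (trans (X-comm j (b ℤ.+ c) n m (Pol-resp p)) (cong (λ z → Δ (b ℤ.+ c) (λ j → X j z f m) j) (sym (minus-minus n c b (ℤ.+-comm c b)))))))
    l : ∀ a b c → a + b ≡ (c + a) - c + b
    l = solve-∀ ℚR
  vacuum : ∀ b → b ≢ + 0 → ∀ n k → let x = vev (n ℤ.- b) in U (λ j → bracket (Λ (ℤ.- b)) j n vac []) k ≡ ι b * (U (Sᶻ b x) k + U x k) - (Sᶻ (ℤ.suc b) x k - S x k) - (Sᶻ b x k - x k)
  vacuum (+ zero) ne = ⊥-elim (ne refl)
  vacuum (+ suc b) _ = vev-bracket⁺ b
  vacuum -[1+ a ] _ = vev-bracket⁻ a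

T-[] : ∀ f → T f [] ≡ 0ℚ
T-[] f = ℚ.*-zeroʳ ⅓

T-vac : ∀ m → T vac m ≡ 0ℚ
T-vac m = trans (cong (⅓ *_) (Σ<-zero (bnd (+ 0) m) (λ i → trans (cong₂ _+_ (lin-zero (J-lin -[1+ i ]) (Λ⁻-vac i) m) (lin-zero (lin Λ-isFam (+ suc i)) (J⁺-vac (suc i)) m)) (ℚ.+-identityʳ 0ℚ)))) (ℚ.*-zeroʳ ⅓)

-- u [T, X(n)] = DT_n X(n)
T-X : ∀ k n {f} m → Pol f → U (λ j → bracket T j n f m) k ≡ DT n (λ j → X j n f m) k
T-X = bracket-X T-lin T-resp (λ n → n) (λ _ _ → refl) DT DT-op step
    (λ n k → trans (lin-zero U-lin (λ j → trans (cong₂ _-_ (T-[] (X j n vac)) (lin-zero (lin (X-isFam j) n) T-vac [])) (ℚ.+-inverseʳ 0ℚ)) k) (sym (DT-vac n k)))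
  where
  step : ∀ c n {f} m k → c ≢ + 0 → Pol f → U (λ j → comm c (bracket T j) n f m) k ≡
    DT n (Δ c (λ j → X j (n ℤ.- c) f m)) k - Δ c (DT (n ℤ.- c) (λ j → X j (n ℤ.- c) f m)) k + Δ c (U (λ j → bracket T j (n ℤ.- c) f m)) k
  step c n {f} m k ne p = trans (U-lin (ι c) (λ j → bracket-comm T-lin T-resp c (ι c) (Λ (ℤ.- c)) (λ m r → T-comm c m r) j n m (Pol-resp p)) k)
      -- `Λ-X` is available for nonzero `c` only, which is why `uniqueness` asks for the commutators
      -- with nonzero modes.
      (trans (cong₂ (λ x y → ι c * x + y) (Λ-X c ne k n m p) (Δ-U c q k))
      (trans (l (ι c * BΛ c n z k) (Δ c (U q) k) (Δ c (DT (n ℤ.- c) z) k)) (cong (λ y → y - Δ c (DT (n ℤ.- c) z) k + Δ c (U q) k) (sym (DT-Δ n c z k)))))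
    where
    q z : Seq
    q j = bracket T j (n ℤ.- c) f m
    z j = X j (n ℤ.- c) f m
    l : ∀ a b c → a + b ≡ (a + c) - c + b
    l = solve-∀ ℚR
  -- DT_n contains the factor n, and n ⟨X(n)⟩ = 0.
  DT-vac : ∀ n k → DT n (vev n) k ≡ 0ℚ
  DT-vac n k = trans (sym (lin-* (slin K) (ι n) {s = vev n} (λ _ → refl) k)) (lin-zero (slin K) (vev-degree n) k)
    where K = +-op H-op (*-op (1ℚ - ι n) U-op)

-- The commutator of C with P_k

½ : ℚ
½ = recip 1

2*½ : 2ℚ * ½ ≡ 1ℚ
2*½ = trans (ℚ.*-comm 2ℚ ½) (trans (cong (½ *_) (sym (trans (ι-suc 1) (cong (λ z → 1ℚ + z) ι1)))) (recip-ι 1))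

-- P k = P^{(k+1)}_{-1} / (k+1).
P : ℕ → Fn → Fn
P k f m = recip k * X (suc k) (+ 1) f m

-- The operators P_k are the falling factorials of ad C applied to p₁.
C-P : ∀ k {f} m → Pol f → ½ * (T (P k f) m - P k (T f) m) ≡ P (suc k) f m + ι (+ k) * P k f m
C-P k {f} m p = begin
  ½ * (T (P k f) m - recip k * X (suc k) (+ 1) (T f) m)
    ≡⟨ cong (λ z → ½ * (z - recip k * X (suc k) (+ 1) (T f) m)) (lin-* T-lin (recip k) {s = X (suc k) (+ 1) f} (λ _ → refl) m) ⟩
  ½ * (recip k * T (X (suc k) (+ 1) f) m - recip k * X (suc k) (+ 1) (T f) m)
    ≡⟨ l1 ½ (recip k) (T (X (suc k) (+ 1) f) m) (X (suc k) (+ 1) (T f) m) ⟩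
  ½ * (recip k * q)
    ≡⟨ cong (λ z → ½ * (recip k * z)) (ι-suc-cancel (suc k) qe) ⟩
  ½ * (recip k * (2ℚ * (ι (+ suc k) * (recip (suc k) * x₂ + ι (+ k) * (recip k * x₁)))))
    ≡⟨ l2 ½ (recip k) 2ℚ (ι (+ suc k)) (recip (suc k) * x₂ + ι (+ k) * (recip k * x₁)) ⟩
  (2ℚ * ½) * (recip k * ι (+ suc k)) * (recip (suc k) * x₂ + ι (+ k) * (recip k * x₁))
    ≡⟨ cong₂ (λ a b → a * b * (recip (suc k) * x₂ + ι (+ k) * (recip k * x₁))) 2*½ (recip-ι k) ⟩
  1ℚ * 1ℚ * (recip (suc k) * x₂ + ι (+ k) * (recip k * x₁))
    ≡⟨ l3 (recip (suc k) * x₂ + ι (+ k) * (recip k * x₁)) ⟩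
  recip (suc k) * x₂ + ι (+ k) * (recip k * x₁) ∎
  where
  open ≡-Reasoning
  x : Seq
  x j = X j (+ 1) f m
  x₁ = x (suc k)
  x₂ = x (suc (suc k))
  q = bracket T (suc k) (+ 1) f m
  I = ι (+ suc (suc k))
  l1 : ∀ h r a b → h * (r * a - r * b) ≡ h * (r * (a - b))
  l1 = solve-∀ ℚR
  l2 : ∀ h r t i z → h * (r * (t * (i * z))) ≡ (t * h) * (r * i) * z
  l2 = solve-∀ ℚR
  l3 : ∀ z → 1ℚ * 1ℚ * z ≡ z
  l3 = solve-∀ ℚR
  qe : I * q ≡ I * (2ℚ * (ι (+ suc k) * (recip (suc k) * x₂ + ι (+ k) * (recip k * x₁))))
  qe = begin
    I * q
      -- The index is k + 2 because there `U` yields k + 2 times the bracket of `X (suc k)`; this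
      -- factor is cancelled afterwards. In degree 1 the summand (1 - n) u of `DT` vanishes.
      ≡⟨ T-X (suc (suc k)) (+ 1) m p ⟩
    ι (+ 1) * (2ℚ * (I * (x₂ + ι (+ suc k) * x₁)) + (- 2ℚ) * (x₂ + I * x₁) + (1ℚ - ι (+ 1)) * (I * x₁))
      ≡⟨ cong₂ (λ i j → i * (2ℚ * (j * (x₂ + ι (+ suc k) * x₁)) + (- 2ℚ) * (x₂ + j * x₁) + (1ℚ - i) * (j * x₁))) ι1 Ik ⟩
    1ℚ * (2ℚ * (i2 * (x₂ + ι (+ suc k) * x₁)) + (- 2ℚ) * (x₂ + i2 * x₁) + (1ℚ - 1ℚ) * (i2 * x₁))
      ≡⟨ cong (λ z → 1ℚ * (2ℚ * (i2 * (x₂ + z * x₁)) + (- 2ℚ) * (x₂ + i2 * x₁) + (1ℚ - 1ℚ) * (i2 * x₁))) (ι-suc k) ⟩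
    1ℚ * (2ℚ * (i2 * (x₂ + (1ℚ + ι (+ k)) * x₁)) + (- 2ℚ) * (x₂ + i2 * x₁) + (1ℚ - 1ℚ) * (i2 * x₁))
      ≡⟨ l4 2ℚ (ι (+ k)) x₁ x₂ ⟩
    2ℚ * ((1ℚ + ι (+ k)) * x₂ + (1ℚ + (1ℚ + ι (+ k))) * (ι (+ k) * x₁))
      ≡⟨ cong₂ (λ a b → 2ℚ * (a * x₂ + b * (ι (+ k) * x₁))) (sym (ι-suc k)) (sym Ik) ⟩
    2ℚ * (ι (+ suc k) * x₂ + I * (ι (+ k) * x₁))
      ≡⟨ cong₂ (λ a b → 2ℚ * (a + b)) (sym (trans (l6 (recip (suc k)) I (ι (+ suc k)) x₂) (trans (cong (λ z → z * (ι (+ suc k) * x₂)) (recip-ι (suc k))) (ℚ.*-identityˡ (ι (+ suc k) * x₂)))))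
             (sym (trans (l7 (recip k) (ι (+ suc k)) I (ι (+ k) * x₁)) (trans (cong (λ z → z * (I * (ι (+ k) * x₁))) (recip-ι k)) (ℚ.*-identityˡ (I * (ι (+ k) * x₁)))))) ⟩
    2ℚ * (I * (ι (+ suc k) * (recip (suc k) * x₂)) + I * (ι (+ suc k) * (recip k * (ι (+ k) * x₁))))
      ≡⟨ l5 2ℚ I (ι (+ suc k)) (recip (suc k) * x₂) (recip k) (ι (+ k)) x₁ ⟩
    I * (2ℚ * (ι (+ suc k) * (recip (suc k) * x₂ + ι (+ k) * (recip k * x₁)))) ∎
    where
    i2 = 1ℚ + (1ℚ + ι (+ k))
    Ik : I ≡ i2
    Ik = trans (ι-suc (suc k)) (cong (λ z → 1ℚ + z) (ι-suc k))
    l4 : ∀ t k a b → 1ℚ * (t * ((1ℚ + (1ℚ + k)) * (b + (1ℚ + k) * a)) + (- t) * (b + (1ℚ + (1ℚ + k)) * a) + (1ℚ - 1ℚ) * ((1ℚ + (1ℚ + k)) * a)) ≡ t * ((1ℚ + k) * b + (1ℚ + (1ℚ + k)) * (k * a))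
    l4 = solve-∀ ℚR
    l5 : ∀ t I i a r k b → t * (I * (i * a) + I * (i * (r * (k * b)))) ≡ I * (t * (i * (a + k * (r * b))))
    l5 = solve-∀ ℚR
    l6 : ∀ r I i x → I * (i * (r * x)) ≡ (r * I) * (i * x)
    l6 = solve-∀ ℚR
    l7 : ∀ r i I x → I * (i * (r * x)) ≡ (r * i) * (I * x)
    l7 = solve-∀ ℚR

-- Modes of the differential polynomials `PD`

-- The term J^{(e_1)} ⋯ J^{(e_j)} of P^{(k)}, in degree n.
Nᵂ : ℕ → ℕ → Fam → Fam
Nᵂ K e φ n f m = Σ< K (λ i → ι (ff -[1+ i ] e) * J -[1+ i ] (φ (n ℤ.+ -[1+ i ]) f) m + ι (ff (+ suc i) e) * φ (n ℤ.+ + suc i) (J (+ suc i) f) m)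

Y : List ℕ → Fam
Y [] n f m = δ n * f m
Y (e ∷ es) n f m = Nᵂ (bnd n m) e (Y es) n f m

-- The conformal weight of the term: its part of degree n carries z to the power n - `order es`.
order : List ℕ → ℕ
order [] = 0
order (e ∷ es) = suc e ℕ.+ order es

Y-lin : ∀ es n → Lin (Y es n)
Y-lin [] n c {s} {t} e m = trans (cong (δ n *_) (e m)) (l c (δ n) (s m) (t m))
  where
  l : ∀ c d x y → d * (c * x + y) ≡ c * (d * x) + d * y
  l = solve-∀ ℚR
Y-lin (k ∷ es) n c {s} {t} e m = Σ<-lin (bnd n m) c (λ i →
    trans (cong₂ (λ x y → ι (ff -[1+ i ] k) * x + ι (ff (+ suc i) k) * y) (J-lin -[1+ i ] c (Y-lin es (n ℤ.+ -[1+ i ]) c e) m) (Y-lin es (n ℤ.+ + suc i) c (J-lin (+ suc i) c e) m))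
      (l c (ι (ff -[1+ i ] k)) (ι (ff (+ suc i) k)) (J -[1+ i ] (Y es (n ℤ.+ -[1+ i ]) s) m) (J -[1+ i ] (Y es (n ℤ.+ -[1+ i ]) t) m) (Y es (n ℤ.+ + suc i) (J (+ suc i) s) m) (Y es (n ℤ.+ + suc i) (J (+ suc i) t) m)))
  where
  l : ∀ c a b x y x' y' → a * (c * x + y) + b * (c * x' + y') ≡ c * (a * x + b * x') + (a * y + b * y')
  l = solve-∀ ℚR

wzero : ∀ a b {x y} → x ≡ 0ℚ → y ≡ 0ℚ → a * x + b * y ≡ 0ℚ
wzero a b refl refl = l a b
  where
  l : ∀ a b → a * 0ℚ + b * 0ℚ ≡ 0ℚ
  l = solve-∀ ℚR

Y-local : ∀ es → Local (Y es)
Y-local [] (suc p) f m lt = ℚ.*-zeroˡ (f m)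
Y-local (e ∷ es) p f m lt = Σ<-zero (bnd (+ p) m) (λ i → wzero (ι (ff -[1+ i ] e)) (ι (ff (+ suc i) e)) (J⁻-φ-zero {Y es} (Y-local es) p f m i lt)
   (Y-local es (p ℕ.+ suc i) (J (+ suc i) f) m (ℕ.≤-trans lt (ℕ.m≤m+n p (suc i)))))

Y-stable : ∀ e es n f m K → bnd n m ≤ K → Nᵂ K e (Y es) n f m ≡ Y (e ∷ es) n f m
Y-stable e es n f m K h = Σ<-stable term h
  where
  term : ∀ i → bnd n m ≤ i → ι (ff -[1+ i ] e) * J -[1+ i ] (Y es (n ℤ.+ -[1+ i ]) f) m + ι (ff (+ suc i) e) * Y es (n ℤ.+ + suc i) (J (+ suc i) f) m ≡ 0ℚ
  term i b with shift⁺ n i (w m) b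
  ... | p , q , lt = wzero (ι (ff -[1+ i ] e)) (ι (ff (+ suc i) e)) (J⁻-zero i m (Y es (n ℤ.+ -[1+ i ]) f) (lk-bound m i (ℕ.≤-trans (ℕ.m≤m+n (w m) _) b)))
      (trans (cong (λ z → Y es z (J (+ suc i) f) m) q) (Y-local es p (J (+ suc i) f) m lt))

-- In other words, only t_1, ..., t_N occur in `f`.
Bounded : ℕ → Fn → Set
Bounded N f = ∀ i m → N ≤ i → J (+ suc i) f m ≡ 0ℚ

J⁺-bounded : ∀ {N f} j → Resp f → Bounded N f → Bounded N (J (+ suc j) f)
J⁺-bounded {N} {f} j r b i m h = trans (l (J (+ suc i) (J (+ suc j) f) m) (J (+ suc j) (J (+ suc i) f) m))
   (trans (cong₂ _+_ (JJ (+ suc i) (+ suc j) f m r) (lin-zero (J-lin (+ suc j)) (λ m → b i m h) m)) (trans (ℚ.+-identityʳ _) (sym (zero-rhs (ι (+ suc i)) (f m) refl))))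
  where
  l : ∀ x y → x ≡ x - y + y
  l = solve-∀ ℚR

ℤ-swap : ∀ a b c → a ℤ.+ b ℤ.+ c ≡ a ℤ.+ c ℤ.+ b
ℤ-swap a b c = trans (ℤ.+-assoc a b c) (trans (cong (λ z → a ℤ.+ z) (ℤ.+-comm b c)) (sym (ℤ.+-assoc a c b)))

step-bound : ∀ N j n c x → n ℤ.+ + (suc j ℕ.* N) ≡ x → n ℤ.+ c ℤ.+ + (j ℕ.* N) ≡ x ℤ.+ (c ℤ.- + N)
step-bound N j n c x e = begin
  n ℤ.+ c ℤ.+ y                     ≡⟨ ℤ-swap n c y ⟩
  n ℤ.+ y ℤ.+ c                     ≡⟨ cong (ℤ._+ c) (sym cancel) ⟩
  n ℤ.+ + (suc j ℕ.* N) ℤ.- + N ℤ.+ c ≡⟨ cong (λ z → z ℤ.- + N ℤ.+ c) e ⟩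
  x ℤ.- + N ℤ.+ c                   ≡⟨ ℤ-swap x (ℤ.- + N) c ⟩
  x ℤ.+ c ℤ.- + N                   ≡⟨ ℤ.+-assoc x c (ℤ.- + N) ⟩
  x ℤ.+ (c ℤ.- + N)                 ∎
  where
  open ≡-Reasoning
  y = + (j ℕ.* N)
  cancel : n ℤ.+ + (suc j ℕ.* N) ℤ.- + N ≡ n ℤ.+ y
  cancel = trans (cong (λ z → n ℤ.+ z ℤ.- + N) (ℤ.+-comm (+ N) y)) (trans (cong (ℤ._- + N) (sym (ℤ.+-assoc n y (+ N)))) (trans (ℤ.+-assoc (n ℤ.+ y) (+ N) (ℤ.- + N)) (trans (cong (λ z → n ℤ.+ y ℤ.+ z) (ℤ.+-inverseʳ (+ N))) (ℤ.+-identityʳ _))))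

⁺-N : ∀ N i → i < N → + suc i ℤ.- + N ≡ ℤ.- + (N ℕ.∸ suc i)
⁺-N (suc N) i lt = ℤ.⊖-≤ lt

⁻-N : ∀ N i → -[1+ i ] ℤ.- + N ≡ -[1+ i ℕ.+ N ]
⁻-N zero i = cong -[1+_] (sym (ℕ.+-identityʳ i))
⁻-N (suc N) i = cong -[1+_] (sym (ℕ.+-suc i N))

neg+neg : ∀ p q → -[1+ p ] ℤ.- + q ≡ -[1+ p ℕ.+ q ]
neg+neg p q = ⁻-N q p

-- Annihilation modes beyond `N` give zero, so each factor lowers the degree by at most `N`, and a
-- degree below - j N is out of reach of j factors.
Y-vanish : ∀ N es n p {f} m → Resp f → Bounded N f → n ℤ.+ + (length es ℕ.* N) ≡ -[1+ p ] → Y es n f m ≡ 0ℚ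
Y-vanish N [] n p {f} m r b e = trans (cong (_* f m) (δ-no (λ z → case trans (sym e) (trans (ℤ.+-identityʳ n) z) of λ ()))) (ℚ.*-zeroˡ (f m))
Y-vanish N (k ∷ es) n p {f} m r b e = Σ<-zero (bnd n m) (λ i → wzero (ι (ff -[1+ i ] k)) (ι (ff (+ suc i) k))
    (lin-zero (J-lin -[1+ i ]) (λ m → Y-vanish N es (n ℤ.+ -[1+ i ]) (suc (p ℕ.+ (i ℕ.+ N))) m r b
       (trans (step-bound N (length es) n -[1+ i ] -[1+ p ] e) (cong (λ z → -[1+ p ] ℤ.+ z) (⁻-N N i)))) m)
    (second i))
  where
  second : ∀ i → Y es (n ℤ.+ + suc i) (J (+ suc i) f) m ≡ 0ℚ
  second i with i ℕ.<? N
  ... | yes lt = Y-vanish N es (n ℤ.+ + suc i) (p ℕ.+ (N ℕ.∸ suc i)) m (J-resp (+ suc i) r) (J⁺-bounded i r b)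
        (trans (step-bound N (length es) n (+ suc i) -[1+ p ] e) (trans (cong (λ z → -[1+ p ] ℤ.+ z) (⁺-N N i lt)) (neg+neg p (N ℕ.∸ suc i))))
  ... | no ge = lin-zero (Y-lin es (n ℤ.+ + suc i)) (λ m → b i m (ℕ.≮⇒≥ ge)) m

-- The same sum over the finite range -B ≤ a ≤ N that Pmode uses.
Yᴿ : ℕ → ℕ → List ℕ → Fam
Yᴿ B N [] n f m = δ n * f m
Yᴿ B N (e ∷ es) n f m = Σ< B (λ i → ι (ff -[1+ i ] e) * J -[1+ i ] (Yᴿ B N es (n ℤ.+ -[1+ i ]) f) m)
  + Σ< N (λ i → ι (ff (+ suc i) e) * Yᴿ B N es (n ℤ.+ + suc i) (J (+ suc i) f) m)

minus-⊖ : ∀ B q c → (+ B ℤ.- + q) ℤ.- + c ≡ + B ℤ.- + (q ℕ.+ c)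
minus-⊖ B q c = minus-minus (+ B) (+ q) (+ c) refl

beyond : ∀ B q i N → B ≤ i → (+ B ℤ.- + q) ℤ.+ (-[1+ i ] ℤ.- + N) ≡ -[1+ (i ℕ.∸ B) ℕ.+ (q ℕ.+ N) ]
beyond B q i N h = begin
  (+ B ℤ.- + q) ℤ.+ (-[1+ i ] ℤ.- + N)   ≡⟨ sym (ℤ.+-assoc (+ B ℤ.- + q) -[1+ i ] (ℤ.- + N)) ⟩
  (+ B ℤ.- + q) ℤ.+ -[1+ i ] ℤ.- + N     ≡⟨ cong (ℤ._- + N) (ℤ-swap (+ B) (ℤ.- + q) -[1+ i ]) ⟩
  + B ℤ.+ -[1+ i ] ℤ.- + q ℤ.- + N       ≡⟨ cong (λ z → z ℤ.- + q ℤ.- + N) (trans (ℤ.⊖-≤ (ℕ.m≤n⇒m≤1+n h)) (cong (λ z → ℤ.- + z) (ℕ.+-∸-assoc 1 h))) ⟩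
  -[1+ i ℕ.∸ B ] ℤ.- + q ℤ.- + N         ≡⟨ minus-minus -[1+ i ℕ.∸ B ] (+ q) (+ N) refl ⟩
  -[1+ i ℕ.∸ B ] ℤ.- + (q ℕ.+ N)         ≡⟨ neg+neg (i ℕ.∸ B) (q ℕ.+ N) ⟩
  -[1+ (i ℕ.∸ B) ℕ.+ (q ℕ.+ N) ]         ∎
  where open ≡-Reasoning

-- The equation says n + j N ≤ B for j factors, with slack `q`. A creation mode beyond `B` would
-- leave the other factors a degree that `Y-vanish` excludes; annihilation modes beyond `N` kill
-- `f`.
Yᴿ≡Y : ∀ B N es n q {f} m → Resp f → Bounded N f → n ℤ.+ + (length es ℕ.* N) ≡ + B ℤ.- + q → Yᴿ B N es n f m ≡ Y es n f m
Yᴿ≡Y B N [] n q m r b e = refl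
Yᴿ≡Y B N (k ∷ es) n q {f} m r b e = begin
  Σ< B (λ i → a i * J -[1+ i ] (Yᴿ B N es (n ℤ.+ -[1+ i ]) f) m) + Σ< N (λ i → c i * Yᴿ B N es (n ℤ.+ + suc i) (J (+ suc i) f) m)
    ≡⟨ cong₂ _+_ (Σ<-cong B (λ i → cong (λ z → a i * (jc -[1+ i ] m * z)) (inner⁻ i (js -[1+ i ] m)))) (Σ<-cong< N (λ i lt → cong (c i *_) (inner⁺ i lt))) ⟩
  Σ< B g⁻ + Σ< N g⁺
    ≡⟨ cong₂ _+_ (sym (Σ<-stable {B} {K} out⁻ (ℕ.m≤m+n B _))) (sym (Σ<-stable {N} {K} out⁺ (ℕ.≤-trans (ℕ.m≤m+n N _) (ℕ.m≤n+m _ B)))) ⟩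
  Σ< K g⁻ + Σ< K g⁺
    ≡⟨ sym (lin-+ (Σ<-Lin K) (λ _ → refl) 0) ⟩
  Nᵂ K k (Y es) n f m
    ≡⟨ Y-stable k es n f m K (ℕ.≤-trans (ℕ.m≤n+m (bnd n m) N) (ℕ.m≤n+m _ B)) ⟩
  Y (k ∷ es) n f m ∎
  where
  open ≡-Reasoning
  K = B ℕ.+ (N ℕ.+ bnd n m)
  a c g⁻ g⁺ : ℕ → ℚ
  a i = ι (ff -[1+ i ] k)
  c i = ι (ff (+ suc i) k)
  g⁻ i = a i * J -[1+ i ] (Y es (n ℤ.+ -[1+ i ]) f) m
  g⁺ i = c i * Y es (n ℤ.+ + suc i) (J (+ suc i) f) m
  x = + B ℤ.- + q
  inner⁻ : ∀ i m → Yᴿ B N es (n ℤ.+ -[1+ i ]) f m ≡ Y es (n ℤ.+ -[1+ i ]) f m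
  inner⁻ i m = Yᴿ≡Y B N es (n ℤ.+ -[1+ i ]) (q ℕ.+ (suc i ℕ.+ N)) m r b
    (trans (step-bound N (length es) n -[1+ i ] x e) (trans (cong (λ z → x ℤ.+ z) (⁻-N N i)) (minus-⊖ B q (suc i ℕ.+ N))))
  inner⁺ : ∀ i → i < N → Yᴿ B N es (n ℤ.+ + suc i) (J (+ suc i) f) m ≡ Y es (n ℤ.+ + suc i) (J (+ suc i) f) m
  inner⁺ i lt = Yᴿ≡Y B N es (n ℤ.+ + suc i) (q ℕ.+ (N ℕ.∸ suc i)) m (J-resp (+ suc i) r) (J⁺-bounded i r b)
    (trans (step-bound N (length es) n (+ suc i) x e) (trans (cong (λ z → x ℤ.+ z) (⁺-N N i lt)) (minus-⊖ B q (N ℕ.∸ suc i))))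
  out⁻ : ∀ i → B ≤ i → g⁻ i ≡ 0ℚ
  out⁻ i h = trans (cong (a i *_) (lin-zero (J-lin -[1+ i ]) (λ m → Y-vanish N es (n ℤ.+ -[1+ i ]) _ m r b
      (trans (step-bound N (length es) n -[1+ i ] x e) (beyond B q i N h))) m)) (ℚ.*-zeroʳ (a i))
  out⁺ : ∀ i → N ≤ i → g⁺ i ≡ 0ℚ
  out⁺ i h = trans (cong (c i *_) (lin-zero (Y-lin es (n ℤ.+ + suc i)) (λ m → b i m h) m)) (ℚ.*-zeroʳ (c i))

Yᴰ : DPoly → Fam
Yᴰ [] n f m = 0ℚ
Yᴰ ((c , es) ∷ D) n f m = ι (+ c) * Y es n f m + Yᴰ D n f m

Yᴰ-++ : ∀ D D' n f m → Yᴰ (D ++ D') n f m ≡ Yᴰ D n f m + Yᴰ D' n f m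
Yᴰ-++ [] D' n f m = sym (ℚ.+-identityˡ _)
Yᴰ-++ ((c , es) ∷ D) D' n f m = trans (cong (λ z → ι (+ c) * Y es n f m + z) (Yᴰ-++ D D' n f m)) (sym (ℚ.+-assoc (ι (+ c) * Y es n f m) (Yᴰ D n f m) (Yᴰ D' n f m)))

Y-Jtimes : ∀ es n f m → Y (0 ∷ es) n f m ≡ 𝒩 (Y es) n f m
Y-Jtimes es n f m = Σ<-cong (bnd n m) (λ i → trans (cong (λ z → z * J -[1+ i ] (Y es (n ℤ.+ -[1+ i ]) f) m + z * Y es (n ℤ.+ + suc i) (J (+ suc i) f) m) ι1)
  (cong₂ _+_ (ℚ.*-identityˡ (J -[1+ i ] (Y es (n ℤ.+ -[1+ i ]) f) m)) (ℚ.*-identityˡ (Y es (n ℤ.+ + suc i) (J (+ suc i) f) m))))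

Yᴰ-Jtimes : ∀ D n f m → Yᴰ (Jtimes D) n f m ≡ 𝒩 (Yᴰ D) n f m
Yᴰ-Jtimes [] n f m = sym (Σ<-zero (bnd n m) (λ i → trans (cong (_+ 0ℚ) (ℚ.*-zeroʳ (jc -[1+ i ] m))) (ℚ.+-identityʳ 0ℚ)))
Yᴰ-Jtimes ((c , es) ∷ D) n f m = trans (cong₂ (λ x y → ι (+ c) * x + y) (Y-Jtimes es n f m) (Yᴰ-Jtimes D n f m))
  (sym (N-Lin (bnd n m) (ι (+ c)) {s = λ { (n , f , m) → Y es n f m }} {t = λ { (n , f , m) → Yᴰ D n f m }} (λ _ → refl) (n , f , m)))

Σincr : List ℕ → Fam
Σincr es n f m = Yᴰ (map (λ es → (1 , es)) (incrEach es)) n f m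

Yᴰ-scale : ∀ c L n f m → Yᴰ (map (λ es → (c , es)) L) n f m ≡ ι (+ c) * Yᴰ (map (λ es → (1 , es)) L) n f m
Yᴰ-scale c [] n f m = sym (ℚ.*-zeroʳ (ι (+ c)))
Yᴰ-scale c (es ∷ L) n f m = trans (cong (λ z → ι (+ c) * Y es n f m + z) (Yᴰ-scale c L n f m))
  (trans (l (ι (+ c)) (Y es n f m) (Yᴰ (map (λ es → (1 , es)) L) n f m)) (cong (λ i → ι (+ c) * (i * Y es n f m + Yᴰ (map (λ es → (1 , es)) L) n f m)) (sym ι1)))
  where
  l : ∀ c x y → c * x + c * y ≡ c * (1ℚ * x + y)
  l = solve-∀ ℚR

Nᵂ-lin : ∀ K e c {φ ψ χ : Fam} → (∀ n f m → χ n f m ≡ c * φ n f m + ψ n f m) → ∀ n f m → Nᵂ K e χ n f m ≡ c * Nᵂ K e φ n f m + Nᵂ K e ψ n f m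
Nᵂ-lin K e c {φ} {ψ} h n f m = Σ<-lin K c (λ i → trans (cong₂ (λ x y → ι (ff -[1+ i ] e) * (jc -[1+ i ] m * x) + ι (ff (+ suc i) e) * y) (h (n ℤ.+ -[1+ i ]) f (js -[1+ i ] m)) (h (n ℤ.+ + suc i) (J (+ suc i) f) m))
   (l c (ι (ff -[1+ i ] e)) (jc -[1+ i ] m) (ι (ff (+ suc i) e)) (φ (n ℤ.+ -[1+ i ]) f (js -[1+ i ] m)) (ψ (n ℤ.+ -[1+ i ]) f (js -[1+ i ] m)) (φ (n ℤ.+ + suc i) (J (+ suc i) f) m) (ψ (n ℤ.+ + suc i) (J (+ suc i) f) m)))
  where
  l : ∀ c a j b x y x' y' → a * (j * (c * x + y)) + b * (c * x' + y') ≡ c * (a * (j * x) + b * x') + (a * (j * y) + b * y')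
  l = solve-∀ ℚR

Nᵂ-map : ∀ e L n f m → Yᴰ (map (λ es → (1 , es)) (map (e ∷_) L)) n f m ≡ Nᵂ (bnd n m) e (Yᴰ (map (λ es → (1 , es)) L)) n f m
Nᵂ-map e [] n f m = sym (Σ<-zero (bnd n m) (λ i → wzero (ι (ff -[1+ i ] e)) (ι (ff (+ suc i) e)) (ℚ.*-zeroʳ (jc -[1+ i ] m)) refl))
Nᵂ-map e (es ∷ L) n f m = trans (cong (λ z → ι (+ 1) * Y (e ∷ es) n f m + z) (Nᵂ-map e L n f m)) (sym (Nᵂ-lin (bnd n m) e (ι (+ 1)) {Y es} {Yᴰ (map (λ es → (1 , es)) L)} (λ _ _ _ → refl) n f m))

-- Differentiation in z multiplies by the exponent of z. The induction splits this exponent into the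
-- share of the first factor, by the recursion of `ff`, and that of the others.
Σincr-Y : ∀ es n f m → Σincr es n f m ≡ ι (n ℤ.- + order es) * Y es n f m
Σincr-Y [] n f m = trans (l (ι n) (f m)) (trans (cong (λ z → z * (f m)) (nδ n)) (trans (cong (λ i → i * δ n * f m) (cong ι (sym (ℤ.+-identityʳ n)))) (ℚ.*-assoc (ι (n ℤ.- + 0)) (δ n) (f m))))
  where
  l : ∀ i x → 0ℚ ≡ 0ℚ * x
  l = solve-∀ ℚR
  nδ : ∀ n → 0ℚ ≡ ι n * δ n
  nδ (+ zero) = sym (trans (cong (_* 1ℚ) ι0) (ℚ.*-zeroˡ 1ℚ))
  nδ (+ suc n) = sym (ℚ.*-zeroʳ (ι (+ suc n)))
  nδ -[1+ n ] = sym (ℚ.*-zeroʳ (ι -[1+ n ]))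
Σincr-Y (e ∷ es) n f m = begin
  ι (+ 1) * Y (suc e ∷ es) n f m + Yᴰ (map (λ es → (1 , es)) (map (e ∷_) (incrEach es))) n f m
    ≡⟨ cong₂ (λ i z → i * Y (suc e ∷ es) n f m + z) ι1 (Nᵂ-map e (incrEach es) n f m) ⟩
  1ℚ * Y (suc e ∷ es) n f m + Nᵂ L e (Σincr es) n f m
    ≡⟨ cong (_+ Nᵂ L e (Σincr es) n f m) (ℚ.*-identityˡ (Y (suc e ∷ es) n f m)) ⟩
  Σ< L (λ i → ι (ff -[1+ i ] (suc e)) * a i + ι (ff (+ suc i) (suc e)) * b i) + Nᵂ L e (Σincr es) n f m
    ≡⟨ sym (lin-+ (Σ<-Lin L) (λ _ → refl) 0) ⟩
  Σ< L (λ i → (ι (ff -[1+ i ] (suc e)) * a i + ι (ff (+ suc i) (suc e)) * b i) + (ι (ff -[1+ i ] e) * J -[1+ i ] (Σincr es (n ℤ.+ -[1+ i ]) f) m + ι (ff (+ suc i) e) * Σincr es (n ℤ.+ + suc i) (J (+ suc i) f) m))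
    ≡⟨ lin-* (Σ<-Lin L) (ι (n ℤ.- + order (e ∷ es))) term 0 ⟩
  ι (n ℤ.- + order (e ∷ es)) * Y (e ∷ es) n f m ∎
  where
  open ≡-Reasoning
  L = bnd n m
  a b : ℕ → ℚ
  a i = J -[1+ i ] (Y es (n ℤ.+ -[1+ i ]) f) m
  b i = Y es (n ℤ.+ + suc i) (J (+ suc i) f) m
  ffs-suc : ∀ c → ι (ff c (suc e)) + ι (n ℤ.+ c ℤ.- + order es) * ι (ff c e) ≡ ι (n ℤ.- + order (e ∷ es)) * ι (ff c e)
  ffs-suc c = trans (cong₂ (λ x y → x + y * ι (ff c e)) (trans (ι-* (ℤ.- c ℤ.- + suc e) (ff c e)) (cong (_* ι (ff c e)) (trans (ι-- (ℤ.- c) (+ suc e)) (cong (_- ι (+ suc e)) (ι-neg c))))) (trans (ι-- (n ℤ.+ c) (+ order es)) (cong (_- ι (+ order es)) (ι-+ n c))))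
    (trans (l (ι c) (ι (+ suc e)) (ι n) (ι (+ order es)) (ι (ff c e))) (cong (_* ι (ff c e)) (sym (trans (ι-- n (+ order (e ∷ es))) (cong (λ z → ι n - z) (ι-+ (+ suc e) (+ order es)))))))
    where
    l : ∀ c e n o x → (- c - e) * x + (n + c - o) * x ≡ (n - (e + o)) * x
    l = solve-∀ ℚR
  term : ∀ i → (ι (ff -[1+ i ] (suc e)) * a i + ι (ff (+ suc i) (suc e)) * b i) + (ι (ff -[1+ i ] e) * J -[1+ i ] (Σincr es (n ℤ.+ -[1+ i ]) f) m + ι (ff (+ suc i) e) * Σincr es (n ℤ.+ + suc i) (J (+ suc i) f) m)
    ≡ ι (n ℤ.- + order (e ∷ es)) * (ι (ff -[1+ i ] e) * a i + ι (ff (+ suc i) e) * b i)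
  term i = begin
    _ ≡⟨ cong₂ (λ x y → (ι (ff -[1+ i ] (suc e)) * a i + ι (ff (+ suc i) (suc e)) * b i) + (ι (ff -[1+ i ] e) * x + ι (ff (+ suc i) e) * y))
           (lin-* (J-lin -[1+ i ]) (ι (n ℤ.+ -[1+ i ] ℤ.- + order es)) (λ m → Σincr-Y es (n ℤ.+ -[1+ i ]) f m) m) (Σincr-Y es (n ℤ.+ + suc i) (J (+ suc i) f) m) ⟩
    _ ≡⟨ l (ι (ff -[1+ i ] (suc e))) (ι (ff (+ suc i) (suc e))) (ι (ff -[1+ i ] e)) (ι (ff (+ suc i) e)) (ι (n ℤ.+ -[1+ i ] ℤ.- + order es)) (ι (n ℤ.+ + suc i ℤ.- + order es)) (a i) (b i) ⟩
    (ι (ff -[1+ i ] (suc e)) + ι (n ℤ.+ -[1+ i ] ℤ.- + order es) * ι (ff -[1+ i ] e)) * a i + (ι (ff (+ suc i) (suc e)) + ι (n ℤ.+ + suc i ℤ.- + order es) * ι (ff (+ suc i) e)) * b i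
      ≡⟨ cong₂ (λ x y → x * a i + y * b i) (ffs-suc -[1+ i ]) (ffs-suc (+ suc i)) ⟩
    _ ≡⟨ l2 (ι (n ℤ.- + order (e ∷ es))) (ι (ff -[1+ i ] e)) (ι (ff (+ suc i) e)) (a i) (b i) ⟩
    ι (n ℤ.- + order (e ∷ es)) * (ι (ff -[1+ i ] e) * a i + ι (ff (+ suc i) e) * b i) ∎
    where
    l : ∀ s t p q u v a b → (s * a + t * b) + (p * (u * a) + q * (v * b)) ≡ (s + u * p) * a + (t + v * q) * b
    l = solve-∀ ℚR
    l2 : ∀ n p q a b → (n * p) * a + (n * q) * b ≡ n * (p * a + q * b)
    l2 = solve-∀ ℚR

HasOrder : ℕ → DPoly → Set
HasOrder k = All (λ u → order (proj₂ u) ≡ k)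

Yᴰ-∂z : ∀ k D → HasOrder k D → ∀ n f m → Yᴰ (∂z D) n f m ≡ ι (n ℤ.- + k) * Yᴰ D n f m
Yᴰ-∂z k [] [] n f m = sym (ℚ.*-zeroʳ (ι (n ℤ.- + k)))
Yᴰ-∂z k ((c , es) ∷ D) (refl ∷ h) n f m = trans (Yᴰ-++ (map (λ es → (c , es)) (incrEach es)) (∂z D) n f m)
  (trans (cong₂ _+_ (trans (Yᴰ-scale c (incrEach es) n f m) (cong (λ z → ι (+ c) * z) (Σincr-Y es n f m))) (Yᴰ-∂z k D h n f m)) (l (ι (+ c)) (ι (n ℤ.- + k)) (Y es n f m) (Yᴰ D n f m)))
  where
  l : ∀ c i x y → c * (i * x) + i * y ≡ i * (c * x + y)
  l = solve-∀ ℚR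

incrEach-order : ∀ es → All (λ es' → order es' ≡ suc (order es)) (incrEach es)
incrEach-order [] = []
incrEach-order (e ∷ es) = refl ∷ All.map⁺ (All.map (λ {x} p → trans (cong (suc e ℕ.+_) p) (ℕ.+-suc (suc e) (order es))) (incrEach-order es))

∂z-order : ∀ k D → HasOrder k D → HasOrder (suc k) (∂z D)
∂z-order k [] [] = []
∂z-order k ((c , es) ∷ D) (p ∷ h) = All.++⁺ (All.map⁺ (All.map (λ q → trans q (cong suc p)) (incrEach-order es))) (∂z-order k D h)

Jtimes-order : ∀ k D → HasOrder k D → HasOrder (suc k) (Jtimes D)
Jtimes-order k [] [] = []
Jtimes-order k (u ∷ D) (p ∷ h) = cong suc p ∷ Jtimes-order k D h

PD-order : ∀ k → HasOrder (suc k) (PD (suc k))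
PD-order zero = refl ∷ []
PD-order (suc k) = All.++⁺ (∂z-order (suc k) (PD (suc k)) (PD-order k)) (Jtimes-order (suc k) (PD (suc k)) (PD-order k))

-- The two summands of `PD` become the two summands in the recursion of `X`: differentiation gives
-- the scalar, and `Jtimes` gives `𝒩`.
PD-X : ∀ k n f m → Yᴰ (PD (suc k)) n f m ≡ X (suc k) n f m
PD-X zero n f m = trans (ℚ.+-identityʳ _) (trans (cong₂ _*_ ι1 (Y-Jtimes [] n f m)) (trans (ℚ.*-identityˡ (𝒩 (Y []) n f m)) (sym (trans (cong (_+ 𝒩 (X 0) n f m) (nδ n)) (ℚ.+-identityˡ (𝒩 (X 0) n f m))))))
  where
  nδ : ∀ n → ι (n ℤ.- + 0) * (δ n * f m) ≡ 0ℚ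
  nδ (+ zero) = trans (cong (_* (1ℚ * f m)) ι0) (ℚ.*-zeroˡ (1ℚ * f m))
  nδ (+ suc n) = trans (cong (λ z → ι (+ suc n ℤ.- + 0) * z) (ℚ.*-zeroˡ (f m))) (ℚ.*-zeroʳ (ι (+ suc n ℤ.- + 0)))
  nδ -[1+ n ] = trans (cong (λ z → ι (-[1+ n ] ℤ.- + 0) * z) (ℚ.*-zeroˡ (f m))) (ℚ.*-zeroʳ (ι (-[1+ n ] ℤ.- + 0)))
PD-X (suc k) n f m = trans (Yᴰ-++ (∂z (PD (suc k))) (Jtimes (PD (suc k))) n f m)
  (cong₂ _+_ (trans (Yᴰ-∂z (suc k) (PD (suc k)) (PD-order k) n f m) (cong (λ z → ι (n ℤ.- + suc k) * z) (PD-X k n f m)))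
    (trans (Yᴰ-Jtimes (PD (suc k)) n f m) (lin-cong (N-Lin (bnd n m)) {s = λ { (n , f , m) → Yᴰ (PD (suc k)) n f m }} {t = λ { (n , f , m) → X (suc k) n f m }} (λ { (n , f , m) → PD-X k n f m }) (n , f , m))))

-- Polynomials

⟦_⟧ : Bool → ℚ
⟦ true ⟧ = 1ℚ
⟦ false ⟧ = 0ℚ

⟦∧⟧ : ∀ a b → ⟦ a ∧ b ⟧ ≡ ⟦ a ⟧ * ⟦ b ⟧
⟦∧⟧ true b = sym (ℚ.*-identityˡ ⟦ b ⟧)
⟦∧⟧ false b = sym (ℚ.*-zeroˡ ⟦ b ⟧)

∧-true : ∀ {a b} → a ∧ b ≡ true → (a ≡ true) × (b ≡ true)
∧-true {true} {true} e = refl , refl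

bool-iff : ∀ a b → (a ≡ true → b ≡ true) → (b ≡ true → a ≡ true) → a ≡ b
bool-iff true b f g = sym (f refl)
bool-iff false true f g = g refl
bool-iff false false f g = refl

≡ᵇ-true : ∀ m n → (m ℕ.≡ᵇ n) ≡ true → m ≡ n
≡ᵇ-true zero zero e = refl
≡ᵇ-true (suc m) (suc n) e = cong suc (≡ᵇ-true m n e)

≡ᵇ-refl : ∀ m → (m ℕ.≡ᵇ m) ≡ true
≡ᵇ-refl zero = refl
≡ᵇ-refl (suc m) = ≡ᵇ-refl m

allZero-sound : ∀ xs → allZero xs ≡ true → ∀ n → lookupD xs n ≡ 0
allZero-sound [] e n = refl
allZero-sound (zero ∷ xs) e zero = refl
allZero-sound (zero ∷ xs) e (suc n) = allZero-sound xs e n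

allZero-complete : ∀ xs → (∀ n → lookupD xs n ≡ 0) → allZero xs ≡ true
allZero-complete [] h = refl
allZero-complete (zero ∷ xs) h = allZero-complete xs (h ∘ suc)
allZero-complete (suc x ∷ xs) h = case h 0 of λ ()

eqL-sound : ∀ xs ys → eqL xs ys ≡ true → xs ~ ys
eqL-sound [] ys e .~e n = sym (allZero-sound ys e n)
eqL-sound (x ∷ xs) [] e .~e n = allZero-sound (x ∷ xs) e n
eqL-sound (x ∷ xs) (y ∷ ys) e .~e zero = ≡ᵇ-true x y (proj₁ (∧-true e))
eqL-sound (x ∷ xs) (y ∷ ys) e .~e (suc n) = ~e (eqL-sound xs ys (proj₂ (∧-true {x ℕ.≡ᵇ y} e))) n

eqL-complete : ∀ xs ys → xs ~ ys → eqL xs ys ≡ true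
eqL-complete [] ys e = allZero-complete ys (λ n → sym (~e e n))
eqL-complete (x ∷ xs) [] e = allZero-complete (x ∷ xs) (~e e)
eqL-complete (x ∷ xs) (y ∷ ys) e with ~e e 0
... | refl rewrite ≡ᵇ-refl x = eqL-complete xs ys (~i (λ n → ~e e (suc n)))

eqL-iff : ∀ {xs ys xs' ys'} → (xs ~ ys → xs' ~ ys') → (xs' ~ ys' → xs ~ ys) → eqL xs ys ≡ eqL xs' ys'
eqL-iff {xs} {ys} {xs'} {ys'} f g = bool-iff (eqL xs ys) (eqL xs' ys') (eqL-complete xs' ys' ∘ f ∘ eqL-sound xs ys) (eqL-complete xs ys ∘ g ∘ eqL-sound xs' ys')

eqL-no : ∀ xs ys → ¬ (xs ~ ys) → eqL xs ys ≡ false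
eqL-no xs ys ne with eqL xs ys in eq
... | true = ⊥-elim (ne (eqL-sound xs ys eq))
... | false = refl

~-sym : ∀ {xs ys} → xs ~ ys → ys ~ xs
~-sym e .~e n = sym (~e e n)

~-trans : ∀ {xs ys zs} → xs ~ ys → ys ~ zs → xs ~ zs
~-trans e f .~e n = trans (~e e n) (~e f n)

-- The linear extension of a function of monomials. Coefficients are the case of indicator
-- functions, and operations on polynomials turn into operations on such functions.
⟨_,_⟩ : ∀ {r} → Poly r → (Mono r → ℚ) → ℚ
⟨ [] , φ ⟩ = 0ℚ
⟨ (c , u) ∷ p , φ ⟩ = c * φ u + ⟨ p , φ ⟩

module _ {r : ℕ} where

  ind : Mono r → Mono r → ℚ
  ind m u = ⟦ eqMono u m ⟧

  coeff-⟨⟩ : ∀ (p : Poly r) m → coeff p m ≡ ⟨ p , ind m ⟩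
  coeff-⟨⟩ [] m = refl
  coeff-⟨⟩ ((c , u) ∷ p) m with eqMono u m
  ... | true = cong₂ _+_ (sym (ℚ.*-identityʳ c)) (coeff-⟨⟩ p m)
  ... | false = trans (coeff-⟨⟩ p m) (sym (trans (cong (_+ ⟨ p , ind m ⟩) (ℚ.*-zeroʳ c)) (ℚ.+-identityˡ ⟨ p , ind m ⟩)))

  ⟨⟩-cong : ∀ (p : Poly r) {φ ψ} → (∀ u → φ u ≡ ψ u) → ⟨ p , φ ⟩ ≡ ⟨ p , ψ ⟩
  ⟨⟩-cong [] e = refl
  ⟨⟩-cong ((c , u) ∷ p) e = cong₂ (λ x y → c * x + y) (e u) (⟨⟩-cong p e)

  ⟨⟩-lin : ∀ (p : Poly r) → Lin {Mono r} {ℕ} (λ φ _ → ⟨ p , φ ⟩)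
  ⟨⟩-lin [] c e _ = sym (trans (ℚ.+-identityʳ (c * 0ℚ)) (ℚ.*-zeroʳ c))
  ⟨⟩-lin ((b , u) ∷ p) c {s} {t} e n = trans (cong₂ (λ x y → b * x + y) (e u) (⟨⟩-lin p c e n)) (l b c (s u) (t u) ⟨ p , s ⟩ ⟨ p , t ⟩)
    where
    l : ∀ b c x y x' y' → b * (c * x + y) + (c * x' + y') ≡ c * (b * x + x') + (b * y + y')
    l = solve-∀ ℚR

  ⟨⟩-++ : ∀ (p q : Poly r) φ → ⟨ p ++ q , φ ⟩ ≡ ⟨ p , φ ⟩ + ⟨ q , φ ⟩
  ⟨⟩-++ [] q φ = sym (ℚ.+-identityˡ _)
  ⟨⟩-++ ((c , u) ∷ p) q φ = trans (cong (λ z → c * φ u + z) (⟨⟩-++ p q φ)) (sym (ℚ.+-assoc (c * φ u) ⟨ p , φ ⟩ ⟨ q , φ ⟩))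

  ⟨⟩-scale : ∀ c (p : Poly r) φ → ⟨ scaleP c p , φ ⟩ ≡ c * ⟨ p , φ ⟩
  ⟨⟩-scale c [] φ = sym (ℚ.*-zeroʳ c)
  ⟨⟩-scale c ((b , u) ∷ p) φ = trans (cong (λ z → c * b * φ u + z) (⟨⟩-scale c p φ)) (l c b (φ u) ⟨ p , φ ⟩)
    where
    l : ∀ c b x y → c * b * x + c * y ≡ c * (b * x + y)
    l = solve-∀ ℚR

  ⟨⟩-⊗ : ∀ (p q : Poly r) φ → ⟨ p ⊗ q , φ ⟩ ≡ ⟨ p , (λ u → ⟨ q , (λ v → φ (mulMono u v)) ⟩) ⟩
  ⟨⟩-⊗ [] q φ = refl
  ⟨⟩-⊗ ((c , u) ∷ p) q φ = trans (⟨⟩-++ (map (λ w → (c * proj₁ w , mulMono u (proj₂ w))) q) (p ⊗ q) φ) (cong₂ _+_ (go q) (⟨⟩-⊗ p q φ))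
    where
    l : ∀ c b x y → c * b * x + c * y ≡ c * (b * x + y)
    l = solve-∀ ℚR
    go : ∀ q → ⟨ map (λ w → (c * proj₁ w , mulMono u (proj₂ w))) q , φ ⟩ ≡ c * ⟨ q , (λ v → φ (mulMono u v)) ⟩
    go [] = sym (ℚ.*-zeroʳ c)
    go ((b , v) ∷ q) = trans (cong (λ z → c * b * φ (mulMono u v) + z) (go q)) (l c b (φ (mulMono u v)) ⟨ q , (λ v → φ (mulMono u v)) ⟩)

  ⟨⟩-dT : ∀ n (p : Poly r) φ → ⟨ dT n p , φ ⟩ ≡ ⟨ p , (λ u → ι (+ lookupD (te u) n) * φ (mono (xe u) (ve u) (decAt (te u) n))) ⟩
  ⟨⟩-dT n [] φ = refl
  ⟨⟩-dT n ((c , u) ∷ p) φ = cong₂ _+_ (trans (cong (λ z → c * z * φ u') (ι-def (+ lookupD (te u) n))) (ℚ.*-assoc c (ι (+ lookupD (te u) n)) (φ u'))) (⟨⟩-dT n p φ)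
    where u' = mono (xe u) (ve u) (decAt (te u) n)

  slice : Poly r → ℕ → Vec ℕ r → Fn
  slice p x v t = coeff p (mono x v t)

  ind-resp : ∀ u x v → Resp (λ t → ind (mono x v t) u)
  ind-resp u x v {s} {t} e = cong (λ b → ⟦ (xe u ℕ.≡ᵇ x) ∧ eqV (ve u) v ∧ b ⟧) (eqL-iff {te u} {s} {te u} {t} (λ h → ~-trans h e) (λ h → ~-trans h (~-sym e)))

  slice-resp : ∀ p x v → Resp (slice p x v)
  slice-resp p x v {s} {t} e = trans (coeff-⟨⟩ p (mono x v s)) (trans (⟨⟩-cong p (λ u → ind-resp u x v e)) (sym (coeff-⟨⟩ p (mono x v t))))

  ind-split : ∀ u x v t → ind (mono x v t) u ≡ ⟦ (xe u ℕ.≡ᵇ x) ∧ eqV (ve u) v ⟧ * ⟦ eqL (te u) t ⟧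
  ind-split u x v t with xe u ℕ.≡ᵇ x
  ... | true = ⟦∧⟧ (eqV (ve u) v) (eqL (te u) t)
  ... | false = sym (ℚ.*-zeroˡ ⟦ eqL (te u) t ⟧)

  -- The derivative of t^u is a multiple of t^t exactly when u is `incAt t n`, except when the
  -- exponent of the variable is 0: then `decAt` changes nothing and the factor has to vanish
  -- instead.
  dec-eqL : ∀ n u t → ι (+ lookupD u n) * ⟦ eqL (decAt u n) t ⟧ ≡ ι (+ suc (lookupD t n)) * ⟦ eqL u (incAt t n) ⟧
  dec-eqL n u t with lookupD u n in eq
  ... | zero = trans (trans (cong (_* ⟦ eqL (decAt u n) t ⟧) ι0) (ℚ.*-zeroˡ ⟦ eqL (decAt u n) t ⟧))
          (sym (trans (cong (λ b → ι (+ suc (lookupD t n)) * ⟦ b ⟧) (eqL-no u (incAt t n) (λ h → case trans (sym eq) (trans (~e h n) (lk-inc-≡ t n)) of λ ()))) (ℚ.*-zeroʳ (ι (+ suc (lookupD t n))))))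
  ... | suc e with eqL (decAt u n) t in eq'
  ...   | true = cong₂ (λ a b → ι (+ suc a) * ⟦ b ⟧) (trans (sym (trans (lk-dec-≡ u n) (cong (ℕ._∸ 1) eq))) (~e h n)) (sym (eqL-complete u (incAt t n) (~-trans (~-sym (inc-dec u n eq)) (inc-resp n h))))
    where h = eqL-sound (decAt u n) t eq'
  ...   | false = trans (ℚ.*-zeroʳ (ι (+ suc e))) (sym (trans (cong (λ b → ι (+ suc (lookupD t n)) * ⟦ b ⟧) (eqL-no u (incAt t n) no')) (ℚ.*-zeroʳ (ι (+ suc (lookupD t n))))))
    where
    no' : ¬ (u ~ incAt t n)
    no' h = case trans (sym eq') (eqL-complete (decAt u n) t (~-trans (dec-resp n h) (dec-inc t n))) of λ ()

  dT-slice : ∀ n p x v t → slice (dT n p) x v t ≡ J (+ suc n) (slice p x v) t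
  dT-slice n p x v t = begin
    coeff (dT n p) (mono x v t) ≡⟨ coeff-⟨⟩ (dT n p) (mono x v t) ⟩
    ⟨ dT n p , ind (mono x v t) ⟩ ≡⟨ ⟨⟩-dT n p (ind (mono x v t)) ⟩
    ⟨ p , (λ u → ι (+ lookupD (te u) n) * ind (mono x v t) (mono (xe u) (ve u) (decAt (te u) n))) ⟩ ≡⟨ ⟨⟩-cong p term ⟩
    ⟨ p , (λ u → ι (+ suc (lookupD t n)) * ind (mono x v (incAt t n)) u) ⟩ ≡⟨ lin-* (⟨⟩-lin p) (ι (+ suc (lookupD t n))) (λ _ → refl) 0 ⟩
    ι (+ suc (lookupD t n)) * ⟨ p , ind (mono x v (incAt t n)) ⟩ ≡⟨ cong (λ z → ι (+ suc (lookupD t n)) * z) (sym (coeff-⟨⟩ p (mono x v (incAt t n)))) ⟩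
    J (+ suc n) (slice p x v) t ∎
    where
    open ≡-Reasoning
    l : ∀ a b c → a * (b * c) ≡ b * (a * c)
    l = solve-∀ ℚR
    term : ∀ u → ι (+ lookupD (te u) n) * ind (mono x v t) (mono (xe u) (ve u) (decAt (te u) n)) ≡ ι (+ suc (lookupD t n)) * ind (mono x v (incAt t n)) u
    term u = trans (cong (λ z → ι (+ lookupD (te u) n) * z) (ind-split (mono (xe u) (ve u) (decAt (te u) n)) x v t))
      (trans (l (ι (+ lookupD (te u) n)) ⟦ b ⟧ ⟦ eqL (decAt (te u) n) t ⟧) (trans (cong (⟦ b ⟧ *_) (dec-eqL n (te u) t))
      (trans (l ⟦ b ⟧ (ι (+ suc (lookupD t n))) ⟦ eqL (te u) (incAt t n) ⟧) (cong (λ z → ι (+ suc (lookupD t n)) * z) (sym (ind-split u x v (incAt t n)))))))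
      where b = (xe u ℕ.≡ᵇ x) ∧ eqV (ve u) v

  addL-tExp : ∀ n u → addL (tExp n) u ~ incAt u n
  addL-tExp zero [] = ~i (λ _ → refl)
  addL-tExp zero (x ∷ u) = ~i (λ _ → refl)
  addL-tExp (suc n) [] = ~i (λ { zero → refl ; (suc k) → trans (cong (λ z → lookupD z k) (sym (addL-[] (tExp n)))) (~e (addL-tExp n []) k) })
    where
    addL-[] : ∀ xs → addL xs [] ≡ xs
    addL-[] [] = refl
    addL-[] (x ∷ xs) = refl
  addL-tExp (suc n) (x ∷ u) = ~i (λ { zero → refl ; (suc k) → ~e (addL-tExp n u) k })

  inc-eqL : ∀ n u t → ⟦ eqL (addL (tExp n) u) t ⟧ ≡ nz (lookupD t n) * ⟦ eqL u (decAt t n) ⟧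
  inc-eqL n u t with lookupD t n in eq
  ... | zero = trans (cong ⟦_⟧ (eqL-no (addL (tExp n) u) t (λ h → case trans (sym eq) (trans (sym (~e h n)) (trans (~e (addL-tExp n u) n) (lk-inc-≡ u n))) of λ ()))) (sym (ℚ.*-zeroˡ ⟦ eqL u (decAt t n) ⟧))
  ... | suc e = trans (cong ⟦_⟧ (eqL-iff {addL (tExp n) u} {t} {u} {decAt t n} (λ h → ~-trans (~-sym (dec-inc u n)) (dec-resp n (~-trans (~-sym (addL-tExp n u)) h)))
       (λ h → ~-trans (addL-tExp n u) (~-trans (inc-resp n h) (inc-dec t n eq))))) (sym (ℚ.*-identityˡ ⟦ eqL u (decAt t n) ⟧))

  zip-0 : ∀ {n} (v : Vec ℕ n) → Vec.zipWith ℕ._+_ (Vec.replicate n 0) v ≡ v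
  zip-0 [] = refl
  zip-0 (x ∷ v) = cong (x ∷_) (zip-0 v)

  tP-slice : ∀ n p x v t → slice (scaleP (ℕtoℚ (suc n)) (tP n) ⊗ p) x v t ≡ J -[1+ n ] (slice p x v) t
  tP-slice n p x v t = begin
    coeff (scaleP (ℕtoℚ (suc n)) (tP n) ⊗ p) (mono x v t) ≡⟨ coeff-⟨⟩ (scaleP (ℕtoℚ (suc n)) (tP n) ⊗ p) (mono x v t) ⟩
    ⟨ scaleP (ℕtoℚ (suc n)) (tP n) ⊗ p , ind (mono x v t) ⟩ ≡⟨ ⟨⟩-⊗ (scaleP (ℕtoℚ (suc n)) (tP n)) p (ind (mono x v t)) ⟩
    ℕtoℚ (suc n) * 1ℚ * ⟨ p , (λ u → ind (mono x v t) (mono (xe u) (Vec.zipWith ℕ._+_ (Vec.replicate _ 0) (ve u)) (addL (tExp n) (te u)))) ⟩ + 0ℚ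
      ≡⟨ cong₂ (λ a b → a * 1ℚ * b + 0ℚ) (ι-def (+ suc n)) (⟨⟩-cong p term) ⟩
    ι (+ suc n) * 1ℚ * ⟨ p , (λ u → nz (lookupD t n) * ind (mono x v (decAt t n)) u) ⟩ + 0ℚ
      ≡⟨ cong (λ z → ι (+ suc n) * 1ℚ * z + 0ℚ) (lin-* (⟨⟩-lin p) (nz (lookupD t n)) (λ _ → refl) 0) ⟩
    ι (+ suc n) * 1ℚ * (nz (lookupD t n) * ⟨ p , ind (mono x v (decAt t n)) ⟩) + 0ℚ
      ≡⟨ l2 (ι (+ suc n)) (nz (lookupD t n)) ⟨ p , ind (mono x v (decAt t n)) ⟩ ⟩
    nz (lookupD t n) * ι (+ suc n) * ⟨ p , ind (mono x v (decAt t n)) ⟩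
      ≡⟨ cong (λ z → nz (lookupD t n) * ι (+ suc n) * z) (sym (coeff-⟨⟩ p (mono x v (decAt t n)))) ⟩
    J -[1+ n ] (slice p x v) t ∎
    where
    open ≡-Reasoning
    l : ∀ a b c → a * (b * c) ≡ b * (a * c)
    l = solve-∀ ℚR
    l2 : ∀ i z x → i * 1ℚ * (z * x) + 0ℚ ≡ z * i * x
    l2 = solve-∀ ℚR
    term : ∀ u → ind (mono x v t) (mono (xe u) (Vec.zipWith ℕ._+_ (Vec.replicate _ 0) (ve u)) (addL (tExp n) (te u))) ≡ nz (lookupD t n) * ind (mono x v (decAt t n)) u
    term u = trans (cong (λ z → ind (mono x v t) (mono (xe u) z (addL (tExp n) (te u)))) (zip-0 (ve u)))
      (trans (ind-split (mono (xe u) (ve u) (addL (tExp n) (te u))) x v t) (trans (cong (⟦ b ⟧ *_) (inc-eqL n (te u) t))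
      (trans (l ⟦ b ⟧ (nz (lookupD t n)) ⟦ eqL (te u) (decAt t n) ⟧) (cong (λ z → nz (lookupD t n) * z) (sym (ind-split u x v (decAt t n)))))))
      where b = (xe u ℕ.≡ᵇ x) ∧ eqV (ve u) v

  slice-scale : ∀ c p x v t → slice (scaleP c p) x v t ≡ c * slice p x v t
  slice-scale c p x v t = trans (coeff-⟨⟩ (scaleP c p) (mono x v t)) (trans (⟨⟩-scale c p (ind (mono x v t))) (cong (c *_) (sym (coeff-⟨⟩ p (mono x v t)))))

  slice-++ : ∀ p q x v t → slice (p ++ q) x v t ≡ slice p x v t + slice q x v t
  slice-++ p q x v t = trans (coeff-⟨⟩ (p ++ q) (mono x v t)) (trans (⟨⟩-++ p q (ind (mono x v t))) (sym (cong₂ _+_ (coeff-⟨⟩ p (mono x v t)) (coeff-⟨⟩ q (mono x v t)))))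

-- Normally ordered products on coefficient functions

DF MF nordF : List ℤ → Fn → Fn
DF [] f = f
DF (+ zero ∷ as) f m = 0ℚ
DF (+ suc n ∷ as) f = J (+ suc n) (DF as f)
DF (-[1+ n ] ∷ as) f = DF as f
MF [] f = f
MF (+ n ∷ as) f = MF as f
MF (-[1+ n ] ∷ as) f = J -[1+ n ] (MF as f)
nordF as f = MF as (DF as f)

MF-lin : ∀ as → Lin (MF as)
MF-lin [] c e = e
MF-lin (+ n ∷ as) = MF-lin as
MF-lin (-[1+ n ] ∷ as) c e = J-lin -[1+ n ] c (MF-lin as c e)

DF-resp : ∀ as {f} → Resp f → Resp (DF as f)
DF-resp [] r = r
DF-resp (+ zero ∷ as) r e = refl
DF-resp (+ suc n ∷ as) r = J-resp (+ suc n) (DF-resp as r)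
DF-resp (-[1+ n ] ∷ as) r = DF-resp as r

DF-comm : ∀ as n {f} → Resp f → ∀ m → J (+ suc n) (DF as f) m ≡ DF as (J (+ suc n) f) m
DF-comm [] n r m = refl
DF-comm (+ zero ∷ as) n r m = ℚ.*-zeroʳ (jc (+ suc n) m)
DF-comm (+ suc k ∷ as) n {f} r m = trans (l (J (+ suc n) (J (+ suc k) (DF as f)) m) (J (+ suc k) (J (+ suc n) (DF as f)) m))
  (trans (cong₂ _+_ (trans (JJ (+ suc n) (+ suc k) (DF as f) m (DF-resp as r)) (sym (zero-rhs (ι (+ suc n)) (DF as f m) refl))) (lin-cong (J-lin (+ suc k)) (DF-comm as n r) m)) (ℚ.+-identityˡ _))
  where
  l : ∀ x y → x ≡ x - y + y
  l = solve-∀ ℚR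
DF-comm (-[1+ k ] ∷ as) n r m = DF-comm as n r m

-- `applyD` lets the head of the list act last, whereas `Yᴿ` lets it act first on the argument;
-- annihilation modes commute, so the two agree.
nordF⁺ : ∀ n as {f} → Resp f → ∀ m → nordF (+ suc n ∷ as) f m ≡ nordF as (J (+ suc n) f) m
nordF⁺ n as r = lin-cong (MF-lin as) (DF-comm as n r)

nordF⁰ : ∀ as f m → nordF (+ 0 ∷ as) f m ≡ 0ℚ
nordF⁰ as f = lin-zero (MF-lin as) (λ _ → refl)

applyD-slice : ∀ {r} as (p : Poly r) x v t → slice (applyD as p) x v t ≡ DF as (slice p x v) t
applyD-slice [] p x v t = refl
applyD-slice (+ zero ∷ as) p x v t = refl
applyD-slice (+ suc n ∷ as) p x v t = trans (dT-slice n (applyD as p) x v t) (lin-cong (J-lin (+ suc n)) (applyD-slice as p x v) t)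
applyD-slice (-[1+ n ] ∷ as) p x v t = applyD-slice as p x v t

applyM-slice : ∀ {r} as (p : Poly r) x v t → slice (applyM as p) x v t ≡ MF as (slice p x v) t
applyM-slice [] p x v t = refl
applyM-slice (+ n ∷ as) p x v t = applyM-slice as p x v t
applyM-slice (-[1+ n ] ∷ as) p x v t = trans (tP-slice n (applyM as p) x v t) (lin-cong (J-lin -[1+ n ]) (applyM-slice as p x v) t)

nord-slice : ∀ {r} as (p : Poly r) x v t → slice (nord as p) x v t ≡ nordF as (slice p x v) t
nord-slice as p x v t = trans (applyM-slice as (applyD as p) x v t) (lin-cong (MF-lin as) (applyD-slice as p x v) t)

ΣL : ∀ {A : Set} → List A → (A → ℚ) → ℚ
ΣL [] g = 0ℚ
ΣL (x ∷ xs) g = g x + ΣL xs g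

module _ {A : Set} where

  ΣL-cong : ∀ (xs : List A) {g h} → (∀ x → g x ≡ h x) → ΣL xs g ≡ ΣL xs h
  ΣL-cong [] e = refl
  ΣL-cong (x ∷ xs) e = cong₂ _+_ (e x) (ΣL-cong xs e)

  ΣL-Lin : ∀ (xs : List A) → Lin {A} {ℕ} (λ g _ → ΣL xs g)
  ΣL-Lin [] c e _ = sym (trans (ℚ.+-identityʳ (c * 0ℚ)) (ℚ.*-zeroʳ c))
  ΣL-Lin (x ∷ xs) c {s} {t} e n = trans (cong₂ _+_ (e x) (ΣL-Lin xs c e n)) (l c (s x) (t x) (ΣL xs s) (ΣL xs t))
    where
    l : ∀ c x y x' y' → (c * x + y) + (c * x' + y') ≡ c * (x + x') + (y + y')
    l = solve-∀ ℚR

  ΣL-zero : ∀ (xs : List A) {g} → (∀ x → g x ≡ 0ℚ) → ΣL xs g ≡ 0ℚ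
  ΣL-zero xs z = lin-zero (ΣL-Lin xs) z 0

  ΣL-* : ∀ (xs : List A) c {g} → ΣL xs (λ x → c * g x) ≡ c * ΣL xs g
  ΣL-* xs c = lin-* (ΣL-Lin xs) c (λ _ → refl) 0

  ΣL-++ : ∀ (xs ys : List A) g → ΣL (xs ++ ys) g ≡ ΣL xs g + ΣL ys g
  ΣL-++ [] ys g = sym (ℚ.+-identityˡ _)
  ΣL-++ (x ∷ xs) ys g = trans (cong (λ z → g x + z) (ΣL-++ xs ys g)) (sym (ℚ.+-assoc (g x) (ΣL xs g) (ΣL ys g)))

  ΣL-map : ∀ {B : Set} (h : B → A) xs g → ΣL (map h xs) g ≡ ΣL xs (g ∘ h)
  ΣL-map h [] g = refl
  ΣL-map h (x ∷ xs) g = cong (λ z → g (h x) + z) (ΣL-map h xs g)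

  ΣL-concatMap : ∀ {B : Set} (h : B → List A) xs g → ΣL (concatMap h xs) g ≡ ΣL xs (λ x → ΣL (h x) g)
  ΣL-concatMap h [] g = refl
  ΣL-concatMap h (x ∷ xs) g = trans (ΣL-++ (h x) (concatMap h xs) g) (cong (λ z → ΣL (h x) g + z) (ΣL-concatMap h xs g))

  ΣL-filter : ∀ (ok : A → Bool) xs g → ΣL (filterᵇ ok xs) g ≡ ΣL xs (λ x → ⟦ ok x ⟧ * g x)
  ΣL-filter ok [] g = refl
  ΣL-filter ok (x ∷ xs) g with ok x
  ... | true = cong₂ _+_ (sym (ℚ.*-identityˡ (g x))) (ΣL-filter ok xs g)
  ... | false = trans (ΣL-filter ok xs g) (sym (trans (cong (_+ ΣL xs (λ x → ⟦ ok x ⟧ * g x)) (ℚ.*-zeroˡ (g x))) (ℚ.+-identityˡ _)))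

  ΣL-natural : ∀ {B C : Set} {Q : (B → ℚ) → (C → ℚ)} → Lin Q → ∀ (xs : List A) (g : A → B → ℚ) c → Q (λ b → ΣL xs (λ x → g x b)) c ≡ ΣL xs (λ x → Q (g x) c)
  ΣL-natural L [] g c = lin-zero L (λ _ → refl) c
  ΣL-natural {Q = Q} L (x ∷ xs) g c = trans (lin-+ L (λ _ → refl) c) (cong (λ z → Q (g x) c + z) (ΣL-natural L xs g c))

slice-sumP : ∀ {r} (ps : List (Poly r)) x v t → slice (sumP ps) x v t ≡ ΣL ps (λ p → slice p x v t)
slice-sumP [] x v t = refl
slice-sumP (p ∷ ps) x v t = trans (slice-++ p (sumP ps) x v t) (cong (λ z → slice p x v t + z) (slice-sumP ps x v t))

Σ<-head : ∀ c h → Σ< (suc c) h ≡ h 0 + Σ< c (h ∘ suc)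
Σ<-head zero h = ℚ.+-comm 0ℚ (h 0)
Σ<-head (suc c) h = trans (cong (_+ h (suc c)) (Σ<-head c h)) (ℚ.+-assoc (h 0) (Σ< c (h ∘ suc)) (h (suc c)))

ΣL-pos : ∀ p c g → ΣL (rangeZ (+ p) c) g ≡ Σ< c (λ i → g (+ (p ℕ.+ i)))
ΣL-pos p zero g = refl
ΣL-pos p (suc c) g = trans (cong₂ _+_ (cong g (cong +_ (sym (ℕ.+-identityʳ p)))) (trans (ΣL-pos (p ℕ.+ 1) c g) (Σ<-cong c (λ i → cong (λ z → g (+ z)) (ℕ.+-assoc p 1 i))))) (sym (Σ<-head c (λ i → g (+ (p ℕ.+ i)))))

ΣL-range : ∀ B N g → ΣL (rangeZ (ℤ.- + B) (B ℕ.+ suc N)) g ≡ Σ< B (λ i → g -[1+ i ]) + (g (+ 0) + Σ< N (λ i → g (+ suc i)))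
ΣL-range zero N g = trans (cong (λ z → g (+ 0) + z) (ΣL-pos 1 N g)) (sym (ℚ.+-identityˡ _))
ΣL-range (suc B) N g = trans (cong (λ z → g -[1+ B ] + ΣL (rangeZ z (B ℕ.+ suc N)) g) (step B)) (trans (cong (λ z → g -[1+ B ] + z) (ΣL-range B N g)) (l (g -[1+ B ]) (Σ< B (λ i → g -[1+ i ])) (g (+ 0) + Σ< N (λ i → g (+ suc i)))))
  where
  l : ∀ a b c → a + (b + c) ≡ b + a + c
  l = solve-∀ ℚR
  step : ∀ B → -[1+ B ] ℤ.+ + 1 ≡ ℤ.- + B
  step zero = refl
  step (suc B) = refl

≟-δ : ∀ x y → ⟦ ⌊ x ℤ.≟ y ⌋ ⟧ ≡ δ (x ℤ.- y)
≟-δ x y with x ℤ.≟ y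
... | yes refl = sym (δ-yes (ℤ.+-inverseʳ x))
... | no ne = sym (δ-no (λ e → ne (ℤ.i-j≡0⇒i≡j x y e)))

δ-neg : ∀ z → δ (ℤ.- z) ≡ δ z
δ-neg (+ zero) = refl
δ-neg (+ suc n) = refl
δ-neg -[1+ n ] = refl

-- The filter on the exponent of z has become a delta, which the recursion carries to the empty
-- tuple. The head of a tuple is split by its sign into creation, J_0 = 0 and annihilation.
tuples-Y : ∀ B N es n {f} m → Resp f →
  ΣL (tuples (length es) (rangeZ (ℤ.- + B) (B ℕ.+ suc N))) (λ as → δ (zExp as es ℤ.- (n ℤ.- + order es)) * (ι (ffs as es) * nordF as f m)) ≡ Yᴿ B N es n f m
tuples-Y B N [] n {f} m r = trans (cong₂ (λ x y → x * (y * f m) + 0ℚ) (trans (cong δ (ℤL n)) (δ-neg n)) ι1) (l (δ n) (f m))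
  where
  ℤL : ∀ n → + 0 ℤ.- (n ℤ.- + 0) ≡ ℤ.- n
  ℤL = ℤSolver.solve-∀
  l : ∀ d x → d * (1ℚ * x) + 0ℚ ≡ d * x
  l = solve-∀ ℚR
tuples-Y B N (e ∷ es) n {f} m r = begin
  ΣL (concatMap (λ a → map (a ∷_) L) R) g
    ≡⟨ ΣL-concatMap (λ a → map (a ∷_) L) R g ⟩
  ΣL R (λ a → ΣL (map (a ∷_) L) g)
    ≡⟨ ΣL-cong R (λ a → trans (ΣL-map (a ∷_) L g) (ΣL-cong L (λ as → rewr a as))) ⟩
  ΣL R G
    ≡⟨ ΣL-range B N G ⟩
  Σ< B (λ i → G -[1+ i ]) + (G (+ 0) + Σ< N (λ i → G (+ suc i)))
    ≡⟨ cong₂ _+_ (Σ<-cong B neg) (trans (cong₂ _+_ zer (Σ<-cong N pos)) (ℚ.+-identityˡ _)) ⟩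
  Yᴿ B N (e ∷ es) n f m ∎
  where
  open ≡-Reasoning
  R = rangeZ (ℤ.- + B) (B ℕ.+ suc N)
  L = tuples (length es) R
  o = + order es
  g : List ℤ → ℚ
  g as = δ (zExp as (e ∷ es) ℤ.- (n ℤ.- + order (e ∷ es))) * (ι (ffs as (e ∷ es)) * nordF as f m)
  G : ℤ → ℚ
  G a = ΣL L (λ as → ι (ff a e) * (δ (zExp as es ℤ.- (n ℤ.+ a ℤ.- o)) * (ι (ffs as es) * nordF (a ∷ as) f m)))
  ℤL : ∀ a e z n o → (ℤ.- a ℤ.- + 1 ℤ.- e ℤ.+ z) ℤ.- (n ℤ.- (+ 1 ℤ.+ e ℤ.+ o)) ≡ z ℤ.- (n ℤ.+ a ℤ.- o)
  ℤL = ℤSolver.solve-∀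
  l : ∀ d a b x → d * (a * b * x) ≡ a * (d * (b * x))
  l = solve-∀ ℚR
  rewr : ∀ a as → g (a ∷ as) ≡ ι (ff a e) * (δ (zExp as es ℤ.- (n ℤ.+ a ℤ.- o)) * (ι (ffs as es) * nordF (a ∷ as) f m))
  rewr a as = trans (cong₂ (λ x y → δ x * (y * nordF (a ∷ as) f m)) (ℤL a (+ e) (zExp as es) n o) (ι-* (ff a e) (ffs as es)))
    (l (δ (zExp as es ℤ.- (n ℤ.+ a ℤ.- o))) (ι (ff a e)) (ι (ffs as es)) (nordF (a ∷ as) f m))
  l2 : ∀ d i j x → d * (i * (j * x)) ≡ j * (d * (i * x))
  l2 = solve-∀ ℚR
  neg : ∀ i → G -[1+ i ] ≡ ι (ff -[1+ i ] e) * J -[1+ i ] (Yᴿ B N es (n ℤ.+ -[1+ i ]) f) m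
  neg i = trans (ΣL-* L (ι (ff -[1+ i ] e))) (cong (λ z → ι (ff -[1+ i ] e) * z)
    (trans (ΣL-cong L (λ as → l2 (δ (zExp as es ℤ.- (n ℤ.+ -[1+ i ] ℤ.- o))) (ι (ffs as es)) (jc -[1+ i ] m) (nordF as f (js -[1+ i ] m))))
    (trans (ΣL-* L (jc -[1+ i ] m)) (cong (λ z → jc -[1+ i ] m * z) (tuples-Y B N es (n ℤ.+ -[1+ i ]) (js -[1+ i ] m) r)))))
  l3 : ∀ a d b → a * (d * (b * 0ℚ)) ≡ 0ℚ
  l3 = solve-∀ ℚR
  zer : G (+ 0) ≡ 0ℚ
  zer = ΣL-zero L (λ as → trans (cong (λ z → ι (ff (+ 0) e) * (δ (zExp as es ℤ.- (n ℤ.+ + 0 ℤ.- o)) * (ι (ffs as es) * z))) (nordF⁰ as f m)) (l3 (ι (ff (+ 0) e)) (δ (zExp as es ℤ.- (n ℤ.+ + 0 ℤ.- o))) (ι (ffs as es))))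
  pos : ∀ i → G (+ suc i) ≡ ι (ff (+ suc i) e) * Yᴿ B N es (n ℤ.+ + suc i) (J (+ suc i) f) m
  pos i = trans (ΣL-* L (ι (ff (+ suc i) e))) (cong (λ z → ι (ff (+ suc i) e) * z)
    (trans (ΣL-cong L (λ as → cong (λ z → δ (zExp as es ℤ.- (n ℤ.+ + suc i ℤ.- o)) * (ι (ffs as es) * z)) (nordF⁺ i as r m)))
      (tuples-Y B N es (n ℤ.+ + suc i) m (J-resp (+ suc i) r))))

maxT-bounded : ∀ {r} (p : Poly r) x v → Bounded (maxT p) (slice p x v)
maxT-bounded p x v i m h = trans (cong (λ z → jc (+ suc i) m * z) (trans (coeff-⟨⟩ p (mono x v (incAt m i))) (go p h))) (ℚ.*-zeroʳ (jc (+ suc i) m))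
  where
  lk-len : ∀ u i → length u ≤ i → lookupD u i ≡ 0
  lk-len [] i h = refl
  lk-len (y ∷ u) (suc i) h = lk-len u i (ℕ.≤-pred h)
  go : ∀ p → maxT p ≤ i → ⟨ p , ind (mono x v (incAt m i)) ⟩ ≡ 0ℚ
  go [] h = refl
  go ((c , u) ∷ p) h = trans (cong₂ (λ a b → c * a + b) (trans (ind-split u x v (incAt m i)) (trans (cong (λ b → ⟦ (xe u ℕ.≡ᵇ x) ∧ eqV (ve u) v ⟧ * ⟦ b ⟧)
       (eqL-no (te u) (incAt m i) (λ q → case trans (sym (lk-len (te u) i (ℕ.≤-trans (ℕ.m≤m⊔n (length (te u)) (maxT p)) h))) (trans (~e q i) (lk-inc-≡ m i)) of λ ()))) (ℚ.*-zeroʳ ⟦ (xe u ℕ.≡ᵇ x) ∧ eqV (ve u) v ⟧)))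
     (go p (ℕ.≤-trans (ℕ.m≤n⊔m (length (te u)) (maxT p)) h))) (trans (ℚ.+-identityʳ (c * 0ℚ)) (ℚ.*-zeroʳ c))

order-sum : ∀ es → + order es ≡ + length es ℤ.+ sumZ (map +_ es)
order-sum [] = refl
order-sum (e ∷ es) = trans (cong (λ z → + suc e ℤ.+ z) (order-sum es)) (l (+ e) (+ length es) (sumZ (map +_ es)))
  where
  l : ∀ e j s → + 1 ℤ.+ e ℤ.+ (j ℤ.+ s) ≡ + 1 ℤ.+ j ℤ.+ (e ℤ.+ s)
  l = ℤSolver.solve-∀

module _ {r : ℕ} (k : ℕ) (f : Poly r) where

  private
    N′ = maxT f
    term : ℕ × List ℕ → List (Poly r)
    term (c , es) = map (λ as → scaleP (ℤtoℚ (+ c ℤ.* ffs as es)) (nord as f)) (filterᵇ (λ as → ⌊ zExp as es ℤ.≟ target ⌋) (tuples (length es) range))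
      where
      target = ℤ.- (ℤ.- (+ 1)) ℤ.- + suc k
      W = ℤ.- target ℤ.- + length es ℤ.- sumZ (map +_ es)
      B′ = ℤ.∣ W ∣ ℕ.+ length es ℕ.* N′
      range = rangeZ (ℤ.- (+ B′)) (B′ ℕ.+ suc N′)

    term-Y : ∀ c es → order es ≡ suc k → ∀ x v t → ΣL (term (c , es)) (λ p → slice p x v t) ≡ ι (+ c) * Y es (+ 1) (slice f x v) t
    term-Y c es oe x v t = begin
      ΣL (term (c , es)) (λ p → slice p x v t)
        ≡⟨ ΣL-map (λ as → scaleP (ℤtoℚ (+ c ℤ.* ffs as es)) (nord as f)) (filterᵇ ok L) (λ p → slice p x v t) ⟩
      ΣL (filterᵇ ok L) (λ as → slice (scaleP (ℤtoℚ (+ c ℤ.* ffs as es)) (nord as f)) x v t)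
        ≡⟨ ΣL-filter ok L _ ⟩
      ΣL L (λ as → ⟦ ok as ⟧ * slice (scaleP (ℤtoℚ (+ c ℤ.* ffs as es)) (nord as f)) x v t)
        ≡⟨ ΣL-cong L eqn ⟩
      ΣL L (λ as → ι (+ c) * (δ (zExp as es ℤ.- (+ 1 ℤ.- + order es)) * (ι (ffs as es) * nordF as (slice f x v) t)))
        ≡⟨ ΣL-* L (ι (+ c)) ⟩
      ι (+ c) * ΣL L (λ as → δ (zExp as es ℤ.- (+ 1 ℤ.- + order es)) * (ι (ffs as es) * nordF as (slice f x v) t))
        ≡⟨ cong (λ z → ι (+ c) * z) (trans (tuples-Y B′ N′ es (+ 1) t (slice-resp f x v))
             (Yᴿ≡Y B′ N′ es (+ 1) 0 t (slice-resp f x v) (maxT-bounded f x v) (trans (cong (λ z → + (z ℕ.+ length es ℕ.* N′)) (sym W1)) (sym (ℤ.+-identityʳ (+ B′)))))) ⟩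
      ι (+ c) * Y es (+ 1) (slice f x v) t ∎
      where
      open ≡-Reasoning
      target = ℤ.- (ℤ.- (+ 1)) ℤ.- + suc k
      W = ℤ.- target ℤ.- + length es ℤ.- sumZ (map +_ es)
      B′ = ℤ.∣ W ∣ ℕ.+ length es ℕ.* N′
      L = tuples (length es) (rangeZ (ℤ.- (+ B′)) (B′ ℕ.+ suc N′))
      ok : List ℤ → Bool
      ok as = ⌊ zExp as es ℤ.≟ target ⌋
      ℤL : ∀ j s → ℤ.- (+ 1 ℤ.- (j ℤ.+ s)) ℤ.- j ℤ.- s ≡ ℤ.- + 1
      ℤL = ℤSolver.solve-∀
      -- The quantity `T` of `Pmode` is -1 for the mode -1, whatever the term, because the order is
      -- k + 1. So the range is B = 1 + j `maxT f`, exactly what `Yᴿ≡Y` demands in degree 1 with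
      -- slack 0.
      W1 : ℤ.∣ W ∣ ≡ 1
      W1 = cong ℤ.∣_∣ (trans (cong (λ z → ℤ.- (+ 1 ℤ.- z) ℤ.- + length es ℤ.- sumZ (map +_ es)) (trans (cong +_ (sym oe)) (order-sum es))) (ℤL (+ length es) (sumZ (map +_ es))))
      l : ∀ d c i x → d * (c * i * x) ≡ c * (d * (i * x))
      l = solve-∀ ℚR
      eqn : ∀ as → ⟦ ok as ⟧ * slice (scaleP (ℤtoℚ (+ c ℤ.* ffs as es)) (nord as f)) x v t ≡ ι (+ c) * (δ (zExp as es ℤ.- (+ 1 ℤ.- + order es)) * (ι (ffs as es) * nordF as (slice f x v) t))
      eqn as = trans (cong₂ _*_ (trans (≟-δ (zExp as es) target) (cong (λ z → δ (zExp as es ℤ.- (+ 1 ℤ.- + z))) (sym oe)))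
         (trans (slice-scale (ℤtoℚ (+ c ℤ.* ffs as es)) (nord as f) x v t) (cong₂ _*_ (trans (ι-def (+ c ℤ.* ffs as es)) (ι-* (+ c) (ffs as es))) (nord-slice as f x v t))))
         (l (δ (zExp as es ℤ.- (+ 1 ℤ.- + order es))) (ι (+ c)) (ι (ffs as es)) (nordF as (slice f x v) t))

  Pmode-X : ∀ x v t → slice (Pmode (suc k) (ℤ.- (+ 1)) f) x v t ≡ X (suc k) (+ 1) (slice f x v) t
  Pmode-X x v t = trans (slice-sumP (concatMap term (PD (suc k))) x v t) (trans (ΣL-concatMap term (PD (suc k)) (λ p → slice p x v t)) (trans (go (PD (suc k)) (PD-order k)) (PD-X k (+ 1) (slice f x v) t)))
    where
    go : ∀ D → HasOrder (suc k) D → ΣL D (λ u → ΣL (term u) (λ p → slice p x v t)) ≡ Yᴰ D (+ 1) (slice f x v) t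
    go [] [] = refl
    go ((c , es) ∷ D) (p ∷ h) = cong₂ _+_ (term-Y c es p x v t) (go D h)

-- Iterated commutators with C

Λ⁺-Pol : ∀ a {f} → Pol f → Pol (Λ (+ suc a) f)
Λ⁺-Pol a (lin-pol c p q e) = lin-pol c (Λ⁺-Pol a p) (Λ⁺-Pol a q) (lin Λ-isFam (+ suc a) c e)
Λ⁺-Pol a vac-pol = lin-pol 0ℚ vac-pol (Σ-pol (suc a) {λ i → J -[1+ i ] (J (ℤ.- + (a ℕ.∸ i)) vac)} (λ i → J-Pol -[1+ i ] (J-Pol (ℤ.- + (a ℕ.∸ i)) vac-pol)))
  (λ m → trans (Λ⁺-vac a m) (l (vac m) _))
  where
  l : ∀ x y → y ≡ 0ℚ * x + y
  l = solve-∀ ℚR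
Λ⁺-Pol a (J-pol b {f} p) = lin-pol (- (ι -[1+ b ] + ι -[1+ b ])) (J-Pol (-[1+ b ] ℤ.- + suc a) p) (J-Pol -[1+ b ] (Λ⁺-Pol a p))
  (λ m → trans (l (Λ (+ suc a) (J -[1+ b ] f) m) (J -[1+ b ] (Λ (+ suc a) f) m)) (trans (cong (λ z → - z + J -[1+ b ] (Λ (+ suc a) f) m) (Λ-comm -[1+ b ] (+ suc a) m (Pol-resp p)))
     (l2 (ι -[1+ b ] + ι -[1+ b ]) (J (-[1+ b ] ℤ.- + suc a) f m) (J -[1+ b ] (Λ (+ suc a) f) m))))
  where
  l : ∀ x y → x ≡ - (y - x) + y
  l = solve-∀ ℚR
  l2 : ∀ i x y → - (i * x) + y ≡ (- i) * x + y
  l2 = solve-∀ ℚR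

T-J : ∀ b {f} m → Resp f → T (J b f) m ≡ (- ι b) * Λ (ℤ.- b) f m + J b (T f) m
T-J b {f} m r = trans (l (T (J b f) m) (J b (T f) m)) (trans (cong (λ z → - z + J b (T f) m) (T-comm b m r)) (l2 (ι b) (Λ (ℤ.- b) f m) (J b (T f) m)))
  where
  l : ∀ x y → x ≡ - (y - x) + y
  l = solve-∀ ℚR
  l2 : ∀ i x y → - (i * x) + y ≡ (- i) * x + y
  l2 = solve-∀ ℚR

-- Needed because iterated commutators also evaluate operators at `T f`, and `C-P` is known on
-- polynomials.
T-Pol : ∀ {f} → Pol f → Pol (T f)
T-Pol vac-pol = 0-pol vac-pol T-vac
T-Pol (lin-pol c p q e) = lin-pol c (T-Pol p) (T-Pol q) (T-lin c e)
T-Pol (J-pol b p) = lin-pol (- ι -[1+ b ]) (Λ⁺-Pol b p) (J-Pol -[1+ b ] (T-Pol p)) (λ m → T-J -[1+ b ] m (Pol-resp p))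

ad : (Fn → Fn) → Fn → Fn
ad A f m = ½ * (T (A f) m - A (T f) m)

-- (ad C)^j applied to P_n; later `j` is the exponent of x.
W : ℕ → ℕ → Fn → Fn
W n j = iter j ad (P n)

-- Apply (ad C)^j to [C, P_n] = P_(n+1) + n P_n. In other words, ad C - n carries P_n to P_(n+1).
W-step : ∀ n j {f} → Pol f → ∀ m → W n (suc j) f m ≡ W (suc n) j f m + ι (+ n) * W n j f m
W-step n zero p m = C-P n m p
W-step n (suc j) {f} p m = trans (cong₂ (λ x y → ½ * (x - y)) (T-lin (ι (+ n)) {W n j f} {W (suc n) j f} (λ m → trans (W-step n j p m) (ℚ.+-comm (W (suc n) j f m) (ι (+ n) * W n j f m))) m) (W-step n j (T-Pol p) m))
  (l ½ (ι (+ n)) (T (W n j f) m) (T (W (suc n) j f) m) (W (suc n) j (T f) m) (W n j (T f) m))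
  where
  l : ∀ h i a b c d → h * (i * a + b - (c + i * d)) ≡ h * (b - c) + i * (h * (a - d))
  l = solve-∀ ℚR

P₀ : ∀ f m → P 0 f m ≡ J -[1+ 0 ] f m
P₀ f m = begin
  recip 0 * (ι (+ 1) * (0ℚ * f m) + Σ< (bnd (+ 1) m) (λ i → jc -[1+ i ] m * (δ (+ 1 ℤ.+ -[1+ i ]) * f (decAt m i)) + 0ℚ * J (+ suc i) f m))
    ≡⟨ cong (λ z → recip 0 * (ι (+ 1) * (0ℚ * f m) + z)) (Σ<-single (bnd (+ 1) m) 0 (ℕ.m≤n+m 1 (w m)) (λ { zero ne → ⊥-elim (ne refl) ; (suc i) _ → l1 (jc -[1+ suc i ] m) (f (decAt m (suc i))) (J (+ suc (suc i)) f m) })) ⟩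
  recip 0 * (ι (+ 1) * (0ℚ * f m) + (jc -[1+ 0 ] m * (1ℚ * f (decAt m 0)) + 0ℚ * J (+ 1) f m))
    ≡⟨ cong₂ (λ x y → x * (y * (0ℚ * f m) + (jc -[1+ 0 ] m * (1ℚ * f (decAt m 0)) + 0ℚ * J (+ 1) f m))) r1 ι1 ⟩
  1ℚ * (1ℚ * (0ℚ * f m) + (jc -[1+ 0 ] m * (1ℚ * f (decAt m 0)) + 0ℚ * J (+ 1) f m))
    ≡⟨ l2 (f m) (jc -[1+ 0 ] m) (f (decAt m 0)) (J (+ 1) f m) ⟩
  jc -[1+ 0 ] m * f (decAt m 0) ∎
  where
  open ≡-Reasoning
  l1 : ∀ a x y → a * (0ℚ * x) + 0ℚ * y ≡ 0ℚ
  l1 = solve-∀ ℚR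
  l2 : ∀ a b c d → 1ℚ * (1ℚ * (0ℚ * a) + (b * (1ℚ * c) + 0ℚ * d)) ≡ b * c
  l2 = solve-∀ ℚR
  r1 : recip 0 ≡ 1ℚ
  r1 = trans (sym (ℚ.*-identityʳ (recip 0))) (trans (cong (recip 0 *_) (sym ι1)) (recip-ι 0))

-- Coefficients that are polynomials in v

shift1 : ℕ → (ℕ → ℚ) → ℕ → ℚ
shift1 zero G x = G x
shift1 (suc a) G zero = 0ℚ
shift1 (suc a) G (suc x) = shift1 a G x

-- The coefficient of v^v in v^α · Σ_u G(u) v^u.
shiftV : ∀ {n} → Vec ℕ n → (Vec ℕ n → ℚ) → Vec ℕ n → ℚ
shiftV [] G [] = G []
shiftV (a ∷ α) G (x ∷ v) = shift1 a (λ y → shiftV α (λ u → G (y ∷ u)) v) x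

shift1-Lin : ∀ a → Lin (shift1 a)
shift1-Lin zero c e x = e x
shift1-Lin (suc a) c e zero = sym (trans (ℚ.+-identityʳ (c * 0ℚ)) (ℚ.*-zeroʳ c))
shift1-Lin (suc a) c e (suc x) = shift1-Lin a c e x

shiftV-Lin : ∀ {n} (α : Vec ℕ n) → Lin (shiftV α)
shiftV-Lin [] c e [] = e []
shiftV-Lin (a ∷ α) c e (x ∷ v) = shift1-Lin a c (λ y → shiftV-Lin α c (λ u → e (y ∷ u)) v) x

shiftV-0 : ∀ {n} G (v : Vec ℕ n) → shiftV (Vec.replicate n 0) G v ≡ G v
shiftV-0 G [] = refl
shiftV-0 G (x ∷ v) = shiftV-0 (λ u → G (x ∷ u)) v

shift1-+ : ∀ a b G x → shift1 (a ℕ.+ b) G x ≡ shift1 a (shift1 b G) x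
shift1-+ zero b G x = refl
shift1-+ (suc a) b G zero = refl
shift1-+ (suc a) b G (suc x) = shift1-+ a b G x

shift1-out : ∀ {A B : Set} {Q : (A → ℚ) → (B → ℚ)} → Lin Q → ∀ b (H : ℕ → A → ℚ) y c → shift1 b (λ y' → Q (H y') c) y ≡ Q (λ a → shift1 b (λ y' → H y' a) y) c
shift1-out L zero H y c = refl
shift1-out L (suc b) H zero c = sym (lin-zero L (λ _ → refl) c)
shift1-out L (suc b) H (suc y) c = shift1-out L b H y c

shiftV-+ : ∀ {n} (α β : Vec ℕ n) G v → shiftV (Vec.zipWith ℕ._+_ α β) G v ≡ shiftV α (shiftV β G) v
shiftV-+ [] [] G [] = refl
shiftV-+ (a ∷ α) (b ∷ β) G (x ∷ v) = trans (shift1-+ a b (λ y → shiftV (Vec.zipWith ℕ._+_ α β) (λ u → G (y ∷ u)) v) x)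
  (lin-cong (shift1-Lin a) (λ y → trans (lin-cong (shift1-Lin b) (λ y' → shiftV-+ α β (λ u → G (y' ∷ u)) v) y)
     (shift1-out (shiftV-Lin α) b (λ y' → shiftV β (λ u → G (y' ∷ u))) y v)) x)

eqV-shift : ∀ {n} (α u v : Vec ℕ n) → ⟦ eqV (Vec.zipWith ℕ._+_ α u) v ⟧ ≡ shiftV α (λ v' → ⟦ eqV u v' ⟧) v
eqV-shift [] [] [] = refl
eqV-shift (a ∷ α) (b ∷ u) (x ∷ v) = trans (go a x) (lin-cong (shift1-Lin a) (λ y → trans (⟦∧⟧ (b ℕ.≡ᵇ y) (eqV (Vec.zipWith ℕ._+_ α u) v))
    (trans (cong (⟦ b ℕ.≡ᵇ y ⟧ *_) (eqV-shift α u v)) (sym (lin-* (shiftV-Lin α) ⟦ b ℕ.≡ᵇ y ⟧ (λ v' → ⟦∧⟧ (b ℕ.≡ᵇ y) (eqV u v')) v)))) x)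
  where
  E = eqV (Vec.zipWith ℕ._+_ α u) v
  go : ∀ a x → ⟦ (a ℕ.+ b ℕ.≡ᵇ x) ∧ E ⟧ ≡ shift1 a (λ y → ⟦ (b ℕ.≡ᵇ y) ∧ E ⟧) x
  go zero x = refl
  go (suc a) zero = refl
  go (suc a) (suc x) = go a x

⟨⟩-natural : ∀ {r} {B C : Set} {Q : (B → ℚ) → (C → ℚ)} → Lin Q → ∀ (p : Poly r) (Φ : B → Mono r → ℚ) c → Q (λ b → ⟨ p , Φ b ⟩) c ≡ ⟨ p , (λ u → Q (λ b → Φ b u) c) ⟩
⟨⟩-natural L [] Φ c = lin-zero L (λ _ → refl) c
⟨⟩-natural L ((a , u) ∷ p) Φ c = trans (L a (λ _ → refl) c) (cong (λ z → a * _ + z) (⟨⟩-natural L p Φ c))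

ΣV : ∀ {r} → PolyV r → (Vec ℕ r → ℚ) → Vec ℕ r → ℚ
ΣV a G v = ΣL a (λ u → proj₁ u * shiftV (proj₂ u) G v)

module _ {r : ℕ} where

  ⟨⟩-ιV : ∀ (a : PolyV r) φ → ⟨ ιV a , φ ⟩ ≡ ΣL a (λ u → proj₁ u * φ (mono 0 (proj₂ u) []))
  ⟨⟩-ιV [] φ = refl
  ⟨⟩-ιV (u ∷ a) φ = cong (λ z → proj₁ u * φ (mono 0 (proj₂ u) []) + z) (⟨⟩-ιV a φ)

  ιV-slice : ∀ (a : PolyV r) p x v t → slice (ιV a ⊗ p) x v t ≡ ΣV a (λ v' → slice p x v' t) v
  ιV-slice a p x v t = trans (coeff-⟨⟩ (ιV a ⊗ p) (mono x v t)) (trans (⟨⟩-⊗ (ιV a) p (ind (mono x v t))) (trans (⟨⟩-ιV a _)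
    (ΣL-cong a (λ { (c , α) → cong (c *_) (trans (⟨⟩-cong p (term α)) (trans (sym (⟨⟩-natural (shiftV-Lin α) p (λ v' → ind (mono x v' t)) v)) (lin-cong (shiftV-Lin α) (λ v' → sym (coeff-⟨⟩ p (mono x v' t))) v))) }))))
    where
    split3 : ∀ u v → ind (mono x v t) u ≡ (⟦ xe u ℕ.≡ᵇ x ⟧ * ⟦ eqL (te u) t ⟧) * ⟦ eqV (ve u) v ⟧
    split3 u v = trans (ind-split u x v t) (trans (cong (_* ⟦ eqL (te u) t ⟧) (⟦∧⟧ (xe u ℕ.≡ᵇ x) (eqV (ve u) v))) (l ⟦ xe u ℕ.≡ᵇ x ⟧ ⟦ eqV (ve u) v ⟧ ⟦ eqL (te u) t ⟧))
      where
      l : ∀ a b c → a * b * c ≡ (a * c) * b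
      l = solve-∀ ℚR
    term : ∀ α u → ind (mono x v t) (mulMono (mono 0 α []) u) ≡ shiftV α (λ v' → ind (mono x v' t) u) v
    term α u = trans (split3 (mulMono (mono 0 α []) u) v) (trans (cong (λ z → (⟦ xe u ℕ.≡ᵇ x ⟧ * ⟦ eqL (te u) t ⟧) * z) (eqV-shift α (ve u) v))
      (sym (lin-* (shiftV-Lin α) (⟦ xe u ℕ.≡ᵇ x ⟧ * ⟦ eqL (te u) t ⟧) (split3 u) v)))

  Aop-slice : ∀ (a : Fin (suc r) → PolyV r) p x v t → slice (Aop a p) x v t ≡ ΣL (allFin (suc r)) (λ i → ΣV (a i) (λ v' → X (suc (toℕ i)) (+ 1) (slice p x v') t) v)
  Aop-slice a p x v t = trans (slice-sumP (map (λ i → ιV (a i) ⊗ Pmode (suc (toℕ i)) (ℤ.- (+ 1)) p) (allFin (suc r))) x v t)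
    (trans (ΣL-map (λ i → ιV (a i) ⊗ Pmode (suc (toℕ i)) (ℤ.- (+ 1)) p) (allFin (suc r)) (λ q → slice q x v t))
    (ΣL-cong (allFin (suc r)) (λ i → trans (ιV-slice (a i) (Pmode (suc (toℕ i)) (ℤ.- (+ 1)) p) x v t)
      (ΣL-cong (a i) (λ u → cong (proj₁ u *_) (lin-cong (shiftV-Lin (proj₂ u)) (λ v' → Pmode-X (toℕ i) p x v' t) v))))))

  -- Evaluating a polynomial identity at ad C

  RespM : (Mono r → ℚ) → Set
  RespM φ = ∀ u w → eqMono u w ≡ true → φ u ≡ φ w

  eqV-sound : ∀ {n} (u v : Vec ℕ n) → eqV u v ≡ true → u ≡ v
  eqV-sound [] [] e = refl
  eqV-sound (x ∷ u) (y ∷ v) e = cong₂ _∷_ (≡ᵇ-true x y (proj₁ (∧-true e))) (eqV-sound u v (proj₂ (∧-true {x ℕ.≡ᵇ y} e)))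

  eqV-refl : ∀ {n} (v : Vec ℕ n) → eqV v v ≡ true
  eqV-refl [] = refl
  eqV-refl (x ∷ v) rewrite ≡ᵇ-refl x = eqV-refl v

  ind-RespM : ∀ m → RespM (ind m)
  ind-RespM (mono x v t) (mono x₁ v₁ t₁) (mono x₂ v₂ t₂) e with ∧-true {x₁ ℕ.≡ᵇ x₂} e
  ... | ex , e' with ∧-true {eqV v₁ v₂} e'
  ...   | ev , et with ≡ᵇ-true x₁ x₂ ex | eqV-sound v₁ v₂ ev | eqL-sound t₁ t₂ et
  ...     | refl | refl | h = cong (λ b → ⟦ (x₁ ℕ.≡ᵇ x) ∧ eqV v₁ v ∧ b ⟧) (eqL-iff {t₁} {t} {t₂} {t} (λ q → ~-trans (~-sym h) q) (λ q → ~-trans h q))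

  eqMono-refl : ∀ (u : Mono r) → eqMono u u ≡ true
  eqMono-refl (mono x v t) rewrite ≡ᵇ-refl x | eqV-refl v = eqL-complete t t (~i (λ _ → refl))

  other : Mono r → Poly r → Poly r
  other u = filterᵇ (λ w → not (eqMono (proj₂ w) u))

  other-length : ∀ u p → length (other u p) ≤ length p
  other-length u p = List.length-filter (λ w → Bool.T? (not (eqMono (proj₂ w) u))) p

  ⟨⟩-other : ∀ u (p : Poly r) φ → RespM φ → ⟨ p , φ ⟩ ≡ ⟨ p , ind u ⟩ * φ u + ⟨ other u p , φ ⟩
  ⟨⟩-other u [] φ h = sym (trans (cong (_+ 0ℚ) (ℚ.*-zeroˡ (φ u))) (ℚ.+-identityʳ 0ℚ))
  ⟨⟩-other u ((c , w) ∷ p) φ h with eqMono w u in eq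
  ... | true = trans (cong₂ (λ x y → c * x + y) (h w u eq) (⟨⟩-other u p φ h)) (l c (φ u) ⟨ p , ind u ⟩ ⟨ other u p , φ ⟩)
    where
    l : ∀ c x y z → c * x + (y * x + z) ≡ (c * 1ℚ + y) * x + z
    l = solve-∀ ℚR
  ... | false = trans (cong (λ y → c * φ w + y) (⟨⟩-other u p φ h)) (l c (φ w) (φ u) ⟨ p , ind u ⟩ ⟨ other u p , φ ⟩)
    where
    l : ∀ c x u y z → c * x + (y * u + z) ≡ (c * 0ℚ + y) * u + (c * x + z)
    l = solve-∀ ℚR

  -- A `Poly` may list a monomial several times, so zero coefficients do not make it empty.
  -- Induction on the number of terms: those with the first monomial are collected, their total
  -- coefficient vanishes, and the rest again has zero coefficients only.
  zero-functional : ∀ φ → RespM φ → ∀ n (p : Poly r) → length p ≤ n → (∀ m → ⟨ p , ind m ⟩ ≡ 0ℚ) → ⟨ p , φ ⟩ ≡ 0ℚ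
  zero-functional φ h n [] le z = refl
  zero-functional φ h (suc n) ((c , u) ∷ p) le z = begin
    c * φ u + ⟨ p , φ ⟩ ≡⟨ split φ h ⟩
    ⟨ (c , u) ∷ p , ind u ⟩ * φ u + ⟨ other u p , φ ⟩
      ≡⟨ cong₂ (λ x y → x * φ u + y) (z u) (zero-functional φ h n (other u p) (ℕ.≤-trans (other-length u p) (ℕ.≤-pred le)) rest) ⟩
    0ℚ * φ u + 0ℚ ≡⟨ trans (ℚ.+-identityʳ (0ℚ * φ u)) (ℚ.*-zeroˡ (φ u)) ⟩
    0ℚ ∎
    where
    open ≡-Reasoning
    split : ∀ φ → RespM φ → c * φ u + ⟨ p , φ ⟩ ≡ ⟨ (c , u) ∷ p , ind u ⟩ * φ u + ⟨ other u p , φ ⟩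
    split φ h = trans (cong (λ y → c * φ u + y) (⟨⟩-other u p φ h)) (trans (l c (φ u) ⟨ p , ind u ⟩ ⟨ other u p , φ ⟩)
       (cong (λ b → (c * b + ⟨ p , ind u ⟩) * φ u + ⟨ other u p , φ ⟩) (sym (cong ⟦_⟧ (eqMono-refl u)))))
      where
      l : ∀ c x y z → c * x + (y * x + z) ≡ (c * 1ℚ + y) * x + z
      l = solve-∀ ℚR
    rest : ∀ m → ⟨ other u p , ind m ⟩ ≡ 0ℚ
    rest m = trans (l2 (⟨ (c , u) ∷ p , ind u ⟩ * ind m u) ⟨ other u p , ind m ⟩) (trans (cong₂ (λ x y → x - y * ind m u) (trans (sym (split (ind m) (ind-RespM m))) (z m)) (z u)) (l3 (ind m u)))
      where
      l2 : ∀ a b → b ≡ a + b - a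
      l2 = solve-∀ ℚR
      l3 : ∀ a → 0ℚ - 0ℚ * a ≡ 0ℚ
      l3 = solve-∀ ℚR

  ≋-⟨⟩ : ∀ {p q : Poly r} → p ≋ q → ∀ φ → RespM φ → ⟨ p , φ ⟩ ≡ ⟨ q , φ ⟩
  ≋-⟨⟩ {p} {q} e φ h = trans (l ⟨ p , φ ⟩ ⟨ q , φ ⟩) (trans (cong (_+ ⟨ q , φ ⟩) (trans (sym (diff φ)) (zero-functional φ h _ d ℕ.≤-refl (λ m → trans (diff (ind m)) (trans (cong (_- ⟨ q , ind m ⟩) (trans (sym (coeff-⟨⟩ p m)) (trans (e m) (coeff-⟨⟩ q m)))) (ℚ.+-inverseʳ ⟨ q , ind m ⟩)))))) (ℚ.+-identityˡ _))
    where
    d = p ++ scaleP (- 1ℚ) q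
    l : ∀ x y → x ≡ x - y + y
    l = solve-∀ ℚR
    l' : ∀ x y → x + (- 1ℚ) * y ≡ x - y
    l' = solve-∀ ℚR
    diff : ∀ φ → ⟨ d , φ ⟩ ≡ ⟨ p , φ ⟩ - ⟨ q , φ ⟩
    diff φ = trans (⟨⟩-++ p (scaleP (- 1ℚ) q) φ) (trans (cong (λ z → ⟨ p , φ ⟩ + z) (⟨⟩-scale (- 1ℚ) q φ)) (l' ⟨ p , φ ⟩ ⟨ q , φ ⟩))

  module _ (g : Vec ℕ r → Fn) (t : List ℕ) where

    -- The functional x^j v^α ↦ coefficient of v^v in v^α · O_j g.
    φ : (ℕ → Fn → Fn) → Vec ℕ r → Mono r → ℚ
    φ O v u = shiftV (ve u) (λ v' → O (xe u) (g v') t) v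

    φ-RespM : ∀ O v → RespM (φ O v)
    φ-RespM O v (mono x₁ v₁ t₁) (mono x₂ v₂ t₂) e with ∧-true {x₁ ℕ.≡ᵇ x₂} e
    ... | ex , e' with ≡ᵇ-true x₁ x₂ ex | eqV-sound v₁ v₂ (proj₁ (∧-true e'))
    ...   | refl | refl = refl

    ⟨⟩-ιV⊗ : ∀ (a : PolyV r) q O v → ⟨ ιV a ⊗ q , φ O v ⟩ ≡ ΣV a (λ v' → ⟨ q , φ O v' ⟩) v
    ⟨⟩-ιV⊗ a q O v = trans (⟨⟩-⊗ (ιV a) q (φ O v)) (trans (⟨⟩-ιV a _) (ΣL-cong a (λ { (c , α) → cong (λ z → c * z)
      (trans (⟨⟩-cong q (λ u → shiftV-+ α (ve u) (λ v' → O (xe u) (g v') t) v)) (sym (⟨⟩-natural (shiftV-Lin α) q (φ O) v))) })))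

    φ-one : ∀ O v (u : Mono r) → φ O v (mulMono oneMono u) ≡ φ O v u
    φ-one O v u = cong (λ z → shiftV z (λ v' → O (xe u) (g v') t) v) (zip-0 {r} (ve u))

    ⟨⟩-const⊗ : ∀ c q O v → ⟨ constP c ⊗ q , φ O v ⟩ ≡ c * ⟨ q , φ O v ⟩
    ⟨⟩-const⊗ c q O v = trans (⟨⟩-⊗ (constP c) q (φ O v)) (trans (ℚ.+-identityʳ _) (cong (c *_) (⟨⟩-cong q (φ-one O v))))

    ⟨⟩-x⊗ : ∀ q O v → ⟨ xP ⊗ q , φ O v ⟩ ≡ ⟨ q , φ (O ∘ suc) v ⟩
    ⟨⟩-x⊗ q O v = trans (⟨⟩-⊗ xP q (φ O v)) (trans (ℚ.+-identityʳ _) (trans (ℚ.*-identityˡ _) (⟨⟩-cong q (λ u → cong (λ z → shiftV z (λ v' → O (suc (xe u)) (g v') t) v) (zip-0 {r} (ve u))))))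

    ⟨⟩-v⊗ : ∀ i q O v → ⟨ vP i ⊗ q , φ O v ⟩ ≡ shiftV (Vec.updateAt (Vec.replicate r 0) i (λ _ → 1)) (λ v' → ⟨ q , φ O v' ⟩) v
    ⟨⟩-v⊗ i q O v = trans (⟨⟩-⊗ (vP i) q (φ O v)) (trans (ℚ.+-identityʳ _) (trans (ℚ.*-identityˡ _)
      (trans (⟨⟩-cong q (λ u → shiftV-+ (Vec.updateAt (Vec.replicate r 0) i (λ _ → 1)) (ve u) (λ v' → O (xe u) (g v') t) v)) (sym (⟨⟩-natural (shiftV-Lin (Vec.updateAt (Vec.replicate r 0) i (λ _ → 1))) q (φ O) v)))))

    ⊕⊗ : ∀ (p q s : Poly r) ψ → ⟨ (p ⊕ q) ⊗ s , ψ ⟩ ≡ ⟨ p ⊗ s , ψ ⟩ + ⟨ q ⊗ s , ψ ⟩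
    ⊕⊗ p q s ψ = trans (⟨⟩-⊗ (p ⊕ q) s ψ) (trans (⟨⟩-++ p q _) (sym (cong₂ _+_ (⟨⟩-⊗ p s ψ) (⟨⟩-⊗ q s ψ))))

    ⟨⟩-one : ∀ O v → ⟨ oneP , φ O v ⟩ ≡ O 0 (g v) t
    ⟨⟩-one O v = trans (ℚ.+-identityʳ _) (trans (ℚ.*-identityˡ _) (shiftV-0 (λ v' → O 0 (g v') t) v))

    -- The factor x - s turns `W s` into `W (suc s)` by `W-step`, so n consecutive factors move the
    -- index from s to s + n.
    falling : (∀ v → Pol (g v)) → ∀ n s h v → (∀ j → h j ≡ xP ⊕ constP (- ℕtoℚ (s ℕ.+ j))) → ⟨ prodP (applyUpTo h n) , φ (W s) v ⟩ ≡ P (s ℕ.+ n) (g v) t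
    falling pol zero s h v e = trans (⟨⟩-one (W s) v) (cong (λ z → P z (g v) t) (sym (ℕ.+-identityʳ s)))
    falling pol (suc n) s h v e = begin
      ⟨ h 0 ⊗ q , φ (W s) v ⟩
        ≡⟨ cong (λ z → ⟨ z ⊗ q , φ (W s) v ⟩) (e 0) ⟩
      ⟨ (xP ⊕ constP (- ℕtoℚ (s ℕ.+ 0))) ⊗ q , φ (W s) v ⟩
        ≡⟨ ⊕⊗ xP (constP (- ℕtoℚ (s ℕ.+ 0))) q (φ (W s) v) ⟩
      ⟨ xP ⊗ q , φ (W s) v ⟩ + ⟨ constP (- ℕtoℚ (s ℕ.+ 0)) ⊗ q , φ (W s) v ⟩
        ≡⟨ cong₂ _+_ (⟨⟩-x⊗ q (W s) v) (trans (⟨⟩-const⊗ (- ℕtoℚ (s ℕ.+ 0)) q (W s) v) (cong (λ z → (- z) * ⟨ q , φ (W s) v ⟩) (trans (cong ℕtoℚ (ℕ.+-identityʳ s)) (ι-def (+ s))))) ⟩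
      ⟨ q , φ (W s ∘ suc) v ⟩ + (- ι (+ s)) * ⟨ q , φ (W s) v ⟩
        ≡⟨ trans (ℚ.+-comm ⟨ q , φ (W s ∘ suc) v ⟩ ((- ι (+ s)) * ⟨ q , φ (W s) v ⟩)) (sym (⟨⟩-lin q (- ι (+ s)) (λ u → (shiftV-Lin (ve u) (- ι (+ s)) {h = λ v' → W (suc s) (xe u) (g v') t} (λ v' → l (W s (suc (xe u)) (g v') t) (W (suc s) (xe u) (g v') t) (ι (+ s)) (W s (xe u) (g v') t) (W-step s (xe u) (pol v') t)) v)) 0)) ⟩
      ⟨ q , φ (W (suc s)) v ⟩
        ≡⟨ falling pol n (suc s) (h ∘ suc) v (λ j → trans (e (suc j)) (cong (λ z → xP ⊕ constP (- ℕtoℚ z)) (ℕ.+-suc s j))) ⟩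
      P (suc s ℕ.+ n) (g v) t
        ≡⟨ cong (λ z → P z (g v) t) (sym (ℕ.+-suc s n)) ⟩
      P (s ℕ.+ suc n) (g v) t ∎
      where
      open ≡-Reasoning
      q = prodP (applyUpTo (h ∘ suc) n)
      l : ∀ a b i c → a ≡ b + i * c → b ≡ (- i) * c + a
      l .(b + i * c) b i c refl = l' b i c
        where
        l' : ∀ b i c → b ≡ (- i) * c + (b + i * c)
        l' = solve-∀ ℚR

    -- The value of ∏ (x + v_i) under the functional: for each i, either one more commutator with C
    -- or a shift in the i-th exponent of v.
    RR : List (Fin r) → (ℕ → Fn → Fn) → Vec ℕ r → ℚ
    RR [] O v = O 0 (g v) t
    RR (i ∷ is) O v = RR is (O ∘ suc) v + shiftV (Vec.updateAt (Vec.replicate r 0) i (λ _ → 1)) (RR is O) v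

    ⟨⟩-prod : ∀ is O v → ⟨ prodP (map (λ i → xP ⊕ vP i) is) , φ O v ⟩ ≡ RR is O v
    ⟨⟩-prod [] O v = ⟨⟩-one O v
    ⟨⟩-prod (i ∷ is) O v = trans (⊕⊗ xP (vP i) q (φ O v)) (cong₂ _+_ (trans (⟨⟩-x⊗ q O v) (⟨⟩-prod is (O ∘ suc) v))
      (trans (⟨⟩-v⊗ i q O v) (lin-cong (shiftV-Lin (Vec.updateAt (Vec.replicate r 0) i (λ _ → 1))) (⟨⟩-prod is O) v)))
      where q = prodP (map (λ i → xP ⊕ vP i) is)

    ⟨⟩-sumP : ∀ (ps : List (Poly r)) ψ → ⟨ sumP ps , ψ ⟩ ≡ ΣL ps (λ p → ⟨ p , ψ ⟩)
    ⟨⟩-sumP [] ψ = refl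
    ⟨⟩-sumP (p ∷ ps) ψ = trans (⟨⟩-++ p (sumP ps) ψ) (cong (λ z → ⟨ p , ψ ⟩ + z) (⟨⟩-sumP ps ψ))

    -- The factor k in the identity for the a_k cancels the denominator of `P`. This leaves Σ a_k
    -- P^(k) on the left and ∏ (ad C + v_i), applied to p_1, on the right.
    identity-applied : (∀ v → Pol (g v)) → (a : Fin (suc r) → PolyV r) → aIdentity a → ∀ v →
      ΣL (allFin (suc r)) (λ i → ΣV (a i) (λ v' → X (suc (toℕ i)) (+ 1) (g v') t) v) ≡ RR (allFin r) (W 0) v
    identity-applied pol a aI v = trans (sym lhs) (trans (≋-⟨⟩ {sumP (map F (allFin (suc r)))} {prodP (map (λ i → xP ⊕ vP i) (allFin r))} aI (φ (W 0) v) (φ-RespM (W 0) v)) (⟨⟩-prod (allFin r) (W 0) v))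
      where
      F : Fin (suc r) → Poly r
      F i = constP (ℕtoℚ (suc (toℕ i))) ⊗ (ιV (a i) ⊗ fallingX (toℕ i))
      l : ∀ i r x → (r * i) * x ≡ i * (r * x)
      l = solve-∀ ℚR
      unP : ∀ i v' → ι (+ suc (toℕ i)) * P (toℕ i) (g v') t ≡ X (suc (toℕ i)) (+ 1) (g v') t
      unP i v' = trans (sym (l (ι (+ suc (toℕ i))) (recip (toℕ i)) x)) (trans (cong (_* x) (recip-ι (toℕ i))) (ℚ.*-identityˡ x))
        where x = X (suc (toℕ i)) (+ 1) (g v') t
      lhs : ⟨ sumP (map F (allFin (suc r))) , φ (W 0) v ⟩ ≡ ΣL (allFin (suc r)) (λ i → ΣV (a i) (λ v' → X (suc (toℕ i)) (+ 1) (g v') t) v)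
      lhs = trans (⟨⟩-sumP (map F (allFin (suc r))) (φ (W 0) v)) (trans (ΣL-map F (allFin (suc r)) (λ p → ⟨ p , φ (W 0) v ⟩)) (ΣL-cong (allFin (suc r)) (λ i →
        trans (⟨⟩-const⊗ (ℕtoℚ (suc (toℕ i))) (ιV (a i) ⊗ fallingX (toℕ i)) (W 0) v) (trans (cong₂ _*_ (ι-def (+ suc (toℕ i))) (⟨⟩-ιV⊗ (a i) (fallingX (toℕ i)) (W 0) v))
        (trans (sym (ΣL-* (a i) (ι (+ suc (toℕ i))))) (ΣL-cong (a i) (λ { (c , α) → trans (comm* (ι (+ suc (toℕ i))) c _)
           (cong (c *_) (trans (sym (lin-* (shiftV-Lin α) (ι (+ suc (toℕ i))) (λ _ → refl) v)) (lin-cong (shiftV-Lin α) (λ v' → trans (cong (λ z → ι (+ suc (toℕ i)) * z) (falling pol (toℕ i) 0 (λ j → xP ⊕ constP (- ℕtoℚ j)) v' (λ _ → refl))) (unP i v')) v))) })))))))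
        where
        comm* : ∀ a b c → a * (b * c) ≡ b * (a * c)
        comm* = solve-∀ ℚR

-- `RR` again, now recursing along the exponent vector instead of a list of indices, which is the
-- form that arises from tuples of permutations.
RV : ∀ n → (ℕ → Fn → Fn) → (Vec ℕ n → Fn) → Vec ℕ n → Fn
RV zero O g [] t = O 0 (g []) t
RV (suc n) O g (k ∷ ks) t = RV n (O ∘ suc) (λ us → g (k ∷ us)) ks t + shift1 1 (λ k' → RV n O (λ us → g (k' ∷ us)) ks t) k

RR-suc : ∀ {r} (g : Vec ℕ (suc r) → Fn) t is O k ks → RR g t (map Fin.suc is) O (k ∷ ks) ≡ RR (λ us → g (k ∷ us)) t is O ks
RR-suc g t [] O k ks = refl
RR-suc {r} g t (i ∷ is) O k ks = cong₂ _+_ (RR-suc g t is (O ∘ suc) k ks) (lin-cong (shiftV-Lin (Vec.updateAt (Vec.replicate r 0) i (λ _ → 1))) (λ us → RR-suc g t is O k us) ks)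

RR-RV : ∀ r (g : Vec ℕ r → Fn) t O v → RR g t (allFin r) O v ≡ RV r O g v t
RR-RV zero g t O [] = refl
RR-RV (suc r) g t O (k ∷ ks) = trans (cong (λ is → RR g t is (O ∘ suc) (k ∷ ks) + shift1 1 (λ y → shiftV (Vec.replicate r 0) (λ u → RR g t is O (y ∷ u)) ks) k) (sym (List.map-tabulate (λ i → i) Fin.suc)))
  (cong₂ _+_ (go (O ∘ suc) k) (lin-cong (shift1-Lin 1) (λ y → trans (shiftV-0 (λ u → RR g t (map Fin.suc (allFin r)) O (y ∷ u)) ks) (go O y)) k))
  where
  go : ∀ O k → RR g t (map Fin.suc (allFin r)) O (k ∷ ks) ≡ RV r O (λ us → g (k ∷ us)) ks t
  go O k = trans (RR-suc g t (allFin r) O k ks) (RR-RV r (λ us → g (k ∷ us)) t O ks)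

Aop-RV : ∀ {r} (a : Fin (suc r) → PolyV r) → aIdentity a → ∀ p x → (∀ v → Pol (slice p x v)) → ∀ v t → slice (Aop a p) x v t ≡ RV r (W 0) (slice p x) v t
Aop-RV {r} a aI p x pol v t = trans (Aop-slice a p x v t) (trans (identity-applied (slice p x) t pol a aI v) (RR-RV r (slice p x) t (W 0) v))

-- Cutting and joining cycles

-- An entry `l` stands for the factor p_(l+1), as in `J -[1+ l ]`.
PP : List ℕ → Fn
PP [] = vac
PP (l ∷ ls) = J -[1+ l ] (PP ls)

PP-Pol : ∀ ls → Pol (PP ls)
PP-Pol [] = vac-pol
PP-Pol (l ∷ ls) = J-pol l (PP-Pol ls)

J⁻-comm : ∀ a b {f} m → Resp f → J -[1+ a ] (J (ℤ.- + b) f) m ≡ J (ℤ.- + b) (J -[1+ a ] f) m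
J⁻-comm a b {f} m r = trans (l (J -[1+ a ] (J (ℤ.- + b) f) m) (J (ℤ.- + b) (J -[1+ a ] f) m))
  (trans (cong (_+ J (ℤ.- + b) (J -[1+ a ] f) m) (trans (JJ -[1+ a ] (ℤ.- + b) f m r) (sym (zero-rhs (ι -[1+ a ]) (f m) (neg b))))) (ℚ.+-identityˡ _))
  where
  l : ∀ x y → x ≡ x - y + y
  l = solve-∀ ℚR
  neg : ∀ b → δ (-[1+ a ] ℤ.+ ℤ.- + b) ≡ 0ℚ
  neg zero = refl
  neg (suc b) = refl

PP-↭ : ∀ {ls ls'} → ls ↭ ls' → ∀ m → PP ls m ≡ PP ls' m
PP-↭ ↭.refl m = refl
PP-↭ (↭.prep l p) m = lin-cong (J-lin -[1+ l ]) (PP-↭ p) m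
PP-↭ (↭.swap {xs} l k p) m = trans (J⁻-comm l (suc k) m (Pol-resp (PP-Pol xs))) (lin-cong (J-lin -[1+ k ]) (lin-cong (J-lin -[1+ l ]) (PP-↭ p)) m)
PP-↭ (↭.trans p q) m = trans (PP-↭ p m) (PP-↭ q m)

-- A cycle of length l + 1 is cut into lengths i + 1 and l - i, or joined with one of length c + 1
-- at any of the c + 1 points of the latter. The index `i` = `l` is no cut and contributes J_0 = 0.
Cut Join : ℕ → List ℕ → Fn
Cut l ls m = Σ< (suc l) (λ i → J -[1+ i ] (J (ℤ.- + (l ℕ.∸ i)) (PP ls)) m)
Join l [] m = 0ℚ
Join l (c ∷ ls) m = ι (+ suc c) * J -[1+ suc (c ℕ.+ l) ] (PP ls) m + J -[1+ c ] (Join l ls) m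

Cut-∷ : ∀ l c ls m → Cut l (c ∷ ls) m ≡ J -[1+ c ] (Cut l ls) m
Cut-∷ l c ls m = trans (Σ<-cong (suc l) (λ i → trans (lin-cong (J-lin -[1+ i ]) (λ m → sym (J⁻-comm c (l ℕ.∸ i) m r)) m) (J⁻-comm i (suc c) m (J-resp (ℤ.- + (l ℕ.∸ i)) r))))
  (sym (lin-Σ< (J-lin -[1+ c ]) (suc l) (λ i → J -[1+ i ] (J (ℤ.- + (l ℕ.∸ i)) (PP ls))) m))
  where r = Pol-resp (PP-Pol ls)

-- On the vacuum `Λ` only cuts. Every factor it passes leaves a commutator with the doubled
-- coefficient of `Λ-comm`, hence the two copies of `Join`.
Λ-PP : ∀ l ls m → Λ (+ suc l) (PP ls) m ≡ Cut l ls m + (Join l ls m + Join l ls m)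
Λ-PP l [] m = trans (Λ⁺-vac l m) (sym (ℚ.+-identityʳ _))
Λ-PP l (c ∷ ls) m = begin
  Λ (+ suc l) (J -[1+ c ] (PP ls)) m
    ≡⟨ l1 (Λ (+ suc l) (J -[1+ c ] (PP ls)) m) (J -[1+ c ] (Λ (+ suc l) (PP ls)) m) ⟩
  J -[1+ c ] (Λ (+ suc l) (PP ls)) m - (J -[1+ c ] (Λ (+ suc l) (PP ls)) m - Λ (+ suc l) (J -[1+ c ] (PP ls)) m)
    ≡⟨ cong₂ _-_ (trans (lin-+ (J-lin -[1+ c ]) {Cut l ls} {λ m → Join l ls m + Join l ls m} (Λ-PP l ls) m) (cong (λ z → J -[1+ c ] (Cut l ls) m + z) (lin-+ (J-lin -[1+ c ]) {Join l ls} {Join l ls} (λ _ → refl) m)))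
         (trans (Λ-comm -[1+ c ] (+ suc l) m (Pol-resp (PP-Pol ls))) (cong (λ i → (i + i) * J -[1+ suc (c ℕ.+ l) ] (PP ls) m) (ι-neg (+ suc c)))) ⟩
  J -[1+ c ] (Cut l ls) m + (J -[1+ c ] (Join l ls) m + J -[1+ c ] (Join l ls) m) - (- ι (+ suc c) + - ι (+ suc c)) * J -[1+ suc (c ℕ.+ l) ] (PP ls) m
    ≡⟨ l2 (J -[1+ c ] (Cut l ls) m) (J -[1+ c ] (Join l ls) m) (ι (+ suc c)) (J -[1+ suc (c ℕ.+ l) ] (PP ls) m) ⟩
  J -[1+ c ] (Cut l ls) m + (Join l (c ∷ ls) m + Join l (c ∷ ls) m)
    ≡⟨ cong (_+ (Join l (c ∷ ls) m + Join l (c ∷ ls) m)) (sym (Cut-∷ l c ls m)) ⟩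
  Cut l (c ∷ ls) m + (Join l (c ∷ ls) m + Join l (c ∷ ls) m) ∎
  where
  open ≡-Reasoning
  l1 : ∀ x y → x ≡ y - (y - x)
  l1 = solve-∀ ℚR
  l2 : ∀ x y i z → x + (y + y) - (- i + - i) * z ≡ x + ((i * z + y) + (i * z + y))
  l2 = solve-∀ ℚR

select : ∀ {A : Set} → List A → List (A × List A)
select [] = []
select (x ∷ xs) = (x , xs) ∷ map (λ s → (proj₁ s , x ∷ proj₂ s)) (select xs)

Join-select : ∀ l ls m → Join l ls m ≡ ΣL (select ls) (λ s → ι (+ suc (proj₁ s)) * J -[1+ suc (proj₁ s ℕ.+ l) ] (PP (proj₂ s)) m)
Join-select l [] m = refl
Join-select l (c ∷ ls) m = cong (λ z → ι (+ suc c) * J -[1+ suc (c ℕ.+ l) ] (PP ls) m + z) (begin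
  J -[1+ c ] (Join l ls) m
    ≡⟨ lin-cong (J-lin -[1+ c ]) (Join-select l ls) m ⟩
  J -[1+ c ] (λ m → ΣL (select ls) (λ s → t s m)) m
    ≡⟨ ΣL-natural (J-lin -[1+ c ]) (select ls) t m ⟩
  ΣL (select ls) (λ s → J -[1+ c ] (t s) m)
    ≡⟨ ΣL-cong (select ls) (λ s → trans (lin-* (J-lin -[1+ c ]) (ι (+ suc (proj₁ s))) {s = J -[1+ suc (proj₁ s ℕ.+ l) ] (PP (proj₂ s))} (λ _ → refl) m) (cong (λ z → ι (+ suc (proj₁ s)) * z) (J⁻-comm c (suc (suc (proj₁ s ℕ.+ l))) m (Pol-resp (PP-Pol (proj₂ s)))))) ⟩
  ΣL (select ls) (λ s → ι (+ suc (proj₁ s)) * J -[1+ suc (proj₁ s ℕ.+ l) ] (PP (c ∷ proj₂ s)) m)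
    ≡⟨ sym (ΣL-map (λ s → (proj₁ s , c ∷ proj₂ s)) (select ls) _) ⟩
  ΣL (map (λ s → (proj₁ s , c ∷ proj₂ s)) (select ls)) (λ s → ι (+ suc (proj₁ s)) * J -[1+ suc (proj₁ s ℕ.+ l) ] (PP (proj₂ s)) m) ∎)
  where
  open ≡-Reasoning
  t : ℕ × List ℕ → Fn
  t s m = ι (+ suc (proj₁ s)) * J -[1+ suc (proj₁ s ℕ.+ l) ] (PP (proj₂ s)) m

cutjoin : ℕ × List ℕ → Fn
cutjoin (l , ls) m = ι (+ suc l) * (Cut l ls m + Join l ls m)

-- T = 2C is the cut-and-join operator: choose a point of some cycle, then cut or join there.
T-PP : ∀ ls m → T (PP ls) m ≡ ΣL (select ls) (λ s → cutjoin s m)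
T-PP [] m = T-vac m
T-PP (l ∷ ls) m = begin
  T (J -[1+ l ] (PP ls)) m
    ≡⟨ T-J -[1+ l ] m (Pol-resp (PP-Pol ls)) ⟩
  (- ι -[1+ l ]) * Λ (+ suc l) (PP ls) m + J -[1+ l ] (T (PP ls)) m
    ≡⟨ cong₂ (λ x y → x + y) (cong₂ (λ i x → (- i) * x) (ι-neg (+ suc l)) (Λ-PP l ls m)) (lin-cong (J-lin -[1+ l ]) (T-PP ls) m) ⟩
  (- - ι (+ suc l)) * (Cut l ls m + (Join l ls m + Join l ls m)) + J -[1+ l ] (λ m → ΣL (select ls) (λ s → cutjoin s m)) m
    -- Of the two copies of `Join`, one stays with the chosen cycle and the other is handed to the
    -- cycles that it joins, so that each of them counts the join from its own side.
    ≡⟨ l1 (ι (+ suc l)) (Cut l ls m) (Join l ls m) (J -[1+ l ] (λ m → ΣL (select ls) (λ s → cutjoin s m)) m) ⟩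
  cutjoin (l , ls) m + (ι (+ suc l) * Join l ls m + J -[1+ l ] (λ m → ΣL (select ls) (λ s → cutjoin s m)) m)
    ≡⟨ cong (λ z → cutjoin (l , ls) m + z) (cong₂ _+_ (trans (cong (λ z → ι (+ suc l) * z) (Join-select l ls m)) (sym (ΣL-* (select ls) (ι (+ suc l))))) (ΣL-natural (J-lin -[1+ l ]) (select ls) cutjoin m)) ⟩
  cutjoin (l , ls) m + (ΣL (select ls) (λ s → ι (+ suc l) * (ι (+ suc (proj₁ s)) * J -[1+ suc (proj₁ s ℕ.+ l) ] (PP (proj₂ s)) m)) + ΣL (select ls) (λ s → J -[1+ l ] (cutjoin s) m))
    ≡⟨ cong (λ z → cutjoin (l , ls) m + z) (trans (sym (lin-+ (ΣL-Lin (select ls)) (λ _ → refl) 0)) (ΣL-cong (select ls) term)) ⟩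
  cutjoin (l , ls) m + ΣL (select ls) (λ s → cutjoin (proj₁ s , l ∷ proj₂ s) m)
    ≡⟨ cong (λ z → cutjoin (l , ls) m + z) (sym (ΣL-map (λ s → (proj₁ s , l ∷ proj₂ s)) (select ls) (λ s → cutjoin s m))) ⟩
  ΣL (select (l ∷ ls)) (λ s → cutjoin s m) ∎
  where
  open ≡-Reasoning
  l1 : ∀ i c j x → (- - i) * (c + (j + j)) + x ≡ i * (c + j) + (i * j + x)
  l1 = solve-∀ ℚR
  l2 : ∀ i k x c j → i * (k * x) + k * (c + j) ≡ k * (c + (i * x + j))
  l2 = solve-∀ ℚR
  term : ∀ s → ι (+ suc l) * (ι (+ suc (proj₁ s)) * J -[1+ suc (proj₁ s ℕ.+ l) ] (PP (proj₂ s)) m) + J -[1+ l ] (cutjoin s) m ≡ cutjoin (proj₁ s , l ∷ proj₂ s) m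
  term (y , ys) = trans (cong₂ (λ a b → ι (+ suc l) * (ι (+ suc y) * J -[1+ suc a ] (PP ys) m) + b) (ℕ.+-comm y l)
      (trans (lin-* (J-lin -[1+ l ]) (ι (+ suc y)) {s = λ m → Cut y ys m + Join y ys m} (λ _ → refl) m) (cong (λ z → ι (+ suc y) * z) (trans (lin-+ (J-lin -[1+ l ]) {Cut y ys} {Join y ys} (λ _ → refl) m) (cong (_+ J -[1+ l ] (Join y ys) m) (sym (Cut-∷ y l ys m)))))))
    (l2 (ι (+ suc l)) (ι (+ suc y)) (J -[1+ suc (l ℕ.+ y) ] (PP ys) m) (Cut y (l ∷ ys) m) (J -[1+ l ] (Join y ys) m))

-- Cycle decompositions of permutations

Unique-↭ : ∀ {A : Set} {xs ys : List A} → xs ↭ ys → Unique xs → Unique ys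
Unique-↭ ↭.refl u = u
Unique-↭ (↭.prep x p) (a ∷ u) = ↭.All-resp-↭ p a ∷ Unique-↭ p u
Unique-↭ (↭.swap x y p) ((xy ∷ a) ∷ (b ∷ u)) = ((xy ∘ sym) ∷ ↭.All-resp-↭ p b) ∷ (↭.All-resp-↭ p a ∷ Unique-↭ p u)
Unique-↭ (↭.trans p q) u = Unique-↭ q (Unique-↭ p u)

ΣL-↭ : ∀ {A : Set} {xs ys : List A} g → xs ↭ ys → ΣL xs g ≡ ΣL ys g
ΣL-↭ g ↭.refl = refl
ΣL-↭ g (↭.prep x p) = cong (λ z → g x + z) (ΣL-↭ g p)
ΣL-↭ g (↭.swap {xs} {ys} x y p) = trans (cong (λ z → g x + (g y + z)) (ΣL-↭ g p)) (l (g x) (g y) (ΣL ys g))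
  where
  l : ∀ a b c → a + (b + c) ≡ b + (a + c)
  l = solve-∀ ℚR
ΣL-↭ g (↭.trans p q) = trans (ΣL-↭ g p) (ΣL-↭ g q)

ΣL-congᴬ : ∀ {A : Set} {xs : List A} {g h} → All (λ x → g x ≡ h x) xs → ΣL xs g ≡ ΣL xs h
ΣL-congᴬ [] = refl
ΣL-congᴬ (p ∷ a) = cong₂ _+_ p (ΣL-congᴬ a)

ΣL-const : ∀ {A : Set} (xs : List A) x → ΣL xs (λ _ → x) ≡ ι (+ length xs) * x
ΣL-const [] x = sym (trans (cong (_* x) ι0) (ℚ.*-zeroˡ x))
ΣL-const (_ ∷ xs) x = trans (cong (λ z → x + z) (ΣL-const xs x)) (trans (l (ι (+ length xs)) x) (cong (_* x) (sym (ι-suc (length xs)))))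
  where
  l : ∀ i x → x + i * x ≡ (1ℚ + i) * x
  l = solve-∀ ℚR

select-fst : ∀ {A : Set} (xs : List A) g → ΣL xs g ≡ ΣL (select xs) (g ∘ proj₁)
select-fst [] g = refl
select-fst (x ∷ xs) g = cong (λ z → g x + z) (trans (select-fst xs g) (sym (ΣL-map (λ s → (proj₁ s , x ∷ proj₂ s)) (select xs) (g ∘ proj₁))))

select-↭ : ∀ {A : Set} (xs : List A) → All (λ s → xs ↭ proj₁ s ∷ proj₂ s) (select xs)
select-↭ [] = []
select-↭ (x ∷ xs) = ↭.refl ∷ All.map⁺ (All.map (λ {s} p → ↭.trans (↭.prep x p) (↭.swap x (proj₁ s) ↭.refl)) (select-↭ xs))

select-map : ∀ {A B : Set} (f : A → B) xs → select (map f xs) ≡ map (λ s → (f (proj₁ s) , map f (proj₂ s))) (select xs)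
select-map f [] = refl
select-map f (x ∷ xs) = cong ((f x , map f xs) ∷_) (trans (cong (map (λ s → (proj₁ s , f x ∷ proj₂ s))) (select-map f xs)) (trans (sym (List.map-∘ (select xs))) (List.map-∘ (select xs))))

-- The cycle (x, xs) = (x x₁ x₂ …).
Cycle : ℕ → Set
Cycle d = Fin d × List (Fin d)

module _ {d : ℕ} where

  elems : Cycle d → List (Fin d)
  elems (x , xs) = x ∷ xs

  size : Cycle d → ℕ
  size c = length (proj₂ c)

  flat : List (Cycle d) → List (Fin d)
  flat = concatMap elems

  Path : Perm d → Fin d → List (Fin d) → Fin d → Set
  Path σ x [] y = lookup σ x ≡ y
  Path σ x (z ∷ zs) y = (lookup σ x ≡ z) × Path σ z zs y

  IsCycle : Perm d → Cycle d → Set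
  IsCycle σ (x , xs) = Path σ x xs x

  -- The cycles come in any order, each started at any of its points: products with transpositions
  -- are computed after rotating a cycle to the point in question.
  record Rep (σ : Perm d) (cs : List (Cycle d)) : Set where
    constructor rep
    field
      cycles : All (IsCycle σ) cs
      covers : flat cs ↭ allFin d
  open Rep public

  Path-join : ∀ σ x as z {bs y} → Path σ x as z → Path σ z bs y → Path σ x (as ++ z ∷ bs) y
  Path-join σ x [] z p q = p , q
  Path-join σ x (a ∷ as) z (e , p) q = e , Path-join σ a as z p q

  Path-split : ∀ σ x as z {bs y} → Path σ x (as ++ z ∷ bs) y → Path σ x as z × Path σ z bs y
  Path-split σ x [] z (p , q) = p , q
  Path-split σ x (a ∷ as) z (e , p) = (e , proj₁ (Path-split σ a as z p)) , proj₂ (Path-split σ a as z p)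

  rotate : ∀ {σ i} c → IsCycle σ c → i ∈ elems c → Σ (List (Fin d)) λ xs → IsCycle σ (i , xs) × (elems (i , xs) ↭ elems c)
  rotate (x , xs) p (here refl) = xs , p , ↭.refl
  rotate {σ} {i} (x , xs) p (there h) with ∈.∈-∃++ h
  ... | as , bs , refl with Path-split σ x as i p
  ...   | q₁ , q₂ = bs ++ x ∷ as , Path-join σ i bs x q₂ q₁ , ↭.++-comm (i ∷ bs) (x ∷ as)

  flat-↭ : ∀ {cs cs'} → cs ↭ cs' → flat cs ↭ flat cs'
  flat-↭ ↭.refl = ↭.refl
  flat-↭ (↭.prep c p) = ↭.++⁺ˡ (elems c) (flat-↭ p)
  flat-↭ (↭.swap {xs} {ys} c c' p) = ↭.trans (↭.++⁺ˡ (elems c) (↭.++⁺ˡ (elems c') (flat-↭ p))) (↭.shifts (elems c) (elems c'))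
  flat-↭ (↭.trans p q) = ↭.trans (flat-↭ p) (flat-↭ q)

  Rep-↭ : ∀ {σ cs cs'} → cs ↭ cs' → Rep σ cs → Rep σ cs'
  Rep-↭ p (rep a c) = rep (↭.All-resp-↭ p a) (↭.trans (↭.↭-sym (flat-↭ p)) c)

  Rep-rotate : ∀ {σ i} c rest → Rep σ (c ∷ rest) → i ∈ elems c → Σ (List (Fin d)) λ xs → Rep σ ((i , xs) ∷ rest) × (length xs ≡ size c)
  Rep-rotate c rest (rep (p ∷ a) cov) h with rotate c p h
  ... | xs , q , e = xs , rep (q ∷ a) (↭.trans (↭.++⁺ʳ (flat rest) e) cov) , ℕ.suc-injective (↭.↭-length e)

  Rep-unique : ∀ {σ cs} → Rep σ cs → Unique (flat cs)
  Rep-unique R = Unique-↭ (↭.↭-sym (covers R)) (Unique.allFin⁺ d)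

  sw : Fin d → Fin d → Fin d → Fin d
  sw i j k with k Fin.≟ i | k Fin.≟ j
  ... | yes _ | _ = j
  ... | no _ | yes _ = i
  ... | no _ | no _ = k

  sw-l : ∀ i j → sw i j i ≡ j
  sw-l i j with i Fin.≟ i
  ... | yes _ = refl
  ... | no ne = ⊥-elim (ne refl)

  sw-r : ∀ i j → sw i j j ≡ i
  sw-r i j with j Fin.≟ i | j Fin.≟ j
  ... | yes e | _ = e
  ... | no _ | yes _ = refl
  ... | no _ | no ne = ⊥-elim (ne refl)

  sw-o : ∀ i j k → i ≢ k → j ≢ k → sw i j k ≡ k
  sw-o i j k p q with k Fin.≟ i | k Fin.≟ j
  ... | yes e | _ = ⊥-elim (p (sym e))
  ... | no _ | yes e = ⊥-elim (q (sym e))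
  ... | no _ | no _ = refl

  sw-invol : ∀ i j k → sw i j (sw i j k) ≡ k
  sw-invol i j k = go (k Fin.≟ i) (k Fin.≟ j)
    where
    go : Dec (k ≡ i) → Dec (k ≡ j) → sw i j (sw i j k) ≡ k
    go (yes refl) _ = trans (cong (sw i j) (sw-l i j)) (sw-r i j)
    go (no _) (yes refl) = trans (cong (sw i j) (sw-r i j)) (sw-l i j)
    go (no p) (no q) = trans (cong (sw i j) (sw-o i j k (p ∘ sym) (q ∘ sym))) (sw-o i j k (p ∘ sym) (q ∘ sym))

  swap-perm : Fin d → Fin d → Perm d
  swap-perm i j = Vec.tabulate (sw i j)

  _∙⟨_,_⟩ : Perm d → Fin d → Fin d → Perm d
  σ ∙⟨ i , j ⟩ = compose σ (swap-perm i j)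

  lookup-compose : ∀ (σ τ : Perm d) i → lookup (compose σ τ) i ≡ lookup σ (lookup τ i)
  lookup-compose σ τ i = Vec.lookup-map i (lookup σ) τ

  lookup-∙ : ∀ σ i j k → lookup (σ ∙⟨ i , j ⟩) k ≡ lookup σ (sw i j k)
  lookup-∙ σ i j k = trans (lookup-compose σ (swap-perm i j) k) (cong (lookup σ) (Vec.lookup∘tabulate (sw i j) k))

  lookup-ext : ∀ {σ τ : Perm d} → (∀ i → lookup σ i ≡ lookup τ i) → σ ≡ τ
  lookup-ext {σ} {τ} e = trans (sym (Vec.tabulate∘lookup σ)) (trans (Vec.tabulate-cong e) (Vec.tabulate∘lookup τ))

  Avoid : Fin d → Fin d → List (Fin d) → Set
  Avoid i j = All (λ k → (i ≢ k) × (j ≢ k))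

  Path-avoid : ∀ σ i j z zs {y} → Avoid i j (z ∷ zs) → Path σ z zs y → Path (σ ∙⟨ i , j ⟩) z zs y
  Path-avoid σ i j z [] ((p , q) ∷ []) e = trans (lookup-∙ σ i j z) (trans (cong (lookup σ) (sw-o i j z p q)) e)
  Path-avoid σ i j z (z' ∷ zs) ((p , q) ∷ a) (e , h) = trans (lookup-∙ σ i j z) (trans (cong (lookup σ) (sw-o i j z p q)) e) , Path-avoid σ i j z' zs a h

  Path-restart : ∀ σ i j x x' zs {y} → sw i j x' ≡ x → Avoid i j zs → Path σ x zs y → Path (σ ∙⟨ i , j ⟩) x' zs y
  Path-restart σ i j x x' [] s a e = trans (lookup-∙ σ i j x') (trans (cong (lookup σ) s) e)
  Path-restart σ i j x x' (z ∷ zs) s a (e , h) = trans (lookup-∙ σ i j x') (trans (cong (lookup σ) s) e) , Path-avoid σ i j z zs a h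

  cycles-avoid : ∀ σ i j cs → Avoid i j (flat cs) → All (IsCycle σ) cs → All (IsCycle (σ ∙⟨ i , j ⟩)) cs
  cycles-avoid σ i j [] a [] = []
  cycles-avoid σ i j (c ∷ cs) a (p ∷ ps) with All.++⁻ (elems c) a
  ... | a₁ , a₂ = Path-avoid σ i j (proj₁ c) (proj₂ c) a₁ p ∷ cycles-avoid σ i j cs a₂ ps

  Unique-avoid : ∀ {i j L} → Unique (i ∷ j ∷ L) → Avoid i j L
  Unique-avoid ((_ ∷ a) ∷ (b ∷ _)) = All.zip (a , b)

  -- In σ (i j) the points i and j exchange their images, so the walk from i continues along `ys` to
  -- j and then along `xs` back to i.
  Rep-join : ∀ {σ} i xs j ys rest → Rep σ ((i , xs) ∷ (j , ys) ∷ rest) → Rep (σ ∙⟨ i , j ⟩) ((i , ys ++ j ∷ xs) ∷ rest)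
  Rep-join {σ} i xs j ys rest R@(rep (p ∷ q ∷ r) cov) with All.++⁻ xs (Unique-avoid (Unique-↭ (↭.prep i (↭.shift j xs (ys ++ flat rest))) (Rep-unique R)))
  ... | a , a' with All.++⁻ ys a'
  ...   | b , c = rep
    (Path-join (σ ∙⟨ i , j ⟩) i ys j (Path-restart σ i j j i ys (sw-l i j) b q) (Path-restart σ i j i j xs (sw-r i j) a p) ∷ cycles-avoid σ i j rest c r)
    (↭.trans (↭.prep i (↭.trans (↭.↭-reflexive (List.++-assoc ys (j ∷ xs) (flat rest))) (↭.trans (↭.shifts ys (j ∷ xs)) (↭.↭-sym (↭.shift j xs (ys ++ flat rest)))))) cov)

  -- The same exchange within one cycle: i continues with what followed j, and j with what followed
  -- i, so both parts close up.
  Rep-cut : ∀ {σ} i as j bs rest → Rep σ ((i , as ++ j ∷ bs) ∷ rest) → Rep (σ ∙⟨ i , j ⟩) ((i , bs) ∷ (j , as) ∷ rest)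
  Rep-cut {σ} i as j bs rest R@(rep (p ∷ r) cov) with Path-split σ i as j p
  ... | p₁ , p₂ with All.++⁻ as (Unique-avoid (Unique-↭ (↭.prep i (↭.trans (↭.↭-reflexive (List.++-assoc as (j ∷ bs) (flat rest))) (↭.shift j as (bs ++ flat rest)))) (Rep-unique R)))
  ...   | a , a' with All.++⁻ bs a'
  ...     | b , c = rep
    (Path-restart σ i j j i bs (sw-l i j) b p₂ ∷ Path-restart σ i j i j as (sw-r i j) a p₁ ∷ cycles-avoid σ i j rest c r)
    (↭.trans (↭.prep i (↭.trans (↭.shift j bs (as ++ flat rest)) (↭.trans (↭.prep j (↭.shifts bs as)) (↭.trans (↭.↭-sym (↭.shift j as (bs ++ flat rest))) (↭.↭-reflexive (sym (List.++-assoc as (j ∷ bs) (flat rest)))))))) cov)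

  map-Path : ∀ σ x xs {y} → Path σ x xs y → map (lookup σ) (x ∷ xs) ≡ xs ++ y ∷ []
  map-Path σ x [] e = cong (_∷ []) e
  map-Path σ x (z ∷ zs) (e , p) = cong₂ _∷_ e (map-Path σ z zs p)

  map-flat : ∀ σ cs → All (IsCycle σ) cs → map (lookup σ) (flat cs) ↭ flat cs
  map-flat σ [] [] = ↭.refl
  map-flat σ ((x , xs) ∷ cs) (p ∷ ps) = ↭.trans (↭.↭-reflexive (List.map-++ (lookup σ) (x ∷ xs) (flat cs)))
    (↭.++⁺ (↭.trans (↭.↭-reflexive (map-Path σ x xs p)) (↭.↭-sym (↭.∷↭∷ʳ x xs))) (map-flat σ cs ps))

  -- Along each cycle σ acts as a rotation, so it permutes the list of all points.
  reindex : ∀ {σ cs} → Rep σ cs → ∀ g → ΣL (allFin d) (g ∘ lookup σ) ≡ ΣL (allFin d) g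
  reindex {σ} {cs} R g = trans (ΣL-↭ (g ∘ lookup σ) (↭.↭-sym (covers R))) (trans (sym (ΣL-map (lookup σ) (flat cs) g)) (trans (ΣL-↭ g (map-flat σ cs (cycles R))) (ΣL-↭ g (covers R))))

-- From permutations of d points to d + 1 points

lift : ∀ {d} → Perm d → Perm (suc d)
lift σ = zero ∷ Vec.map suc σ

lookup-lift : ∀ {d} (σ : Perm d) i → lookup (lift σ) (suc i) ≡ suc (lookup σ i)
lookup-lift σ i = Vec.lookup-map i suc σ

liftC : ∀ {d} → Cycle d → Cycle (suc d)
liftC (x , xs) = suc x , map suc xs

Path-lift : ∀ {d} (σ : Perm d) x xs {y} → Path σ x xs y → Path (lift σ) (suc x) (map suc xs) (suc y)
Path-lift σ x [] e = trans (lookup-lift σ x) (cong suc e)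
Path-lift σ x (z ∷ zs) (e , p) = trans (lookup-lift σ x) (cong suc e) , Path-lift σ z zs p

flat-lift : ∀ {d} (cs : List (Cycle d)) → flat (map liftC cs) ≡ map suc (flat cs)
flat-lift [] = refl
flat-lift (c ∷ cs) = trans (cong (map suc (elems c) ++_) (flat-lift cs)) (sym (List.map-++ suc (elems c) (flat cs)))

Rep-lift : ∀ {d} {σ : Perm d} {cs} → Rep σ cs → Rep (lift σ) ((zero , []) ∷ map liftC cs)
Rep-lift {d} {σ} {cs} (rep a c) = rep (refl ∷ All.map⁺ (All.map (λ {c} p → Path-lift σ (proj₁ c) (proj₂ c) p) a))
  (↭.prep zero (↭.trans (↭.↭-reflexive (flat-lift cs)) (↭.trans (↭.map⁺ suc c) (↭.↭-reflexive (List.map-tabulate (λ i → i) suc)))))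

Inj : ∀ {d} → Perm d → Set
Inj σ = ∀ i j → lookup σ i ≡ lookup σ j → i ≡ j

down : ∀ {d} (x : Fin (suc d)) → x ≢ zero → Fin d
down zero ne = ⊥-elim (ne refl)
down (suc x) _ = x

suc-down : ∀ {d} (x : Fin (suc d)) ne → suc (down x ne) ≡ x
suc-down zero ne = ⊥-elim (ne refl)
suc-down (suc x) ne = refl

unlift : ∀ {d} (b : Perm (suc d)) → Inj b → lookup b zero ≡ zero → Σ (Perm d) λ b' → (lift b' ≡ b) × Inj b'
unlift {d} b inj b0 = b' , lift≡ , inj'
  where
  nz' : ∀ i → lookup b (suc i) ≢ zero
  nz' i e = case inj (suc i) zero (trans e (sym b0)) of λ ()
  b' = Vec.tabulate (λ i → down (lookup b (suc i)) (nz' i))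
  at : ∀ i → suc (lookup b' i) ≡ lookup b (suc i)
  at i = trans (cong suc (Vec.lookup∘tabulate _ i)) (suc-down _ (nz' i))
  lift≡ : lift b' ≡ b
  lift≡ = lookup-ext λ { zero → sym b0 ; (suc i) → trans (lookup-lift b' i) (at i) }
  inj' : Inj b'
  inj' i j e = Fin.suc-injective (inj (suc i) (suc j) (trans (sym (at i)) (trans (cong suc e) (at j))))

swapˡ : ∀ {d} → Fin d → Fin d → Perm d → Perm d
swapˡ i j b = compose (swap-perm i j) b

lookup-swapˡ : ∀ {d} (i j : Fin d) b x → lookup (swapˡ i j b) x ≡ sw i j (lookup b x)
lookup-swapˡ i j b x = trans (lookup-compose (swap-perm i j) b x) (Vec.lookup∘tabulate (sw i j) (lookup b x))

sw-injective : ∀ {d} (i j : Fin d) {x y} → sw i j x ≡ sw i j y → x ≡ y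
sw-injective i j {x} {y} e = trans (sym (sw-invol i j x)) (trans (cong (sw i j) e) (sw-invol i j y))

Inj-swapˡ : ∀ {d} (i j : Fin d) b → Inj b → Inj (swapˡ i j b)
Inj-swapˡ i j b inj x y e = inj x y (sw-injective i j (trans (sym (lookup-swapˡ i j b x)) (trans e (lookup-swapˡ i j b y))))

swapˡ-invol : ∀ {d} (i j : Fin d) b → swapˡ i j (swapˡ i j b) ≡ b
swapˡ-invol i j b = lookup-ext (λ x → trans (lookup-swapˡ i j (swapˡ i j b) x) (trans (cong (sw i j) (lookup-swapˡ i j b x)) (sw-invol i j (lookup b x))))

-- Conjugation by σ carries (0 k) to (0 σ(k)).
swap-lift : ∀ {d} (σ : Perm d) k → Inj σ → swapˡ zero (suc (lookup σ k)) (lift σ) ≡ lift σ ∙⟨ zero , suc k ⟩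
swap-lift σ k inj = lookup-ext λ x → trans (lookup-swapˡ zero (suc (lookup σ k)) (lift σ) x) (trans (go x (x Fin.≟ suc k)) (sym (lookup-∙ (lift σ) zero (suc k) x)))
  where
  go : ∀ x → Dec (x ≡ suc k) → sw zero (suc (lookup σ k)) (lookup (lift σ) x) ≡ lookup (lift σ) (sw zero (suc k) x)
  go zero _ = trans (sw-l zero (suc (lookup σ k))) (sym (trans (cong (lookup (lift σ)) (sw-l zero (suc k))) (lookup-lift σ k)))
  go (suc x) (yes refl) = trans (cong (sw zero (suc (lookup σ k))) (lookup-lift σ k)) (trans (sw-r zero (suc (lookup σ k))) (sym (cong (lookup (lift σ)) (sw-r zero (suc k)))))
  go (suc x) (no ne) = trans (cong (sw zero (suc (lookup σ k))) (lookup-lift σ x)) (trans (sw-o zero (suc (lookup σ k)) (suc (lookup σ x)) (λ ()) (λ e → ne (cong suc (sym (inj k x (Fin.suc-injective e))))))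
     (sym (trans (cong (lookup (lift σ)) (sw-o zero (suc k) (suc x) (λ ()) (ne ∘ sym))) (lookup-lift σ x))))

-- Multiplication on the left by (0 a(0)) makes 0 a fixed point, which can then be dropped.
factor : ∀ {d} (a : Perm (suc d)) → Inj a → Σ (Perm d) λ σ → (swapˡ zero (lookup a zero) a ≡ lift σ) × Inj σ
factor a inj with unlift (swapˡ zero (lookup a zero) a) (Inj-swapˡ zero (lookup a zero) a inj) (trans (lookup-swapˡ zero (lookup a zero) a zero) (sw-r zero (lookup a zero)))
... | σ , e , i = σ , sym e , i

-- In `lift σ` the point 0 is a cycle of its own; the transposition joins it to the cycle that
-- contains k.
Rep-zero-join : ∀ {d} {σ : Perm d} {cs} → Rep σ cs → ∀ k → Σ (Cycle d × List (Cycle d)) λ s → (cs ↭ proj₁ s ∷ proj₂ s) ×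
  Σ (List (Fin (suc d))) λ xs → Rep (lift σ ∙⟨ zero , suc k ⟩) ((zero , xs) ∷ map liftC (proj₂ s))
Rep-zero-join {d} {σ} {cs} R k = go (pick cs (↭.∈-resp-↭ (↭.↭-sym (covers R)) (∈.∈-allFin k)))
  where
  pick : ∀ cs → k ∈ flat cs → Σ (Cycle d × List (Cycle d)) λ s → (cs ↭ proj₁ s ∷ proj₂ s) × (k ∈ elems (proj₁ s))
  pick (c ∷ cs) h with ∈.∈-++⁻ (elems c) h
  ... | inj₁ h' = (c , cs) , ↭.refl , h'
  ... | inj₂ h' with pick cs h'
  ...   | (c' , cs') , p , m = (c' , c ∷ cs') , ↭.trans (↭.prep c p) (↭.swap c c' ↭.refl) , m
  go : (Σ (Cycle d × List (Cycle d)) λ s → (cs ↭ proj₁ s ∷ proj₂ s) × (k ∈ elems (proj₁ s))) → _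
  go ((c , rest) , p , h) with Rep-rotate c rest (Rep-↭ p R) h
  ... | ys , R' , _ = (c , rest) , p , map suc ys ++ suc k ∷ [] , Rep-join zero [] (suc k) (map suc ys) (map liftC rest) (Rep-lift R')

swapˡ-trivial : ∀ {d} (i : Fin d) b → swapˡ i i b ≡ b
swapˡ-trivial i b = lookup-ext (λ x → trans (lookup-swapˡ i i b x) (fix (lookup b x) (lookup b x Fin.≟ i)))
  where
  fix : ∀ y → Dec (y ≡ i) → sw i i y ≡ y
  fix y (yes refl) = sw-l i i
  fix y (no p) = sw-o i i y (p ∘ sym) (p ∘ sym)

preimage : ∀ {d} {σ : Perm d} {cs} → Rep σ cs → ∀ k → Σ (Fin d) λ j → lookup σ j ≡ k
preimage {σ = σ} {cs} R k with ∈.∈-map⁻ (lookup σ) (↭.∈-resp-↭ (↭.↭-sym (↭.trans (↭.map⁺ (lookup σ) (↭.↭-sym (covers R))) (↭.trans (map-flat σ cs (cycles R)) (covers R)))) (∈.∈-allFin k))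
... | j , _ , e = j , sym e

-- Induction on d through `factor`: depending on the image of 0, this point is a cycle by itself or
-- is inserted into a cycle of the smaller permutation.
Rep-exists : ∀ {d} (a : Perm d) → Inj a → Σ (List (Cycle d)) (Rep a)
Rep-exists {zero} a inj = [] , rep [] ↭.refl
Rep-exists {suc d} a inj with factor a inj
... | σ , e , injσ with Rep-exists σ injσ
...   | cs , R = go (lookup a zero) refl
  where
  a≡ : a ≡ swapˡ zero (lookup a zero) (lift σ)
  a≡ = trans (sym (swapˡ-invol zero (lookup a zero) a)) (cong (swapˡ zero (lookup a zero)) e)
  go : ∀ k → lookup a zero ≡ k → Σ (List (Cycle (suc d))) (Rep a)
  go zero q = (zero , []) ∷ map liftC cs , subst (λ z → Rep z ((zero , []) ∷ map liftC cs)) (sym (trans a≡ (trans (cong (λ z → swapˡ zero z (lift σ)) q) (swapˡ-trivial zero (lift σ))))) (Rep-lift R)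
  go (suc k) q with preimage R k
  ... | j , ej with Rep-zero-join R j
  ...   | s , _ , xs , R' = (zero , xs) ∷ map liftC (proj₂ s) , subst (λ z → Rep z ((zero , xs) ∷ map liftC (proj₂ s))) (sym (trans a≡ (trans (cong (λ z → swapˡ zero z (lift σ)) (trans q (cong suc (sym ej)))) (swap-lift σ j injσ)))) R'

-- Cycle lengths and cycle minima

eqFin-sound : ∀ {d} (i j : Fin d) → eqFin i j ≡ true → i ≡ j
eqFin-sound i j e = Fin.toℕ-injective (≡ᵇ-true (toℕ i) (toℕ j) e)

eqFin-refl : ∀ {d} (i : Fin d) → eqFin i i ≡ true
eqFin-refl i = ≡ᵇ-refl (toℕ i)

eqFin-no : ∀ {d} {i j : Fin d} → i ≢ j → eqFin i j ≡ false
eqFin-no {i = i} {j} ne with eqFin i j in eq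
... | true = ⊥-elim (ne (eqFin-sound i j eq))
... | false = refl

≤ᵇ-sound : ∀ m n → (m ℕ.≤ᵇ n) ≡ true → m ≤ n
≤ᵇ-sound m n e = ℕ.≤ᵇ⇒≤ m n (subst Bool.T (sym e) _)

≤ᵇ-complete : ∀ {m n} → m ≤ n → (m ℕ.≤ᵇ n) ≡ true
≤ᵇ-complete {m} {n} h with m ℕ.≤ᵇ n | ℕ.≤⇒≤ᵇ h
... | true | _ = refl

allL-sound : ∀ {A : Set} (p : A → Bool) xs → allL p xs ≡ true → ∀ {x} → x ∈ xs → p x ≡ true
allL-sound p (x ∷ xs) e (here refl) = proj₁ (∧-true e)
allL-sound p (x ∷ xs) e (there h) = allL-sound p xs (proj₂ (∧-true {p x} e)) h

allL-complete : ∀ {A : Set} (p : A → Bool) xs → (∀ {x} → x ∈ xs → p x ≡ true) → allL p xs ≡ true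
allL-complete p [] h = refl
allL-complete p (x ∷ xs) h rewrite h (here {xs = xs} (refl {x = x})) = allL-complete p xs (h ∘ there)

-- A name for the local loop of cycleLen.  Splitting off its arguments as variables makes
-- the metavariable below a pattern, and unification then solves it by that loop.
mutual
  cycleLenFrom : ∀ d → Perm d → Fin d → ℕ → ℕ → ℕ
  cycleLenFrom = _

  cycleLen-suc : ∀ e (σ : Perm (suc e)) i → eqFin (lookup σ i) i ≡ false → cycleLen σ i ≡ cycleLenFrom (suc e) σ i e 2
  cycleLen-suc e σ i p rewrite p with suc e
  ... | D with e | 2
  ... | x | n = refl

cycleLenFrom-first : ∀ {d} (σ : Perm d) i L f n → n ≤ L → L ≤ n ℕ.+ f → (∀ k → n ≤ k → k < L → iterP σ k i ≢ i) → iterP σ L i ≡ i → cycleLenFrom d σ i f n ≡ L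
cycleLenFrom-first σ i L zero n h₁ h₂ early hit = ℕ.≤-antisym h₁ (subst (L ≤_) (ℕ.+-identityʳ n) h₂)
cycleLenFrom-first σ i L (suc f) n h₁ h₂ early hit with n ℕ.≟ L
... | yes refl rewrite hit | eqFin-refl i = refl
... | no ne rewrite eqFin-no (early n ℕ.≤-refl (ℕ.≤∧≢⇒< h₁ ne)) = cycleLenFrom-first σ i L f (suc n) (ℕ.≤∧≢⇒< h₁ ne) (subst (L ≤_) (ℕ.+-suc n f) h₂) (λ k p → early k (ℕ.<⇒≤ p)) hit

module _ {d : ℕ} where

  cycleLen-first : ∀ (σ : Perm d) i l → suc l ≤ d → (∀ k → k < l → iterP σ (suc k) i ≢ i) → iterP σ (suc l) i ≡ i → cycleLen σ i ≡ suc l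
  cycleLen-first σ i zero (s≤s h) early hit rewrite hit | eqFin-refl i = refl
  cycleLen-first σ i (suc l) (s≤s h) early hit = trans (cycleLen-suc _ σ i (eqFin-no (early 0 (s≤s z≤n))))
    (cycleLenFrom-first σ i (suc (suc l)) _ 2 (s≤s (s≤s z≤n)) (s≤s (ℕ.m≤n⇒m≤1+n h)) early' hit)
    where
    early' : ∀ k → 2 ≤ k → k < suc (suc l) → iterP σ k i ≢ i
    early' (suc (suc k)) (s≤s p) (s≤s q) = early (suc k) q

  iter-Path : ∀ (σ : Perm d) x as z {m} → ∀ i → iterP σ m i ≡ x → Path σ x as z → iterP σ (suc (length as) ℕ.+ m) i ≡ z
  iter-Path σ x [] z i e p = trans (cong (lookup σ) e) p
  iter-Path σ x (a ∷ as) z {m} i e (q , p) = trans (cong (λ k → iterP σ k i) (cong suc (sym (ℕ.+-suc (length as) m)))) (iter-Path σ a as z {suc m} i (trans (cong (lookup σ) e) q) p)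

  closed : ∀ (σ : Perm d) x xs {y} → Path σ x xs y → ∀ {z} → z ∈ x ∷ xs → lookup σ z ∈ xs ++ y ∷ []
  closed σ x [] e (here refl) = here e
  closed σ x (a ∷ as) (e , p) (here refl) = here e
  closed σ x (a ∷ as) (e , p) (there h) = there (closed σ a as p h)

  iter-closed : ∀ (σ : Perm d) i xs → Path σ i xs i → ∀ n → iterP σ n i ∈ i ∷ xs
  iter-closed σ i xs p zero = here refl
  iter-closed σ i xs p (suc n) with ∈.∈-++⁻ xs (closed σ i xs p (iter-closed σ i xs p n))
  ... | inj₁ h = there h
  ... | inj₂ (here e) = here e

  reached : ∀ (σ : Perm d) i xs → Path σ i xs i → ∀ {z} → z ∈ i ∷ xs → Σ ℕ λ n → (n ≤ length xs) × (iterP σ n i ≡ z)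
  reached σ i xs p (here refl) = 0 , z≤n , refl
  reached σ i xs p (there h) with ∈.∈-∃++ h
  ... | as , bs , refl = suc (length as) , subst (suc (length as) ≤_) (sym (trans (List.length-++ as) (ℕ.+-suc (length as) (length bs)))) (s≤s (ℕ.m≤m+n (length as) (length bs))) ,
     trans (cong (λ k → iterP σ k i) (sym (ℕ.+-identityʳ (suc (length as))))) (iter-Path σ i as _ {0} i refl (proj₁ (Path-split σ i as _ p)))

  -- Before the path closes, the iterates of i are entries of `xs`, and i is not among them.
  not-early : ∀ (σ : Perm d) i xs → Path σ i xs i → Unique (i ∷ xs) → ∀ k → k < length xs → iterP σ (suc k) i ≢ i
  not-early σ i xs p (a ∷ _) k lt e with split k xs lt
    where
    split : ∀ k (xs : List (Fin d)) → k < length xs → Σ (List (Fin d)) λ as → Σ (Fin d) λ z → Σ (List (Fin d)) λ bs → (xs ≡ as ++ z ∷ bs) × (length as ≡ k)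
    split zero (x ∷ xs) h = [] , x , xs , refl , refl
    split (suc k) (x ∷ xs) (s≤s h) with split k xs h
    ... | as , z , bs , refl , refl = x ∷ as , z , bs , refl , refl
  ... | as , z , bs , refl , refl = All.lookup a (∈.∈-++⁺ʳ as (here refl)) (trans (sym e) (trans (cong (λ k → iterP σ k i) (sym (ℕ.+-identityʳ (suc (length as))))) (iter-Path σ i as z {0} i refl (proj₁ (Path-split σ i as z p)))))

  filter-single : ∀ (p : Fin d → Bool) xs m → Unique xs → m ∈ xs → p m ≡ true → (∀ {y} → y ∈ xs → p y ≡ true → y ≡ m) → filterᵇ p xs ≡ m ∷ []
  filter-single p (x ∷ xs) .x (a ∷ u) (here refl) pm only rewrite pm = cong (x ∷_) (none xs a (only ∘ there))
    where
    none : ∀ ys → All (x ≢_) ys → (∀ {y} → y ∈ ys → p y ≡ true → y ≡ x) → filterᵇ p ys ≡ []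
    none [] a o = refl
    none (y ∷ ys) (ne ∷ a) o with p y in eq
    ... | true = ⊥-elim (ne (sym (o (here refl) eq)))
    ... | false = none ys a (o ∘ there)
  filter-single p (x ∷ xs) m (a ∷ u) (there h) pm only with p x in eq
  ... | true = ⊥-elim (All.lookup a h (only (here refl) eq))
  ... | false = filter-single p xs m u h pm (only ∘ there)

  minimum : ∀ x (xs : List (Fin d)) → Σ (Fin d) λ m → (m ∈ x ∷ xs) × (∀ {y} → y ∈ x ∷ xs → toℕ m ≤ toℕ y)
  minimum x [] = x , here refl , λ { (here refl) → ℕ.≤-refl }
  minimum x (y ∷ ys) with minimum y ys
  ... | m , h , l with ℕ.≤-total (toℕ x) (toℕ m)
  ...   | inj₁ x≤m = x , here refl , λ { (here refl) → ℕ.≤-refl ; (there q) → ℕ.≤-trans x≤m (l q) }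
  ...   | inj₂ m≤x = m , there h , λ { (here refl) → m≤x ; (there q) → l q }

  isCycleMin-≤ : ∀ (σ : Perm d) i xs → Path σ i xs i → length xs < d → isCycleMin σ i ≡ true → ∀ {y} → y ∈ i ∷ xs → toℕ i ≤ toℕ y
  isCycleMin-≤ σ i xs p lt e h with reached σ i xs p h
  ... | n , n≤ , refl = ≤ᵇ-sound (toℕ i) _ (allL-sound (λ n → toℕ i ℕ.≤ᵇ toℕ (iterP σ n i)) (upTo (suc d)) e (∈.∈-upTo⁺ (ℕ.≤-trans (s≤s n≤) (ℕ.m≤n⇒m≤1+n lt))))

  isCycleMin-min : ∀ (σ : Perm d) i xs → Path σ i xs i → (∀ {y} → y ∈ i ∷ xs → toℕ i ≤ toℕ y) → isCycleMin σ i ≡ true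
  isCycleMin-min σ i xs p h = allL-complete (λ n → toℕ i ℕ.≤ᵇ toℕ (iterP σ n i)) (upTo (suc d)) (λ {n} _ → ≤ᵇ-complete (h (iter-closed σ i xs p n)))

  -- A cycle has exactly one point that is minimal among its iterates, and the first return to it
  -- takes as many steps as the cycle has points. The bound on the size keeps both searches within
  -- their fuel.
  one-min : ∀ (σ : Perm d) c → IsCycle σ c → Unique (elems c) → size c < d → map (cycleLen σ) (filterᵇ (isCycleMin σ) (elems c)) ≡ suc (size c) ∷ []
  one-min σ c@(x , xs) p u lt with minimum x xs
  ... | m , h , l with rotate c p h
  ...   | ys , q , e = trans (cong (map (cycleLen σ)) (filter-single (isCycleMin σ) (elems c) m u h
            (isCycleMin-min σ m ys q (λ k → l (↭.∈-resp-↭ e k)))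
            (λ {y} k t → is-m y k t)))
          (cong (_∷ []) (trans (cycleLen-first σ m (length ys) (subst (λ z → suc z ≤ d) (sym len) lt) (not-early σ m ys q (Unique-↭ (↭.↭-sym e) u))
              (trans (cong (λ k → iterP σ k m) (sym (ℕ.+-identityʳ (suc (length ys))))) (iter-Path σ m ys m {0} m refl q))) (cong suc len)))
    where
    len : length ys ≡ length xs
    len = ℕ.suc-injective (↭.↭-length e)
    is-m : ∀ y → y ∈ elems c → isCycleMin σ y ≡ true → y ≡ m
    is-m y k t with rotate c p k
    ... | zs , r , e' = Fin.toℕ-injective (ℕ.≤-antisym (isCycleMin-≤ σ y zs r (subst (_< d) (sym (ℕ.suc-injective (↭.↭-length e'))) lt) t (↭.∈-resp-↭ (↭.↭-sym e') h)) (l k))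

  -- Cycle lengths minus one, so that p_len is J -[1+ l ].
  shape : List (Cycle d) → List ℕ
  shape = map size

  mins-flat : ∀ (σ : Perm d) cs → All (IsCycle σ) cs → Unique (flat cs) → length (flat cs) ≤ d → map (cycleLen σ) (filterᵇ (isCycleMin σ) (flat cs)) ≡ map suc (shape cs)
  mins-flat σ [] [] u h = refl
  mins-flat σ (c ∷ cs) (p ∷ ps) u h = trans (cong (map (cycleLen σ)) (List.filter-++ (λ x → Bool.T? (isCycleMin σ x)) (elems c) (flat cs)))
    (trans (List.map-++ (cycleLen σ) (filterᵇ (isCycleMin σ) (elems c)) (filterᵇ (isCycleMin σ) (flat cs)))
    (cong₂ _++_ (one-min σ c p (Unique-++ˡ (elems c) u) (ℕ.≤-trans (ℕ.m≤m+n (suc (size c)) (length (flat cs))) h'))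
      (mins-flat σ cs ps (Unique-++ʳ (elems c) u) (ℕ.≤-trans (ℕ.m≤n+m (length (flat cs)) (suc (size c))) h'))))
    where
    h' : suc (size c) ℕ.+ length (flat cs) ≤ d
    h' = subst (_≤ d) (List.length-++ (elems c)) h
    Unique-++ˡ : ∀ (xs : List (Fin d)) {ys} → Unique (xs ++ ys) → Unique xs
    Unique-++ˡ [] u = []
    Unique-++ˡ (x ∷ xs) (a ∷ u) = All.++⁻ˡ xs a ∷ Unique-++ˡ xs u
    Unique-++ʳ : ∀ (xs : List (Fin d)) {ys} → Unique (xs ++ ys) → Unique ys
    Unique-++ʳ [] u = u
    Unique-++ʳ (x ∷ xs) (a ∷ u) = Unique-++ʳ xs u

  lengths-Rep : ∀ {σ : Perm d} {cs} → Rep σ cs → map (cycleLen σ) (cycleMins σ) ↭ map suc (shape cs)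
  lengths-Rep {σ} {cs} R = ↭.trans (↭.map⁺ (cycleLen σ) (↭.filter-↭ (λ x → Bool.T? (isCycleMin σ x)) (↭.↭-sym (covers R))))
    (↭.↭-reflexive (mins-flat σ cs (cycles R) (Rep-unique R) (ℕ.≤-reflexive (trans (↭.↭-length (covers R)) (List.length-tabulate (λ i → i))))))

  numCycles-Rep : ∀ {σ : Perm d} {cs} → Rep σ cs → numCycles σ ≡ length cs
  numCycles-Rep {σ} {cs} R = trans (sym (List.length-map (cycleLen σ) (cycleMins σ))) (trans (↭.↭-length (lengths-Rep R)) (trans (List.length-map suc (shape cs)) (List.length-map size cs)))

  -- Transpositions and the cut-and-join operator

  -- The monomial p_type(σ); `pred` adapts cycle lengths to the convention of `PP`.
  Ψ : Perm d → Fn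
  Ψ σ = PP (map ℕ.pred (map (cycleLen σ) (cycleMins σ)))

  Ψ-Pol : ∀ σ → Pol (Ψ σ)
  Ψ-Pol σ = PP-Pol (map ℕ.pred (map (cycleLen σ) (cycleMins σ)))

  Ψ-Rep : ∀ {σ : Perm d} {cs} → Rep σ cs → ∀ m → Ψ σ m ≡ PP (shape cs) m
  Ψ-Rep {σ} {cs} R = PP-↭ (↭.trans (↭.map⁺ ℕ.pred (lengths-Rep R)) (↭.↭-reflexive (trans (sym (List.map-∘ (shape cs))) (List.map-id (shape cs)))))

  ne : Fin d → Fin d → ℚ
  ne i j = ⟦ not (eqFin i j) ⟧

  ne-refl : ∀ i → ne i i ≡ 0ℚ
  ne-refl i = cong (λ b → ⟦ not b ⟧) (eqFin-refl i)

  ne-≢ : ∀ {i j} → i ≢ j → ne i j ≡ 1ℚ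
  ne-≢ p = cong (λ b → ⟦ not b ⟧) (eqFin-no p)

  -- The sum is indexed by the number `i` of entries after the chosen one. This matches `Cut`, where
  -- the piece of length i + 1 is the one that keeps the starting point.
  ΣL-splits : ∀ pre xs (g : Fin d → ℚ) (h : ℕ → ℕ → ℚ) → (∀ as j bs → pre ++ xs ≡ as ++ j ∷ bs → g j ≡ h (length as) (length bs)) →
    ΣL xs g ≡ Σ< (length xs) (λ i → h (length pre ℕ.+ (length xs ℕ.∸ suc i)) i)
  ΣL-splits pre [] g h e = refl
  ΣL-splits pre (j ∷ bs) g h e = trans (ℚ.+-comm (g j) (ΣL bs g)) (cong₂ _+_
    (trans (ΣL-splits (pre ++ j ∷ []) bs g h (λ as k cs q → e as k cs (trans (sym (List.++-assoc pre (j ∷ []) bs)) q)))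
      (Σ<-cong< (length bs) (λ i lt → cong (λ z → h z i) (trans (cong (ℕ._+ (length bs ℕ.∸ suc i)) (trans (List.length-++ pre) (ℕ.+-comm (length pre) 1)))
         (trans (sym (ℕ.+-suc (length pre) (length bs ℕ.∸ suc i))) (cong (length pre ℕ.+_) (sym (ℕ.+-∸-assoc 1 lt))))))))
    (trans (e pre j bs refl) (cong (λ z → h z (length bs)) (trans (sym (ℕ.+-identityʳ (length pre))) (cong (length pre ℕ.+_) (sym (ℕ.n∸n≡0 (length bs))))))))

  -- If j lies in the cycle of i, the transposition cuts this cycle; if not, it joins two cycles,
  -- with a result whose type depends only on the cycle of j.
  through : ∀ {σ : Perm d} i xs rest → Rep σ ((i , xs) ∷ rest) → ∀ m → ΣL (allFin d) (λ j → ne i j * Ψ (σ ∙⟨ i , j ⟩) m) ≡ Cut (length xs) (shape rest) m + Join (length xs) (shape rest) m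
  through {σ} i xs rest R m = begin
    ΣL (allFin d) g ≡⟨ ΣL-↭ g (↭.↭-sym (covers R)) ⟩
    g i + ΣL (xs ++ flat rest) g ≡⟨ cong₂ _+_ (trans (cong (_* Ψ (σ ∙⟨ i , i ⟩) m) (ne-refl i)) (ℚ.*-zeroˡ (Ψ (σ ∙⟨ i , i ⟩) m))) (ΣL-++ xs (flat rest) g) ⟩
    0ℚ + (ΣL xs g + ΣL (flat rest) g) ≡⟨ ℚ.+-identityˡ _ ⟩
    ΣL xs g + ΣL (flat rest) g ≡⟨ cong₂ _+_ cut join ⟩
    Cut l ls m + Join l ls m ∎
    where
    open ≡-Reasoning
    g : Fin d → ℚ
    g j = ne i j * Ψ (σ ∙⟨ i , j ⟩) m
    l = length xs
    ls = shape rest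
    apart : ∀ {j} → j ∈ xs ++ flat rest → i ≢ j
    apart h with Rep-unique R
    ... | a ∷ _ = All.lookup a h
    g≡ : ∀ {j cs} → j ∈ xs ++ flat rest → Rep (σ ∙⟨ i , j ⟩) cs → g j ≡ PP (shape cs) m
    g≡ {j} h R' = trans (cong₂ _*_ (ne-≢ (apart h)) (Ψ-Rep R' m)) (ℚ.*-identityˡ _)
    cut : ΣL xs g ≡ Cut l ls m
    cut = trans (ΣL-splits [] xs g (λ a b → PP (b ∷ a ∷ ls) m) (λ { as j bs refl → g≡ (∈.∈-++⁺ˡ (∈.∈-++⁺ʳ as (here refl))) (Rep-cut i as j bs rest R) }))
      (trans (Σ<-cong< l (λ i lt → cong (λ z → J -[1+ i ] (J (ℤ.- + z) (PP ls)) m) (sym (ℕ.+-∸-assoc 1 lt))))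
        (sym (trans (cong (λ z → Σ< l (λ i → J -[1+ i ] (J (ℤ.- + (l ℕ.∸ i)) (PP ls)) m) + J -[1+ l ] (J (ℤ.- + z) (PP ls)) m) (ℕ.n∸n≡0 l))
          (trans (cong (λ z → Σ< l (λ i → J -[1+ i ] (J (ℤ.- + (l ℕ.∸ i)) (PP ls)) m) + z) (lin-zero (J-lin -[1+ l ]) (λ m → ℚ.*-zeroˡ (PP ls m)) m)) (ℚ.+-identityʳ _)))))
    one : ∀ s → rest ↭ proj₁ s ∷ proj₂ s → ΣL (elems (proj₁ s)) g ≡ ι (+ suc (size (proj₁ s))) * J -[1+ suc (size (proj₁ s) ℕ.+ l) ] (PP (shape (proj₂ s))) m
    one (c , rest') p = trans (ΣL-congᴬ {h = λ _ → J -[1+ suc (size c ℕ.+ l) ] (PP (shape rest')) m} (All.tabulate term)) (ΣL-const (elems c) (J -[1+ suc (size c ℕ.+ l) ] (PP (shape rest')) m))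
      where
      term : ∀ {j} → j ∈ elems c → g j ≡ J -[1+ suc (size c ℕ.+ l) ] (PP (shape rest')) m
      term {j} h with Rep-rotate c ((i , xs) ∷ rest') (Rep-↭ (↭.trans (↭.prep (i , xs) p) (↭.swap (i , xs) c ↭.refl)) R) h
      ... | ys , R' , len = trans (g≡ (∈.∈-++⁺ʳ xs (↭.∈-resp-↭ (flat-↭ (↭.↭-sym p)) (∈.∈-++⁺ˡ h))) (Rep-join i xs j ys rest' (Rep-↭ (↭.swap (j , ys) (i , xs) ↭.refl) R')))
        (cong (λ z → J -[1+ z ] (PP (shape rest')) m) (trans (List.length-++ ys) (trans (ℕ.+-suc (length ys) l) (cong (λ z → suc (z ℕ.+ l)) len))))
    join : ΣL (flat rest) g ≡ Join l ls m
    join = trans (ΣL-concatMap elems rest g) (trans (select-fst rest (λ c → ΣL (elems c) g)) (trans (ΣL-congᴬ (All.map (λ {s} p → one s p) (select-↭ rest)))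
      (sym (trans (Join-select l ls m) (trans (cong (λ z → ΣL z F) (select-map size rest)) (ΣL-map (λ s → (size (proj₁ s) , shape (proj₂ s))) (select rest) F))))))
      where
      F : ℕ × List ℕ → ℚ
      F s = ι (+ suc (proj₁ s)) * J -[1+ suc (proj₁ s ℕ.+ l) ] (PP (proj₂ s)) m

  -- Ordered pairs are summed, so every transposition counts twice, in agreement with `T` being 2C.
  T-Ψ : ∀ {σ : Perm d} → Inj σ → ∀ m → T (Ψ σ) m ≡ ΣL (allFin d) (λ i → ΣL (allFin d) (λ j → ne i j * Ψ (σ ∙⟨ i , j ⟩) m))
  T-Ψ {σ} inj m with Rep-exists σ inj
  ... | cs , R = begin
    T (Ψ σ) m ≡⟨ lin-cong T-lin (Ψ-Rep R) m ⟩
    T (PP (shape cs)) m ≡⟨ T-PP (shape cs) m ⟩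
    ΣL (select (shape cs)) (λ s → cutjoin s m) ≡⟨ trans (cong (λ z → ΣL z (λ s → cutjoin s m)) (select-map size cs)) (ΣL-map (λ s → (size (proj₁ s) , shape (proj₂ s))) (select cs) (λ s → cutjoin s m)) ⟩
    ΣL (select cs) (λ s → cutjoin (size (proj₁ s) , shape (proj₂ s)) m) ≡⟨ sym (ΣL-congᴬ (All.map (λ {s} p → one s p) (select-↭ cs))) ⟩
    ΣL (select cs) (λ s → ΣL (elems (proj₁ s)) S′) ≡⟨ sym (select-fst cs (λ c → ΣL (elems c) S′)) ⟩
    ΣL cs (λ c → ΣL (elems c) S′) ≡⟨ sym (ΣL-concatMap elems cs S′) ⟩
    ΣL (flat cs) S′ ≡⟨ ΣL-↭ S′ (covers R) ⟩
    ΣL (allFin d) S′ ∎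
    where
    open ≡-Reasoning
    S′ : Fin d → ℚ
    S′ i = ΣL (allFin d) (λ j → ne i j * Ψ (σ ∙⟨ i , j ⟩) m)
    one : ∀ s → cs ↭ proj₁ s ∷ proj₂ s → ΣL (elems (proj₁ s)) S′ ≡ cutjoin (size (proj₁ s) , shape (proj₂ s)) m
    one (c , rest) p = trans (ΣL-congᴬ {h = λ _ → Cut (size c) (shape rest) m + Join (size c) (shape rest) m} (All.tabulate term)) (ΣL-const (elems c) _)
      where
      term : ∀ {i} → i ∈ elems c → S′ i ≡ Cut (size c) (shape rest) m + Join (size c) (shape rest) m
      term {i} h with Rep-rotate c rest (Rep-↭ p R) h
      ... | xs , R' , len = trans (through i xs rest R' m) (cong (λ z → Cut z (shape rest) m + Join z (shape rest) m) len)

-- The Jucys-Murphy element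

compose-assoc : ∀ {d} (a b c : Perm d) → compose (compose a b) c ≡ compose a (compose b c)
compose-assoc a b c = lookup-ext (λ i → trans (lookup-compose (compose a b) c i) (trans (lookup-compose a b (lookup c i)) (sym (trans (lookup-compose a (compose b c) i) (cong (lookup a) (lookup-compose b c i))))))

lookup-id : ∀ {d} (i : Fin d) → lookup idPerm i ≡ i
lookup-id i = Vec.lookup∘tabulate (λ i → i) i

Inj-compose : ∀ {d} (a b : Perm d) → Inj a → Inj b → Inj (compose a b)
Inj-compose a b ia ib i j e = ib i j (ia (lookup b i) (lookup b j) (trans (sym (lookup-compose a b i)) (trans e (lookup-compose a b j))))

Inj-id : ∀ {d} → Inj (idPerm {d})
Inj-id i j e = trans (sym (lookup-id i)) (trans e (lookup-id j))

Inj-swap : ∀ {d} (i j : Fin d) → Inj (swap-perm i j)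
Inj-swap i j x y e = sw-injective i j (trans (sym (Vec.lookup∘tabulate (sw i j) x)) (trans e (Vec.lookup∘tabulate (sw i j) y)))

Inj-∙ : ∀ {d} (σ : Perm d) i j → Inj σ → Inj (σ ∙⟨ i , j ⟩)
Inj-∙ σ i j inj = Inj-compose σ (swap-perm i j) inj (Inj-swap i j)

Inj-lift : ∀ {d} (σ : Perm d) → Inj σ → Inj (lift σ)
Inj-lift σ inj zero zero e = refl
Inj-lift σ inj zero (suc j) e = case trans e (lookup-lift σ j) of λ ()
Inj-lift σ inj (suc i) zero e = case trans (sym (lookup-lift σ i)) e of λ ()
Inj-lift σ inj (suc i) (suc j) e = cong suc (inj i j (Fin.suc-injective (trans (sym (lookup-lift σ i)) (trans e (lookup-lift σ j)))))

lift-compose : ∀ {d} (a b : Perm d) → compose (lift a) (lift b) ≡ lift (compose a b)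
lift-compose a b = lookup-ext λ { zero → lookup-compose (lift a) (lift b) zero
  ; (suc i) → trans (lookup-compose (lift a) (lift b) (suc i)) (trans (cong (lookup (lift a)) (lookup-lift b i)) (trans (lookup-lift a (lookup b i)) (sym (trans (lookup-lift (compose a b) i) (cong suc (lookup-compose a b i)))))) }

sw-conj : ∀ {d e} (φ : Fin d → Fin e) → (∀ {x y} → φ x ≡ φ y → x ≡ y) → ∀ a b x → φ (sw a b x) ≡ sw (φ a) (φ b) (φ x)
sw-conj φ inj a b x = go (x Fin.≟ a) (x Fin.≟ b)
  where
  go : Dec (x ≡ a) → Dec (x ≡ b) → φ (sw a b x) ≡ sw (φ a) (φ b) (φ x)
  go (yes refl) _ = trans (cong φ (sw-l a b)) (sym (sw-l (φ a) (φ b)))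
  go (no _) (yes refl) = trans (cong φ (sw-r a b)) (sym (sw-r (φ a) (φ b)))
  go (no p) (no q) = trans (cong φ (sw-o a b x (p ∘ sym) (q ∘ sym))) (sym (sw-o (φ a) (φ b) (φ x) (λ e → p (inj (sym e))) (λ e → q (inj (sym e)))))

swap-lift-perm : ∀ {d} (i j : Fin d) → lift (swap-perm i j) ≡ swap-perm (suc i) (suc j)
swap-lift-perm i j = lookup-ext λ { zero → sym (trans (Vec.lookup∘tabulate (sw (suc i) (suc j)) zero) (sw-o (suc i) (suc j) zero (λ ()) (λ ())))
  ; (suc x) → trans (lookup-lift (swap-perm i j) x) (trans (cong suc (Vec.lookup∘tabulate (sw i j) x)) (trans (sw-conj suc Fin.suc-injective i j x) (sym (Vec.lookup∘tabulate (sw (suc i) (suc j)) (suc x))))) }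

lift-∙ : ∀ {d} (σ : Perm d) i j → lift (σ ∙⟨ i , j ⟩) ≡ lift σ ∙⟨ suc i , suc j ⟩
lift-∙ σ i j = trans (sym (lift-compose σ (swap-perm i j))) (cong (compose (lift σ)) (swap-lift-perm i j))

-- Summed over k, this says that the Jucys-Murphy element commutes with the copy of S_d: the
-- relabelling by β is absorbed in the sum.
∙-lift : ∀ {d} (ρ : Perm (suc d)) (β : Perm d) k → Inj β → compose (ρ ∙⟨ zero , suc (lookup β k) ⟩) (lift β) ≡ compose ρ (lift β) ∙⟨ zero , suc k ⟩
∙-lift ρ β k inj = trans (compose-assoc ρ (swap-perm zero (suc (lookup β k))) (lift β)) (trans (cong (compose ρ) (swap-lift β k inj)) (sym (compose-assoc ρ (lift β) (swap-perm zero (suc k)))))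

swap-sym : ∀ {d} (i j : Fin d) → swap-perm i j ≡ swap-perm j i
swap-sym i j = Vec.tabulate-cong (λ x → go x (x Fin.≟ i) (x Fin.≟ j))
  where
  go : ∀ x → Dec (x ≡ i) → Dec (x ≡ j) → sw i j x ≡ sw j i x
  go x (yes refl) _ = trans (sw-l i j) (sym (sw-r j i))
  go x (no _) (yes refl) = trans (sw-r i j) (sym (sw-l j i))
  go x (no p) (no q) = trans (sw-o i j x (p ∘ sym) (q ∘ sym)) (sym (sw-o j i x (q ∘ sym) (p ∘ sym)))

ΣL-allFin-suc : ∀ d (g : Fin (suc d) → ℚ) → ΣL (allFin (suc d)) g ≡ g zero + ΣL (allFin d) (g ∘ suc)
ΣL-allFin-suc d g = cong (λ z → g zero + z) (trans (cong (λ z → ΣL z g) (sym (List.map-tabulate (λ i → i) suc))) (ΣL-map suc (allFin d) g))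

reindexᴵ : ∀ {d} (σ : Perm d) → Inj σ → ∀ g → ΣL (allFin d) (g ∘ lookup σ) ≡ ΣL (allFin d) g
reindexᴵ σ inj g = reindex (proj₂ (Rep-exists σ inj)) g

-- `F`, extended linearly to the group algebra, at ρ times the n-th power of the Jucys-Murphy
-- element.
Tr : ∀ {d} → ℕ → (Perm (suc d) → ℚ) → Perm (suc d) → ℚ
Tr zero F ρ = F ρ
Tr {d} (suc n) F ρ = ΣL (allFin d) (λ j → Tr n F (ρ ∙⟨ zero , suc j ⟩))

TrΨ : ∀ {d} → ℕ → Perm (suc d) → Fn
TrΨ n ρ m = Tr n (λ ρ → Ψ ρ m) ρ

Tr-swap : ∀ {d} n (F : Perm (suc d) → ℚ) ρ i k → ΣL (allFin d) (λ j → Tr n F (ρ ∙⟨ zero , suc j ⟩ ∙⟨ suc i , suc k ⟩)) ≡ Tr (suc n) F (ρ ∙⟨ suc i , suc k ⟩)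
Tr-swap {d} n F ρ i k = trans (sym (reindexᴵ (swap-perm i k) (Inj-swap i k) (λ j → Tr n F (ρ ∙⟨ zero , suc j ⟩ ∙⟨ suc i , suc k ⟩))))
  (ΣL-cong (allFin d) (λ j → cong (Tr n F) (trans (cong (compose (ρ ∙⟨ zero , suc (lookup (swap-perm i k) j) ⟩)) (sym (swap-lift-perm i k)))
    (trans (∙-lift ρ (swap-perm i k) j (Inj-swap i k)) (cong (λ z → compose ρ z ∙⟨ zero , suc j ⟩) (swap-lift-perm i k))))))

Σne : ∀ d → (Fin d → Fin d → ℚ) → ℚ
Σne d G = ΣL (allFin d) (λ i → ΣL (allFin d) (λ k → ne i k * G i k))

Σne-cong : ∀ d {G H} → (∀ i k → G i k ≡ H i k) → Σne d G ≡ Σne d H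
Σne-cong d e = ΣL-cong (allFin d) (λ i → ΣL-cong (allFin d) (λ k → cong (ne i k *_) (e i k)))

Σne-natural : ∀ {B C : Set} {Q : (B → ℚ) → (C → ℚ)} → Lin Q → ∀ d (G : Fin d → Fin d → B → ℚ) c → Q (λ b → Σne d (λ i k → G i k b)) c ≡ Σne d (λ i k → Q (G i k) c)
Σne-natural L d G c = trans (ΣL-natural L (allFin d) (λ i b → ΣL (allFin d) (λ k → ne i k * G i k b)) c) (ΣL-cong (allFin d) (λ i → trans (ΣL-natural L (allFin d) (λ k b → ne i k * G i k b) c) (ΣL-cong (allFin d) (λ k → lin-* L (ne i k) (λ _ → refl) c))))

-- The transpositions of d + 1 points are split. Those that move 0 make up one more Jucys-Murphy
-- factor, twice because pairs are ordered; the others commute with the factors already present, by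
-- `Tr-swap`.
T-TrΨ : ∀ {d} n (ρ : Perm (suc d)) → Inj ρ → ∀ m → T (TrΨ n ρ) m ≡ 2ℚ * TrΨ (suc n) ρ m + Σne d (λ i k → TrΨ n (ρ ∙⟨ suc i , suc k ⟩) m)
T-TrΨ {d} zero ρ inj m = begin
  T (Ψ ρ) m ≡⟨ T-Ψ inj m ⟩
  ΣL (allFin (suc d)) (λ i → ΣL (allFin (suc d)) (λ j → ne i j * Ψ (ρ ∙⟨ i , j ⟩) m)) ≡⟨ ΣL-allFin-suc d (λ i → ΣL (allFin (suc d)) (G i)) ⟩
  ΣL (allFin (suc d)) (λ j → ne {suc d} zero j * Ψ (ρ ∙⟨ zero , j ⟩) m) + ΣL (allFin d) (λ i → ΣL (allFin (suc d)) (λ j → ne (suc i) j * Ψ (ρ ∙⟨ suc i , j ⟩) m))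
    ≡⟨ cong₂ _+_ (trans (ΣL-allFin-suc d (G zero)) (trans (cong (_+ ΣL (allFin d) (λ j → 1ℚ * Ψ (ρ ∙⟨ zero , suc j ⟩) m)) (ℚ.*-zeroˡ (Ψ (ρ ∙⟨ zero , zero ⟩) m))) (trans (ℚ.+-identityˡ (ΣL (allFin d) (λ j → 1ℚ * Ψ (ρ ∙⟨ zero , suc j ⟩) m))) (ΣL-cong (allFin d) (λ j → ℚ.*-identityˡ (Ψ (ρ ∙⟨ zero , suc j ⟩) m))))))
        (ΣL-cong (allFin d) (λ i → ΣL-allFin-suc d (G (suc i)))) ⟩
  TrΨ 1 ρ m + ΣL (allFin d) (λ i → 1ℚ * Ψ (ρ ∙⟨ suc i , zero ⟩) m + ΣL (allFin d) (λ k → ne i k * Ψ (ρ ∙⟨ suc i , suc k ⟩) m))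
    ≡⟨ cong (λ z → TrΨ 1 ρ m + z) (trans (lin-+ (ΣL-Lin (allFin d)) (λ _ → refl) 0) (cong (_+ Σne d (λ i k → Ψ (ρ ∙⟨ suc i , suc k ⟩) m)) (ΣL-cong (allFin d) (λ i → trans (ℚ.*-identityˡ (Ψ (ρ ∙⟨ suc i , zero ⟩) m)) (cong (λ z → Ψ (compose ρ z) m) (swap-sym (suc i) zero)))))) ⟩
  TrΨ 1 ρ m + (TrΨ 1 ρ m + Σne d (λ i k → Ψ (ρ ∙⟨ suc i , suc k ⟩) m)) ≡⟨ l (TrΨ 1 ρ m) (Σne d (λ i k → Ψ (ρ ∙⟨ suc i , suc k ⟩) m)) ⟩
  2ℚ * TrΨ 1 ρ m + Σne d (λ i k → Ψ (ρ ∙⟨ suc i , suc k ⟩) m) ∎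
  where
  open ≡-Reasoning
  G : Fin (suc d) → Fin (suc d) → ℚ
  G i j = ne i j * Ψ (ρ ∙⟨ i , j ⟩) m
  l : ∀ x y → x + (x + y) ≡ (1ℚ + 1ℚ) * x + y
  l = solve-∀ ℚR
T-TrΨ {d} (suc n) ρ inj m = begin
  T (λ m → ΣL (allFin d) (λ j → TrΨ n (ρ ∙⟨ zero , suc j ⟩) m)) m
    ≡⟨ ΣL-natural T-lin (allFin d) (λ j → TrΨ n (ρ ∙⟨ zero , suc j ⟩)) m ⟩
  ΣL (allFin d) (λ j → T (TrΨ n (ρ ∙⟨ zero , suc j ⟩)) m)
    ≡⟨ ΣL-cong (allFin d) (λ j → T-TrΨ n (ρ ∙⟨ zero , suc j ⟩) (Inj-∙ ρ zero (suc j) inj) m) ⟩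
  ΣL (allFin d) (λ j → 2ℚ * TrΨ (suc n) (ρ ∙⟨ zero , suc j ⟩) m + Σne d (λ i k → TrΨ n (ρ ∙⟨ zero , suc j ⟩ ∙⟨ suc i , suc k ⟩) m))
    ≡⟨ trans (ΣL-Lin (allFin d) 2ℚ (λ _ → refl) 0) (cong (λ z → 2ℚ * TrΨ (suc (suc n)) ρ m + z) (Σne-natural (ΣL-Lin (allFin d)) d (λ i k j → TrΨ n (ρ ∙⟨ zero , suc j ⟩ ∙⟨ suc i , suc k ⟩) m) 0)) ⟩
  2ℚ * TrΨ (suc (suc n)) ρ m + Σne d (λ i k → ΣL (allFin d) (λ j → TrΨ n (ρ ∙⟨ zero , suc j ⟩ ∙⟨ suc i , suc k ⟩) m))
    ≡⟨ cong (λ z → 2ℚ * TrΨ (suc (suc n)) ρ m + z) (Σne-cong d (λ i k → Tr-swap n (λ ρ → Ψ ρ m) ρ i k)) ⟩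
  2ℚ * TrΨ (suc (suc n)) ρ m + Σne d (λ i k → TrΨ (suc n) (ρ ∙⟨ suc i , suc k ⟩) m) ∎
  where open ≡-Reasoning

P-lin : ∀ n → Lin (P n)
P-lin n c {s} {t} e m = trans (cong (recip n *_) (IsFam.lin (X-isFam (suc n)) (+ 1) c e m)) (l (recip n) c (X (suc n) (+ 1) s m) (X (suc n) (+ 1) t m))
  where
  l : ∀ r c x y → r * (c * x + y) ≡ c * (r * x) + r * y
  l = solve-∀ ℚR

W-lin : ∀ s n → Lin (W s n)
W-lin s zero = P-lin s
W-lin s (suc n) c {f} {g} e m = trans (cong₂ (λ x y → ½ * (x - y)) (T-lin c (W-lin s n c e) m) (W-lin s n c (T-lin c e) m)) (l ½ c (T (W s n f) m) (T (W s n g) m) (W s n (T f) m) (W s n (T g) m))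
  where
  l : ∀ h c x y x' y' → h * (c * x + y - (c * x' + y')) ≡ c * (h * (x - x')) + h * (y - y')
  l = solve-∀ ℚR

Ψ-lift : ∀ {d} (σ : Perm d) → Inj σ → ∀ m → Ψ (lift σ) m ≡ J -[1+ 0 ] (Ψ σ) m
Ψ-lift σ inj m with Rep-exists σ inj
... | cs , R = trans (Ψ-Rep (Rep-lift R) m) (lin-cong (J-lin -[1+ 0 ]) (λ m → trans (cong (λ z → PP z m) (trans (sym (List.map-∘ cs)) (List.map-cong (λ c → List.length-map suc (proj₂ c)) cs))) (sym (Ψ-Rep R m))) m)

-- (ad C)^n p₁ inserts the point 0 and multiplies by the n-th power of the Jucys-Murphy element Σ_j (0 j).
W-Ψ : ∀ {d} n (σ : Perm d) → Inj σ → ∀ m → W 0 n (Ψ σ) m ≡ TrΨ n (lift σ) m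
W-Ψ zero σ inj m = trans (P₀ (Ψ σ) m) (sym (Ψ-lift σ inj m))
W-Ψ {d} (suc n) σ inj m = begin
  ½ * (T (W 0 n (Ψ σ)) m - W 0 n (T (Ψ σ)) m)
    ≡⟨ cong₂ (λ x y → ½ * (x - y)) (trans (lin-cong T-lin (W-Ψ n σ inj) m) (T-TrΨ n (lift σ) (Inj-lift σ inj) m))
         (trans (lin-cong (W-lin 0 n) (T-Ψ inj) m) (trans (Σne-natural (W-lin 0 n) d (λ i k → Ψ (σ ∙⟨ i , k ⟩)) m)
           (Σne-cong d (λ i k → trans (W-Ψ n (σ ∙⟨ i , k ⟩) (Inj-∙ σ i k inj) m) (cong (λ z → TrΨ n z m) (lift-∙ σ i k)))))) ⟩
  -- The transpositions that fix 0 occur in both products and cancel in the commutator.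
  ½ * (2ℚ * TrΨ (suc n) (lift σ) m + z - z)
    ≡⟨ l ½ 2ℚ (TrΨ (suc n) (lift σ) m) z ⟩
  (2ℚ * ½) * TrΨ (suc n) (lift σ) m
    ≡⟨ trans (cong (_* TrΨ (suc n) (lift σ) m) 2*½) (ℚ.*-identityˡ _) ⟩
  TrΨ (suc n) (lift σ) m ∎
  where
  open ≡-Reasoning
  z = Σne d (λ i k → TrΨ n (lift σ ∙⟨ suc i , suc k ⟩) m)
  l : ∀ h t x z → h * (t * x + z - z) ≡ (t * h) * x
  l = solve-∀ ℚR

-- Sums over the symmetric group

eqv : ∀ {d n} → Vec (Fin d) n → Vec (Fin d) n → Bool
eqv [] [] = true
eqv (x ∷ xs) (y ∷ ys) = eqFin x y ∧ eqv xs ys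

eqv-sound : ∀ {d n} (xs ys : Vec (Fin d) n) → eqv xs ys ≡ true → xs ≡ ys
eqv-sound [] [] e = refl
eqv-sound (x ∷ xs) (y ∷ ys) e = cong₂ _∷_ (eqFin-sound x y (proj₁ (∧-true e))) (eqv-sound xs ys (proj₂ (∧-true {eqFin x y} e)))

eqv-refl : ∀ {d n} (xs : Vec (Fin d) n) → eqv xs xs ≡ true
eqv-refl [] = refl
eqv-refl (x ∷ xs) rewrite eqFin-refl x = eqv-refl xs

eqv-iff : ∀ {d n d' n'} (xs ys : Vec (Fin d) n) (xs' ys' : Vec (Fin d') n') → (xs ≡ ys → xs' ≡ ys') → (xs' ≡ ys' → xs ≡ ys) → eqv xs ys ≡ eqv xs' ys'
eqv-iff xs ys xs' ys' f g = bool-iff (eqv xs ys) (eqv xs' ys') (λ e → subst (λ z → eqv xs' z ≡ true) (f (eqv-sound xs ys e)) (eqv-refl xs')) (λ e → subst (λ z → eqv xs z ≡ true) (g (eqv-sound xs' ys' e)) (eqv-refl xs))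

eqv-no : ∀ {d n} (xs ys : Vec (Fin d) n) → xs ≢ ys → eqv xs ys ≡ false
eqv-no xs ys ne with eqv xs ys in eq
... | true = ⊥-elim (ne (eqv-sound xs ys eq))
... | false = refl

count-Fin : ∀ {d} (x : Fin d) (h : Fin d → ℚ) → ΣL (allFin d) (λ i → ⟦ eqFin x i ⟧ * h i) ≡ h x
count-Fin {suc d} zero h = trans (ΣL-allFin-suc d (λ i → ⟦ eqFin {suc d} zero i ⟧ * h i)) (trans (cong₂ _+_ (ℚ.*-identityˡ (h zero)) (ΣL-zero (allFin d) (λ i → ℚ.*-zeroˡ (h (suc i))))) (ℚ.+-identityʳ (h zero)))
count-Fin {suc d} (suc x) h = trans (ΣL-allFin-suc d (λ i → ⟦ eqFin (suc x) i ⟧ * h i)) (trans (cong₂ _+_ (ℚ.*-zeroˡ (h zero)) (count-Fin x (h ∘ suc))) (ℚ.+-identityˡ (h (suc x))))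

count-Vec : ∀ {d} n (x : Vec (Fin d) n) (h : Vec (Fin d) n → ℚ) → ΣL (allVecs (allFin d) n) (λ a → ⟦ eqv x a ⟧ * h a) ≡ h x
count-Vec zero [] h = trans (ℚ.+-identityʳ _) (ℚ.*-identityˡ (h []))
count-Vec {d} (suc n) (x ∷ xs) h = trans (ΣL-concatMap (λ y → map (y ∷_) (allVecs (allFin d) n)) (allFin d) _)
  (trans (ΣL-cong (allFin d) (λ y → trans (ΣL-map (y ∷_) (allVecs (allFin d) n) _) (trans (ΣL-cong (allVecs (allFin d) n) (λ ys → trans (cong (_* h (y ∷ ys)) (⟦∧⟧ (eqFin x y) (eqv xs ys))) (ℚ.*-assoc ⟦ eqFin x y ⟧ ⟦ eqv xs ys ⟧ (h (y ∷ ys)))))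
     (trans (ΣL-* (allVecs (allFin d) n) ⟦ eqFin x y ⟧) (cong (⟦ eqFin x y ⟧ *_) (count-Vec n xs (λ ys → h (y ∷ ys))))))))
  (count-Fin x (λ y → h (y ∷ xs))))

-- Indicator functions span the functions on a finite set, so an identity between sums reduces to
-- counting how often each vector is reached.
functional-ext : ∀ {d} {S₁ S₂ : (Perm d → ℚ) → (ℕ → ℚ)} → Lin S₁ → Lin S₂ → (∀ a → S₁ (λ x → ⟦ eqv x a ⟧) 0 ≡ S₂ (λ x → ⟦ eqv x a ⟧) 0) → ∀ G → S₁ G 0 ≡ S₂ G 0
functional-ext {d} {S₁} {S₂} L₁ L₂ e G = trans (expand L₁) (trans (ΣL-cong (allVecs (allFin d) d) (λ a → cong (G a *_) (e a))) (sym (expand L₂)))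
  where
  expand : ∀ {S} → Lin S → S G 0 ≡ ΣL (allVecs (allFin d) d) (λ a → G a * S (λ x → ⟦ eqv x a ⟧) 0)
  expand L = trans (lin-cong L (λ x → sym (count-Vec d x G)) 0) (trans (ΣL-natural L (allVecs (allFin d) d) (λ a x → ⟦ eqv x a ⟧ * G a) 0)
    (ΣL-cong (allVecs (allFin d) d) (λ a → lin-* L (G a) (λ x → ℚ.*-comm ⟦ eqv x a ⟧ (G a)) 0)))

isInjective-sound : ∀ {d} (σ : Perm d) → isInjective σ ≡ true → Inj σ
isInjective-sound {d} σ e i j q with allL-sound _ (allFin d) (allL-sound _ (allFin d) e (∈.∈-allFin i)) (∈.∈-allFin j)
... | h rewrite q | eqFin-refl (lookup σ j) = eqFin-sound i j h

isInjective-complete : ∀ {d} (σ : Perm d) → Inj σ → isInjective σ ≡ true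
isInjective-complete {d} σ inj = allL-complete _ (allFin d) (λ {i} _ → allL-complete _ (allFin d) (λ {j} _ → go i j))
  where
  go : ∀ i j → not (eqFin (lookup σ i) (lookup σ j)) ∨ eqFin i j ≡ true
  go i j with eqFin (lookup σ i) (lookup σ j) in eq
  ... | false = refl
  ... | true = subst (λ z → eqFin i z ≡ true) (inj i j (eqFin-sound (lookup σ i) (lookup σ j) eq)) (eqFin-refl i)

Sym-Inj : ∀ d → All Inj (Sym d)
Sym-Inj d = All.map (λ {σ} t → isInjective-sound σ (T-true t)) (All.all-filter (λ σ → Bool.T? (isInjective σ)) (allVecs (allFin d) d))
  where
  T-true : ∀ {b} → Bool.T b → b ≡ true
  T-true {true} _ = refl

count-Sym : ∀ {d} (a : Perm d) (h : Perm d → ℚ) → ΣL (Sym d) (λ x → ⟦ eqv a x ⟧ * h x) ≡ ⟦ isInjective a ⟧ * h a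
count-Sym {d} a h = trans (ΣL-filter isInjective (allVecs (allFin d) d) _) (trans (ΣL-cong (allVecs (allFin d) d) (λ x → l ⟦ isInjective x ⟧ ⟦ eqv a x ⟧ (h x))) (count-Vec d a (λ x → ⟦ isInjective x ⟧ * h x)))
  where
  l : ∀ a b c → a * (b * c) ≡ b * (a * c)
  l = solve-∀ ℚR

-- By `factor` every permutation is reached exactly once, as (0 k) times a lift, with k its value at
-- 0. Vectors that are not permutations are reached on neither side.
Sym-left : ∀ d (G : Perm (suc d) → ℚ) → ΣL (Sym (suc d)) G ≡ ΣL (Sym d) (λ σ → ΣL (allFin (suc d)) (λ k → G (swapˡ zero k (lift σ))))
Sym-left d = functional-ext {S₁ = λ G _ → ΣL (Sym (suc d)) G} {S₂ = λ G _ → ΣL (Sym d) (λ σ → ΣL (allFin (suc d)) (λ k → G (swapˡ zero k (lift σ))))}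
  (λ c e _ → ΣL-Lin (Sym (suc d)) c e 0) (λ c e _ → ΣL-Lin (Sym d) c (λ σ → ΣL-Lin (allFin (suc d)) c (λ k → e (swapˡ zero k (lift σ))) 0) 0) indicator
  where
  lift-injective : ∀ {σ τ : Perm d} → lift σ ≡ lift τ → σ ≡ τ
  lift-injective {σ} {τ} e = lookup-ext (λ i → Fin.suc-injective (trans (sym (lookup-lift σ i)) (trans (cong (λ z → lookup z (suc i)) e) (lookup-lift τ i))))
  indicator : ∀ a → ΣL (Sym (suc d)) (λ x → ⟦ eqv x a ⟧) ≡ ΣL (Sym d) (λ σ → ΣL (allFin (suc d)) (λ k → ⟦ eqv (swapˡ zero k (lift σ)) a ⟧))
  indicator a = trans (trans (ΣL-cong (Sym (suc d)) (λ x → trans (cong ⟦_⟧ (eqv-iff x a a x sym sym)) (sym (ℚ.*-identityʳ ⟦ eqv a x ⟧)))) (trans (count-Sym a (λ _ → 1ℚ)) (ℚ.*-identityʳ ⟦ isInjective a ⟧))) (rhs (isInjective a) refl)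
    where
    rhs : ∀ b → isInjective a ≡ b → ⟦ b ⟧ ≡ ΣL (Sym d) (λ σ → ΣL (allFin (suc d)) (λ k → ⟦ eqv (swapˡ zero k (lift σ)) a ⟧))
    rhs false ni = sym (trans (ΣL-congᴬ {h = λ _ → 0ℚ} (All.map (λ {σ} i → ΣL-zero (allFin (suc d)) (λ k → cong ⟦_⟧ (eqv-no (swapˡ zero k (lift σ)) a
        (λ e → case trans (sym ni) (isInjective-complete a (subst Inj e (Inj-swapˡ zero k (lift σ) (Inj-lift σ i)))) of λ ())))) (Sym-Inj d))) (ΣL-zero (Sym d) (λ _ → refl)))
    rhs true yi with factor a (isInjective-sound a yi)
    ... | σ₀ , e₀ , i₀ = sym (trans (ΣL-cong (Sym d) (λ σ → trans (ΣL-cong (allFin (suc d)) (λ k → term σ k)) (count-Fin (lookup a zero) (λ _ → ⟦ eqv σ₀ σ ⟧ * 1ℚ)))) (trans (count-Sym σ₀ (λ _ → 1ℚ)) (trans (ℚ.*-identityʳ _) (cong ⟦_⟧ (isInjective-complete σ₀ i₀)))))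
      where
      there-and-back : swapˡ zero (lookup a zero) (lift σ₀) ≡ a
      there-and-back = trans (cong (swapˡ zero (lookup a zero)) (sym e₀)) (swapˡ-invol zero (lookup a zero) a)
      term : ∀ σ k → ⟦ eqv (swapˡ zero k (lift σ)) a ⟧ ≡ ⟦ eqFin (lookup a zero) k ⟧ * (⟦ eqv σ₀ σ ⟧ * 1ℚ)
      term σ k = trans (cong ⟦_⟧ (bool-iff (eqv (swapˡ zero k (lift σ)) a) (eqFin (lookup a zero) k ∧ eqv σ₀ σ) fwd bwd)) (trans (⟦∧⟧ (eqFin (lookup a zero) k) (eqv σ₀ σ)) (cong (λ z → ⟦ eqFin (lookup a zero) k ⟧ * z) (sym (ℚ.*-identityʳ ⟦ eqv σ₀ σ ⟧))))
        where
        fwd : eqv (swapˡ zero k (lift σ)) a ≡ true → eqFin (lookup a zero) k ∧ eqv σ₀ σ ≡ true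
        fwd q = cong₂ _∧_ (subst (λ z → eqFin (lookup a zero) z ≡ true) a0 (eqFin-refl (lookup a zero))) (subst (λ z → eqv σ₀ z ≡ true) σ≡ (eqv-refl σ₀))
          where
          e = eqv-sound (swapˡ zero k (lift σ)) a q
          a0 : lookup a zero ≡ k
          a0 = trans (cong (λ z → lookup z zero) (sym e)) (trans (lookup-swapˡ zero k (lift σ) zero) (sw-l zero k))
          σ≡ : σ₀ ≡ σ
          σ≡ = lift-injective (trans (sym e₀) (trans (cong₂ (λ i z → swapˡ zero i z) a0 (sym e)) (swapˡ-invol zero k (lift σ))))
        bwd : eqFin (lookup a zero) k ∧ eqv σ₀ σ ≡ true → eqv (swapˡ zero k (lift σ)) a ≡ true
        bwd q with eqFin-sound (lookup a zero) k (proj₁ (∧-true q)) | eqv-sound σ₀ σ (proj₂ (∧-true {eqFin (lookup a zero) k} q))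
        ... | refl | refl = subst (λ z → eqv z a ≡ true) (sym there-and-back) (eqv-refl a)

-- Passes from left to right multiples: (0 σ(k)) σ = σ (0 k), and σ permutes the indices k.
Sym-suc : ∀ d (G : Perm (suc d) → ℚ) → ΣL (Sym (suc d)) G ≡ ΣL (Sym d) (λ σ → G (lift σ) + ΣL (allFin d) (λ j → G (lift σ ∙⟨ zero , suc j ⟩)))
Sym-suc d G = trans (Sym-left d G) (ΣL-congᴬ (All.map (λ {σ} i → trans (ΣL-allFin-suc d (λ k → G (swapˡ zero k (lift σ)))) (cong₂ _+_ (cong G (swapˡ-trivial zero (lift σ)))
  (trans (sym (reindexᴵ σ i (λ k → G (swapˡ zero (suc k) (lift σ))))) (ΣL-cong (allFin d) (λ k → cong G (swap-lift σ k i)))))) (Sym-Inj d)))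

numCycles-lift : ∀ {d} (σ : Perm d) → Inj σ → numCycles (lift σ) ≡ suc (numCycles σ)
numCycles-lift σ i with Rep-exists σ i
... | cs , R = trans (numCycles-Rep (Rep-lift R)) (cong suc (trans (List.length-map liftC cs) (sym (numCycles-Rep R))))

numCycles-∙ : ∀ {d} (σ : Perm d) j → Inj σ → numCycles (lift σ ∙⟨ zero , suc j ⟩) ≡ numCycles σ
numCycles-∙ σ j i with Rep-exists σ i
... | cs , R with Rep-zero-join R j
...   | s , p , xs , R' = trans (numCycles-Rep R') (trans (cong suc (List.length-map liftC (proj₂ s))) (trans (sym (↭.↭-length p)) (sym (numCycles-Rep R))))

-- Tuples with prescribed numbers of cycles

prod : ∀ {d n} → Vec (Perm d) n → Perm d
prod = Vec.foldr _ compose idPerm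

-- The last permutation of a tuple is determined by the others and is not summed over here; `F` will
-- be p_type, evaluated at the product of the others.
Zt : ∀ d n → Vec ℕ n → (Perm d → ℚ) → ℚ
Zt d n ks F = ΣL (allVecs (Sym d) n) (λ αs → ⟦ eqV (Vec.map numCycles αs) ks ⟧ * F (prod αs))

Zt-Lin : ∀ d n ks → Lin {Perm d} {ℕ} (λ F _ → Zt d n ks F)
Zt-Lin d n ks c {s} {t} e _ = ΣL-Lin (allVecs (Sym d) n) c (λ αs → trans (cong (λ z → ⟦ eqV (Vec.map numCycles αs) ks ⟧ * z) (e (prod αs))) (l ⟦ eqV (Vec.map numCycles αs) ks ⟧ c (s (prod αs)) (t (prod αs)))) 0
  where
  l : ∀ b c x y → b * (c * x + y) ≡ c * (b * x) + b * y
  l = solve-∀ ℚR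

prod-Inj : ∀ d n → All (λ αs → Inj (prod αs)) (allVecs (Sym d) n)
prod-Inj d zero = Inj-id ∷ []
prod-Inj d (suc n) = All.concat⁺ (All.map⁺ (All.map (λ {σ} i → All.map⁺ (All.map (λ {αs} h → Inj-compose σ (prod αs) i h) (prod-Inj d n))) (Sym-Inj d)))

Zt-cong : ∀ d n ks {F G} → (∀ β → Inj β → F β ≡ G β) → Zt d n ks F ≡ Zt d n ks G
Zt-cong d n ks e = ΣL-congᴬ (All.map (λ {αs} i → cong (λ z → ⟦ eqV (Vec.map numCycles αs) ks ⟧ * z) (e (prod αs) i)) (prod-Inj d n))

Zt-suc : ∀ d n k ks F → Zt d (suc n) (k ∷ ks) F ≡ ΣL (Sym d) (λ α → ⟦ numCycles α ℕ.≡ᵇ k ⟧ * Zt d n ks (λ β → F (compose α β)))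
Zt-suc d n k ks F = trans (ΣL-concatMap (λ α → map (α ∷_) (allVecs (Sym d) n)) (Sym d) _) (ΣL-cong (Sym d) (λ α → trans (ΣL-map (α ∷_) (allVecs (Sym d) n) _)
  (trans (ΣL-cong (allVecs (Sym d) n) (λ αs → trans (cong (_* F (compose α (prod αs))) (⟦∧⟧ (numCycles α ℕ.≡ᵇ k) (eqV (Vec.map numCycles αs) ks))) (ℚ.*-assoc ⟦ numCycles α ℕ.≡ᵇ k ⟧ ⟦ eqV (Vec.map numCycles αs) ks ⟧ (F (compose α (prod αs))))))
    (ΣL-* (allVecs (Sym d) n) ⟦ numCycles α ℕ.≡ᵇ k ⟧))))

-- `RV` as a linear functional on arbitrary functions of a power `s` and an exponent vector, so that
-- it can be exchanged with sums over permutations.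
RVq : ∀ n → (ℕ × Vec ℕ n → ℚ) → Vec ℕ n → ℚ
RVq zero h [] = h (0 , [])
RVq (suc n) h (k ∷ ks) = RVq n (λ { (s , us) → h (suc s , k ∷ us) }) ks + shift1 1 (λ k' → RVq n (λ { (s , us) → h (s , k' ∷ us) }) ks) k

RVq-Lin : ∀ n → Lin (RVq n)
RVq-Lin zero c e [] = e (0 , [])
RVq-Lin (suc n) c {s} {t} e (k ∷ ks) = trans (cong₂ _+_ (RVq-Lin n c (λ { (s , us) → e (suc s , k ∷ us) }) ks) (shift1-Lin 1 c (λ k' → RVq-Lin n c (λ { (s , us) → e (s , k' ∷ us) }) ks) k))
  (l c (RVq n (λ { (i , us) → s (suc i , k ∷ us) }) ks) (RVq n (λ { (i , us) → t (suc i , k ∷ us) }) ks) (shift1 1 (λ k' → RVq n (λ { (i , us) → s (i , k' ∷ us) }) ks) k) (shift1 1 (λ k' → RVq n (λ { (i , us) → t (i , k' ∷ us) }) ks) k))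
  where
  l : ∀ c x y x' y' → (c * x + y) + (c * x' + y') ≡ c * (x + x') + (y + y')
  l = solve-∀ ℚR

RV-RVq : ∀ n O g ks t → RV n O g ks t ≡ RVq n (λ { (s , us) → O s (g us) t }) ks
RV-RVq zero O g [] t = refl
RV-RVq (suc n) O g (k ∷ ks) t = cong₂ _+_ (trans (RV-RVq n (O ∘ suc) (λ us → g (k ∷ us)) ks t) (lin-cong (RVq-Lin n) (λ _ → refl) ks))
  (lin-cong (shift1-Lin 1) (λ k' → trans (RV-RVq n O (λ us → g (k' ∷ us)) ks t) (lin-cong (RVq-Lin n) (λ _ → refl) ks)) k)

Tr-compose : ∀ {d} s (F : Perm (suc d) → ℚ) γ ρ → Tr s (F ∘ compose γ) ρ ≡ Tr s F (compose γ ρ)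
Tr-compose zero F γ ρ = refl
Tr-compose {d} (suc s) F γ ρ = ΣL-cong (allFin d) (λ j → trans (Tr-compose s F γ (ρ ∙⟨ zero , suc j ⟩)) (cong (Tr s F) (sym (compose-assoc γ ρ (swap-perm zero (suc j))))))

lift-id : ∀ {d} → lift (idPerm {d}) ≡ idPerm
lift-id = lookup-ext λ { zero → refl ; (suc i) → trans (lookup-lift idPerm i) (trans (cong suc (lookup-id i)) (sym (lookup-id (suc i)))) }

shift1-≡ᵇ : ∀ c x k → shift1 1 (λ k' → ⟦ c ℕ.≡ᵇ k' ⟧ * x) k ≡ ⟦ suc c ℕ.≡ᵇ k ⟧ * x
shift1-≡ᵇ c x zero = sym (ℚ.*-zeroˡ x)
shift1-≡ᵇ c x (suc k) = refl

-- Each factor is a lift, which has one cycle more and so shifts the exponent, or a lift times (0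
-- j). In the second case the sum over j is a Jucys-Murphy element; it commutes with the lifts that
-- follow and is collected on the right, where `s` counts these elements.
Zt-step : ∀ d n ks F → Zt (suc d) n ks F ≡ RVq n (λ { (s , us) → Zt d n us (λ β → Tr s F (lift β)) }) ks
Zt-step d zero [] F = cong (λ z → 1ℚ * F z + 0ℚ) (sym lift-id)
Zt-step d (suc n) (k ∷ ks) F = begin
  Zt (suc d) (suc n) (k ∷ ks) F
    ≡⟨ Zt-suc (suc d) n k ks F ⟩
  ΣL (Sym (suc d)) (λ α → ⟦ numCycles α ℕ.≡ᵇ k ⟧ * Zt (suc d) n ks (F ∘ compose α))
    ≡⟨ Sym-suc d _ ⟩
  ΣL (Sym d) (λ σ → ⟦ numCycles (lift σ) ℕ.≡ᵇ k ⟧ * Zt (suc d) n ks (F ∘ compose (lift σ)) + ΣL (allFin d) (λ j → ⟦ numCycles (lift σ ∙⟨ zero , suc j ⟩) ℕ.≡ᵇ k ⟧ * Zt (suc d) n ks (F ∘ compose (lift σ ∙⟨ zero , suc j ⟩))))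
    ≡⟨ ΣL-congᴬ (All.map (λ {σ} i → cong₂ _+_ (cong₂ (λ a b → ⟦ a ℕ.≡ᵇ k ⟧ * b) (numCycles-lift σ i) (fixed σ)) (moved σ i)) (Sym-Inj d)) ⟩
  ΣL (Sym d) (λ σ → ⟦ suc (numCycles σ) ℕ.≡ᵇ k ⟧ * a₀ σ + ⟦ numCycles σ ℕ.≡ᵇ k ⟧ * a₁ σ)
    ≡⟨ trans (lin-+ (ΣL-Lin (Sym d)) (λ _ → refl) 0) (ℚ.+-comm (ΣL (Sym d) (λ σ → ⟦ suc (numCycles σ) ℕ.≡ᵇ k ⟧ * a₀ σ)) _) ⟩
  ΣL (Sym d) (λ σ → ⟦ numCycles σ ℕ.≡ᵇ k ⟧ * a₁ σ) + ΣL (Sym d) (λ σ → ⟦ suc (numCycles σ) ℕ.≡ᵇ k ⟧ * a₀ σ)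
    ≡⟨ cong₂ _+_ (sym first) (sym second) ⟩
  RVq (suc n) (λ { (s , us) → Zt d (suc n) us (λ β → Tr s F (lift β)) }) (k ∷ ks) ∎
  where
  open ≡-Reasoning
  h₀ h₁ : Perm d → ℕ × Vec ℕ n → ℚ
  h₀ σ (s , us) = Zt d n us (λ β → Tr s F (lift (compose σ β)))
  h₁ σ (s , us) = Zt d n us (λ β → Tr (suc s) F (lift (compose σ β)))
  a₀ a₁ : Perm d → ℚ
  a₀ σ = RVq n (h₀ σ) ks
  a₁ σ = RVq n (h₁ σ) ks
  fixed : ∀ σ → Zt (suc d) n ks (F ∘ compose (lift σ)) ≡ a₀ σ
  fixed σ = trans (Zt-step d n ks (F ∘ compose (lift σ))) (lin-cong (RVq-Lin n) (λ { (s , us) → Zt-cong d n us (λ β _ → trans (Tr-compose s F (lift σ) (lift β)) (cong (Tr s F) (lift-compose σ β))) }) ks)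
  moved : ∀ σ → Inj σ → ΣL (allFin d) (λ j → ⟦ numCycles (lift σ ∙⟨ zero , suc j ⟩) ℕ.≡ᵇ k ⟧ * Zt (suc d) n ks (F ∘ compose (lift σ ∙⟨ zero , suc j ⟩))) ≡ ⟦ numCycles σ ℕ.≡ᵇ k ⟧ * a₁ σ
  moved σ i = trans (ΣL-cong (allFin d) (λ j → cong₂ (λ a b → ⟦ a ℕ.≡ᵇ k ⟧ * b) (numCycles-∙ σ j i) (Zt-step d n ks (F ∘ compose (lift σ ∙⟨ zero , suc j ⟩)))))
    (trans (ΣL-* (allFin d) ⟦ numCycles σ ℕ.≡ᵇ k ⟧) (cong (λ z → ⟦ numCycles σ ℕ.≡ᵇ k ⟧ * z)
      (trans (sym (ΣL-natural (RVq-Lin n) (allFin d) (λ { j (s , us) → Zt d n us (λ β → Tr s (F ∘ compose (lift σ ∙⟨ zero , suc j ⟩)) (lift β)) }) ks))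
        (lin-cong (RVq-Lin n) (λ { (s , us) → trans (sym (ΣL-natural (Zt-Lin d n us) (allFin d) (λ j β → Tr s (F ∘ compose (lift σ ∙⟨ zero , suc j ⟩)) (lift β)) 0)) (Zt-cong d n us (λ β iβ → relabel s β iβ)) }) ks))))
    where
    relabel : ∀ s β → Inj β → ΣL (allFin d) (λ j → Tr s (F ∘ compose (lift σ ∙⟨ zero , suc j ⟩)) (lift β)) ≡ Tr (suc s) F (lift (compose σ β))
    relabel s β iβ = trans (ΣL-cong (allFin d) (λ j → Tr-compose s F (lift σ ∙⟨ zero , suc j ⟩) (lift β)))
      (trans (sym (reindexᴵ β iβ (λ j → Tr s F (compose (lift σ ∙⟨ zero , suc j ⟩) (lift β)))))
        (ΣL-cong (allFin d) (λ j → cong (Tr s F) (trans (∙-lift (lift σ) β j iβ) (cong (_∙⟨ zero , suc j ⟩) (lift-compose σ β))))))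
  pull : ∀ k' s F' → RVq n (λ { (i , us) → Zt d (suc n) (k' ∷ us) (λ β → Tr (s i) F' (lift β)) }) ks ≡ ΣL (Sym d) (λ σ → ⟦ numCycles σ ℕ.≡ᵇ k' ⟧ * RVq n (λ { (i , us) → Zt d n us (λ β → Tr (s i) F' (lift (compose σ β))) }) ks)
  pull k' s F' = trans (lin-cong (RVq-Lin n) {t = λ { (i , us) → ΣL (Sym d) (λ σ → ⟦ numCycles σ ℕ.≡ᵇ k' ⟧ * Zt d n us (λ β → Tr (s i) F' (lift (compose σ β)))) }} (λ { (i , us) → Zt-suc d n k' us (λ β → Tr (s i) F' (lift β)) }) ks)
    (trans (lin-cong (RVq-Lin n) (λ _ → refl) ks) (trans (ΣL-natural (RVq-Lin n) (Sym d) (λ { σ (i , us) → ⟦ numCycles σ ℕ.≡ᵇ k' ⟧ * Zt d n us (λ β → Tr (s i) F' (lift (compose σ β))) }) ks)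
      (ΣL-cong (Sym d) (λ σ → lin-* (RVq-Lin n) ⟦ numCycles σ ℕ.≡ᵇ k' ⟧ (λ _ → refl) ks))))
  first : RVq n (λ { (s , us) → Zt d (suc n) (k ∷ us) (λ β → Tr (suc s) F (lift β)) }) ks ≡ ΣL (Sym d) (λ σ → ⟦ numCycles σ ℕ.≡ᵇ k ⟧ * a₁ σ)
  first = trans (lin-cong (RVq-Lin n) (λ _ → refl) ks) (trans (pull k suc F) (ΣL-cong (Sym d) (λ σ → cong (⟦ numCycles σ ℕ.≡ᵇ k ⟧ *_) (lin-cong (RVq-Lin n) (λ _ → refl) ks))))
  second : shift1 1 (λ k' → RVq n (λ { (s , us) → Zt d (suc n) (k' ∷ us) (λ β → Tr s F (lift β)) }) ks) k ≡ ΣL (Sym d) (λ σ → ⟦ suc (numCycles σ) ℕ.≡ᵇ k ⟧ * a₀ σ)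
  second = trans (lin-cong (shift1-Lin 1) (λ k' → trans (lin-cong (RVq-Lin n) (λ _ → refl) ks) (trans (pull k' (λ i → i) F) (ΣL-cong (Sym d) (λ σ → cong (⟦ numCycles σ ℕ.≡ᵇ k' ⟧ *_) (lin-cong (RVq-Lin n) (λ _ → refl) ks))))) k)
    (trans (ΣL-natural (shift1-Lin 1) (Sym d) (λ σ k' → ⟦ numCycles σ ℕ.≡ᵇ k' ⟧ * a₀ σ) k) (ΣL-cong (Sym d) (λ σ → shift1-≡ᵇ (numCycles σ) (a₀ σ) k)))

-- Both sides insert ∏ (v_i + 𝒳) into the sum for S_d: the left one through `W-Ψ`, the right one
-- through `Zt-step`.
RV-Zt : ∀ d r v t → RV r (W 0) (λ us t → Zt d r us (λ β → Ψ β t)) v t ≡ Zt (suc d) r v (λ ρ → Ψ ρ t)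
RV-Zt d r v t = trans (RV-RVq r (W 0) (λ us t → Zt d r us (λ β → Ψ β t)) v t)
  (trans (lin-cong (RVq-Lin r) (λ { (s , us) → inner s us }) v) (sym (Zt-step d r v (λ ρ → Ψ ρ t))))
  where
  inner : ∀ s us → W 0 s (λ t → Zt d r us (λ β → Ψ β t)) t ≡ Zt d r us (λ β → Tr s (λ ρ → Ψ ρ t) (lift β))
  inner s us = trans (ΣL-natural (W-lin 0 s) (allVecs (Sym d) r) (λ αs t → ⟦ eqV (Vec.map numCycles αs) us ⟧ * Ψ (prod αs) t) t)
    (trans (ΣL-cong (allVecs (Sym d) r) (λ αs → lin-* (W-lin 0 s) ⟦ eqV (Vec.map numCycles αs) us ⟧ {s = Ψ (prod αs)} (λ _ → refl) t)) (Zt-cong d r us (λ β i → W-Ψ s β i t)))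

-- Induction on the degree d

vac-allZero : ∀ t → vac t ≡ ⟦ allZero t ⟧
vac-allZero [] = refl
vac-allZero (zero ∷ t) = vac-allZero t
vac-allZero (suc x ∷ t) = refl

one-slice : ∀ {r} x (v : Vec ℕ r) t → slice oneP x v t ≡ ⟦ 0 ℕ.≡ᵇ x ⟧ * (⟦ eqV (Vec.replicate r 0) v ⟧ * vac t)
one-slice {r} x v t = trans (coeff-⟨⟩ oneP (mono x v t)) (trans (ℚ.+-identityʳ _) (trans (ℚ.*-identityˡ _) (trans (⟦∧⟧ (0 ℕ.≡ᵇ x) (eqV (Vec.replicate r 0) v ∧ allZero t))
  (cong (⟦ 0 ℕ.≡ᵇ x ⟧ *_) (trans (⟦∧⟧ (eqV (Vec.replicate r 0) v) (allZero t)) (cong (λ z → ⟦ eqV (Vec.replicate r 0) v ⟧ * z) (sym (vac-allZero t))))))))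

Zt-0 : ∀ r v F → Zt 0 r v F ≡ ⟦ eqV (Vec.replicate r 0) v ⟧ * F []
Zt-0 zero [] F = ℚ.+-identityʳ (1ℚ * F [])
Zt-0 (suc r) (k ∷ v) F = trans (Zt-suc 0 r k v F) (trans (ℚ.+-identityʳ _) (trans (cong (⟦ 0 ℕ.≡ᵇ k ⟧ *_) (trans (Zt-0 r v (λ β → F (compose [] β))) refl))
  (trans (sym (ℚ.*-assoc ⟦ 0 ℕ.≡ᵇ k ⟧ ⟦ eqV (Vec.replicate r 0) v ⟧ (F []))) (cong (_* F []) (sym (⟦∧⟧ (0 ℕ.≡ᵇ k) (eqV (Vec.replicate r 0) v)))))))

iter-slice : ∀ {r} (a : Fin (suc r) → PolyV r) → aIdentity a → ∀ d x v t → slice (iter d (Aop a) oneP) x v t ≡ ⟦ 0 ℕ.≡ᵇ x ⟧ * Zt d r v (λ β → Ψ β t)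
iter-slice {r} a aI zero x v t = trans (one-slice x v t) (cong (⟦ 0 ℕ.≡ᵇ x ⟧ *_) (sym (Zt-0 r v (λ β → Ψ β t))))
iter-slice {r} a aI (suc d) x v t = begin
  slice (Aop a p) x v t
    ≡⟨ Aop-RV a aI p x pol v t ⟩
  RV r (W 0) (slice p x) v t
    ≡⟨ RV-RVq r (W 0) (slice p x) v t ⟩
  RVq r (λ { (s , us) → W 0 s (slice p x us) t }) v
    ≡⟨ lin-* (RVq-Lin r) ⟦ 0 ℕ.≡ᵇ x ⟧ (λ { (s , us) → lin-* (W-lin 0 s) ⟦ 0 ℕ.≡ᵇ x ⟧ (λ t → iter-slice a aI d x us t) t }) v ⟩
  ⟦ 0 ℕ.≡ᵇ x ⟧ * RVq r (λ { (s , us) → W 0 s (λ t → Zt d r us (λ β → Ψ β t)) t }) v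
    ≡⟨ cong (⟦ 0 ℕ.≡ᵇ x ⟧ *_) (trans (sym (RV-RVq r (W 0) (λ us t → Zt d r us (λ β → Ψ β t)) v t)) (RV-Zt d r v t)) ⟩
  ⟦ 0 ℕ.≡ᵇ x ⟧ * Zt (suc d) r v (λ ρ → Ψ ρ t) ∎
  where
  open ≡-Reasoning
  p = iter d (Aop a) oneP
  ΣL-pol : ∀ {A : Set} (xs : List A) (c : A → ℚ) (g : A → Fn) → (∀ x → Pol (g x)) → Pol (λ m → ΣL xs (λ x → c x * g x m))
  ΣL-pol [] c g h = 0-pol vac-pol (λ _ → refl)
  ΣL-pol (y ∷ ys) c g h = lin-pol (c y) (h y) (ΣL-pol ys c g h) (λ _ → refl)
  -- The induction hypothesis also shows that the slices are polynomials, as `Aop-RV` requires.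
  pol : ∀ v → Pol (slice p x v)
  pol v = lin-pol ⟦ 0 ℕ.≡ᵇ x ⟧ (ΣL-pol (allVecs (Sym d) r) (λ αs → ⟦ eqV (Vec.map numCycles αs) v ⟧) (λ αs → Ψ (prod αs)) (λ αs → Ψ-Pol (prod αs))) (0-pol vac-pol (λ _ → refl))
    (λ t → trans (iter-slice a aI d x v t) (sym (ℚ.+-identityʳ _)))

-- Eliminating the last permutation

module _ {d : ℕ} (β : Perm d) (inj : Inj β) where

  private
    cs = proj₁ (Rep-exists β inj)
    R = proj₂ (Rep-exists β inj)

  inv : Perm d
  inv = Vec.tabulate (proj₁ ∘ preimage R)

  β-inv : ∀ k → lookup β (lookup inv k) ≡ k
  β-inv k = trans (cong (lookup β) (Vec.lookup∘tabulate (proj₁ ∘ preimage R) k)) (proj₂ (preimage R k))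

  inv-β : ∀ {i k} → lookup β i ≡ k → lookup inv k ≡ i
  inv-β {i} {k} e = inj (lookup inv k) i (trans (β-inv k) (sym e))

  Inj-inv : Inj inv
  Inj-inv i j e = trans (sym (β-inv i)) (trans (cong (lookup β) e) (β-inv j))

  Path-inv : ∀ x xs {y} → Path β x xs y → Path inv y (reverse xs) x
  Path-inv x [] e = inv-β e
  Path-inv x (z ∷ zs) {y} (e , p) = subst (λ l → Path inv y l x) (sym (List.unfold-reverse z zs)) (Path-join inv y (reverse zs) z (Path-inv z zs p) (inv-β e))

  reverseC : Cycle d → Cycle d
  reverseC (x , xs) = x , reverse xs

  Rep-inv : Rep inv (map reverseC cs)
  Rep-inv = rep (All.map⁺ (All.map (λ {c} p → Path-inv (proj₁ c) (proj₂ c) p) (cycles R))) (↭.trans (flat-rev cs) (covers R))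
    where
    flat-rev : ∀ cs → flat (map reverseC cs) ↭ flat cs
    flat-rev [] = ↭.refl
    flat-rev (c ∷ cs) = ↭.prep (proj₁ c) (↭.++⁺ (↭.↭-reverse (proj₂ c)) (flat-rev cs))

  -- Inversion reverses every cycle and keeps its length.
  Ψ-inv : ∀ m → Ψ inv m ≡ Ψ β m
  Ψ-inv m = trans (Ψ-Rep Rep-inv m) (trans (cong (λ z → PP z m) (trans (sym (List.map-∘ cs)) (List.map-cong (λ c → List.length-reverse (proj₂ c)) cs))) (sym (Ψ-Rep R m)))

  isId-eqv : ∀ α → isId (compose β α) ≡ eqv inv α
  isId-eqv α = bool-iff (isId (compose β α)) (eqv inv α)
    (λ e → subst (λ z → eqv inv z ≡ true) (lookup-ext (λ i → inv-β (trans (sym (lookup-compose β α i)) (eqFin-sound _ i (allL-sound _ (allFin d) e (∈.∈-allFin i)))))) (eqv-refl inv))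
    (λ e → allL-complete _ (allFin d) (λ {i} _ → subst (λ z → eqFin z i ≡ true) (sym (trans (lookup-compose β α i) (trans (cong (λ z → lookup β (lookup z i)) (sym (eqv-sound inv α e))) (β-inv i)))) (eqFin-refl i)))

  sum-inverse : ∀ (h : Perm d → ℚ) → ΣL (Sym d) (λ α → ⟦ isId (compose β α) ⟧ * h α) ≡ h inv
  sum-inverse h = trans (ΣL-cong (Sym d) (λ α → cong (λ z → ⟦ z ⟧ * h α) (isId-eqv α))) (trans (count-Sym inv h) (trans (cong (λ z → ⟦ z ⟧ * h inv) (isInjective-complete inv Inj-inv)) (ℚ.*-identityˡ (h inv))))

-- Partitions

data Desc : ℕ → List ℕ → Set where
  []  : ∀ {m} → Desc m []
  _∷_ : ∀ {m p μ} → suc p ≤ m → Desc (suc p) μ → Desc m (suc p ∷ μ)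

ΣL-applyUpTo : ∀ {A : Set} (f : ℕ → A) K g → ΣL (applyUpTo f K) g ≡ Σ< K (g ∘ f)
ΣL-applyUpTo f zero g = refl
ΣL-applyUpTo f (suc K) g = trans (cong (λ z → g (f 0) + z) (ΣL-applyUpTo (f ∘ suc) K g)) (sym (Σ<-head K (g ∘ f)))

-- Among the candidates for the first part only the head of `τ` matches, and its tail obeys the
-- bound under which the remainder is enumerated. So every partition is listed exactly once.
count-partsF : ∀ f n m τ (c : List ℕ → ℚ) → n ≤ f → Desc m τ → sum τ ≡ n → ΣL (partsF f n m) (λ μ → ⟦ eqListℕ τ μ ⟧ * c μ) ≡ c τ
count-partsF f zero m [] c h [] e = trans (ℚ.+-identityʳ _) (ℚ.*-identityˡ (c []))
count-partsF zero (suc n) m τ c () d e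
count-partsF (suc f) (suc n) m (suc q ∷ τ) c (s≤s h) (q<m ∷ ds) e = begin
  ΣL (concatMap part (upTo (m ℕ.⊓ suc n))) (λ μ → ⟦ eqListℕ (suc q ∷ τ) μ ⟧ * c μ)
    ≡⟨ trans (ΣL-concatMap part (upTo (m ℕ.⊓ suc n)) _) (ΣL-applyUpTo (λ p → p) (m ℕ.⊓ suc n) _) ⟩
  Σ< (m ℕ.⊓ suc n) (λ p → ΣL (part p) (λ μ → ⟦ eqListℕ (suc q ∷ τ) μ ⟧ * c μ))
    ≡⟨ Σ<-cong (m ℕ.⊓ suc n) (λ p → trans (ΣL-map (suc p ∷_) (partsF f (n ℕ.∸ p) (suc p)) _) (trans (ΣL-cong (partsF f (n ℕ.∸ p) (suc p)) (λ μ → trans (cong (_* c (suc p ∷ μ)) (⟦∧⟧ (q ℕ.≡ᵇ p) (eqListℕ τ μ))) (ℚ.*-assoc ⟦ q ℕ.≡ᵇ p ⟧ ⟦ eqListℕ τ μ ⟧ (c (suc p ∷ μ)))))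
         (ΣL-* (partsF f (n ℕ.∸ p) (suc p)) ⟦ q ℕ.≡ᵇ p ⟧))) ⟩
  Σ< (m ℕ.⊓ suc n) (λ p → ⟦ q ℕ.≡ᵇ p ⟧ * inner p)
    ≡⟨ Σ<-single (m ℕ.⊓ suc n) q (ℕ.⊓-glb q<m q<n) (λ p ne → trans (cong (λ z → ⟦ z ⟧ * inner p) (≡ᵇ-no (ne ∘ sym))) (ℚ.*-zeroˡ (inner p))) ⟩
  ⟦ q ℕ.≡ᵇ q ⟧ * inner q
    ≡⟨ trans (cong (λ z → ⟦ z ⟧ * inner q) (≡ᵇ-refl q)) (ℚ.*-identityˡ (inner q)) ⟩
  inner q
    ≡⟨ count-partsF f (n ℕ.∸ q) (suc q) τ (λ μ → c (suc q ∷ μ)) (ℕ.≤-trans (ℕ.m∸n≤m n q) h) ds sumτ ⟩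
  c (suc q ∷ τ) ∎
  where
  open ≡-Reasoning
  part : ℕ → List (List ℕ)
  part p = map (suc p ∷_) (partsF f (n ℕ.∸ p) (suc p))
  inner : ℕ → ℚ
  inner p = ΣL (partsF f (n ℕ.∸ p) (suc p)) (λ μ → ⟦ eqListℕ τ μ ⟧ * c (suc p ∷ μ))
  e' : q ℕ.+ sum τ ≡ n
  e' = ℕ.suc-injective e
  q<n : suc q ≤ suc n
  q<n = s≤s (subst (q ≤_) e' (ℕ.m≤m+n q (sum τ)))
  sumτ : sum τ ≡ n ℕ.∸ q
  sumτ = trans (sym (ℕ.m+n∸m≡n q (sum τ))) (cong (ℕ._∸ q) e')
  ≡ᵇ-no : ∀ {a b} → a ≢ b → (a ℕ.≡ᵇ b) ≡ false
  ≡ᵇ-no {a} {b} ne with a ℕ.≡ᵇ b in eq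
  ... | true = ⊥-elim (ne (≡ᵇ-true a b eq))
  ... | false = refl

insertDesc-Desc : ∀ {m} x ys → suc x ≤ m → Desc m ys → Desc m (insertDesc (suc x) ys)
insertDesc-Desc x [] h [] = h ∷ []
insertDesc-Desc x (suc y ∷ ys) h (p ∷ ds) with suc y ℕ.≤ᵇ suc x in eq
... | true = h ∷ (≤ᵇ-sound (suc y) (suc x) eq ∷ ds)
... | false = p ∷ insertDesc-Desc x ys (ℕ.<⇒≤ (ℕ.≰⇒> (λ le → case trans (sym eq) (≤ᵇ-complete le) of λ ()))) ds

insertDesc-↭ : ∀ x ys → insertDesc x ys ↭ x ∷ ys
insertDesc-↭ x [] = ↭.refl
insertDesc-↭ x (y ∷ ys) with y ℕ.≤ᵇ x
... | true = ↭.refl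
... | false = ↭.trans (↭.prep y (insertDesc-↭ x ys)) (↭.swap y x ↭.refl)

sortDesc-↭ : ∀ xs → sortDesc xs ↭ xs
sortDesc-↭ [] = ↭.refl
sortDesc-↭ (x ∷ xs) = ↭.trans (insertDesc-↭ x (sortDesc xs)) (↭.prep x (sortDesc-↭ xs))

sortDesc-Desc : ∀ {m} xs → All (λ x → (1 ≤ x) × (x ≤ m)) xs → Desc m (sortDesc xs)
sortDesc-Desc [] [] = []
sortDesc-Desc (suc x ∷ xs) ((_ , h) ∷ a) = insertDesc-Desc x (sortDesc xs) h (sortDesc-Desc xs a)

module _ {d : ℕ} {σ : Perm d} (inj : Inj σ) where

  private
    cs = proj₁ (Rep-exists σ inj)
    R = proj₂ (Rep-exists σ inj)
    ls = map (cycleLen σ) (cycleMins σ)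

    sum-flat : ∀ (cs : List (Cycle d)) → sum (map suc (shape cs)) ≡ length (flat cs)
    sum-flat [] = refl
    sum-flat (c ∷ cs) = trans (cong (suc (size c) ℕ.+_) (sum-flat cs)) (sym (List.length-++ (elems c)))

    sum-ls : sum ls ≡ d
    sum-ls = trans (Sum.sum-↭ (lengths-Rep R)) (trans (sum-flat cs) (trans (↭.↭-length (covers R)) (List.length-tabulate (λ i → i))))

    bounded : ∀ xs → All (λ x → x ≤ sum xs) xs
    bounded [] = []
    bounded (x ∷ xs) = ℕ.m≤m+n x (sum xs) ∷ All.map (λ h → ℕ.≤-trans h (ℕ.m≤n+m (sum xs) x)) (bounded xs)

  cycleType-Desc : Desc d (cycleType σ)
  cycleType-Desc = sortDesc-Desc ls (All.zip (↭.All-resp-↭ (↭.↭-sym (lengths-Rep R)) (All.map⁺ (All.tabulate (λ _ → s≤s z≤n))) , All.map (λ h → ℕ.≤-trans h (ℕ.≤-reflexive sum-ls)) (bounded ls)))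

  cycleType-sum : sum (cycleType σ) ≡ d
  cycleType-sum = trans (Sum.sum-↭ (sortDesc-↭ ls)) sum-ls

  cycleType-PP : ∀ m → PP (map ℕ.pred (cycleType σ)) m ≡ Ψ σ m
  cycleType-PP = PP-↭ (↭.map⁺ ℕ.pred (sortDesc-↭ ls))

  count-partitions : ∀ (c : List ℕ → ℚ) → ΣL (partitions d) (λ μ → ⟦ eqListℕ (cycleType σ) μ ⟧ * c μ) ≡ c (cycleType σ)
  count-partitions c = count-partsF d d d (cycleType σ) c ℕ.≤-refl cycleType-Desc cycleType-sum

-- `Zcoeff` multiplies by v^k with k the very exponent that is extracted, so the other factor is
-- read at exponent 0.
shiftV-diag : ∀ {n} (k : Vec ℕ n) G → shiftV k G k ≡ G (Vec.replicate n 0)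
shiftV-diag [] G = refl
shiftV-diag (a ∷ k) G = trans (go a (λ y → shiftV k (λ u → G (y ∷ u)) k)) (shiftV-diag k (λ u → G (0 ∷ u)))
  where
  go : ∀ a H → shift1 a H a ≡ H 0
  go zero H = refl
  go (suc a) H = go a H

pμ-slice : ∀ {r m} μ → Desc m μ → ∀ x t → slice {r} (pμ μ) x (Vec.replicate r 0) t ≡ ⟦ 0 ℕ.≡ᵇ x ⟧ * PP (map ℕ.pred μ) t
pμ-slice {r} [] [] x t = trans (one-slice x (Vec.replicate r 0) t) (cong (⟦ 0 ℕ.≡ᵇ x ⟧ *_) (trans (cong (λ z → ⟦ z ⟧ * vac t) (eqV-refl {r} (Vec.replicate r 0))) (ℚ.*-identityˡ (vac t))))
pμ-slice {r} (suc p ∷ μ) (_ ∷ ds) x t = trans (tP-slice p (pμ μ) x (Vec.replicate r 0) t) (lin-* (J-lin -[1+ p ]) ⟦ 0 ℕ.≡ᵇ x ⟧ (pμ-slice μ ds x) t)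

vp-slice : ∀ {r m} (k : Vec ℕ r) μ → Desc m μ → ∀ x t → coeff (vMonoP k ⊗ pμ μ) (mono x k t) ≡ ⟦ 0 ℕ.≡ᵇ x ⟧ * PP (map ℕ.pred μ) t
vp-slice k μ ds x t = trans (ιV-slice ((1ℚ , k) ∷ []) (pμ μ) x k t) (trans (ℚ.+-identityʳ _) (trans (ℚ.*-identityˡ _) (trans (shiftV-diag k (λ v' → slice (pμ μ) x v' t)) (pμ-slice μ ds x t))))

sumℚ-ΣL : ∀ {A : Set} (h : A → ℚ) xs → sumℚ (map h xs) ≡ ΣL xs h
sumℚ-ΣL h [] = refl
sumℚ-ΣL h (x ∷ xs) = cong (λ z → h x + z) (sumℚ-ΣL h xs)

length-ΣL : ∀ {A : Set} (p : A → Bool) xs → ℕtoℚ (length (filterᵇ p xs)) ≡ ΣL xs (λ x → ⟦ p x ⟧)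
length-ΣL p xs = trans (ι-def (+ length (filterᵇ p xs))) (trans (sym (ℚ.*-identityʳ _)) (trans (sym (ΣL-const (filterᵇ p xs) 1ℚ)) (trans (ΣL-filter p xs (λ _ → 1ℚ)) (ΣL-cong xs (λ x → ℚ.*-identityʳ ⟦ p x ⟧)))))

prod-last : ∀ {d n} (αs : Vec (Perm d) n) α → Vec.foldr _ compose α αs ≡ compose (prod αs) α
prod-last [] α = lookup-ext (λ i → sym (trans (lookup-compose idPerm α i) (lookup-id (lookup α i))))
prod-last (β ∷ αs) α = trans (cong (compose β) (prod-last αs α)) (sym (compose-assoc β (prod αs) α))

Nbullet-sum : ∀ {r} d (k : Vec ℕ r) μ → Nbullet d k μ ≡ invFact d * ΣL (allVecs (Sym d) r) (λ αs → ΣL (Sym d) (λ α → ⟦ isId (compose (prod αs) α) ⟧ * (⟦ eqV (Vec.map numCycles αs) k ⟧ * ⟦ eqListℕ (cycleType α) μ ⟧)))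
Nbullet-sum {r} d k μ = cong (invFact d *_) (trans (length-ΣL _ (concatMap (λ αs → map (αs ,_) (Sym d)) (allVecs (Sym d) r)))
  (trans (ΣL-concatMap (λ αs → map (αs ,_) (Sym d)) (allVecs (Sym d) r) _) (ΣL-cong (allVecs (Sym d) r) (λ αs → trans (ΣL-map (αs ,_) (Sym d) _) (ΣL-cong (Sym d) (λ α →
    trans (⟦∧⟧ (isId (Vec.foldr _ compose α αs)) (eqV (Vec.map numCycles αs) k ∧ eqListℕ (cycleType α) μ)) (cong₂ (λ a b → ⟦ isId a ⟧ * b) (prod-last αs α) (⟦∧⟧ (eqV (Vec.map numCycles αs) k) (eqListℕ (cycleType α) μ)))))))))

-- The sums are exchanged. The sum over partitions retains only the cycle type of the last
-- permutation, and the sum over the last permutation only the inverse of the product of the others,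
-- which has the same type as that product.
Zcoeff-Zt : ∀ {r} d x (v : Vec ℕ r) t → Zcoeff d (mono x v t) ≡ invFact d * (⟦ 0 ℕ.≡ᵇ x ⟧ * Zt d r v (λ β → Ψ β t))
Zcoeff-Zt {r} d x v t = begin
  sumℚ (map (λ μ → Nbullet d v μ * c μ) (partitions d))
    ≡⟨ sumℚ-ΣL (λ μ → Nbullet d v μ * c μ) (partitions d) ⟩
  ΣL (partitions d) (λ μ → Nbullet d v μ * c μ)
    ≡⟨ ΣL-cong (partitions d) (λ μ → trans (cong (_* c μ) (Nbullet-sum d v μ)) (trans (ℚ.*-assoc (invFact d) _ (c μ)) (cong (invFact d *_) (spread μ)))) ⟩
  ΣL (partitions d) (λ μ → invFact d * ΣL (allVecs (Sym d) r) (λ αs → ΣL (Sym d) (λ α → term αs α μ)))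
    ≡⟨ ΣL-* (partitions d) (invFact d) ⟩
  invFact d * ΣL (partitions d) (λ μ → ΣL (allVecs (Sym d) r) (λ αs → ΣL (Sym d) (λ α → term αs α μ)))
    ≡⟨ cong (invFact d *_) (trans (ΣL-natural (ΣL-Lin (partitions d)) (allVecs (Sym d) r) (λ αs μ → ΣL (Sym d) (λ α → term αs α μ)) 0)
         (ΣL-cong (allVecs (Sym d) r) (λ αs → trans (ΣL-natural (ΣL-Lin (partitions d)) (Sym d) (λ α μ → term αs α μ) 0)
           (ΣL-congᴬ (All.map (λ {α} i → by-type αs α i) (Sym-Inj d)))))) ⟩
  invFact d * ΣL (allVecs (Sym d) r) (λ αs → ΣL (Sym d) (λ α → ⟦ isId (compose (prod αs) α) ⟧ * (⟦ eqV (Vec.map numCycles αs) v ⟧ * (e * Ψ α t))))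
    ≡⟨ cong (invFact d *_) (trans (ΣL-congᴬ (All.map (λ {αs} i → invert αs i) (prod-Inj d r))) (ΣL-* (allVecs (Sym d) r) e)) ⟩
  invFact d * (e * Zt d r v (λ β → Ψ β t)) ∎
  where
  open ≡-Reasoning
  e = ⟦ 0 ℕ.≡ᵇ x ⟧
  c : List ℕ → ℚ
  c μ = coeff (vMonoP v ⊗ pμ μ) (mono x v t)
  term : Vec (Perm d) r → Perm d → List ℕ → ℚ
  term αs α μ = ⟦ isId (compose (prod αs) α) ⟧ * (⟦ eqV (Vec.map numCycles αs) v ⟧ * (⟦ eqListℕ (cycleType α) μ ⟧ * c μ))
  l : ∀ a b f c → c * (a * (b * f)) ≡ a * (b * (f * c))
  l = solve-∀ ℚR
  spread : ∀ μ → ΣL (allVecs (Sym d) r) (λ αs → ΣL (Sym d) (λ α → ⟦ isId (compose (prod αs) α) ⟧ * (⟦ eqV (Vec.map numCycles αs) v ⟧ * ⟦ eqListℕ (cycleType α) μ ⟧))) * c μ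
    ≡ ΣL (allVecs (Sym d) r) (λ αs → ΣL (Sym d) (λ α → term αs α μ))
  spread μ = trans (ℚ.*-comm _ (c μ)) (trans (sym (ΣL-* (allVecs (Sym d) r) (c μ))) (ΣL-cong (allVecs (Sym d) r) (λ αs → trans (sym (ΣL-* (Sym d) (c μ)))
    (ΣL-cong (Sym d) (λ α → l ⟦ isId (compose (prod αs) α) ⟧ ⟦ eqV (Vec.map numCycles αs) v ⟧ ⟦ eqListℕ (cycleType α) μ ⟧ (c μ))))))
  by-type : ∀ αs α → Inj α → ΣL (partitions d) (term αs α) ≡ ⟦ isId (compose (prod αs) α) ⟧ * (⟦ eqV (Vec.map numCycles αs) v ⟧ * (e * Ψ α t))
  by-type αs α i = trans (ΣL-* (partitions d) ⟦ isId (compose (prod αs) α) ⟧) (cong (λ z → ⟦ isId (compose (prod αs) α) ⟧ * z) (trans (ΣL-* (partitions d) ⟦ eqV (Vec.map numCycles αs) v ⟧)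
    (cong (λ z → ⟦ eqV (Vec.map numCycles αs) v ⟧ * z) (trans (count-partitions i c) (trans (vp-slice v (cycleType α) (cycleType-Desc i) x t) (cong (e *_) (cycleType-PP i t)))))))
  l' : ∀ a b c → a * (b * c) ≡ b * (a * c)
  l' = solve-∀ ℚR
  invert : ∀ αs → Inj (prod αs) → ΣL (Sym d) (λ α → ⟦ isId (compose (prod αs) α) ⟧ * (⟦ eqV (Vec.map numCycles αs) v ⟧ * (e * Ψ α t))) ≡ e * (⟦ eqV (Vec.map numCycles αs) v ⟧ * Ψ (prod αs) t)
  invert αs i = trans (sum-inverse (prod αs) i (λ α → ⟦ eqV (Vec.map numCycles αs) v ⟧ * (e * Ψ α t))) (trans (cong (λ z → ⟦ eqV (Vec.map numCycles αs) v ⟧ * (e * z)) (Ψ-inv (prod αs) i t)) (l' ⟦ eqV (Vec.map numCycles αs) v ⟧ e (Ψ (prod αs) t)))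

theorem3p5 : (r : ℕ) → 1 ≤ r → (a : Fin (suc r) → PolyV r) → aIdentity a →
    (d : ℕ) (m : Mono r) → coeff (expCoeff a d) m ≡ Zcoeff d m
theorem3p5 r _ a aI d (mono x v t) = trans (slice-scale (invFact d) (iter d (Aop a) oneP) x v t)
  (trans (cong (invFact d *_) (iter-slice a aI d x v t)) (sym (Zcoeff-Zt d x v t)))
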